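{- Let $n$ be a positive integer and let $\widetilde T_n\in\mathcal R_n$ satisfy both condition (A) and condition (B) below. Then: (i) for every right $\Gamma$-coset $K=M_0\Gamma\subset\mathcal M_n$ (with $M_0\in\mathcal M_n$) we have $\langle\widetilde T_n,K\rangle=-1$; (ii) for every $\Gamma$-conjugacy class $X=\{\gamma^{ -1}M_0\gamma:\gamma\in\Gamma\}\subset\mathcal M_n$ we have $\langle\widetilde T_n,X\rangle=w(X)$.
   Context: Let $\Gamma=\mathrm{PSL}_2(\mathbb Z)$ and $S=\pm\begin{pmatrix}0&-1\\1&0\end{pmatrix}$, $U=\pm\begin{pmatrix}1&-1\\1&0\end{pmatrix}$, $T=US=\pm\begin{pmatrix}1&1\\0&1\end{pmatrix}$. For $n\ge1$ let $\mathcal M_n$ be the set of $2\times2$ integer matrices of determinant $n$ modulo $\{\pm1\}$, and $\mathcal R_n=\mathbb Q[\mathcal M_n]$ the $\mathbb Q$-vector space of formal finite linear combinations of elements of $\mathcal M_n$; multiplication of matrices extends bilinearly, so $\mathcal R_1=\mathbb Q[\Gamma]$ acts on $\mathcal R_n$ on the left and on the right ($1$ denotes the identity matrix). For $\xi=\sum c_MM\in\mathcal R_n$ and a subset $\mathcal S\subset\mathcal M_n$ set $\langle\xi,\mathcal S\rangle=\sum_{M\in\mathcal S}c_M$. Let $T_n^\infty=\sum_{M\in\mathcal M_n^\infty}M$, where $\mathcal M_n^\infty\subset\mathcal M_n$ is a set of representatives of $\Gamma\backslash\mathcal M_n$ consisting of matrices fixing $\infty$ (lower-left entry $0$). Condition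 (A): $(1-S)\widetilde T_n-T_n^\infty(1-S)\in(1-T)\mathcal R_n$. Condition (B): $\widetilde T_n(1+S)\in(1+U+U^2)\mathcal R_n$ and $\widetilde T_n(1+U+U^2)\in(1+S)\mathcal R_n$. Weights: for $M\in\mathcal M_n$ let $\Gamma_M$ be its centralizer in $\Gamma$. Define $w(M)=1/6$ if $M$ is scalar ($M=\pm\sqrt n I_2$); $w(M)=-1/|\Gamma_M|$ if $M$ is elliptic ($\operatorname{tr}(M)^2<4n$); $w(M)=1$ if $M$ is split hyperbolic ($\operatorname{tr}(M)^2-4n$ a positive perfect square); $w(M)=0$ if $M$ is non-split hyperbolic ($\operatorname{tr}(M)^2-4n$ positive, not a square) or parabolic ($\operatorname{tr}(M)^2=4n$, $M$ not scalar). This depends only on the conjugacy class $X$ of $M$, written $w(X)$. -}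

module Defs where

open import Data.Nat using (ℕ; suc)
open import Data.Integer as ℤ using (ℤ; +_; -[1+_])
open import Data.Rational as ℚ using (ℚ; 0ℚ; 1ℚ)
open import Data.Product using (_×_; _,_; proj₁; proj₂; Σ; ∃; ∃-syntax)
open import Data.Product.Properties using (≡-dec)
open import Data.Sum using (_⊎_; inj₁; inj₂)
open import Data.List using (List; []; _∷_; map; filter; foldr; concatMap; _++_; length)
open import Data.List.Relation.Unary.All using (All)
open import Data.List.Relation.Unary.Any using (Any)
open import Data.List.Relation.Unary.AllPairs using (AllPairs)
open import Relation.Nullary using (¬_; Dec; yes; no)
open import Relation.Nullary.Decidable using (_⊎-dec_)
open import Relation.Binary.PropositionalEquality using (_≡_)
open import Relation.Unary using (Pred; Decidable)
open import Level using (0ℓ)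

-- 2×2 integer matrices  (a , b , c , d)  ~  ( a b ; c d )

Mat : Set
Mat = ℤ × ℤ × ℤ × ℤ

mat : ℤ → ℤ → ℤ → ℤ → Mat
mat a b c d = a , b , c , d

_≟M_ : (M N : Mat) → Dec (M ≡ N)
_≟M_ = ≡-dec ℤ._≟_ (≡-dec ℤ._≟_ (≡-dec ℤ._≟_ ℤ._≟_))

_⊗_ : Mat → Mat → Mat
(a , b , c , d) ⊗ (a' , b' , c' , d') =
  mat (a ℤ.* a' ℤ.+ b ℤ.* c') (a ℤ.* b' ℤ.+ b ℤ.* d')
      (c ℤ.* a' ℤ.+ d ℤ.* c') (c ℤ.* b' ℤ.+ d ℤ.* d')

det : Mat → ℤ
det (a , b , c , d) = a ℤ.* d ℤ.- b ℤ.* c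

tr : Mat → ℤ
tr (a , b , c , d) = a ℤ.+ d

lowerLeft : Mat → ℤ
lowerLeft (a , b , c , d) = c

negM : Mat → Mat
negM (a , b , c , d) = mat (ℤ.- a) (ℤ.- b) (ℤ.- c) (ℤ.- d)

-- inverse of a determinant-1 matrix (the adjugate)
inv : Mat → Mat
inv (a , b , c , d) = mat d (ℤ.- b) (ℤ.- c) a

-- equality modulo {±1}: the elements of M_n are classes {M, -M}
_∼_ : Mat → Mat → Set
M ∼ N = M ≡ N ⊎ M ≡ negM N

_∼?_ : (M N : Mat) → Dec (M ∼ N)
M ∼? N = (M ≟M N) ⊎-dec (M ≟M negM N)

-- Γ = PSL₂(ℤ): represented by determinant-1 integer matrices (mod ±)
InΓ : Mat → Set
InΓ γ = det γ ≡ + 1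

Imat Smat Umat Tmat : Mat
Imat = mat (+ 1) (+ 0) (+ 0) (+ 1)
Smat = mat (+ 0) -[1+ 0 ] (+ 1) (+ 0)
Umat = mat (+ 1) -[1+ 0 ] (+ 1) (+ 0)
Tmat = mat (+ 1) (+ 1) (+ 0) (+ 1)

-- Formal finite ℚ-linear combinations of matrices (mod ±)

Formal : Set
Formal = List (ℚ × Mat)

coeff : Formal → Mat → ℚ
coeff ξ M = foldr ℚ._+_ 0ℚ (map proj₁ (filter (λ p → proj₂ p ∼? M) ξ))

_≋_ : Formal → Formal → Set
ξ ≋ η = ∀ M → coeff ξ M ≡ coeff η M

InR : ℕ → Formal → Set
InR n ξ = All (λ p → det (proj₂ p) ≡ + n) ξ

infixr 5 _⊕_
infix 8 ⊖_
infixl 7 _⊙_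

_⊕_ : Formal → Formal → Formal
ξ ⊕ η = ξ ++ η

⊖_ : Formal → Formal
⊖ ξ = map (λ p → ℚ.- proj₁ p , proj₂ p) ξ

_⊙_ : Formal → Formal → Formal
ξ ⊙ η = concatMap (λ p → map (λ q → proj₁ p ℚ.* proj₁ q , proj₂ p ⊗ proj₂ q) η) ξ

⟦_⟧ : Mat → Formal
⟦ M ⟧ = (1ℚ , M) ∷ []

one : Formal
one = ⟦ Imat ⟧

InLeftMul : ℕ → Formal → Formal → Set
InLeftMul n α ξ = ∃[ η ] (InR n η × (α ⊙ η) ≋ ξ)

sumMats : List Mat → Formal
sumMats L = map (λ M → 1ℚ , M) L

LeftEquiv : Mat → Mat → Set
LeftEquiv M N = ∃[ γ ] (InΓ γ × M ∼ (γ ⊗ N))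

InRightCoset : Mat → Mat → Set
InRightCoset N M = ∃[ γ ] (InΓ γ × M ∼ (N ⊗ γ))

InConjClass : Mat → Mat → Set
InConjClass N M = ∃[ γ ] (InΓ γ × M ∼ ((inv γ ⊗ N) ⊗ γ))

IsRepsInfty : ℕ → List Mat → Set
IsRepsInfty n L =
  All (λ M → det M ≡ + n × lowerLeft M ≡ + 0) L
  × AllPairs (λ M N → ¬ LeftEquiv M N) L
  × (∀ M → det M ≡ + n → Any (λ N → LeftEquiv M N) L)

CondA : ℕ → List Mat → Formal → Set
CondA n Tinf ξ =
  InLeftMul n (one ⊕ ⊖ ⟦ Tmat ⟧)
    (((one ⊕ ⊖ ⟦ Smat ⟧) ⊙ ξ) ⊕ ⊖ (sumMats Tinf ⊙ (one ⊕ ⊖ ⟦ Smat ⟧)))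

CondB : ℕ → Formal → Set
CondB n ξ =
  InLeftMul n (one ⊕ ⟦ Umat ⟧ ⊕ ⟦ Umat ⊗ Umat ⟧) (ξ ⊙ (one ⊕ ⟦ Smat ⟧))
  × InLeftMul n (one ⊕ ⟦ Smat ⟧) (ξ ⊙ (one ⊕ ⟦ Umat ⟧ ⊕ ⟦ Umat ⊗ Umat ⟧))

-- Pairing ⟨ξ , S⟩ with a (decidable, ±-closed) subset S

pairing : Formal → {P : Pred Mat 0ℓ} → Decidable P → ℚ
pairing ξ P? = foldr ℚ._+_ 0ℚ (map proj₁ (filter (λ p → P? (proj₂ p)) ξ))

Centralizes : Mat → Mat → Set
Centralizes M γ = InΓ γ × ((inv γ ⊗ M) ⊗ γ) ∼ M

CentralizerOrder : Mat → ℕ → Set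
CentralizerOrder M k = Σ (List Mat) λ L →
  length L ≡ k
  × All (Centralizes M) L
  × AllPairs (λ γ δ → ¬ γ ∼ δ) L
  × (∀ γ → Centralizes M γ → Any (γ ∼_) L)

disc : Mat → ℤ
disc M = tr M ℤ.* tr M ℤ.- + 4 ℤ.* det M

IsScalar : Mat → Set
IsScalar (a , b , c , d) = b ≡ + 0 × c ≡ + 0 × a ≡ d

data Weight (M : Mat) : ℚ → Set where
  scalar     : IsScalar M → Weight M (+ 1 ℚ./ 6)
  elliptic   : ∀ k → disc M ℤ.< + 0 → CentralizerOrder M (suc k) →
               Weight M (ℚ.- (+ 1 ℚ./ suc k))
  split      : ∀ m → disc M ≡ + (suc m) ℤ.* + (suc m) → Weight M 1ℚ
  nonsplit   : + 0 ℤ.< disc M → (∀ m → ¬ disc M ≡ m ℤ.* m) → Weight M 0ℚ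
  parabolic  : disc M ≡ + 0 → ¬ IsScalar M → Weight M 0ℚ

{-# OPTIONS --safe #-}
module Submission where

-- Conditions (A) and (B) are used through their pairings with even test functions f on matrices. By (B),
-- ⟨ξ, f(M) + f(MS)⟩ = 0 if f sums to zero over the orbits of U from the left, and ⟨ξ, f(M) + f(MU) + f(MU²)⟩ = 0 if
-- f(SM) = -f(M); by (A), ⟨ξ, f(M) - f(SM)⟩ = ∑ f(N) - f(NS) over N in T_n^∞ if f(TM) = f(M).
--
-- (i) Let θ be invariant under Γ on both sides. Weighting θ by indicators of arcs of P¹(ℚ) gives f that add up to
-- ⟨ξ, θ⟩ = -∑ θ(N), N in T_n^∞. The function c(N) = ⟨ξ, NΓ⟩ is invariant on both sides, and it is unchanged by the
-- adjugate, because every double coset contains an antidiagonal matrix. For θ = c + 1 the identity therefore becomes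
-- ∑ (c(N) + 1)² = 0.
--
-- (ii) Attach to each matrix Q of the class a measure on P¹(ℝ), equivariantly for conjugation, of total mass e(Q): the point
-- mass at the attracting fixed point if disc Q ≥ 0, and the orbit of a cusp under the centralizer if disc Q < 0. Let P(Q) be the
-- mass of the arc (∞,0]. Summing the pairings of (B) with P(T^k M) over k telescopes, and (A) turns the rest into
-- 2⟨ξ, e⟩ = -∑ P(U²QU) (in(Q∞) - in(Q0)) over all Q, where in is the indicator of [0,1). Comparing Q with
-- TQT⁻¹ cancels everything in the sum except finitely many matrices in a fundamental domain for translation, and at most
-- one class ±Q of them contributes. A scalar Q has no equivariant measure: there the two parts of (B) are used with the weights
-- 1/2 and 1/3 in place of P, and 1/2 - 1/3 = 1/6 is what remains.

open import Defs
open import Data.Nat as ℕ using (ℕ; zero; suc; NonZero)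
import Data.Nat.Properties as ℕ
open import Data.Integer as ℤ using (ℤ; +_; -[1+_]; +0; +[1+_]; 0ℤ; _+_; _*_; _-_; _≤_; _<_; _≤?_; _<?_; _≟_)
import Data.Integer.Properties as ℤ
import Data.Integer.DivMod as ℤ
open import Data.Integer.Divisibility.Signed using (_∣_; divides; _∣?_)
open import Data.Integer.Tactic.RingSolver using () renaming (solve-∀ to ℤ-ring)
open import Data.Nat.Tactic.RingSolver using () renaming (solve-∀ to ℕ-ring)
open import Data.Rational as ℚ using (ℚ; 0ℚ; 1ℚ; -_)
import Data.Rational.Properties as ℚ
open import Data.List using (List; []; _∷_; map; filter; concatMap; _++_; length; upTo; downFrom; cartesianProduct)
open import Data.List.Membership.Propositional using (_∈_)
open import Data.List.Membership.Propositional.Properties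
  using (∈-map⁺; ∈-map⁻; ∈-++⁺ˡ; ∈-++⁺ʳ; ∈-upTo⁺; ∈-downFrom⁺; ∈-downFrom⁻; ∈-filter⁺; ∈-filter⁻; ∈-cartesianProduct⁺)
open import Data.List.Relation.Unary.All as All using (All; []; _∷_)
import Data.List.Relation.Unary.All.Properties as All
open import Data.List.Relation.Unary.Any as Any using (Any; here; there)
open import Data.List.Relation.Unary.AllPairs as AllPairs using (AllPairs; []; _∷_)
open import Data.List.Relation.Unary.Unique.Propositional using (Unique)
import Data.List.Relation.Unary.Unique.Propositional.Properties as Unique
open import Data.Product using (_×_; _,_; proj₁; proj₂; Σ; ∃-syntax)
open import Data.Sum using (_⊎_; inj₁; inj₂)
open import Data.Empty using (⊥; ⊥-elim)
open import Function.Bundles using (_⇔_; Equivalence)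
open import Level using (0ℓ)
open import Relation.Nullary using (¬_; Dec; yes; no)
open import Relation.Nullary.Decidable using (dec⇒maybe; map′; _×-dec_; _⊎-dec_)
open import Relation.Binary.PropositionalEquality
open import Relation.Binary.Definitions using (Tri; tri<; tri≈; tri>)
open import Relation.Unary using (Pred; Decidable)
open import Tactic.RingSolver using () renaming (solve-∀ to ring-of)
open import Tactic.RingSolver.Core.AlmostCommutativeRing using (AlmostCommutativeRing; fromCommutativeRing)
import Data.Rational.Unnormalised as ℚᵘ
import Data.Rational.Unnormalised.Properties as ℚᵘ

-- An equivariant measure yields test functions for both parts of (B) at once: (∞,0] and its image
-- under S tile P¹, and so do its three images under U. The arcs are half open because mass may sit
-- at the cusps 0, 1, ∞ themselves. A scalar Q commutes with Γ, so its measure would be a finite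
-- Γ-invariant measure on P¹(ℝ), and only 0 is one.
--
-- The sums over T^k M and over Q are infinite as they stand. The first breaks off because |tr| is
-- constant on a class while T^k shifts the trace of M, or, for upper triangular M, pushes the fixed
-- point out of the arc. The second is taken over large balls of integer matrices, where each class
-- occurs as Q and as -Q; hence the factor 2.
--
-- What turns the telescoped terms into a condition on Q∞ is the Farey tessellation. Its edges do
-- not cross, so "starts in [0,1)" and "lies in [0,1]" differ only for edges that start at 0 or 1.
-- The exceptions are the matrices S T^k and U T^(k+1), which are those that the telescoping
-- produces, and "lies in [0,1]" is blind to the orientation that S reverses.

ringℚ : AlmostCommutativeRing 0ℓ 0ℓ
ringℚ = fromCommutativeRing ℚ.+-*-commutativeRing (λ x → dec⇒maybe (0ℚ ℚ.≟ x))

-- Matrices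

mat≡ : ∀ {a b c d a' b' c' d' : ℤ} → a ≡ a' → b ≡ b' → c ≡ c' → d ≡ d' →
       _≡_ {A = Mat} (a , b , c , d) (a' , b' , c' , d')
mat≡ refl refl refl refl = refl

⊗-assoc : ∀ L M N → (L ⊗ M) ⊗ N ≡ L ⊗ (M ⊗ N)
⊗-assoc (a , b , c , d) (a' , b' , c' , d') (x , y , z , w) =
  mat≡ (lem a b a' b' c' d' x z) (lem a b a' b' c' d' y w)
       (lem c d a' b' c' d' x z) (lem c d a' b' c' d' y w)
  where
  lem : ∀ a b a' b' c' d' x z →
        (a * a' + b * c') * x + (a * b' + b * d') * z
        ≡ a * (a' * x + b' * z) + b * (c' * x + d' * z)
  lem = ℤ-ring

det-⊗ : ∀ M N → det (M ⊗ N) ≡ det M * det N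
det-⊗ (a , b , c , d) (a' , b' , c' , d') = lem a b c d a' b' c' d'
  where
  lem : ∀ a b c d a' b' c' d' →
    (a * a' + b * c') * (c * b' + d * d') - (a * b' + b * d') * (c * a' + d * c')
    ≡ (a * d - b * c) * (a' * d' - b' * c')
  lem = ℤ-ring

⊗-identityʳ : ∀ M → M ⊗ Imat ≡ M
⊗-identityʳ (a , b , c , d) = mat≡ (l₁ a b) (l₂ a b) (l₁ c d) (l₂ c d)
  where
  l₁ : ∀ a b → a * + 1 + b * + 0 ≡ a
  l₁ = ℤ-ring
  l₂ : ∀ a b → a * + 0 + b * + 1 ≡ b
  l₂ = ℤ-ring

⊗-identityˡ : ∀ M → Imat ⊗ M ≡ M
⊗-identityˡ (a , b , c , d) = mat≡ (l₁ a c) (l₁ b d) (l₂ a c) (l₂ b d)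
  where
  l₁ : ∀ a b → + 1 * a + + 0 * b ≡ a
  l₁ = ℤ-ring
  l₂ : ∀ a b → + 0 * a + + 1 * b ≡ b
  l₂ = ℤ-ring

negM-⊗ˡ : ∀ M N → negM M ⊗ N ≡ negM (M ⊗ N)
negM-⊗ˡ (a , b , c , d) (a' , b' , c' , d') = mat≡ (l a b a' c') (l a b b' d') (l c d a' c') (l c d b' d')
  where
  l : ∀ a b x y → ℤ.- a * x + ℤ.- b * y ≡ ℤ.- (a * x + b * y)
  l = ℤ-ring

negM-⊗ʳ : ∀ M N → M ⊗ negM N ≡ negM (M ⊗ N)
negM-⊗ʳ (a , b , c , d) (a' , b' , c' , d') = mat≡ (l a b a' c') (l a b b' d') (l c d a' c') (l c d b' d')
  where
  l : ∀ a b x y → a * ℤ.- x + b * ℤ.- y ≡ ℤ.- (a * x + b * y)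
  l = ℤ-ring

negM-involutive : ∀ M → negM (negM M) ≡ M
negM-involutive (a , b , c , d) =
  mat≡ (ℤ.neg-involutive a) (ℤ.neg-involutive b) (ℤ.neg-involutive c) (ℤ.neg-involutive d)

det-negM : ∀ M → det (negM M) ≡ det M
det-negM (a , b , c , d) = l a b c d
  where
  l : ∀ a b c d → ℤ.- a * ℤ.- d - ℤ.- b * ℤ.- c ≡ a * d - b * c
  l = ℤ-ring

det-inv : ∀ M → det (inv M) ≡ det M
det-inv (a , b , c , d) = l a b c d
  where
  l : ∀ a b c d → d * a - ℤ.- b * ℤ.- c ≡ a * d - b * c
  l = ℤ-ring

inv-⊗ : ∀ M N → inv (M ⊗ N) ≡ inv N ⊗ inv M
inv-⊗ (a , b , c , d) (a' , b' , c' , d') =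
  mat≡ (l₁ c d b' d') (l₂ a b b' d') (l₃ c d a' c') (l₄ a b a' c')
  where
  l₁ : ∀ c d x y → c * x + d * y ≡ y * d + ℤ.- x * ℤ.- c
  l₁ = ℤ-ring
  l₂ : ∀ a b x y → ℤ.- (a * x + b * y) ≡ y * ℤ.- b + ℤ.- x * a
  l₂ = ℤ-ring
  l₃ : ∀ c d x y → ℤ.- (c * x + d * y) ≡ ℤ.- y * d + x * ℤ.- c
  l₃ = ℤ-ring
  l₄ : ∀ a b x y → a * x + b * y ≡ ℤ.- y * ℤ.- b + x * a
  l₄ = ℤ-ring

inv-involutive : ∀ M → inv (inv M) ≡ M
inv-involutive (a , b , c , d) = mat≡ refl (ℤ.neg-involutive b) (ℤ.neg-involutive c) refl

inv-negM : ∀ M → inv (negM M) ≡ negM (inv M)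
inv-negM M = refl

∼-refl : ∀ {M} → M ∼ M
∼-refl = inj₁ refl

∼-neg : ∀ {M} → negM M ∼ M
∼-neg = inj₂ refl

∼-sym : ∀ {M N} → M ∼ N → N ∼ M
∼-sym (inj₁ refl) = inj₁ refl
∼-sym {N = N} (inj₂ refl) = inj₂ (sym (negM-involutive N))

∼-trans : ∀ {L M N} → L ∼ M → M ∼ N → L ∼ N
∼-trans (inj₁ refl) q = q
∼-trans (inj₂ refl) (inj₁ refl) = inj₂ refl
∼-trans {N = N} (inj₂ refl) (inj₂ refl) = inj₁ (negM-involutive N)

∼-⊗ˡ : ∀ L {M N} → M ∼ N → (L ⊗ M) ∼ (L ⊗ N)
∼-⊗ˡ L (inj₁ refl) = inj₁ refl
∼-⊗ˡ L {N = N} (inj₂ refl) = inj₂ (negM-⊗ʳ L N)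

∼-⊗ʳ : ∀ L {M N} → M ∼ N → (M ⊗ L) ∼ (N ⊗ L)
∼-⊗ʳ L (inj₁ refl) = inj₁ refl
∼-⊗ʳ L {N = N} (inj₂ refl) = inj₂ (negM-⊗ˡ N L)

det-∼ : ∀ {M N} → M ∼ N → det M ≡ det N
det-∼ (inj₁ refl) = refl
det-∼ {N = N} (inj₂ refl) = det-negM N

-- A function on matrices modulo ±1 is kept as an even function on matrices. The relation `≋`
-- compares coefficients of classes, so evenness is what makes a pairing respect it.
Even : (Mat → ℚ) → Set
Even f = ∀ M → f (negM M) ≡ f M

even-∼ : ∀ {f} → Even f → ∀ {M N} → M ∼ N → f M ≡ f N
even-∼ ef (inj₁ refl) = refl
even-∼ ef {N = N} (inj₂ refl) = ef N

ind : ∀ {A : Set} → Dec A → ℚ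
ind (yes _) = 1ℚ
ind (no _) = 0ℚ

ind-yes : ∀ {A : Set} (d : Dec A) → A → ind d ≡ 1ℚ
ind-yes (yes _) a = refl
ind-yes (no ¬a) a = ⊥-elim (¬a a)

ind-no : ∀ {A : Set} (d : Dec A) → ¬ A → ind d ≡ 0ℚ
ind-no (yes a) ¬a = ⊥-elim (¬a a)
ind-no (no _) ¬a = refl

ind-cong : ∀ {A B : Set} (d : Dec A) (e : Dec B) → (A → B) → (B → A) → ind d ≡ ind e
ind-cong (yes a) e f g = sym (ind-yes e (f a))
ind-cong (no ¬a) e f g = sym (ind-no e (λ b → ¬a (g b)))

-- Finite sums and the pairing of a formal sum with a function

∑ : ∀ {A : Set} → List A → (A → ℚ) → ℚ
∑ [] f = 0ℚ
∑ (x ∷ L) f = f x ℚ.+ ∑ L f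

⟪_∣_⟫ : Formal → (Mat → ℚ) → ℚ
⟪ ξ ∣ f ⟫ = ∑ ξ (λ p → proj₁ p ℚ.* f (proj₂ p))

∑-cong : ∀ {A : Set} (L : List A) {f g : A → ℚ} → All (λ x → f x ≡ g x) L → ∑ L f ≡ ∑ L g
∑-cong [] [] = refl
∑-cong (x ∷ L) (p ∷ ps) = cong₂ ℚ._+_ p (∑-cong L ps)

∑-ext : ∀ {A : Set} (L : List A) {f g : A → ℚ} → (∀ x → f x ≡ g x) → ∑ L f ≡ ∑ L g
∑-ext L h = ∑-cong L (All.universal h L)

∑-zero : ∀ {A : Set} (L : List A) → ∑ L (λ _ → 0ℚ) ≡ 0ℚ
∑-zero [] = refl
∑-zero (x ∷ L) = trans (ℚ.+-identityˡ _) (∑-zero L)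

∑-+ : ∀ {A : Set} (L : List A) (f g : A → ℚ) → ∑ L (λ x → f x ℚ.+ g x) ≡ ∑ L f ℚ.+ ∑ L g
∑-+ [] f g = refl
∑-+ (x ∷ L) f g = trans (cong (f x ℚ.+ g x ℚ.+_) (∑-+ L f g)) (lem (f x) (g x) (∑ L f) (∑ L g))
  where
  lem : ∀ a b c d → a ℚ.+ b ℚ.+ (c ℚ.+ d) ≡ a ℚ.+ c ℚ.+ (b ℚ.+ d)
  lem = ring-of ringℚ

∑-*ˡ : ∀ {A : Set} (L : List A) (k : ℚ) (f : A → ℚ) → ∑ L (λ x → k ℚ.* f x) ≡ k ℚ.* ∑ L f
∑-*ˡ [] k f = sym (ℚ.*-zeroʳ k)
∑-*ˡ (x ∷ L) k f = trans (cong (k ℚ.* f x ℚ.+_) (∑-*ˡ L k f)) (sym (ℚ.*-distribˡ-+ k (f x) (∑ L f)))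

∑-- : ∀ {A : Set} (L : List A) (f g : A → ℚ) → ∑ L (λ x → f x ℚ.- g x) ≡ ∑ L f ℚ.- ∑ L g
∑-- [] f g = refl
∑-- (x ∷ L) f g = trans (cong (f x ℚ.- g x ℚ.+_) (∑-- L f g)) (lem (f x) (g x) (∑ L f) (∑ L g))
  where
  lem : ∀ a b c d → a ℚ.- b ℚ.+ (c ℚ.- d) ≡ a ℚ.+ c ℚ.- (b ℚ.+ d)
  lem = ring-of ringℚ

∑-swap : ∀ {A B : Set} (L : List A) (K : List B) (f : A → B → ℚ) →
         ∑ L (λ x → ∑ K (f x)) ≡ ∑ K (λ y → ∑ L (λ x → f x y))
∑-swap [] K f = sym (∑-zero K)
∑-swap (x ∷ L) K f = trans (cong (∑ K (f x) ℚ.+_) (∑-swap L K f)) (sym (∑-+ K (f x) _))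

∑-++ : ∀ {A : Set} (L K : List A) (f : A → ℚ) → ∑ (L ++ K) f ≡ ∑ L f ℚ.+ ∑ K f
∑-++ [] K f = sym (ℚ.+-identityˡ _)
∑-++ (x ∷ L) K f = trans (cong (f x ℚ.+_) (∑-++ L K f)) (sym (ℚ.+-assoc (f x) (∑ L f) (∑ K f)))

∑-map : ∀ {A B : Set} (g : A → B) (L : List A) (f : B → ℚ) → ∑ (map g L) f ≡ ∑ L (λ x → f (g x))
∑-map g [] f = refl
∑-map g (x ∷ L) f = cong (f (g x) ℚ.+_) (∑-map g L f)

∑-concatMap : ∀ {A B : Set} (g : A → List B) (L : List A) (f : B → ℚ) →
              ∑ (concatMap g L) f ≡ ∑ L (λ x → ∑ (g x) f)
∑-concatMap g [] f = refl
∑-concatMap g (x ∷ L) f = trans (∑-++ (g x) (concatMap g L) f) (cong (∑ (g x) f ℚ.+_) (∑-concatMap g L f))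

pair-ext : ∀ ξ {f g} → (∀ M → f M ≡ g M) → ⟪ ξ ∣ f ⟫ ≡ ⟪ ξ ∣ g ⟫
pair-ext ξ h = ∑-ext ξ (λ p → cong (proj₁ p ℚ.*_) (h (proj₂ p)))

pair-cong : ∀ ξ {f g} → All (λ p → f (proj₂ p) ≡ g (proj₂ p)) ξ → ⟪ ξ ∣ f ⟫ ≡ ⟪ ξ ∣ g ⟫
pair-cong ξ h = ∑-cong ξ (All.map (λ {p} → cong (proj₁ p ℚ.*_)) h)

pair-+ : ∀ ξ f g → ⟪ ξ ∣ (λ M → f M ℚ.+ g M) ⟫ ≡ ⟪ ξ ∣ f ⟫ ℚ.+ ⟪ ξ ∣ g ⟫
pair-+ ξ f g = trans (∑-ext ξ (λ p → ℚ.*-distribˡ-+ (proj₁ p) _ _)) (∑-+ ξ _ _)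

pair-- : ∀ ξ f g → ⟪ ξ ∣ (λ M → f M ℚ.- g M) ⟫ ≡ ⟪ ξ ∣ f ⟫ ℚ.- ⟪ ξ ∣ g ⟫
pair-- ξ f g = trans (∑-ext ξ (λ p → lem (proj₁ p) (f (proj₂ p)) (g (proj₂ p)))) (∑-- ξ _ _)
  where
  lem : ∀ a b c → a ℚ.* (b ℚ.- c) ≡ a ℚ.* b ℚ.- a ℚ.* c
  lem = ring-of ringℚ

pair-*ˡ : ∀ ξ k f → ⟪ ξ ∣ (λ M → k ℚ.* f M) ⟫ ≡ k ℚ.* ⟪ ξ ∣ f ⟫
pair-*ˡ ξ k f = trans (∑-ext ξ (λ p → lem (proj₁ p) (f (proj₂ p)) k)) (∑-*ˡ ξ k _)
  where
  lem : ∀ a b k → a ℚ.* (k ℚ.* b) ≡ k ℚ.* (a ℚ.* b)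
  lem = ring-of ringℚ

pair-⊖ : ∀ ξ f → ⟪ ⊖ ξ ∣ f ⟫ ≡ ℚ.- ⟪ ξ ∣ f ⟫
pair-⊖ [] f = refl
pair-⊖ ((c , M) ∷ ξ) f = trans (cong (ℚ.- c ℚ.* f M ℚ.+_) (pair-⊖ ξ f)) (lem c (f M) ⟪ ξ ∣ f ⟫)
  where
  lem : ∀ c x y → ℚ.- c ℚ.* x ℚ.+ ℚ.- y ≡ ℚ.- (c ℚ.* x ℚ.+ y)
  lem = ring-of ringℚ

pair-⊙ : ∀ ξ η f → ⟪ ξ ⊙ η ∣ f ⟫ ≡ ⟪ ξ ∣ (λ M → ⟪ η ∣ (λ N → f (M ⊗ N)) ⟫) ⟫
pair-⊙ ξ η f = trans (∑-concatMap _ ξ _) (∑-ext ξ (λ p → trans (∑-map _ η _)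
  (trans (∑-ext η (λ q → ℚ.*-assoc (proj₁ p) (proj₁ q) _)) (∑-*ˡ η (proj₁ p) _))))

pair-sumMats : ∀ L f → ⟪ sumMats L ∣ f ⟫ ≡ ∑ L f
pair-sumMats L f = trans (∑-map _ L _) (∑-ext L (λ M → ℚ.*-identityˡ (f M)))

pairing≡pair : ∀ ξ {P : Pred Mat 0ℓ} (P? : Decidable P) → pairing ξ P? ≡ ⟪ ξ ∣ (λ M → ind (P? M)) ⟫
pairing≡pair [] P? = refl
pairing≡pair ((c , M) ∷ ξ) P? with P? M
... | yes _ = cong₂ ℚ._+_ (sym (ℚ.*-identityʳ c)) (pairing≡pair ξ P?)
... | no _ = trans (pairing≡pair ξ P?) (sym (trans (cong (ℚ._+ _) (ℚ.*-zeroʳ c)) (ℚ.+-identityˡ _)))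

-- The relation ≋ only compares coefficients, so on the finite set L the function f is replaced by a combination of indicators of classes mod ±1.
coeff-span : ∀ (L : List Mat) f → Even f → Σ (Mat → ℚ) λ g →
  All (λ M → g M ≡ f M) L × Even g × (∀ ξ η → ξ ≋ η → ⟪ ξ ∣ g ⟫ ≡ ⟪ η ∣ g ⟫)
coeff-span [] f ef = (λ _ → 0ℚ) , [] , (λ _ → refl) , λ ξ η _ → trans (zero-pair ξ) (sym (zero-pair η))
  where
  zero-pair : ∀ ξ → ⟪ ξ ∣ (λ _ → 0ℚ) ⟫ ≡ 0ℚ
  zero-pair ξ = trans (∑-ext ξ (λ p → ℚ.*-zeroʳ (proj₁ p))) (∑-zero ξ)
coeff-span (M₀ ∷ L) f ef with coeff-span L f ef
... | g , gf , eg , g≋ = g' , at-M₀ ∷ All.map at-L gf , eg' , g≋'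
  where
  k = f M₀ ℚ.- g M₀
  δ : Mat → ℚ
  δ M = ind (M ∼? M₀)
  g' : Mat → ℚ
  g' M = g M ℚ.+ k ℚ.* δ M
  add₁ : ∀ x y → y ℚ.+ (x ℚ.- y) ℚ.* 1ℚ ≡ x
  add₁ = ring-of ringℚ
  at-M₀ : g' M₀ ≡ f M₀
  at-M₀ = trans (cong (λ t → g M₀ ℚ.+ k ℚ.* t) (ind-yes (M₀ ∼? M₀) ∼-refl)) (add₁ (f M₀) (g M₀))
  at-L : ∀ {M} → g M ≡ f M → g' M ≡ f M
  at-L {M} h with M ∼? M₀
  ... | no _ = trans (cong (g M ℚ.+_) (ℚ.*-zeroʳ k)) (trans (ℚ.+-identityʳ _) h)
  ... | yes r = trans (cong (ℚ._+ k ℚ.* 1ℚ) (even-∼ eg r)) (trans (add₁ (f M₀) (g M₀)) (sym (even-∼ ef r)))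
  eg' : Even g'
  eg' M = cong₂ (λ s t → s ℚ.+ k ℚ.* t) (eg M)
    (ind-cong (negM M ∼? M₀) (M ∼? M₀) (∼-trans (∼-sym ∼-neg)) (∼-trans ∼-neg))
  expand : ∀ ξ → ⟪ ξ ∣ g' ⟫ ≡ ⟪ ξ ∣ g ⟫ ℚ.+ k ℚ.* coeff ξ M₀
  expand ξ = trans (pair-+ ξ g _) (cong (⟪ ξ ∣ g ⟫ ℚ.+_)
    (trans (pair-*ˡ ξ k δ) (cong (k ℚ.*_) (sym (pairing≡pair ξ (_∼? M₀))))))
  g≋' : ∀ ξ η → ξ ≋ η → ⟪ ξ ∣ g' ⟫ ≡ ⟪ η ∣ g' ⟫
  g≋' ξ η h = trans (expand ξ) (trans (cong₂ (λ s t → s ℚ.+ k ℚ.* t) (g≋ ξ η h) (h M₀)) (sym (expand η)))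

-- The function g supplied by `coeff-span` agrees with f on every matrix that occurs in ξ or η, and
-- a pairing sees no others.
pair-≋ : ∀ {f} → Even f → ∀ ξ η → ξ ≋ η → ⟪ ξ ∣ f ⟫ ≡ ⟪ η ∣ f ⟫
pair-≋ {f} ef ξ η h with coeff-span (map proj₂ (ξ ++ η)) f ef
... | g , gf , eg , g≋ = trans (sym (pair-cong ξ (All.++⁻ˡ ξ gf'))) (trans (g≋ ξ η h) (pair-cong η (All.++⁻ʳ ξ gf')))
  where
  gf' : All (λ p → g (proj₂ p) ≡ f (proj₂ p)) (ξ ++ η)
  gf' = All.map⁻ gf

-- Test functions for conditions (A) and (B)

U²mat : Mat
U²mat = Umat ⊗ Umat

two-terms : ∀ x y → 1ℚ ℚ.* x ℚ.+ (1ℚ ℚ.* y ℚ.+ 0ℚ) ≡ x ℚ.+ y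
two-terms = ring-of ringℚ

three-terms : ∀ x y z → 1ℚ ℚ.* x ℚ.+ (1ℚ ℚ.* y ℚ.+ (1ℚ ℚ.* z ℚ.+ 0ℚ)) ≡ x ℚ.+ y ℚ.+ z
three-terms = ring-of ringℚ

difference-terms : ∀ x y → 1ℚ ℚ.* x ℚ.+ (ℚ.- 1ℚ ℚ.* y ℚ.+ 0ℚ) ≡ x ℚ.- y
difference-terms = ring-of ringℚ

pair-vanish : ∀ {n ξ f} → InR n ξ → (∀ N → det N ≡ + n → f N ≡ 0ℚ) → ⟪ ξ ∣ f ⟫ ≡ 0ℚ
pair-vanish {ξ = ξ} ξR h = trans (pair-cong ξ (All.map (λ {p} → h (proj₂ p)) ξR))
  (trans (∑-ext ξ (λ p → ℚ.*-zeroʳ (proj₁ p))) (∑-zero ξ))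

module _ (f : Mat → ℚ) where

  pair-[1+X]⊙ : ∀ X η → ⟪ (one ⊕ ⟦ X ⟧) ⊙ η ∣ f ⟫ ≡ ⟪ η ∣ (λ N → f N ℚ.+ f (X ⊗ N)) ⟫
  pair-[1+X]⊙ X η = trans (pair-⊙ (one ⊕ ⟦ X ⟧) η f)
    (trans (two-terms ⟪ η ∣ (λ N → f (Imat ⊗ N)) ⟫ ⟪ η ∣ (λ N → f (X ⊗ N)) ⟫)
    (trans (sym (pair-+ η (λ N → f (Imat ⊗ N)) (λ N → f (X ⊗ N))))
    (pair-ext η (λ N → cong (λ M → f M ℚ.+ f (X ⊗ N)) (⊗-identityˡ N)))))

  pair-[1-X]⊙ : ∀ X η → ⟪ (one ⊕ ⊖ ⟦ X ⟧) ⊙ η ∣ f ⟫ ≡ ⟪ η ∣ (λ N → f N ℚ.- f (X ⊗ N)) ⟫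
  pair-[1-X]⊙ X η = trans (pair-⊙ (one ⊕ ⊖ ⟦ X ⟧) η f)
    (trans (difference-terms ⟪ η ∣ (λ N → f (Imat ⊗ N)) ⟫ ⟪ η ∣ (λ N → f (X ⊗ N)) ⟫)
    (trans (sym (pair-- η (λ N → f (Imat ⊗ N)) (λ N → f (X ⊗ N))))
    (pair-ext η (λ N → cong (λ M → f M ℚ.- f (X ⊗ N)) (⊗-identityˡ N)))))

  pair-[1+X+Y]⊙ : ∀ X Y η →
    ⟪ (one ⊕ ⟦ X ⟧ ⊕ ⟦ Y ⟧) ⊙ η ∣ f ⟫ ≡ ⟪ η ∣ (λ N → f N ℚ.+ f (X ⊗ N) ℚ.+ f (Y ⊗ N)) ⟫
  pair-[1+X+Y]⊙ X Y η = trans (pair-⊙ (one ⊕ ⟦ X ⟧ ⊕ ⟦ Y ⟧) η f)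
    (trans (three-terms ⟪ η ∣ (λ N → f (Imat ⊗ N)) ⟫ ⟪ η ∣ (λ N → f (X ⊗ N)) ⟫ ⟪ η ∣ (λ N → f (Y ⊗ N)) ⟫)
    (trans (sym (trans (pair-+ η (λ N → f (Imat ⊗ N) ℚ.+ f (X ⊗ N)) (λ N → f (Y ⊗ N)))
                       (cong (λ t → t ℚ.+ ⟪ η ∣ (λ N → f (Y ⊗ N)) ⟫) (pair-+ η (λ N → f (Imat ⊗ N)) (λ N → f (X ⊗ N))))))
    (pair-ext η (λ N → cong (λ M → f M ℚ.+ f (X ⊗ N) ℚ.+ f (Y ⊗ N)) (⊗-identityˡ N)))))

  pair-⊙[1+X] : ∀ X ξ → ⟪ ξ ⊙ (one ⊕ ⟦ X ⟧) ∣ f ⟫ ≡ ⟪ ξ ∣ (λ N → f N ℚ.+ f (N ⊗ X)) ⟫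
  pair-⊙[1+X] X ξ = trans (pair-⊙ ξ (one ⊕ ⟦ X ⟧) f) (pair-ext ξ (λ N →
    trans (two-terms (f (N ⊗ Imat)) (f (N ⊗ X))) (cong (λ M → f M ℚ.+ f (N ⊗ X)) (⊗-identityʳ N))))

  pair-⊙[1-X] : ∀ X ξ → ⟪ ξ ⊙ (one ⊕ ⊖ ⟦ X ⟧) ∣ f ⟫ ≡ ⟪ ξ ∣ (λ N → f N ℚ.- f (N ⊗ X)) ⟫
  pair-⊙[1-X] X ξ = trans (pair-⊙ ξ (one ⊕ ⊖ ⟦ X ⟧) f) (pair-ext ξ (λ N →
    trans (difference-terms (f (N ⊗ Imat)) (f (N ⊗ X))) (cong (λ M → f M ℚ.- f (N ⊗ X)) (⊗-identityʳ N))))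

  pair-⊙[1+X+Y] : ∀ X Y ξ →
    ⟪ ξ ⊙ (one ⊕ ⟦ X ⟧ ⊕ ⟦ Y ⟧) ∣ f ⟫ ≡ ⟪ ξ ∣ (λ N → f N ℚ.+ f (N ⊗ X) ℚ.+ f (N ⊗ Y)) ⟫
  pair-⊙[1+X+Y] X Y ξ = trans (pair-⊙ ξ (one ⊕ ⟦ X ⟧ ⊕ ⟦ Y ⟧) f) (pair-ext ξ (λ N →
    trans (three-terms (f (N ⊗ Imat)) (f (N ⊗ X)) (f (N ⊗ Y)))
          (cong (λ M → f M ℚ.+ f (N ⊗ X) ℚ.+ f (N ⊗ Y)) (⊗-identityʳ N))))

difference-zero : ∀ x y → x ℚ.- y ≡ 0ℚ → x ≡ y
difference-zero x y p = trans (sym (lem x y)) (trans (cong (λ t → t ℚ.+ y) p) (ℚ.+-identityˡ y))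
  where
  lem : ∀ x y → x ℚ.- y ℚ.+ y ≡ x
  lem = ring-of ringℚ

module _ (n : ℕ) (ξ : Formal) where

  -- The left factor of the witness η moves onto θ. Nothing is known of η beyond its determinant, so
  -- the orbit sums of θ are required to vanish on all matrices of determinant n.
  pair-B₁ : CondB n ξ → ∀ {θ} → Even θ →
    (∀ N → det N ≡ + n → θ N ℚ.+ θ (Umat ⊗ N) ℚ.+ θ (U²mat ⊗ N) ≡ 0ℚ) →
    ⟪ ξ ∣ (λ N → θ N ℚ.+ θ (N ⊗ Smat)) ⟫ ≡ 0ℚ
  pair-B₁ ((η , ηR , eq) , _) {θ} eθ h = trans (sym (pair-⊙[1+X] θ Smat ξ))
    (trans (sym (pair-≋ eθ ((one ⊕ ⟦ Umat ⟧ ⊕ ⟦ U²mat ⟧) ⊙ η) (ξ ⊙ (one ⊕ ⟦ Smat ⟧)) eq))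
    (trans (pair-[1+X+Y]⊙ θ Umat U²mat η) (pair-vanish ηR h)))

  pair-B₂ : CondB n ξ → ∀ {θ} → Even θ → (∀ N → det N ≡ + n → θ N ℚ.+ θ (Smat ⊗ N) ≡ 0ℚ) →
    ⟪ ξ ∣ (λ N → θ N ℚ.+ θ (N ⊗ Umat) ℚ.+ θ (N ⊗ U²mat)) ⟫ ≡ 0ℚ
  pair-B₂ (_ , (η , ηR , eq)) {θ} eθ h = trans (sym (pair-⊙[1+X+Y] θ Umat U²mat ξ))
    (trans (sym (pair-≋ eθ ((one ⊕ ⟦ Smat ⟧) ⊙ η) (ξ ⊙ (one ⊕ ⟦ Umat ⟧ ⊕ ⟦ U²mat ⟧)) eq))
    (trans (pair-[1+X]⊙ θ Smat η) (pair-vanish ηR h)))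

  -- T-invariance of H annihilates the unknown multiple of 1 - T; what remains is a sum over the
  -- explicit representatives.
  pair-A : ∀ Tinf → CondA n Tinf ξ → ∀ {H} → Even H → (∀ N → det N ≡ + n → H (Tmat ⊗ N) ≡ H N) →
    ⟪ ξ ∣ (λ N → H N ℚ.- H (Smat ⊗ N)) ⟫ ≡ ∑ Tinf (λ N → H N ℚ.- H (N ⊗ Smat))
  pair-A Tinf (η , ηR , eq) {H} eH h =
    trans (sym (pair-[1-X]⊙ H Smat ξ)) (trans (difference-zero _ _ main)
      (trans (pair-⊙[1-X] H Smat (sumMats Tinf)) (pair-sumMats Tinf (λ N → H N ℚ.- H (N ⊗ Smat)))))
    where
    lhs = (one ⊕ ⊖ ⟦ Smat ⟧) ⊙ ξ
    rhs = sumMats Tinf ⊙ (one ⊕ ⊖ ⟦ Smat ⟧)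
    main : ⟪ lhs ∣ H ⟫ ℚ.- ⟪ rhs ∣ H ⟫ ≡ 0ℚ
    main = trans (cong (λ t → ⟪ lhs ∣ H ⟫ ℚ.+ t) (sym (pair-⊖ rhs H)))
      (trans (sym (∑-++ lhs (⊖ rhs) (λ p → proj₁ p ℚ.* H (proj₂ p))))
      (trans (sym (pair-≋ eH ((one ⊕ ⊖ ⟦ Tmat ⟧) ⊙ η) (lhs ⊕ ⊖ rhs) eq))
      (trans (pair-[1-X]⊙ H Tmat η) (pair-vanish ηR (λ N d →
        trans (cong (λ t → H N ℚ.- t) (h N d)) (ℚ.+-inverseʳ (H N)))))))

-- Integer inequalities, proved by exhibiting nonnegative combinations

nn+ : ∀ {x y} → 0ℤ ≤ x → 0ℤ ≤ y → 0ℤ ≤ x + y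
nn+ p q = ℤ.+-mono-≤ p q

nn* : ∀ {x y} → 0ℤ ≤ x → 0ℤ ≤ y → 0ℤ ≤ x * y
nn* {x} {y} p q = subst (_≤ x * y) (ℤ.*-zeroʳ x) (ℤ.*-monoˡ-≤-nonNeg x {{ℤ.nonNegative p}} q)

≤⇒nn : ∀ {x y} → x ≤ y → 0ℤ ≤ y - x
≤⇒nn = ℤ.i≤j⇒0≤j-i

nn⇒≤ : ∀ {x y} → 0ℤ ≤ y - x → x ≤ y
nn⇒≤ = ℤ.0≤i-j⇒j≤i

-- Over ℤ a strict inequality has slack 1; the certificates below work with the reduced form
-- `y - x - + 1`.
<⇒nn : ∀ {x y} → x < y → 0ℤ ≤ y - x - + 1
<⇒nn {x} {y} p = subst (0ℤ ≤_) (lem x y) (≤⇒nn (ℤ.i<j⇒suc[i]≤j p))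
  where
  lem : ∀ x y → y - (+ 1 + x) ≡ y - x - + 1
  lem = ℤ-ring

nn⇒< : ∀ {x y} → 0ℤ ≤ y - x - + 1 → x < y
nn⇒< {x} {y} p = ℤ.suc[i]≤j⇒i<j (nn⇒≤ (subst (0ℤ ≤_) (lem x y) p))
  where
  lem : ∀ x y → y - x - + 1 ≡ y - (+ 1 + x)
  lem = ℤ-ring

-- An equation enters a certificate with a multiplier k of either sign.
≡⇒nn : ∀ k {x y} → x ≡ y → 0ℤ ≤ k * (x - y)
≡⇒nn k {x} refl = ℤ.≤-reflexive (lem k x)
  where
  lem : ∀ k x → + 0 ≡ k * (x - x)
  lem = ℤ-ring

nn-≡ : ∀ {x y} → 0ℤ ≤ x → x ≡ y → 0ℤ ≤ y
nn-≡ p refl = p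

square-nn : ∀ z → 0ℤ ≤ z * z
square-nn +0 = ℤ.≤-refl
square-nn +[1+ _ ] = ℤ.+≤+ ℕ.z≤n
square-nn -[1+ _ ] = ℤ.+≤+ ℕ.z≤n

-- The end of a certificate: nonnegative terms add up to an expression that the ring solver
-- identifies with a negative constant.
¬nn : ∀ {x k} → 0ℤ ≤ x → x ≡ -[1+ k ] → ⊥
¬nn () refl

-- Sums over lists

∑-indicator : ∀ {A : Set} {P : A → Set} (P? : Decidable P) (L : List A) →
  Any P L → AllPairs (λ x y → ¬ (P x × P y)) L → ∑ L (λ x → ind (P? x)) ≡ 1ℚ
∑-indicator P? (x ∷ L) (here p) (h ∷ _) = trans (cong₂ ℚ._+_ (ind-yes (P? x) p)
  (trans (∑-cong L (All.map (λ {y} n → ind-no (P? y) (λ q → n (p , q))) h)) (∑-zero L))) refl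
∑-indicator P? (x ∷ L) (there a) (h ∷ hs) = trans (cong₂ ℚ._+_ (ind-no (P? x) λ p → none a h p)
  (∑-indicator P? L a hs)) (ℚ.+-identityˡ 1ℚ)
  where
  none : ∀ {M} → Any _ M → All _ M → _ → ⊥
  none (here q) (n ∷ _) p = n (p , q)
  none (there a) (_ ∷ ns) p = none a ns p

∑-*ʳ : ∀ {A : Set} (L : List A) (f : A → ℚ) k → ∑ L (λ x → f x ℚ.* k) ≡ ∑ L f ℚ.* k
∑-*ʳ L f k = trans (∑-ext L (λ x → ℚ.*-comm (f x) k)) (trans (∑-*ˡ L k f) (ℚ.*-comm k (∑ L f)))

∑-∈ : ∀ {A : Set} (L : List A) {f g : A → ℚ} → (∀ x → x ∈ L → f x ≡ g x) → ∑ L f ≡ ∑ L g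
∑-∈ L h = ∑-cong L (All.tabulate (λ {x} → h x))

module _ {A : Set} {_≈_ : A → A → Set} (_≈?_ : ∀ x y → Dec (x ≈ y))
  (≈-sym : ∀ {x y} → x ≈ y → y ≈ x) (≈-trans : ∀ {x y z} → x ≈ y → y ≈ z → x ≈ z) where

  -- Counting pairs (x , y) with x ≈ y in two ways.
  ∑-reindex : ∀ (L K : List A) {f : A → ℚ} → (∀ {x y} → x ≈ y → f x ≡ f y) →
    AllPairs (λ x y → ¬ (x ≈ y)) L → AllPairs (λ x y → ¬ (x ≈ y)) K →
    (∀ x → x ∈ L → Any (x ≈_) K ⊎ f x ≡ 0ℚ) → (∀ x → x ∈ K → Any (x ≈_) L ⊎ f x ≡ 0ℚ) →
    ∑ L f ≡ ∑ K f
  ∑-reindex L K {f} f≈ uL uK hL hK =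
    trans (∑-∈ L (λ x m → sym (count K uK x (hL x m))))
    (trans (∑-ext L (λ x → sym (∑-*ˡ K (f x) (λ y → ind (x ≈? y)))))
    (trans (∑-swap L K (λ x y → f x ℚ.* ind (x ≈? y)))
    (trans (∑-ext K (λ y → trans (∑-ext L (λ x → flip x y)) (∑-*ˡ L (f y) (λ x → ind (y ≈? x)))))
    (∑-∈ K (λ y m → count L uL y (hK y m))))))
    where
    count : ∀ K → AllPairs (λ x y → ¬ (x ≈ y)) K → ∀ x → Any (x ≈_) K ⊎ f x ≡ 0ℚ →
      f x ℚ.* ∑ K (λ y → ind (x ≈? y)) ≡ f x
    count K u x (inj₁ a) = trans (cong (f x ℚ.*_) (∑-indicator (x ≈?_) K a
      (AllPairs.map (λ n (p , q) → n (≈-trans (≈-sym p) q)) u))) (ℚ.*-identityʳ (f x))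
    count K u x (inj₂ z) = trans (cong (λ t → t ℚ.* ∑ K (λ y → ind (x ≈? y))) z) (trans (ℚ.*-zeroˡ (∑ K (λ y → ind (x ≈? y)))) (sym z))
    flip : ∀ x y → f x ℚ.* ind (x ≈? y) ≡ f y ℚ.* ind (y ≈? x)
    flip x y with x ≈? y | y ≈? x
    ... | yes p | yes q = cong (ℚ._* 1ℚ) (f≈ p)
    ... | yes p | no q = ⊥-elim (q (≈-sym p))
    ... | no p | yes q = ⊥-elim (p (≈-sym q))
    ... | no p | no q = trans (ℚ.*-zeroʳ (f x)) (sym (ℚ.*-zeroʳ (f y)))

∑-same-support : ∀ (L K : List Mat) {f : Mat → ℚ} → Unique L → Unique K →
  (∀ x → x ∈ L → x ∈ K ⊎ f x ≡ 0ℚ) → (∀ x → x ∈ K → x ∈ L ⊎ f x ≡ 0ℚ) → ∑ L f ≡ ∑ K f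
∑-same-support L K = ∑-reindex _≟M_ sym trans L K (λ { refl → refl })

-- Balls of matrices

-- The sum of absolute values is unchanged by negation and by conjugation with S, so both permute
-- every ball.
norm : Mat → ℕ
norm (a , b , c , d) = ℤ.∣ a ∣ ℕ.+ ℤ.∣ b ∣ ℕ.+ (ℤ.∣ c ∣ ℕ.+ ℤ.∣ d ∣)

opaque

  interval : ℕ → List ℤ
  interval R = map +_ (upTo (suc R)) ++ map -[1+_] (upTo R)

  ∈-interval : ∀ R z → ℤ.∣ z ∣ ℕ.≤ R → z ∈ interval R
  ∈-interval R (+ k) h = ∈-++⁺ˡ (∈-map⁺ +_ (∈-upTo⁺ (ℕ.s≤s h)))
  ∈-interval R -[1+ k ] h = ∈-++⁺ʳ (map +_ (upTo (suc R))) (∈-map⁺ -[1+_] (∈-upTo⁺ h))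

  unique-interval : ∀ R → Unique (interval R)
  unique-interval R = Unique.++⁺ (Unique.map⁺ ℤ.+-injective (Unique.upTo⁺ (suc R)))
    (Unique.map⁺ ℤ.-[1+-injective (Unique.upTo⁺ R)) disjoint
    where
    disjoint : ∀ {z} → ¬ (z ∈ map +_ (upTo (suc R)) × z ∈ map -[1+_] (upTo R))
    disjoint (p , q) with ∈-map⁻ +_ p | ∈-map⁻ -[1+_] q
    ... | _ , _ , refl | _ , _ , ()

cube : ℕ → List Mat
cube R = cartesianProduct (interval R) (cartesianProduct (interval R) (cartesianProduct (interval R) (interval R)))

opaque

  ball : ℕ → List Mat
  ball R = filter (λ M → norm M ℕ.≤? R) (cube R)

  unique-ball : ∀ R → Unique (ball R)
  unique-ball R = Unique.filter⁺ (λ M → norm M ℕ.≤? R)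
    (Unique.cartesianProduct⁺ u (Unique.cartesianProduct⁺ u (Unique.cartesianProduct⁺ u u)))
    where
    u : Unique (interval R)
    u = unique-interval R

  ∈-ball : ∀ {R M} → norm M ℕ.≤ R → M ∈ ball R
  ∈-ball {R} {a , b , c , d} h = ∈-filter⁺ (λ M → norm M ℕ.≤? R)
    (∈-cartesianProduct⁺ (e a (ℕ.≤-trans (ℕ.m≤m+n ∣a∣ ∣b∣) (ℕ.m≤m+n (∣a∣ ℕ.+ ∣b∣) (∣c∣ ℕ.+ ∣d∣))))
    (∈-cartesianProduct⁺ (e b (ℕ.≤-trans (ℕ.m≤n+m ∣b∣ ∣a∣) (ℕ.m≤m+n (∣a∣ ℕ.+ ∣b∣) (∣c∣ ℕ.+ ∣d∣))))
    (∈-cartesianProduct⁺ (e c (ℕ.≤-trans (ℕ.m≤m+n ∣c∣ ∣d∣) (ℕ.m≤n+m (∣c∣ ℕ.+ ∣d∣) (∣a∣ ℕ.+ ∣b∣))))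
                         (e d (ℕ.≤-trans (ℕ.m≤n+m ∣d∣ ∣c∣) (ℕ.m≤n+m (∣c∣ ℕ.+ ∣d∣) (∣a∣ ℕ.+ ∣b∣))))))) h
    where
    ∣a∣ ∣b∣ ∣c∣ ∣d∣ : ℕ
    ∣a∣ = ℤ.∣ a ∣
    ∣b∣ = ℤ.∣ b ∣
    ∣c∣ = ℤ.∣ c ∣
    ∣d∣ = ℤ.∣ d ∣
    e : ∀ z → ℤ.∣ z ∣ ℕ.≤ norm (a , b , c , d) → z ∈ interval R
    e z p = ∈-interval R z (ℕ.≤-trans p h)

  ball-norm : ∀ {R M} → M ∈ ball R → norm M ℕ.≤ R
  ball-norm {R} {M} m = proj₂ (∈-filter⁻ (λ M → norm M ℕ.≤? R) {v = M} {xs = cube R} m)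

norm-negM : ∀ M → norm (negM M) ≡ norm M
norm-negM (a , b , c , d) = cong₂ ℕ._+_ (cong₂ ℕ._+_ (ℤ.∣-i∣≡∣i∣ a) (ℤ.∣-i∣≡∣i∣ b)) (cong₂ ℕ._+_ (ℤ.∣-i∣≡∣i∣ c) (ℤ.∣-i∣≡∣i∣ d))

norm-∼ : ∀ {M N} → M ∼ N → norm M ≡ norm N
norm-∼ (inj₁ refl) = refl
norm-∼ {N = N} (inj₂ refl) = norm-negM N

-- The ball need not be stable under φ: it is enough that f vanishes on whatever enters or leaves
-- it.
∑-ball-permute : ∀ R (φ ψ : Mat → Mat) → (∀ M → φ (ψ M) ≡ M) → (∀ M → ψ (φ M) ≡ M) → (f : Mat → ℚ) →
  (∀ M → norm M ℕ.≤ R → norm (φ M) ℕ.≤ R ⊎ f (φ M) ≡ 0ℚ) → (∀ M → norm M ℕ.≤ R → norm (ψ M) ℕ.≤ R ⊎ f M ≡ 0ℚ) →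
  ∑ (ball R) (λ M → f (φ M)) ≡ ∑ (ball R) f
∑-ball-permute R φ ψ φψ ψφ f h₁ h₂ = trans (sym (∑-map φ (ball R) f))
  (∑-same-support (map φ (ball R)) (ball R) (Unique.map⁺ inj (unique-ball R)) (unique-ball R) to from)
  where
  inj : ∀ {x y} → φ x ≡ φ y → x ≡ y
  inj {x} {y} e = trans (sym (ψφ x)) (trans (cong ψ e) (ψφ y))
  to : ∀ x → x ∈ map φ (ball R) → x ∈ ball R ⊎ f x ≡ 0ℚ
  to x m with ∈-map⁻ φ m
  ... | y , my , refl with h₁ y (ball-norm my)
  ...   | inj₁ b = inj₁ (∈-ball b)
  ...   | inj₂ z = inj₂ z
  from : ∀ x → x ∈ ball R → x ∈ map φ (ball R) ⊎ f x ≡ 0ℚ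
  from x m with h₂ x (ball-norm m)
  ... | inj₁ b = inj₁ (subst (_∈ map φ (ball R)) (φψ x) (∈-map⁺ φ (∈-ball b)))
  ... | inj₂ z = inj₂ z

-- Scalar multiples and cosets

scale : ℤ → Mat → Mat
scale k (a , b , c , d) = k * a , k * b , k * c , k * d

scale-⊗ˡ : ∀ k M N → scale k M ⊗ N ≡ scale k (M ⊗ N)
scale-⊗ˡ k (a , b , c , d) (a' , b' , c' , d') = mat≡ (l k a b a' c') (l k a b b' d') (l k c d a' c') (l k c d b' d')
  where
  l : ∀ k a b x y → k * a * x + k * b * y ≡ k * (a * x + b * y)
  l = ℤ-ring

scale-⊗ʳ : ∀ k M N → M ⊗ scale k N ≡ scale k (M ⊗ N)
scale-⊗ʳ k (a , b , c , d) (a' , b' , c' , d') = mat≡ (l k a b a' c') (l k a b b' d') (l k c d a' c') (l k c d b' d')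
  where
  l : ∀ k a b x y → a * (k * x) + b * (k * y) ≡ k * (a * x + b * y)
  l = ℤ-ring

scale-negM : ∀ k M → scale k (negM M) ≡ negM (scale k M)
scale-negM k (a , b , c , d) = mat≡ (l k a) (l k b) (l k c) (l k d)
  where
  l : ∀ k a → k * ℤ.- a ≡ ℤ.- (k * a)
  l = ℤ-ring

scale-inv : ∀ k M → inv (scale k M) ≡ scale k (inv M)
scale-inv k (a , b , c , d) = mat≡ refl (l k b) (l k c) refl
  where
  l : ∀ k a → ℤ.- (k * a) ≡ k * ℤ.- a
  l = ℤ-ring

scale-injective : ∀ k .{{_ : ℤ.NonZero k}} {M N} → scale k M ≡ scale k N → M ≡ N
scale-injective k {a , b , c , d} {a' , b' , c' , d'} e =
  mat≡ (c₁ (cong proj₁ e)) (c₁ (cong (λ M → proj₁ (proj₂ M)) e))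
       (c₁ (cong (λ M → proj₁ (proj₂ (proj₂ M))) e)) (c₁ (cong (λ M → proj₂ (proj₂ (proj₂ M))) e))
  where
  c₁ : ∀ {x y} → k * x ≡ k * y → x ≡ y
  c₁ {x} {y} = ℤ.*-cancelˡ-≡ k x y

⊗-inv : ∀ M → M ⊗ inv M ≡ scale (det M) Imat
⊗-inv (a , b , c , d) = mat≡ (l₁ a b c d) (l₂ a b c d) (l₃ a b c d) (l₄ a b c d)
  where
  l₁ : ∀ a b c d → a * d + b * ℤ.- c ≡ (a * d - b * c) * + 1
  l₁ = ℤ-ring
  l₂ : ∀ a b c d → a * ℤ.- b + b * a ≡ (a * d - b * c) * + 0
  l₂ = ℤ-ring
  l₃ : ∀ a b c d → c * d + d * ℤ.- c ≡ (a * d - b * c) * + 0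
  l₃ = ℤ-ring
  l₄ : ∀ a b c d → c * ℤ.- b + d * a ≡ (a * d - b * c) * + 1
  l₄ = ℤ-ring

inv-⊗-self : ∀ M → inv M ⊗ M ≡ scale (det M) Imat
inv-⊗-self M = trans (cong (inv M ⊗_) (sym (inv-involutive M)))
  (trans (⊗-inv (inv M)) (cong (λ k → scale k Imat) (det-inv M)))

scale-one : ∀ M → scale (+ 1) M ≡ M
scale-one (a , b , c , d) = mat≡ (ℤ.*-identityˡ a) (ℤ.*-identityˡ b) (ℤ.*-identityˡ c) (ℤ.*-identityˡ d)

⊗-scale-Iʳ : ∀ k M → M ⊗ scale k Imat ≡ scale k M
⊗-scale-Iʳ k M = trans (scale-⊗ʳ k M Imat) (cong (scale k) (⊗-identityʳ M))

⊗-scale-Iˡ : ∀ k M → scale k Imat ⊗ M ≡ scale k M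
⊗-scale-Iˡ k M = trans (scale-⊗ˡ k Imat M) (cong (scale k) (⊗-identityˡ M))

⊗-inv-cancelʳ : ∀ M N → (M ⊗ inv N) ⊗ N ≡ scale (det N) M
⊗-inv-cancelʳ M N = trans (⊗-assoc M (inv N) N) (trans (cong (M ⊗_) (inv-⊗-self N)) (⊗-scale-Iʳ (det N) M))

⊗-cancel-invʳ : ∀ M N → (M ⊗ N) ⊗ inv N ≡ scale (det N) M
⊗-cancel-invʳ M N = trans (⊗-assoc M N (inv N)) (trans (cong (M ⊗_) (⊗-inv N)) (⊗-scale-Iʳ (det N) M))

inv-cancelˡ : ∀ M N → inv N ⊗ (N ⊗ M) ≡ scale (det N) M
inv-cancelˡ M N = trans (sym (⊗-assoc (inv N) N M)) (trans (cong (_⊗ M) (inv-⊗-self N)) (⊗-scale-Iˡ (det N) M))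

cancel-invˡ : ∀ M N → N ⊗ (inv N ⊗ M) ≡ scale (det N) M
cancel-invˡ M N = trans (sym (⊗-assoc N (inv N) M)) (trans (cong (_⊗ M) (⊗-inv N)) (⊗-scale-Iˡ (det N) M))

module _ (γ : Mat) (γΓ : InΓ γ) where

  Γ-inv-cancelˡ : ∀ M → inv γ ⊗ (γ ⊗ M) ≡ M
  Γ-inv-cancelˡ M = trans (inv-cancelˡ M γ) (trans (cong (λ k → scale k M) γΓ) (scale-one M))

  Γ-cancel-invˡ : ∀ M → γ ⊗ (inv γ ⊗ M) ≡ M
  Γ-cancel-invˡ M = trans (cancel-invˡ M γ) (trans (cong (λ k → scale k M) γΓ) (scale-one M))

  Γ-inv-cancelʳ : ∀ M → (M ⊗ inv γ) ⊗ γ ≡ M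
  Γ-inv-cancelʳ M = trans (⊗-inv-cancelʳ M γ) (trans (cong (λ k → scale k M) γΓ) (scale-one M))

  Γ-cancel-invʳ : ∀ M → (M ⊗ γ) ⊗ inv γ ≡ M
  Γ-cancel-invʳ M = trans (⊗-cancel-invʳ M γ) (trans (cong (λ k → scale k M) γΓ) (scale-one M))

  Γ-inv : InΓ (inv γ)
  Γ-inv = trans (det-inv γ) γΓ

Γ-⊗ : ∀ γ δ → InΓ γ → InΓ δ → InΓ (γ ⊗ δ)
Γ-⊗ γ δ p q = trans (det-⊗ γ δ) (cong₂ _*_ p q)

infix 4 _∣M_ _∣M?_

-- For det N = n the adjugate `inv N` is n N⁻¹, so `n ∣M (M ⊗ inv N)` says that M N⁻¹ is integral.
-- This replaces the existential statement M ∈ ΓN by a decidable one.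
record _∣M_ (n : ℕ) (M : Mat) : Set where
  constructor _,_
  field
    quotientM : Mat
    equalityM : M ≡ scale (+ n) quotientM

_∣M?_ : ∀ n M → Dec (n ∣M M)
n ∣M? (a , b , c , d) = map′ to from ((+ n ∣? a) ×-dec (+ n ∣? b) ×-dec (+ n ∣? c) ×-dec (+ n ∣? d))
  where
  to : (+ n ∣ a) × (+ n ∣ b) × (+ n ∣ c) × (+ n ∣ d) → n ∣M (a , b , c , d)
  to (divides p e , divides q f , divides r g , divides s h) =
    (p , q , r , s) , mat≡ (trans e (ℤ.*-comm p (+ n))) (trans f (ℤ.*-comm q (+ n)))
                           (trans g (ℤ.*-comm r (+ n))) (trans h (ℤ.*-comm s (+ n)))
  from : n ∣M (a , b , c , d) → (+ n ∣ a) × (+ n ∣ b) × (+ n ∣ c) × (+ n ∣ d)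
  from ((p , q , r , s) , refl) = divides p (ℤ.*-comm (+ n) p) , divides q (ℤ.*-comm (+ n) q)
                                , divides r (ℤ.*-comm (+ n) r) , divides s (ℤ.*-comm (+ n) s)

∣M-⊗ˡ : ∀ {n} L {M} → n ∣M M → n ∣M (L ⊗ M)
∣M-⊗ˡ {n} L (G , refl) = L ⊗ G , scale-⊗ʳ (+ n) L G

∣M-⊗ʳ : ∀ {n} L {M} → n ∣M M → n ∣M (M ⊗ L)
∣M-⊗ʳ {n} L (G , refl) = G ⊗ L , scale-⊗ˡ (+ n) G L

∣M-negM : ∀ {n M} → n ∣M M → n ∣M negM M
∣M-negM {n} (G , refl) = negM G , sym (scale-negM (+ n) G)

∣M-inv : ∀ {n M} → n ∣M M → n ∣M inv M
∣M-inv {n} (G , refl) = inv G , scale-inv (+ n) G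

ind-∣M-negM : ∀ n M → ind (n ∣M? negM M) ≡ ind (n ∣M? M)
ind-∣M-negM n M = ind-cong (n ∣M? negM M) (n ∣M? M) (λ p → subst (n ∣M_) (negM-involutive M) (∣M-negM p)) (∣M-negM {n} {M})

det-scale : ∀ k M → det (scale k M) ≡ k * k * det M
det-scale k (a , b , c , d) = l k a b c d
  where
  l : ∀ k a b c d → k * a * (k * d) - k * b * (k * c) ≡ k * k * (a * d - b * c)
  l = ℤ-ring

module _ (n : ℕ) .{{n≢0 : NonZero n}} where

  private instance
    +n≢0 : ℤ.NonZero (+ n)
    +n≢0 = ℤ.≢-nonZero (λ e → ℕ.≢-nonZero⁻¹ n {{n≢0}} (ℤ.+-injective e))
    n²≢0 : ℤ.NonZero (+ n * + n)
    n²≢0 = ℤ.i*j≢0 (+ n) (+ n)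

  -- Determinants give n² = n² det G, so the integral quotient of two matrices of determinant n lies
  -- in Γ.
  quotient-Γ : ∀ M N {G} → det M ≡ + n → det N ≡ + n → M ⊗ inv N ≡ scale (+ n) G → InΓ G × M ≡ G ⊗ N
  quotient-Γ M N {G} dM dN e = det-G , scale-injective (+ n) {M} {G ⊗ N} nM
    where
    det-nG : det (scale (+ n) G) ≡ + n * + n
    det-nG = trans (cong det (sym e)) (trans (det-⊗ M (inv N)) (cong₂ _*_ dM (trans (det-inv N) dN)))
    det-G : InΓ G
    det-G = ℤ.*-cancelˡ-≡ (+ n * + n) (det G) (+ 1)
      (trans (sym (det-scale (+ n) G)) (trans det-nG (sym (ℤ.*-identityʳ (+ n * + n)))))
    nM : scale (+ n) M ≡ scale (+ n) (G ⊗ N)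
    nM = trans (cong (λ k → scale k M) (sym dN)) (trans (sym (⊗-inv-cancelʳ M N))
      (trans (cong (_⊗ N) e) (scale-⊗ˡ (+ n) G N)))

  ∣M⇒LeftEquiv : ∀ M N → det M ≡ + n → det N ≡ + n → n ∣M (M ⊗ inv N) → LeftEquiv M N
  ∣M⇒LeftEquiv M N dM dN (G , e) = G , proj₁ q , inj₁ (proj₂ q)
    where
    q : InΓ G × M ≡ G ⊗ N
    q = quotient-Γ M N dM dN e

  LeftEquiv⇒∣M : ∀ M N → det N ≡ + n → LeftEquiv M N → n ∣M (M ⊗ inv N)
  LeftEquiv⇒∣M M N dN (γ , _ , r) = go r
    where
    base : (γ ⊗ N) ⊗ inv N ≡ scale (+ n) γ
    base = trans (⊗-cancel-invʳ γ N) (cong (λ k → scale k γ) dN)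
    go : M ∼ (γ ⊗ N) → n ∣M (M ⊗ inv N)
    go (inj₁ e) = γ , trans (cong (_⊗ inv N) e) base
    go (inj₂ e) = negM γ , trans (cong (_⊗ inv N) e) (trans (negM-⊗ˡ (γ ⊗ N) (inv N))
      (trans (cong negM base) (sym (scale-negM (+ n) γ))))

  LeftEquiv-sym : ∀ M N → LeftEquiv M N → LeftEquiv N M
  LeftEquiv-sym M N (γ , g , r) = inv γ , Γ-inv γ g ,
    ∼-sym {inv γ ⊗ M} {N} (subst ((inv γ ⊗ M) ∼_) (Γ-inv-cancelˡ γ g N) (∼-⊗ˡ (inv γ) {M} {γ ⊗ N} r))

  LeftEquiv-trans : ∀ L M N → LeftEquiv L M → LeftEquiv M N → LeftEquiv L N
  LeftEquiv-trans L M N (γ , g , r) (δ , d , s) = γ ⊗ δ , Γ-⊗ γ δ g d ,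
    ∼-trans {L} {γ ⊗ M} {(γ ⊗ δ) ⊗ N} r
      (subst ((γ ⊗ M) ∼_) (sym (⊗-assoc γ δ N)) (∼-⊗ˡ γ {M} {δ ⊗ N} s))

  ∑-left-representatives : ∀ {L} → IsRepsInfty n L → ∀ Q → det Q ≡ + n → ∑ L (λ N → ind (n ∣M? (Q ⊗ inv N))) ≡ 1ℚ
  ∑-left-representatives {L} (shape , apart , cover) Q dQ = ∑-indicator (λ N → n ∣M? (Q ⊗ inv N)) L
    (some L shape (cover Q dQ)) (few L shape apart)
    where
    Shape : List Mat → Set
    Shape = All (λ M → det M ≡ + n × lowerLeft M ≡ + 0)
    some : ∀ L → Shape L → Any (λ N → LeftEquiv Q N) L → Any (λ N → n ∣M (Q ⊗ inv N)) L
    some (N ∷ L) ((d , _) ∷ _) (here p) = here (LeftEquiv⇒∣M Q N d p)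
    some (N ∷ L) (_ ∷ s) (there a) = there (some L s a)
    clash : ∀ N N' → det N ≡ + n → ¬ LeftEquiv N N' × (det N' ≡ + n × lowerLeft N' ≡ + 0) →
            ¬ (n ∣M (Q ⊗ inv N) × n ∣M (Q ⊗ inv N'))
    clash N N' d (¬e , (d' , _)) (p , q) = ¬e (LeftEquiv-trans N Q N'
      (LeftEquiv-sym Q N (∣M⇒LeftEquiv Q N dQ d p)) (∣M⇒LeftEquiv Q N' dQ d' q))
    few : ∀ L → Shape L → AllPairs (λ M N → ¬ LeftEquiv M N) L →
          AllPairs (λ M N → ¬ (n ∣M (Q ⊗ inv M) × n ∣M (Q ⊗ inv N))) L
    few [] _ _ = []
    few (N ∷ L) ((d , _) ∷ s) (h ∷ hs) = All.zipWith (λ {N'} → clash N N' d) (h , s) ∷ few L s hs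

-- Products with the generators

Umat-⊗ : ∀ a b c d → Umat ⊗ (a , b , c , d) ≡ (a - c , b - d , a , b)
Umat-⊗ a b c d = mat≡ (l₁ a c) (l₁ b d) (l₂ a c) (l₂ b d)
  where
  l₁ : ∀ a c → + 1 * a + -[1+ 0 ] * c ≡ a - c
  l₁ = ℤ-ring
  l₂ : ∀ a c → + 1 * a + + 0 * c ≡ a
  l₂ = ℤ-ring

Smat-⊗ : ∀ a b c d → Smat ⊗ (a , b , c , d) ≡ (ℤ.- c , ℤ.- d , a , b)
Smat-⊗ a b c d = mat≡ (l₁ a c) (l₁ b d) (l₂ a c) (l₂ b d)
  where
  l₁ : ∀ a c → + 0 * a + -[1+ 0 ] * c ≡ ℤ.- c
  l₁ = ℤ-ring
  l₂ : ∀ a c → + 1 * a + + 0 * c ≡ a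
  l₂ = ℤ-ring

⊗-Smat : ∀ a b c d → (a , b , c , d) ⊗ Smat ≡ (b , ℤ.- a , d , ℤ.- c)
⊗-Smat a b c d = mat≡ (l₁ a b) (l₂ a b) (l₁ c d) (l₂ c d)
  where
  l₁ : ∀ a b → a * + 0 + b * + 1 ≡ b
  l₁ = ℤ-ring
  l₂ : ∀ a b → a * -[1+ 0 ] + b * + 0 ≡ ℤ.- a
  l₂ = ℤ-ring

⊗-Umat : ∀ a b c d → (a , b , c , d) ⊗ Umat ≡ (a + b , ℤ.- a , c + d , ℤ.- c)
⊗-Umat a b c d = mat≡ (l₁ a b) (l₂ a b) (l₁ c d) (l₂ c d)
  where
  l₁ : ∀ a b → a * + 1 + b * + 1 ≡ a + b
  l₁ = ℤ-ring
  l₂ : ∀ a b → a * -[1+ 0 ] + b * + 0 ≡ ℤ.- a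
  l₂ = ℤ-ring

U²mat-⊗ : ∀ a b c d → U²mat ⊗ (a , b , c , d) ≡ (ℤ.- c , ℤ.- d , a - c , b - d)
U²mat-⊗ a b c d = mat≡ (l₁ a c) (l₁ b d) (l₂ a c) (l₂ b d)
  where
  l₁ : ∀ a c → + 0 * a + -[1+ 0 ] * c ≡ ℤ.- c
  l₁ = ℤ-ring
  l₂ : ∀ a c → + 1 * a + -[1+ 0 ] * c ≡ a - c
  l₂ = ℤ-ring

⊗-U²mat : ∀ a b c d → (a , b , c , d) ⊗ U²mat ≡ (b , ℤ.- a - b , d , ℤ.- c - d)
⊗-U²mat a b c d = mat≡ (l₁ a b) (l₂ a b) (l₁ c d) (l₂ c d)
  where
  l₁ : ∀ a b → a * + 0 + b * + 1 ≡ b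
  l₁ = ℤ-ring
  l₂ : ∀ a b → a * -[1+ 0 ] + b * -[1+ 0 ] ≡ ℤ.- a - b
  l₂ = ℤ-ring

Tz : ℤ → Mat
Tz k = + 1 , k , + 0 , + 1

Tz-⊗ : ∀ k a b c d → Tz k ⊗ (a , b , c , d) ≡ (a + k * c , b + k * d , c , d)
Tz-⊗ k a b c d = mat≡ (l₁ k a c) (l₁ k b d) (l₂ a c) (l₂ b d)
  where
  l₁ : ∀ k a c → + 1 * a + k * c ≡ a + k * c
  l₁ = ℤ-ring
  l₂ : ∀ a c → + 0 * a + + 1 * c ≡ c
  l₂ = ℤ-ring

⊗-Tz : ∀ k a b c d → (a , b , c , d) ⊗ Tz k ≡ (a , b + k * a , c , d + k * c)
⊗-Tz k a b c d = mat≡ (l₁ a b) (l₂ k a b) (l₁ c d) (l₂ k c d)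
  where
  l₁ : ∀ a c → a * + 1 + c * + 0 ≡ a
  l₁ = ℤ-ring
  l₂ : ∀ k a b → a * k + b * + 1 ≡ b + k * a
  l₂ = ℤ-ring

Tz-+ : ∀ j k → Tz j ⊗ Tz k ≡ Tz (j + k)
Tz-+ j k = trans (Tz-⊗ j (+ 1) k (+ 0) (+ 1)) (mat≡ (l₁ j) (l₂ j k) refl refl)
  where
  l₁ : ∀ j → + 1 + j * + 0 ≡ + 1
  l₁ = ℤ-ring
  l₂ : ∀ j k → k + j * + 1 ≡ j + k
  l₂ = ℤ-ring

Tz-Γ : ∀ k → InΓ (Tz k)
Tz-Γ k = l k
  where
  l : ∀ k → + 1 * + 1 - k * + 0 ≡ + 1
  l = ℤ-ring

SS⊗ : ∀ N → Smat ⊗ (Smat ⊗ N) ≡ negM N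
SS⊗ (a , b , c , d) = trans (cong (Smat ⊗_) (Smat-⊗ a b c d)) (Smat-⊗ (ℤ.- c) (ℤ.- d) a b)

UU²⊗ : ∀ N → Umat ⊗ (U²mat ⊗ N) ≡ negM N
UU²⊗ (a , b , c , d) = trans (cong (Umat ⊗_) (U²mat-⊗ a b c d))
  (trans (Umat-⊗ (ℤ.- c) (ℤ.- d) (a - c) (b - d)) (mat≡ (l a c) (l b d) refl refl))
  where
  l : ∀ a c → ℤ.- c - (a - c) ≡ ℤ.- a
  l = ℤ-ring

T⊗S⊗ : ∀ N → Tmat ⊗ (Smat ⊗ N) ≡ Umat ⊗ N
T⊗S⊗ N = sym (⊗-assoc Tmat Smat N)

U⊗S⊗ : ∀ N → Umat ⊗ (Smat ⊗ N) ≡ negM (Tmat ⊗ N)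
U⊗S⊗ N = trans (sym (T⊗S⊗ (Smat ⊗ N))) (trans (cong (Tmat ⊗_) (SS⊗ N)) (negM-⊗ʳ Tmat N))

-- Cusps and the arc (∞,0]

-- arc x y is the indicator of the cusps x/y in the half-open arc (∞,0] of P¹(ℚ).

arc : ℤ → ℤ → ℚ
arc _ +0 = 0ℚ
arc +0 +[1+ _ ] = 1ℚ
arc +0 -[1+ _ ] = 1ℚ
arc +[1+ _ ] +[1+ _ ] = 0ℚ
arc +[1+ _ ] -[1+ _ ] = 1ℚ
arc -[1+ _ ] +[1+ _ ] = 1ℚ
arc -[1+ _ ] -[1+ _ ] = 0ℚ

arc-neg : ∀ x y → arc (ℤ.- x) (ℤ.- y) ≡ arc x y
arc-neg x +0 = refl
arc-neg +0 +[1+ _ ] = refl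
arc-neg +0 -[1+ _ ] = refl
arc-neg +[1+ _ ] +[1+ _ ] = refl
arc-neg +[1+ _ ] -[1+ _ ] = refl
arc-neg -[1+ _ ] +[1+ _ ] = refl
arc-neg -[1+ _ ] -[1+ _ ] = refl

NonzeroPair : ℤ → ℤ → Set
NonzeroPair x y = ¬ (x ≡ + 0 × y ≡ + 0)

-- S exchanges (∞,0] with its complement (0,∞]; since the arc contains 0 and not ∞, this is exact at
-- the two end points as well.
arc-S : ∀ x y → NonzeroPair x y → arc x y ℚ.+ arc (ℤ.- y) x ≡ 1ℚ
arc-S +0 +0 nz = ⊥-elim (nz (refl , refl))
arc-S +0 +[1+ _ ] nz = refl
arc-S +0 -[1+ _ ] nz = refl
arc-S +[1+ _ ] +0 nz = refl
arc-S +[1+ _ ] +[1+ _ ] nz = refl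
arc-S +[1+ _ ] -[1+ _ ] nz = refl
arc-S -[1+ _ ] +0 nz = refl
arc-S -[1+ _ ] +[1+ _ ] nz = refl
arc-S -[1+ _ ] -[1+ _ ] nz = refl

-- U sends x/y to (x - y)/x, and z stands for x - y. The signs of z and y settle everything unless
-- they are opposite; then the sign of x = z + y is inspected too.
arc-U′ : ∀ x y z → x ≡ z + y → NonzeroPair z y → arc x y ℚ.+ arc z x ℚ.+ arc (ℤ.- y) z ≡ 1ℚ
arc-U′ x +0 +0 e nz = ⊥-elim (nz (refl , refl))
arc-U′ x +[1+ _ ] +0 refl nz = refl
arc-U′ x -[1+ _ ] +0 refl nz = refl
arc-U′ x +0 +[1+ _ ] refl nz = refl
arc-U′ x +0 -[1+ _ ] refl nz = refl
arc-U′ x +[1+ _ ] +[1+ _ ] refl nz = refl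
arc-U′ x -[1+ _ ] -[1+ _ ] refl nz = refl
arc-U′ +0 +[1+ _ ] -[1+ _ ] e nz = refl
arc-U′ +[1+ _ ] +[1+ _ ] -[1+ _ ] e nz = refl
arc-U′ -[1+ _ ] +[1+ _ ] -[1+ _ ] e nz = refl
arc-U′ +0 -[1+ _ ] +[1+ _ ] e nz = refl
arc-U′ +[1+ _ ] -[1+ _ ] +[1+ _ ] e nz = refl
arc-U′ -[1+ _ ] -[1+ _ ] +[1+ _ ] e nz = refl

arc-U : ∀ x y → NonzeroPair x y → arc x y ℚ.+ arc (x - y) x ℚ.+ arc (ℤ.- y) (x - y) ≡ 1ℚ
arc-U x y nz = arc-U′ x y (x - y) (l x y) λ (p , q) → nz (trans (l x y) (cong₂ _+_ p q) , q)
  where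
  l : ∀ x y → x ≡ x - y + y
  l = ℤ-ring

data SameSign : ℤ → ℤ → Set where
  both+ : ∀ {m k} → SameSign +[1+ m ] +[1+ k ]
  both- : ∀ {m k} → SameSign -[1+ m ] -[1+ k ]

sameSign : ∀ x y → 0ℤ < x * y → SameSign x y
sameSign +[1+ _ ] +[1+ _ ] p = both+
sameSign -[1+ _ ] -[1+ _ ] p = both-
sameSign +0 y (ℤ.+<+ ())
sameSign +[1+ m ] +0 p = ⊥-elim (ℤ.<-irrefl (sym (ℤ.*-zeroʳ +[1+ m ])) p)
sameSign -[1+ m ] +0 p = ⊥-elim (ℤ.<-irrefl (sym (ℤ.*-zeroʳ -[1+ m ])) p)
sameSign +[1+ _ ] -[1+ _ ] ()
sameSign -[1+ _ ] +[1+ _ ] ()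

arc-opposite⁺ : ∀ a b x → arc x +[1+ a ] ℚ.+ arc -[1+ b ] x ≡ 1ℚ
arc-opposite⁺ a b +0 = refl
arc-opposite⁺ a b +[1+ _ ] = refl
arc-opposite⁺ a b -[1+ _ ] = refl

arc-opposite⁻ : ∀ a b x → arc x -[1+ a ] ℚ.+ arc +[1+ b ] x ≡ 1ℚ
arc-opposite⁻ a b +0 = refl
arc-opposite⁻ a b +[1+ _ ] = refl
arc-opposite⁻ a b -[1+ _ ] = refl

-- Turning counterclockwise from (v₁,v₂) to (z₁,z₂), arc jumps when one of the axes is crossed.
arc-turn : ∀ v₁ v₂ z₁ z₂ → 0ℤ < v₁ * z₂ - v₂ * z₁ → arc v₁ v₂ ℚ.- arc z₁ z₂ ≡ arc z₂ v₂ ℚ.- arc z₁ v₁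
arc-turn v₁ v₂ z₁ z₂ p = cases v₂ z₁ refl refl
  where
  lem : ∀ x y → x - y - 0ℤ - + 1 + y ≡ x - 0ℤ - + 1
  lem = ℤ-ring
  aligned : 0ℤ ≤ v₂ * z₁ → SameSign v₁ z₂
  aligned q = sameSign v₁ z₂ (nn⇒< (nn-≡ (nn+ (<⇒nn p) q) (lem (v₁ * z₂) (v₂ * z₁))))
  solve : ∀ {a b c d} → a ℚ.+ b ≡ 1ℚ → c ℚ.+ d ≡ 1ℚ → a ℚ.- d ≡ c ℚ.- b
  solve {a} {b} {c} {d} e f = trans (l₁ a b d) (trans (cong (λ t → t ℚ.- b ℚ.- d) (trans e (sym f))) (l₂ b c d))
    where
    l₁ : ∀ a b d → a ℚ.- d ≡ a ℚ.+ b ℚ.- b ℚ.- d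
    l₁ = ring-of ringℚ
    l₂ : ∀ b c d → c ℚ.+ d ℚ.- b ℚ.- d ≡ c ℚ.- b
    l₂ = ring-of ringℚ
  zero-case : ∀ {v₁ z₂} z₁ → SameSign v₁ z₂ → arc v₁ +0 ℚ.- arc z₁ z₂ ≡ arc z₂ +0 ℚ.- arc z₁ v₁
  zero-case +0 both+ = refl
  zero-case +0 both- = refl
  zero-case +[1+ _ ] both+ = refl
  zero-case +[1+ _ ] both- = refl
  zero-case -[1+ _ ] both+ = refl
  zero-case -[1+ _ ] both- = refl
  zero-case′ : ∀ {v₁ z₂} v₂ → SameSign v₁ z₂ → arc v₁ v₂ ℚ.- arc +0 z₂ ≡ arc z₂ v₂ ℚ.- arc +0 v₁
  zero-case′ +0 both+ = refl
  zero-case′ +0 both- = refl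
  zero-case′ +[1+ _ ] both+ = refl
  zero-case′ +[1+ _ ] both- = refl
  zero-case′ -[1+ _ ] both+ = refl
  zero-case′ -[1+ _ ] both- = refl
  equal : ∀ {v₁ z₂ v₂ z₁} → SameSign v₂ z₁ → SameSign v₁ z₂ → arc v₁ v₂ ℚ.- arc z₁ z₂ ≡ arc z₂ v₂ ℚ.- arc z₁ v₁
  equal both+ both+ = refl
  equal both+ both- = refl
  equal both- both+ = refl
  equal both- both- = refl
  cases : ∀ x y → v₂ ≡ x → z₁ ≡ y → arc v₁ v₂ ℚ.- arc z₁ z₂ ≡ arc z₂ v₂ ℚ.- arc z₁ v₁
  cases +0 _ refl refl = zero-case z₁ (aligned (ℤ.≤-refl))
  cases +[1+ _ ] +0 refl refl = zero-case′ v₂ (aligned (ℤ.≤-reflexive (sym (ℤ.*-zeroʳ v₂))))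
  cases -[1+ _ ] +0 refl refl = zero-case′ v₂ (aligned (ℤ.≤-reflexive (sym (ℤ.*-zeroʳ v₂))))
  cases +[1+ _ ] +[1+ _ ] refl refl = equal both+ (aligned (ℤ.+≤+ ℕ.z≤n))
  cases -[1+ _ ] -[1+ _ ] refl refl = equal both- (aligned (ℤ.+≤+ ℕ.z≤n))
  cases +[1+ a ] -[1+ b ] refl refl = solve {arc v₁ v₂} {arc z₁ v₁} {arc z₂ v₂} {arc z₁ z₂}
    (arc-opposite⁺ a b v₁) (arc-opposite⁺ a b z₂)
  cases -[1+ a ] +[1+ b ] refl refl = solve {arc v₁ v₂} {arc z₁ v₁} {arc z₂ v₂} {arc z₁ z₂}
    (arc-opposite⁻ a b v₁) (arc-opposite⁻ a b z₂)

-- Consequences of condition (B) for an arbitrary even function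

module _ (n : ℕ) (ξ : Formal) where

  -- φ - φ∘U adds up to zero over the orbits of U because U³ = -1 and φ is even. Thus every even φ
  -- yields a relation.
  pair-B₁-difference : CondB n ξ → ∀ {φ} → Even φ →
    ⟪ ξ ∣ (λ N → φ N ℚ.- φ (Umat ⊗ N) ℚ.+ (φ (N ⊗ Smat) ℚ.- φ (Umat ⊗ (N ⊗ Smat)))) ⟫ ≡ 0ℚ
  pair-B₁-difference B {φ} eφ = pair-B₁ n ξ B eθ zero-sum
    where
    θ : Mat → ℚ
    θ N = φ N ℚ.- φ (Umat ⊗ N)
    eθ : Even θ
    eθ M = cong₂ ℚ._-_ (eφ M) (trans (cong φ (negM-⊗ʳ Umat M)) (eφ (Umat ⊗ M)))
    cyc : ∀ x y z → x ℚ.- y ℚ.+ (y ℚ.- z) ℚ.+ (z ℚ.- x) ≡ 0ℚ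
    cyc = ring-of ringℚ
    zero-sum : ∀ N → det N ≡ + n → θ N ℚ.+ θ (Umat ⊗ N) ℚ.+ θ (U²mat ⊗ N) ≡ 0ℚ
    zero-sum N _ = trans (cong₂ (λ s t → φ N ℚ.- φ (Umat ⊗ N) ℚ.+ (φ (Umat ⊗ N) ℚ.- s) ℚ.+ (φ (U²mat ⊗ N) ℚ.- t))
      (cong φ (sym (⊗-assoc Umat Umat N))) (trans (cong φ (UU²⊗ N)) (eφ N)))
      (cyc (φ N) (φ (Umat ⊗ N)) (φ (U²mat ⊗ N)))

  -- φ∘S - φ changes sign under S, because S² = -1 and φ is even.
  pair-B₂-difference : CondB n ξ → ∀ {φ} → Even φ →
    ⟪ ξ ∣ (λ N → (φ (Smat ⊗ N) ℚ.- φ N) ℚ.+ (φ (Smat ⊗ (N ⊗ Umat)) ℚ.- φ (N ⊗ Umat))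
                 ℚ.+ (φ (Smat ⊗ (N ⊗ U²mat)) ℚ.- φ (N ⊗ U²mat))) ⟫ ≡ 0ℚ
  pair-B₂-difference B {φ} eφ = pair-B₂ n ξ B eθ zero-sum
    where
    θ : Mat → ℚ
    θ N = φ (Smat ⊗ N) ℚ.- φ N
    eθ : Even θ
    eθ M = cong₂ ℚ._-_ (trans (cong φ (negM-⊗ʳ Smat M)) (eφ (Smat ⊗ M))) (eφ M)
    cyc : ∀ x y → x ℚ.- y ℚ.+ (y ℚ.- x) ≡ 0ℚ
    cyc = ring-of ringℚ
    zero-sum : ∀ N → det N ≡ + n → θ N ℚ.+ θ (Smat ⊗ N) ≡ 0ℚ
    zero-sum N _ = trans (cong (λ s → φ (Smat ⊗ N) ℚ.- φ N ℚ.+ (s ℚ.- φ (Smat ⊗ N))) (trans (cong φ (SS⊗ N)) (eφ N)))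
      (cyc (φ (Smat ⊗ N)) (φ N))

-- The total mass of ξ against a function invariant under Γ on both sides

column-nonzero : ∀ {n} .{{_ : NonZero n}} a b c d → det (a , b , c , d) ≡ + n → NonzeroPair a c
column-nonzero {n} {{n≢0}} a b c d e (refl , refl) = ℕ.≢-nonZero⁻¹ n {{n≢0}} (sym (ℤ.+-injective (trans (sym (l b d)) e)))
  where
  l : ∀ b d → + 0 * d - b * + 0 ≡ + 0
  l = ℤ-ring

module _ (n : ℕ) .{{n≢0 : NonZero n}} (Tinf : List Mat) (reps : IsRepsInfty n Tinf)
         (ξ : Formal) (ξR : InR n ξ) (A : CondA n Tinf ξ) (B : CondB n ξ) where

  -- S and U generate Γ, so this is invariance under Γ on both sides, stated for the generators that
  -- occur in (B).
  record Biinvariant (θ : Mat → ℚ) : Set where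
    field
      even : Even θ
      S-left : ∀ N → θ (Smat ⊗ N) ≡ θ N
      U-left : ∀ N → θ (Umat ⊗ N) ≡ θ N
      S-right : ∀ N → θ (N ⊗ Smat) ≡ θ N
      U-right : ∀ N → θ (N ⊗ Umat) ≡ θ N

  module _ (θ : Mat → ℚ) (inv-θ : Biinvariant θ) where
    open Biinvariant inv-θ

    private
      U²-left : ∀ N → θ (U²mat ⊗ N) ≡ θ N
      U²-left N = trans (cong θ (⊗-assoc Umat Umat N)) (trans (U-left (Umat ⊗ N)) (U-left N))

      U²-right : ∀ N → θ (N ⊗ U²mat) ≡ θ N
      U²-right N = trans (cong θ (sym (⊗-assoc N Umat Umat))) (trans (U-right (N ⊗ Umat)) (U-right N))

      a : Mat → ℚ
      a (x , _ , y , _) = arc x y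

      -- The bottom-row part of what `arc-turn` gives for the steps from N∞ to N1 and from N1 to N0.
      -- Left multiplication by T does not touch the bottom row, so θη may be used in (A).
      η : Mat → ℚ
      η (_ , _ , z , w) = arc (z + w) z ℚ.- arc w (z + w)

      three : ℚ
      three = 1ℚ ℚ.+ 1ℚ ℚ.+ 1ℚ

      -- `a` has total 1 over the orbit of a cusp under U and under S, so 3a - 1 and 1 - 2a have
      -- total 0. With these multiples the terms of `turn` combine to 1 + a(N∞) + a(N0) - 2a(N1),
      -- which is 1 plus a second difference.
      F G H : Mat → ℚ
      F N = θ N ℚ.* (three ℚ.* a N ℚ.- 1ℚ)
      G N = θ N ℚ.* (1ℚ ℚ.- (1ℚ ℚ.+ 1ℚ) ℚ.* a N)
      H N = θ N ℚ.* η N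

      a-even : Even a
      a-even (x , _ , y , _) = arc-neg x y

      η-even : Even η
      η-even (_ , _ , z , w) = cong₂ ℚ._-_
        (trans (cong (λ t → arc t (ℤ.- z)) (sym (ℤ.neg-distrib-+ z w))) (arc-neg (z + w) z))
        (trans (cong (arc (ℤ.- w)) (sym (ℤ.neg-distrib-+ z w))) (arc-neg w (z + w)))

      F-sum : ∀ N → det N ≡ + n → F N ℚ.+ F (Umat ⊗ N) ℚ.+ F (U²mat ⊗ N) ≡ 0ℚ
      F-sum N@(x , y , z , w) e = trans (cong₂ (λ s t → F N ℚ.+ s ℚ.+ t)
          (cong₂ (λ s t → s ℚ.* (three ℚ.* t ℚ.- 1ℚ)) (U-left N) (cong a (Umat-⊗ x y z w)))
          (cong₂ (λ s t → s ℚ.* (three ℚ.* t ℚ.- 1ℚ)) (U²-left N) (cong a (U²mat-⊗ x y z w))))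
        (trans (l (θ N) (arc x z) (arc (x - z) x) (arc (ℤ.- z) (x - z)))
        (trans (cong (λ t → θ N ℚ.* three ℚ.* (t ℚ.- 1ℚ)) (arc-U x z (column-nonzero x y z w e))) (ℚ.*-zeroʳ (θ N ℚ.* three))))
        where
        l : ∀ θ p q r → θ ℚ.* (three ℚ.* p ℚ.- 1ℚ) ℚ.+ θ ℚ.* (three ℚ.* q ℚ.- 1ℚ) ℚ.+ θ ℚ.* (three ℚ.* r ℚ.- 1ℚ)
          ≡ θ ℚ.* three ℚ.* (p ℚ.+ q ℚ.+ r ℚ.- 1ℚ)
        l = ring-of ringℚ

      G-sum : ∀ N → det N ≡ + n → G N ℚ.+ G (Smat ⊗ N) ≡ 0ℚ
      G-sum N@(x , y , z , w) e = trans (cong (λ s → G N ℚ.+ s)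
          (cong₂ (λ s t → s ℚ.* (1ℚ ℚ.- (1ℚ ℚ.+ 1ℚ) ℚ.* t)) (S-left N) (cong a (Smat-⊗ x y z w))))
        (trans (l (θ N) (arc x z) (arc (ℤ.- z) x))
        (trans (cong (λ t → θ N ℚ.* (1ℚ ℚ.+ 1ℚ) ℚ.* (1ℚ ℚ.- t)) (arc-S x z (column-nonzero x y z w e))) (ℚ.*-zeroʳ (θ N ℚ.* (1ℚ ℚ.+ 1ℚ)))))
        where
        l : ∀ θ p q → θ ℚ.* (1ℚ ℚ.- (1ℚ ℚ.+ 1ℚ) ℚ.* p) ℚ.+ θ ℚ.* (1ℚ ℚ.- (1ℚ ℚ.+ 1ℚ) ℚ.* q)
          ≡ θ ℚ.* (1ℚ ℚ.+ 1ℚ) ℚ.* (1ℚ ℚ.- (p ℚ.+ q))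
        l = ring-of ringℚ

      H-T : ∀ N → det N ≡ + n → H (Tmat ⊗ N) ≡ H N
      H-T N@(x , y , z , w) _ = cong₂ ℚ._*_
        (trans (sym (trans (cong θ (U⊗S⊗ N)) (even (Tmat ⊗ N)))) (trans (U-left (Smat ⊗ N)) (S-left N)))
        (cong η (Tz-⊗ (+ 1) x y z w))

      -- N∞, N1, N0 follow each other counterclockwise, with determinant det N > 0 at each step, so
      -- `arc-turn` applies twice and separates the bottom row from the top row. Left multiplication
      -- by S moves the top row to the bottom.
      turn : ∀ N → det N ≡ + n →
        (F N ℚ.+ F (N ⊗ Smat)) ℚ.+ (G N ℚ.+ G (N ⊗ Umat) ℚ.+ G (N ⊗ U²mat)) ≡ θ N ℚ.+ (H N ℚ.- H (Smat ⊗ N))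
      turn N@(x , y , z , w) e = trans (cong₂ ℚ._+_
          (cong (λ s → F N ℚ.+ s) (cong₂ (λ s t → s ℚ.* (three ℚ.* t ℚ.- 1ℚ)) (S-right N) (cong a (⊗-Smat x y z w))))
          (cong₂ (λ s t → G N ℚ.+ s ℚ.+ t)
            (cong₂ (λ s t → s ℚ.* (1ℚ ℚ.- (1ℚ ℚ.+ 1ℚ) ℚ.* t)) (U-right N) (cong a (⊗-Umat x y z w)))
            (cong₂ (λ s t → s ℚ.* (1ℚ ℚ.- (1ℚ ℚ.+ 1ℚ) ℚ.* t)) (U²-right N) (cong a (⊗-U²mat x y z w)))))
        (trans (l₁ (θ N) (arc x z) (arc y w) (arc (x + y) (z + w)))
        (trans (cong₂ (λ s t → θ N ℚ.+ θ N ℚ.* (s ℚ.- t)) (arc-turn x z (x + y) (z + w) d₁) (arc-turn (x + y) (z + w) y w d₂))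
        (trans (l₂ (θ N) (arc (z + w) z) (arc (x + y) x) (arc w (z + w)) (arc y (x + y)))
        (cong (λ s → θ N ℚ.+ (H N ℚ.- s)) (sym (cong₂ ℚ._*_ (S-left N) (cong η (Smat-⊗ x y z w))))))))
        where
        l₁ : ∀ θ p q r → (θ ℚ.* (three ℚ.* p ℚ.- 1ℚ) ℚ.+ θ ℚ.* (three ℚ.* q ℚ.- 1ℚ))
          ℚ.+ (θ ℚ.* (1ℚ ℚ.- (1ℚ ℚ.+ 1ℚ) ℚ.* p) ℚ.+ θ ℚ.* (1ℚ ℚ.- (1ℚ ℚ.+ 1ℚ) ℚ.* r) ℚ.+ θ ℚ.* (1ℚ ℚ.- (1ℚ ℚ.+ 1ℚ) ℚ.* q))
          ≡ θ ℚ.+ θ ℚ.* ((p ℚ.- r) ℚ.- (r ℚ.- q))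
        l₁ = ring-of ringℚ
        l₂ : ∀ θ p q r s → θ ℚ.+ θ ℚ.* ((p ℚ.- q) ℚ.- (r ℚ.- s)) ≡ θ ℚ.+ (θ ℚ.* (p ℚ.- r) ℚ.- θ ℚ.* (q ℚ.- s))
        l₂ = ring-of ringℚ
        pos : 0ℤ < det N
        pos = subst (0ℤ <_) (sym e) (ℤ.+<+ (ℕ.>-nonZero⁻¹ n {{n≢0}}))
        d₁ : 0ℤ < x * (z + w) - z * (x + y)
        d₁ = subst (0ℤ <_) (l x y z w) pos
          where
          l : ∀ x y z w → x * w - y * z ≡ x * (z + w) - z * (x + y)
          l = ℤ-ring
        d₂ : 0ℤ < (x + y) * w - (z + w) * y
        d₂ = subst (0ℤ <_) (l x y z w) pos
          where
          l : ∀ x y z w → x * w - y * z ≡ (x + y) * w - (z + w) * y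
          l = ℤ-ring

      product-even : ∀ {f} → Even f → Even (λ N → θ N ℚ.* f N)
      product-even ef M = cong₂ ℚ._*_ (even M) (ef M)

      -- The bottom row is (0,w) with w ≠ 0. Then `η` is 0 at N, and it is -1 at NS, whose bottom
      -- row is (w,0).
      at-infinity : ∀ N → det N ≡ + n × lowerLeft N ≡ + 0 → H N ℚ.- H (N ⊗ Smat) ≡ θ N
      at-infinity N@(x , y , .(+ 0) , w) (e , refl) = trans
        (cong (λ t → H N ℚ.- t) (cong₂ ℚ._*_ (S-right N) (cong η (⊗-Smat x y (+ 0) w))))
        (trans (cong (λ t → θ N ℚ.* η N ℚ.- θ N ℚ.* t) (cong (λ t → arc t w ℚ.- arc +0 t) (ℤ.+-identityʳ w)))
        (trans (cong (λ t → θ N ℚ.* (0ℚ ℚ.- arc w t) ℚ.- θ N ℚ.* (arc w w ℚ.- arc +0 w)) (ℤ.+-identityˡ w))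
        (trans (cong₂ (λ s t → θ N ℚ.* (0ℚ ℚ.- s) ℚ.- θ N ℚ.* (s ℚ.- t)) (self w) (axis w w≢0)) (l (θ N)))))
        where
        self : ∀ w → arc w w ≡ 0ℚ
        self +0 = refl
        self +[1+ _ ] = refl
        self -[1+ _ ] = refl
        axis : ∀ w → ¬ w ≡ + 0 → arc +0 w ≡ 1ℚ
        axis +0 nz = ⊥-elim (nz refl)
        axis +[1+ _ ] _ = refl
        axis -[1+ _ ] _ = refl
        w≢0 : ¬ w ≡ + 0
        w≢0 refl = ℕ.≢-nonZero⁻¹ n {{n≢0}} (sym (ℤ.+-injective (trans (sym (l x y)) e)))
          where
          l : ∀ x y → x * + 0 - y * + 0 ≡ + 0
          l = ℤ-ring
        l : ∀ θ → θ ℚ.* (0ℚ ℚ.- 0ℚ) ℚ.- θ ℚ.* (0ℚ ℚ.- 1ℚ) ≡ θ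
        l = ring-of ringℚ

    mass-biinvariant : ⟪ ξ ∣ θ ⟫ ℚ.+ ∑ Tinf θ ≡ 0ℚ
    mass-biinvariant = trans (cong (λ t → ⟪ ξ ∣ θ ⟫ ℚ.+ t) (sym (trans (pair-A n ξ Tinf A {H} (product-even η-even) H-T)
        (∑-cong Tinf (All.map (λ {N} → at-infinity N) (proj₁ reps))))))
      (trans (sym (pair-+ ξ θ (λ N → H N ℚ.- H (Smat ⊗ N))))
      (trans (sym (pair-cong ξ (All.map (λ {p} → turn (proj₂ p)) ξR)))
      (trans (pair-+ ξ (λ N → F N ℚ.+ F (N ⊗ Smat)) (λ N → G N ℚ.+ G (N ⊗ Umat) ℚ.+ G (N ⊗ U²mat)))
      (cong₂ ℚ._+_ (pair-B₁ n ξ B {F} (product-even (λ M → cong (λ t → three ℚ.* t ℚ.- 1ℚ) (a-even M))) F-sum)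
                   (pair-B₂ n ξ B {G} (product-even (λ M → cong (λ t → 1ℚ ℚ.- (1ℚ ℚ.+ 1ℚ) ℚ.* t) (a-even M))) G-sum)))))

-- Rational cancellation

halve : ∀ x y → x ℚ.+ x ≡ y ℚ.+ y → x ≡ y
halve x y e = trans (sym (l x)) (trans (cong (ℚ.½ ℚ.*_) e) (l y))
  where
  l : ∀ x → ℚ.½ ℚ.* (x ℚ.+ x) ≡ x
  l = ring-of ringℚ

third : ℚ
third = + 1 ℚ./ 3

divide-by-3 : ∀ x y → x ℚ.+ x ℚ.+ x ≡ y ℚ.+ y ℚ.+ y → x ≡ y
divide-by-3 x y e = trans (sym (l x)) (trans (cong (third ℚ.*_) e) (l y))
  where
  l : ∀ x → third ℚ.* (x ℚ.+ x ℚ.+ x) ≡ x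
  l = ring-of ringℚ

square-positive : ∀ x → x ≡ 0ℚ ⊎ 0ℚ ℚ.< x ℚ.* x
square-positive x with ℚ.<-cmp x 0ℚ
... | tri≈ _ e _ = inj₁ e
... | tri< p _ _ = inj₂ (subst (ℚ._< x ℚ.* x) (ℚ.*-zeroʳ x) (ℚ.*-monoʳ-<-neg x {{ℚ.negative p}} p))
... | tri> _ _ p = inj₂ (subst (ℚ._< x ℚ.* x) (ℚ.*-zeroʳ x) (ℚ.*-monoʳ-<-pos x {{ℚ.positive p}} p))

square-nonneg : ∀ x → 0ℚ ℚ.≤ x ℚ.* x
square-nonneg x with square-positive x
... | inj₁ refl = ℚ.≤-refl
... | inj₂ p = ℚ.<⇒≤ p

∑-squares-nonneg : ∀ {A : Set} (L : List A) (f : A → ℚ) → 0ℚ ℚ.≤ ∑ L (λ x → f x ℚ.* f x)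
∑-squares-nonneg [] f = ℚ.≤-refl
∑-squares-nonneg (x ∷ L) f = ℚ.+-mono-≤ (square-nonneg (f x)) (∑-squares-nonneg L f)

∑-squares-zero : ∀ {A : Set} (L : List A) (f : A → ℚ) → ∑ L (λ x → f x ℚ.* f x) ≡ 0ℚ → All (λ x → f x ≡ 0ℚ) L
∑-squares-zero [] f e = []
∑-squares-zero (x ∷ L) f e with square-positive (f x)
... | inj₂ p = ⊥-elim (ℚ.<-irrefl (sym e) (ℚ.+-mono-<-≤ p (∑-squares-nonneg L f)))
... | inj₁ z = z ∷ ∑-squares-zero L f (trans (sym (trans (cong (λ t → t ℚ.* t ℚ.+ rest) z) (ℚ.+-identityˡ rest))) e)
  where rest = ∑ L (λ x → f x ℚ.* f x)

-- Two-sided reduction to an antidiagonal matrix, on which M ↦ inv M is the identity modulo ±1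

euclid : ∀ a b → ¬ a ≡ + 0 → Σ ℤ λ q → Σ ℕ λ r → b ≡ + r + q * a × r ℕ.< ℤ.∣ a ∣
euclid a b nz = b ℤ./ a , b ℤ.% a , ℤ.a≡a%n+[a/n]*n b a , ℤ.n%d<d b a
  where instance _ = ℤ.≢-nonZero nz

module _ (f : Mat → ℚ) (even : Even f)
  (S-left : ∀ N → f (Smat ⊗ N) ≡ f N) (T-left : ∀ N → f (Tmat ⊗ N) ≡ f N)
  (right : ∀ γ → InΓ γ → ∀ N → f (N ⊗ γ) ≡ f N) where

  private
    T^ : ∀ k N → f (Tz (+ k) ⊗ N) ≡ f N
    T^ zero N = cong f (⊗-identityˡ N)
    T^ (suc k) N = trans (cong f (trans (cong (_⊗ N) (sym (Tz-+ (+ 1) (+ k)))) (⊗-assoc Tmat (Tz (+ k)) N)))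
      (trans (T-left (Tz (+ k) ⊗ N)) (T^ k N))

    Tz-left : ∀ k N → f (Tz k ⊗ N) ≡ f N
    Tz-left (+ k) N = T^ k N
    Tz-left -[1+ k ] N = trans (sym (T^ (suc k) (Tz -[1+ k ] ⊗ N)))
      (cong f (trans (sym (⊗-assoc (Tz (+ suc k)) (Tz -[1+ k ]) N))
        (trans (cong (_⊗ N) (trans (Tz-+ (+ suc k) -[1+ k ]) (cong Tz (ℤ.+-inverseʳ (+ suc k))))) (⊗-identityˡ N))))

    -- The adjugate interchanges left and right multiplication by Γ. As f is invariant on both
    -- sides, this property depends only on the double coset of M.
    Good : Mat → Set
    Good M = f (inv M) ≡ f M

    good-S : ∀ M → Good (Smat ⊗ M) → Good M
    good-S M g = trans (sym (trans (cong f (inv-⊗ Smat M)) (right (inv Smat) refl (inv M)))) (trans g (S-left M))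

    good-Tz : ∀ k M → Good (Tz k ⊗ M) → Good M
    good-Tz k M g = trans (sym (trans (cong f (inv-⊗ (Tz k) M)) (right (inv (Tz k)) (trans (det-inv (Tz k)) (Tz-Γ k)) (inv M))))
      (trans g (Tz-left k M))

    good-S′ : ∀ M → Good (M ⊗ Smat) → Good M
    good-S′ M g = trans (sym (trans (cong f (trans (inv-⊗ M Smat) (negM-⊗ˡ Smat (inv M)))) (trans (even (Smat ⊗ inv M)) (S-left (inv M)))))
      (trans g (right Smat refl M))

    good-Tz′ : ∀ k M → Good (M ⊗ Tz k) → Good M
    good-Tz′ k M g = trans (sym (trans (cong f (inv-⊗ M (Tz k))) (Tz-left (ℤ.- k) (inv M))))
      (trans g (right (Tz k) (Tz-Γ k) M))

    good-row : ∀ q a b c d → Good (ℤ.- c + q * a , ℤ.- d + q * b , a , b) → Good (a , b , c , d)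
    good-row q a b c d g = good-S (a , b , c , d) (good-Tz q (Smat ⊗ (a , b , c , d))
      (subst Good (sym (trans (cong (Tz q ⊗_) (Smat-⊗ a b c d)) (Tz-⊗ q (ℤ.- c) (ℤ.- d) a b))) g))

    good-column : ∀ q a b c d → Good (a , b + q * a , c , d + q * c) → Good (a , b , c , d)
    good-column q a b c d g = good-Tz′ q (a , b , c , d) (subst Good (sym (⊗-Tz q a b c d)) g)

    antidiagonal : ∀ x y → Good (+ 0 , x , y , + 0)
    antidiagonal x y = even (+ 0 , x , y , + 0)

    -- The Euclidean algorithm on the corner entry a, by row operations against c and by column
    -- operations against b. A nonzero remainder becomes a smaller corner, and m bounds |a|.
    good : ∀ m a b c d → ¬ a ≡ + 0 → ℤ.∣ a ∣ ℕ.≤ m → Good (a , b , c , d)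
    good zero a b c d nz h = ⊥-elim (nz (ℤ.∣i∣≡0⇒i≡0 (ℕ.n≤0⇒n≡0 h)))
    good (suc m) a b c d nz h with euclid a c nz
    ... | q , suc r , e , r< = good-row q a b c d (good m (ℤ.- c + q * a) (ℤ.- d + q * b) a b
          (λ z → case (trans (sym neg) z)) (ℕ.≤-pred (ℕ.≤-trans (subst (λ t → ℤ.∣ t ∣ ℕ.< ℤ.∣ a ∣) (sym neg) r<) h)))
      where
      case : -[1+ r ] ≡ + 0 → ⊥
      case ()
      l : ∀ r q a → ℤ.- (r + q * a) + q * a ≡ ℤ.- r
      l = ℤ-ring
      neg : ℤ.- c + q * a ≡ -[1+ r ]
      neg = trans (cong (λ t → ℤ.- t + q * a) e) (l (+ suc r) q a)
    ... | q , zero , e , _ with euclid a b nz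
    ...   | q′ , suc r , e′ , r< = good-column (ℤ.- q′) a b c d (good-S′ (a , b + ℤ.- q′ * a , c , d + ℤ.- q′ * c)
          (subst Good (sym (⊗-Smat a (b + ℤ.- q′ * a) c (d + ℤ.- q′ * c)))
          (good m (b + ℤ.- q′ * a) (ℤ.- a) (d + ℤ.- q′ * c) (ℤ.- c)
            (λ z → case (trans (sym rem) z)) (ℕ.≤-pred (ℕ.≤-trans (subst (λ t → ℤ.∣ t ∣ ℕ.< ℤ.∣ a ∣) (sym rem) r<) h)))))
      where
      case : + suc r ≡ + 0 → ⊥
      case ()
      l : ∀ r q a → r + q * a + ℤ.- q * a ≡ r
      l = ℤ-ring
      rem : b + ℤ.- q′ * a ≡ + suc r
      rem = trans (cong (λ t → t + ℤ.- q′ * a) e′) (l (+ suc r) q′ a)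
    -- Here a divides both b and c. The row step puts 0 in the corner and b at the lower right,
    -- where the column step clears it.
    ...   | q′ , zero , e′ , _ = good-row q a b c d (good-column (ℤ.- q′) (ℤ.- c + q * a) (ℤ.- d + q * b) a b
          (subst Good (sym (mat≡ c₀ refl refl (trans (cong (λ t → t + ℤ.- q′ * a) e′) (l′ q′ a))))
          (antidiagonal (ℤ.- d + q * b + ℤ.- q′ * (ℤ.- c + q * a)) a)))
      where
      l : ∀ q a → ℤ.- (+ 0 + q * a) + q * a ≡ + 0
      l = ℤ-ring
      c₀ : ℤ.- c + q * a ≡ + 0
      c₀ = trans (cong (λ t → ℤ.- t + q * a) e) (l q a)
      l′ : ∀ q a → + 0 + q * a + ℤ.- q * a ≡ + 0
      l′ = ℤ-ring

  inv-invariant : ∀ {n} .{{_ : NonZero n}} M → det M ≡ + n → f (inv M) ≡ f M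
  inv-invariant (a , b , c , d) e with a ≟ + 0
  ... | no nz = good ℤ.∣ a ∣ a b c d nz ℕ.≤-refl
  -- With corner 0 the entry c is nonzero because det M ≠ 0, and S brings -c into the corner.
  ... | yes z = good-S (a , b , c , d) (subst Good (sym (Smat-⊗ a b c d))
    (good ℤ.∣ ℤ.- c ∣ (ℤ.- c) (ℤ.- d) a b (λ y → column-nonzero a b c d e (z , ℤ.neg-injective y)) ℕ.≤-refl))

-- The masses of the right cosets

module _ (n : ℕ) .{{n≢0 : NonZero n}} (Tinf : List Mat) (reps : IsRepsInfty n Tinf)
         (ξ : Formal) (ξR : InR n ξ) (A : CondA n Tinf ξ) (B : CondB n ξ) where

  private
    -- For N and M of determinant n this is the indicator of the right coset NΓ, since `inv N ⊗ M`
    -- is n N⁻¹M.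
    χ : Mat → Mat → ℚ
    χ N M = ind (n ∣M? (inv N ⊗ M))

    c : Mat → ℚ
    c N = ⟪ ξ ∣ χ N ⟫

    χ-even : ∀ N → Even (χ N)
    χ-even N M = trans (cong (λ G → ind (n ∣M? G)) (negM-⊗ʳ (inv N) M)) (ind-∣M-negM n (inv N ⊗ M))

    χ-Γ : ∀ N γ → InΓ γ → ∀ M → χ N (M ⊗ γ) ≡ χ N M
    χ-Γ N γ γΓ M = ind-cong (n ∣M? (inv N ⊗ (M ⊗ γ))) (n ∣M? (inv N ⊗ M))
      (λ p → subst (n ∣M_) (trans (cong (_⊗ inv γ) (sym (⊗-assoc (inv N) M γ))) (Γ-cancel-invʳ γ γΓ (inv N ⊗ M))) (∣M-⊗ʳ (inv γ) p))
      (λ p → subst (n ∣M_) (⊗-assoc (inv N) M γ) (∣M-⊗ʳ γ p))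

    χ-left : ∀ γ N M → χ (inv γ ⊗ N) M ≡ χ N (γ ⊗ M)
    χ-left γ N M = cong (λ G → ind (n ∣M? G))
      (trans (cong (_⊗ M) (trans (inv-⊗ (inv γ) N) (cong (inv N ⊗_) (inv-involutive γ)))) (⊗-assoc (inv N) γ M))

    c-even : Even c
    c-even N = pair-ext ξ (λ M → trans (cong (λ G → ind (n ∣M? G)) (negM-⊗ˡ (inv N) M)) (ind-∣M-negM n (inv N ⊗ M)))

    c-right : ∀ γ → InΓ γ → ∀ N → c (N ⊗ γ) ≡ c N
    c-right γ γΓ N = pair-ext ξ (λ M → ind-cong (n ∣M? (inv (N ⊗ γ) ⊗ M)) (n ∣M? (inv N ⊗ M))
      (λ p → subst (n ∣M_) (Γ-cancel-invˡ γ γΓ (inv N ⊗ M)) (∣M-⊗ˡ γ (subst (n ∣M_) (e M) p)))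
      (λ p → subst (n ∣M_) (sym (e M)) (∣M-⊗ˡ (inv γ) p)))
      where
      e : ∀ M → inv (N ⊗ γ) ⊗ M ≡ inv γ ⊗ (inv N ⊗ M)
      e M = trans (cong (_⊗ M) (inv-⊗ N γ)) (⊗-assoc (inv γ) (inv N) M)

    c-inv : ∀ γ → InΓ γ → (∀ N → ⟪ ξ ∣ (λ M → χ N (γ ⊗ M)) ⟫ ≡ c N) → ∀ N → c (γ ⊗ N) ≡ c N
    c-inv γ γΓ h N = trans (sym (h (γ ⊗ N))) (trans (pair-ext ξ (λ M → sym (χ-left γ (γ ⊗ N) M)))
      (cong c (Γ-inv-cancelˡ γ γΓ N)))

    -- `χ N` is invariant on the right, so the two halves of `pair-B₁-difference` coincide, and ξ
    -- gives `χ N` and its translate by U the same mass.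
    c-U : ∀ N → c (Umat ⊗ N) ≡ c N
    c-U = c-inv Umat refl λ N → sym (halve (c N) (X N) (difference-zero (c N ℚ.+ c N) (X N ℚ.+ X N)
      (trans (sym (expand N)) (pair-B₁-difference n ξ B (χ-even N)))))
      where
      X : Mat → ℚ
      X N = ⟪ ξ ∣ (λ M → χ N (Umat ⊗ M)) ⟫
      l : ∀ x y → x ℚ.- y ℚ.+ (x ℚ.- y) ≡ (x ℚ.+ x) ℚ.- (y ℚ.+ y)
      l = ring-of ringℚ
      step : ∀ N M → χ N M ℚ.- χ N (Umat ⊗ M) ℚ.+ (χ N (M ⊗ Smat) ℚ.- χ N (Umat ⊗ (M ⊗ Smat)))
        ≡ (χ N M ℚ.+ χ N M) ℚ.- (χ N (Umat ⊗ M) ℚ.+ χ N (Umat ⊗ M))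
      step N M = trans (cong₂ (λ s t → χ N M ℚ.- χ N (Umat ⊗ M) ℚ.+ (s ℚ.- t)) (χ-Γ N Smat refl M)
        (trans (cong (χ N) (sym (⊗-assoc Umat M Smat))) (χ-Γ N Smat refl (Umat ⊗ M)))) (l (χ N M) (χ N (Umat ⊗ M)))
      expand : ∀ N → ⟪ ξ ∣ (λ M → χ N M ℚ.- χ N (Umat ⊗ M) ℚ.+ (χ N (M ⊗ Smat) ℚ.- χ N (Umat ⊗ (M ⊗ Smat)))) ⟫
        ≡ (c N ℚ.+ c N) ℚ.- (X N ℚ.+ X N)
      expand N = trans (pair-ext ξ (step N))
        (trans (pair-- ξ (λ M → χ N M ℚ.+ χ N M) (λ M → χ N (Umat ⊗ M) ℚ.+ χ N (Umat ⊗ M)))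
        (cong₂ ℚ._-_ (pair-+ ξ (χ N) (χ N)) (pair-+ ξ (λ M → χ N (Umat ⊗ M)) (λ M → χ N (Umat ⊗ M)))))

    c-S : ∀ N → c (Smat ⊗ N) ≡ c N
    c-S = c-inv Smat refl λ N → divide-by-3 (X N) (c N) (difference-zero (X N ℚ.+ X N ℚ.+ X N) (c N ℚ.+ c N ℚ.+ c N)
      (trans (sym (expand N)) (pair-B₂-difference n ξ B (χ-even N))))
      where
      X : Mat → ℚ
      X N = ⟪ ξ ∣ (λ M → χ N (Smat ⊗ M)) ⟫
      l : ∀ x y → (x ℚ.- y) ℚ.+ (x ℚ.- y) ℚ.+ (x ℚ.- y) ≡ (x ℚ.+ x ℚ.+ x) ℚ.- (y ℚ.+ y ℚ.+ y)
      l = ring-of ringℚ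
      mid : ∀ N γ → InΓ γ → ∀ M → χ N (Smat ⊗ (M ⊗ γ)) ≡ χ N (Smat ⊗ M)
      mid N γ γΓ M = trans (cong (χ N) (sym (⊗-assoc Smat M γ))) (χ-Γ N γ γΓ (Smat ⊗ M))
      step : ∀ N M → (χ N (Smat ⊗ M) ℚ.- χ N M) ℚ.+ (χ N (Smat ⊗ (M ⊗ Umat)) ℚ.- χ N (M ⊗ Umat))
                 ℚ.+ (χ N (Smat ⊗ (M ⊗ U²mat)) ℚ.- χ N (M ⊗ U²mat))
        ≡ (χ N (Smat ⊗ M) ℚ.+ χ N (Smat ⊗ M) ℚ.+ χ N (Smat ⊗ M)) ℚ.- (χ N M ℚ.+ χ N M ℚ.+ χ N M)
      step N M = trans (cong₂ (λ s t → (χ N (Smat ⊗ M) ℚ.- χ N M) ℚ.+ s ℚ.+ t)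
          (cong₂ ℚ._-_ (mid N Umat refl M) (χ-Γ N Umat refl M)) (cong₂ ℚ._-_ (mid N U²mat refl M) (χ-Γ N U²mat refl M)))
        (l (χ N (Smat ⊗ M)) (χ N M))
      three-times : ∀ f → ⟪ ξ ∣ (λ M → f M ℚ.+ f M ℚ.+ f M) ⟫ ≡ ⟪ ξ ∣ f ⟫ ℚ.+ ⟪ ξ ∣ f ⟫ ℚ.+ ⟪ ξ ∣ f ⟫
      three-times f = trans (pair-+ ξ (λ M → f M ℚ.+ f M) f) (cong (λ t → t ℚ.+ ⟪ ξ ∣ f ⟫) (pair-+ ξ f f))
      expand : ∀ N → ⟪ ξ ∣ (λ M → (χ N (Smat ⊗ M) ℚ.- χ N M) ℚ.+ (χ N (Smat ⊗ (M ⊗ Umat)) ℚ.- χ N (M ⊗ Umat))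
                 ℚ.+ (χ N (Smat ⊗ (M ⊗ U²mat)) ℚ.- χ N (M ⊗ U²mat))) ⟫
        ≡ (X N ℚ.+ X N ℚ.+ X N) ℚ.- (c N ℚ.+ c N ℚ.+ c N)
      expand N = trans (pair-ext ξ (step N))
        (trans (pair-- ξ (λ M → χ N (Smat ⊗ M) ℚ.+ χ N (Smat ⊗ M) ℚ.+ χ N (Smat ⊗ M)) (λ M → χ N M ℚ.+ χ N M ℚ.+ χ N M))
        (cong₂ ℚ._-_ (three-times (λ M → χ N (Smat ⊗ M))) (three-times (χ N))))

    c-T : ∀ N → c (Tmat ⊗ N) ≡ c N
    c-T N = trans (sym (trans (cong c (U⊗S⊗ N)) (c-even (Tmat ⊗ N)))) (trans (c-U (Smat ⊗ N)) (c-S N))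

    c⁺ : Mat → ℚ
    c⁺ N = c N ℚ.+ 1ℚ

    c⁺-biinvariant : Biinvariant n Tinf reps ξ ξR A B c⁺
    c⁺-biinvariant = record
      { even = λ N → cong (λ t → t ℚ.+ 1ℚ) (c-even N)
      ; S-left = λ N → cong (λ t → t ℚ.+ 1ℚ) (c-S N)
      ; U-left = λ N → cong (λ t → t ℚ.+ 1ℚ) (c-U N)
      ; S-right = λ N → cong (λ t → t ℚ.+ 1ℚ) (c-right Smat refl N)
      ; U-right = λ N → cong (λ t → t ℚ.+ 1ℚ) (c-right Umat refl N) }

    c-transpose : ∀ N → det N ≡ + n → c (inv N) ≡ c N
    c-transpose = inv-invariant c c-even c-S c-T c-right

    -- If N M = nγ, then M lies in the right coset of `inv N`, whose mass equals that of N by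
    -- `c-transpose`.
    c-coset : ∀ M N → det M ≡ + n → det N ≡ + n → n ∣M (N ⊗ M) → c M ≡ c N
    c-coset M N dM dN p = go (∣M⇒LeftEquiv n (inv M) N (trans (det-inv M) dM) dN (subst (n ∣M_) (inv-⊗ N M) (∣M-inv p)))
      where
      go : LeftEquiv (inv M) N → c M ≡ c N
      go (γ , γΓ , r) = trans (cong c (sym (inv-involutive M))) (trans (lift r)
        (trans (cong c (inv-⊗ γ N)) (trans (c-right (inv γ) (Γ-inv γ γΓ) (inv N)) (c-transpose N dN))))
        where
        lift : inv M ∼ (γ ⊗ N) → c (inv (inv M)) ≡ c (inv (γ ⊗ N))
        lift (inj₁ e) = cong (λ t → c (inv t)) e
        lift (inj₂ e) = trans (cong (λ t → c (inv t)) e) (c-even (inv (γ ⊗ N)))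

    -- The adjugates of representatives of the left cosets ΓN represent the right cosets.
    ∑-right-representatives : ∀ M → det M ≡ + n → ∑ Tinf (λ N → ind (n ∣M? (N ⊗ M))) ≡ 1ℚ
    ∑-right-representatives M dM = trans (∑-ext Tinf (λ N → ind-cong (n ∣M? (N ⊗ M)) (n ∣M? (inv M ⊗ inv N))
        (λ p → subst (n ∣M_) (inv-⊗ N M) (∣M-inv p))
        (λ p → subst (n ∣M_) (trans (inv-⊗ (inv M) (inv N)) (cong₂ _⊗_ (inv-involutive N) (inv-involutive M))) (∣M-inv p))))
      (∑-left-representatives n reps (inv M) (trans (det-inv M) dM))

    shape : ∀ N → N ∈ Tinf → det N ≡ + n
    shape N m = proj₁ (All.lookup (proj₁ reps) m)

    split-cosets : ∀ M → det M ≡ + n → c⁺ M ≡ ∑ Tinf (λ N → c⁺ N ℚ.* ind (n ∣M? (N ⊗ M)))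
    split-cosets M dM = trans (sym (ℚ.*-identityʳ (c⁺ M))) (trans (cong (c⁺ M ℚ.*_) (sym (∑-right-representatives M dM)))
      (trans (sym (∑-*ˡ Tinf (c⁺ M) (λ N → ind (n ∣M? (N ⊗ M))))) (∑-∈ Tinf swap)))
      where
      swap : ∀ N → N ∈ Tinf → c⁺ M ℚ.* ind (n ∣M? (N ⊗ M)) ≡ c⁺ N ℚ.* ind (n ∣M? (N ⊗ M))
      swap N m = by (n ∣M? (N ⊗ M))
        where
        by : (d : Dec (n ∣M (N ⊗ M))) → c⁺ M ℚ.* ind d ≡ c⁺ N ℚ.* ind d
        by (yes p) = cong (λ t → (t ℚ.+ 1ℚ) ℚ.* 1ℚ) (c-coset M N dM (shape N m) p)
        by (no _) = trans (ℚ.*-zeroʳ (c⁺ M)) (sym (ℚ.*-zeroʳ (c⁺ N)))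

    -- The constant value of `c⁺` on each right coset of some `inv N` is collected; that coset has
    -- mass c(`inv N`) = c(N).
    mass-c⁺ : ⟪ ξ ∣ c⁺ ⟫ ≡ ∑ Tinf (λ N → c⁺ N ℚ.* c N)
    mass-c⁺ = trans (pair-cong ξ (All.map (λ {p} → split-cosets (proj₂ p)) ξR))
      (trans (∑-ext ξ (λ p → sym (∑-*ˡ Tinf (proj₁ p) (λ N → c⁺ N ℚ.* ind (n ∣M? (N ⊗ proj₂ p))))))
      (trans (∑-swap ξ Tinf (λ p N → proj₁ p ℚ.* (c⁺ N ℚ.* ind (n ∣M? (N ⊗ proj₂ p)))))
      (∑-∈ Tinf (λ N m → trans (pair-*ˡ ξ (c⁺ N) (λ M → ind (n ∣M? (N ⊗ M))))
        (cong (c⁺ N ℚ.*_) (trans (pair-ext ξ (λ M → cong (λ G → ind (n ∣M? (G ⊗ M))) (sym (inv-involutive N))))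
          (c-transpose N (shape N m))))))))

    c⁺-vanishes : All (λ N → c⁺ N ≡ 0ℚ) Tinf
    c⁺-vanishes = ∑-squares-zero Tinf c⁺ (trans (∑-ext Tinf (λ N → l (c N)))
      (trans (∑-+ Tinf (λ N → c⁺ N ℚ.* c N) c⁺)
      (trans (cong (ℚ._+ ∑ Tinf c⁺) (sym mass-c⁺)) (mass-biinvariant n Tinf reps ξ ξR A B c⁺ c⁺-biinvariant))))
      where
      l : ∀ x → (x ℚ.+ 1ℚ) ℚ.* (x ℚ.+ 1ℚ) ≡ (x ℚ.+ 1ℚ) ℚ.* x ℚ.+ (x ℚ.+ 1ℚ)
      l = ring-of ringℚ

  coset-mass : ∀ M → det M ≡ + n → ⟪ ξ ∣ (λ N → ind (n ∣M? (inv M ⊗ N))) ⟫ ≡ ℚ.- 1ℚ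
  coset-mass M dM = trans (sym (l (c M))) (trans (cong (λ t → t ℚ.- 1ℚ) vanish) refl)
    where
    l : ∀ x → x ℚ.+ 1ℚ ℚ.- 1ℚ ≡ x
    l = ring-of ringℚ
    vanish : c⁺ M ≡ 0ℚ
    -- Every M of determinant n shares its value of `c⁺` with a representative, where it is already
    -- known to be 0.
    vanish = trans (split-cosets M dM) (trans (∑-∈ Tinf (λ N m →
      trans (cong (ℚ._* ind (n ∣M? (N ⊗ M))) (All.lookup c⁺-vanishes m)) (ℚ.*-zeroˡ (ind (n ∣M? (N ⊗ M)))))) (∑-zero Tinf))

  coset-theorem : ∀ M₀ → det M₀ ≡ + n → (K : Pred Mat 0ℓ) (K? : Decidable K) →
    (∀ M → K M ⇔ InRightCoset M₀ M) → pairing ξ K? ≡ ℚ.- 1ℚ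
  coset-theorem M₀ d₀ K K? K⇔ = trans (pairing≡pair ξ K?)
    (trans (pair-cong ξ (All.map (λ {p} d → ind-cong (K? (proj₂ p)) (n ∣M? (inv M₀ ⊗ proj₂ p))
      (λ k → to (proj₂ p) (Equivalence.to (K⇔ (proj₂ p)) k))
      (λ q → Equivalence.from (K⇔ (proj₂ p)) (from (proj₂ p) d q))) ξR))
    (coset-mass M₀ d₀))
    where
    to : ∀ M → InRightCoset M₀ M → n ∣M (inv M₀ ⊗ M)
    to M (γ , γΓ , r) = go r
      where
      base : inv M₀ ⊗ (M₀ ⊗ γ) ≡ scale (+ n) γ
      base = trans (inv-cancelˡ γ M₀) (cong (λ k → scale k γ) d₀)
      go : M ∼ (M₀ ⊗ γ) → n ∣M (inv M₀ ⊗ M)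
      go (inj₁ e) = γ , trans (cong (inv M₀ ⊗_) e) base
      go (inj₂ e) = negM γ , trans (cong (inv M₀ ⊗_) e) (trans (negM-⊗ʳ (inv M₀) (M₀ ⊗ γ))
        (trans (cong negM base) (sym (scale-negM (+ n) γ))))
    from : ∀ M → det M ≡ + n → n ∣M (inv M₀ ⊗ M) → InRightCoset M₀ M
    from M d q = go (∣M⇒LeftEquiv n (inv M) (inv M₀) (trans (det-inv M) d) (trans (det-inv M₀) d₀)
        (subst (n ∣M_) (inv-⊗ (inv M₀) M) (∣M-inv q)))
      where
      go : LeftEquiv (inv M) (inv M₀) → InRightCoset M₀ M
      go (γ , γΓ , r) = inv γ , Γ-inv γ γΓ , flip r
        where
        e : inv (γ ⊗ inv M₀) ≡ M₀ ⊗ inv γ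
        e = trans (inv-⊗ γ (inv M₀)) (cong (_⊗ inv γ) (inv-involutive M₀))
        flip : inv M ∼ (γ ⊗ inv M₀) → M ∼ (M₀ ⊗ inv γ)
        flip (inj₁ p) = inj₁ (trans (sym (inv-involutive M)) (trans (cong inv p) e))
        flip (inj₂ p) = inj₂ (trans (sym (inv-involutive M)) (trans (cong inv p) (cong negM e)))

-- Farey edges inside [0,1]

In01 Cl01 : ℤ → ℤ → Set
In01 x y = (0ℤ ≤ x × x < y) ⊎ (y < x × x ≤ 0ℤ)
Cl01 x y = (0ℤ ≤ x × x ≤ y) ⊎ (y ≤ x × x ≤ 0ℤ)

In01? : ∀ x y → Dec (In01 x y)
In01? x y = ((0ℤ ≤? x) ×-dec (x <? y)) ⊎-dec ((y <? x) ×-dec (x ≤? 0ℤ))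

Cl01? : ∀ x y → Dec (Cl01 x y)
Cl01? x y = ((0ℤ ≤? x) ×-dec (x ≤? y)) ⊎-dec ((y ≤? x) ×-dec (x ≤? 0ℤ))

-- The cusp x/y lies in [0,1), respectively in [0,1].
in01 cl01 : ℤ → ℤ → ℚ
in01 x y = ind (In01? x y)
cl01 x y = ind (Cl01? x y)

In01-neg : ∀ x y → In01 x y → In01 (ℤ.- x) (ℤ.- y)
In01-neg x y (inj₁ (p , q)) = inj₂ (ℤ.neg-mono-< q , ℤ.neg-mono-≤ p)
In01-neg x y (inj₂ (p , q)) = inj₁ (ℤ.neg-mono-≤ q , ℤ.neg-mono-< p)

Cl01-neg : ∀ x y → Cl01 x y → Cl01 (ℤ.- x) (ℤ.- y)
Cl01-neg x y (inj₁ (p , q)) = inj₂ (ℤ.neg-mono-≤ q , ℤ.neg-mono-≤ p)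
Cl01-neg x y (inj₂ (p , q)) = inj₁ (ℤ.neg-mono-≤ q , ℤ.neg-mono-≤ p)

in01-neg : ∀ x y → in01 (ℤ.- x) (ℤ.- y) ≡ in01 x y
in01-neg x y = ind-cong (In01? (ℤ.- x) (ℤ.- y)) (In01? x y)
  (λ p → subst₂ In01 (ℤ.neg-involutive x) (ℤ.neg-involutive y) (In01-neg (ℤ.- x) (ℤ.- y) p)) (In01-neg x y)

cl01-neg : ∀ x y → cl01 (ℤ.- x) (ℤ.- y) ≡ cl01 x y
cl01-neg x y = ind-cong (Cl01? (ℤ.- x) (ℤ.- y)) (Cl01? x y)
  (λ p → subst₂ Cl01 (ℤ.neg-involutive x) (ℤ.neg-involutive y) (Cl01-neg (ℤ.- x) (ℤ.- y) p)) (Cl01-neg x y)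

module _ (n : ℕ) .{{n≢0 : NonZero n}} where

  private instance
    +n>0 : ℤ.Positive (+ n)
    +n>0 = ℤ.positive (ℤ.+<+ (ℕ.>-nonZero⁻¹ n {{n≢0}}))

  private
    up≤ : ∀ {x y} → x ≤ y → + n * x ≤ + n * y
    up≤ {x} {y} = ℤ.*-monoˡ-≤-nonNeg (+ n)
    dn≤ : ∀ {x y} → + n * x ≤ + n * y → x ≤ y
    dn≤ {x} {y} = ℤ.*-cancelˡ-≤-pos x y (+ n)
    up< : ∀ {x y} → x < y → + n * x < + n * y
    up< {x} {y} = ℤ.*-monoˡ-<-pos (+ n)
    dn< : ∀ {x y} → + n * x < + n * y → x < y
    dn< {x} {y} = ℤ.*-cancelˡ-<-nonNeg (+ n)
    z : + n * 0ℤ ≡ 0ℤ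
    z = ℤ.*-zeroʳ (+ n)

  in01-scale⁺ : ∀ x y → in01 (+ n * x) (+ n * y) ≡ in01 x y
  in01-scale⁺ x y = ind-cong (In01? (+ n * x) (+ n * y)) (In01? x y) down up
    where
    down : In01 (+ n * x) (+ n * y) → In01 x y
    down (inj₁ (p , q)) = inj₁ (dn≤ (subst (_≤ + n * x) (sym z) p) , dn< q)
    down (inj₂ (p , q)) = inj₂ (dn< p , dn≤ (subst (+ n * x ≤_) (sym z) q))
    up : In01 x y → In01 (+ n * x) (+ n * y)
    up (inj₁ (p , q)) = inj₁ (subst (_≤ + n * x) z (up≤ p) , up< q)
    up (inj₂ (p , q)) = inj₂ (up< p , subst (+ n * x ≤_) z (up≤ q))

in01-scale : ∀ k x y → ¬ k ≡ + 0 → in01 (k * x) (k * y) ≡ in01 x y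
in01-scale +0 x y nz = ⊥-elim (nz refl)
in01-scale +[1+ n ] x y _ = in01-scale⁺ (suc n) x y
in01-scale -[1+ n ] x y _ = trans (cong₂ in01 (sym (ℤ.neg-distribˡ-* (+ suc n) x)) (sym (ℤ.neg-distribˡ-* (+ suc n) y)))
  (trans (in01-neg (+ suc n * x) (+ suc n * y)) (in01-scale⁺ (suc n) x y))

-- S T^k and U T^(k+1) written out. As Farey edges oriented from g∞ to g0 they run from 0 to -1/k
-- and from 1 to k/(k+1).
STmat UTmat : ℕ → Mat
STmat k = + 0 , -[1+ 0 ] , + 1 , + k
UTmat k = + 1 , + k , + 1 , + suc k

STmat-⊗ : ∀ k N → STmat k ⊗ N ≡ Smat ⊗ (Tz (+ k) ⊗ N)
STmat-⊗ k N = trans (cong (_⊗ N) (sym (Smat-⊗ (+ 1) (+ k) (+ 0) (+ 1)))) (⊗-assoc Smat (Tz (+ k)) N)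

UTmat-⊗ : ∀ k N → UTmat k ⊗ N ≡ Umat ⊗ (Tz (+ suc k) ⊗ N)
UTmat-⊗ k N = trans (cong (_⊗ N) (sym (Umat-⊗ (+ 1) (+ suc k) (+ 0) (+ 1)))) (⊗-assoc Umat (Tz (+ suc k)) N)

STmat-Γ : ∀ k → InΓ (STmat k)
STmat-Γ k = refl

UTmat-Γ : ∀ k → InΓ (UTmat k)
UTmat-Γ k = l (+ k)
  where
  l : ∀ k → + 1 * (+ 1 + k) - k * + 1 ≡ + 1
  l = ℤ-ring

-- Both ends g∞ and g0 of the Farey edge lie in [0,1]. Reversing the edge, g ↦ gS, does not change
-- this, whereas `left01` looks at the initial end only.
inside : Mat → ℚ
inside (a , b , c , d) = cl01 a c ℚ.* cl01 b d

left01 : Mat → ℚ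
left01 (a , b , c , d) = in01 a c

left01-even : Even left01
left01-even (a , b , c , d) = in01-neg a c

inside-even : Even inside
inside-even (a , b , c , d) = cong₂ ℚ._*_ (cl01-neg a c) (cl01-neg b d)

-- Farey edges do not cross, so an edge that starts strictly between 0 and 1 stays in [0,1].
-- `left01` and `inside` can differ only on edges that start at 0 and leave [0,1], or start at 1 and
-- stay in [0,1], as [0,1) omits 1.
data FareyCase (g : Mat) : Set where
  ST-case : ∀ k → g ∼ STmat k → left01 g ≡ 1ℚ → inside g ≡ 0ℚ → FareyCase g
  UT-case : ∀ k → g ∼ UTmat k → left01 g ≡ 0ℚ → inside g ≡ 1ℚ → FareyCase g
  neither : (∀ k → ¬ (g ∼ STmat k)) → (∀ k → ¬ (g ∼ UTmat k)) → left01 g ≡ inside g → FareyCase g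

FareyCase-negM : ∀ g → FareyCase (negM g) → FareyCase g
FareyCase-negM g (ST-case k r p q) = ST-case k (∼-trans (∼-sym ∼-neg) r) (trans (sym (left01-even g)) p) (trans (sym (inside-even g)) q)
FareyCase-negM g (UT-case k r p q) = UT-case k (∼-trans (∼-sym ∼-neg) r) (trans (sym (left01-even g)) p) (trans (sym (inside-even g)) q)
FareyCase-negM g (neither s u p) = neither (λ k r → s k (∼-trans ∼-neg r)) (λ k r → u k (∼-trans ∼-neg r))
  (trans (sym (left01-even g)) (trans p (inside-even g)))

private

  ST-first : ∀ {a b c d} k → (a , b , c , d) ∼ STmat k → a ≡ + 0
  ST-first k (inj₁ refl) = refl
  ST-first k (inj₂ refl) = refl

  ST-third : ∀ {a b c d} k → (a , b , c , d) ∼ STmat k → ¬ c ≡ + 0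
  ST-third k (inj₁ refl) ()
  ST-third k (inj₂ refl) ()

  UT-first : ∀ {a b c d} k → (a , b , c , d) ∼ UTmat k → a ≡ c
  UT-first k (inj₁ refl) = refl
  UT-first k (inj₂ refl) = refl

  UT-third : ∀ {a b c d} k → (a , b , c , d) ∼ UTmat k → ¬ c ≡ + 0
  UT-third k (inj₁ refl) ()
  UT-third k (inj₂ refl) ()

  in01-yes : ∀ x y → In01 x y → in01 x y ≡ 1ℚ
  in01-yes x y = ind-yes (In01? x y)

  in01-no : ∀ x y → ¬ In01 x y → in01 x y ≡ 0ℚ
  in01-no x y = ind-no (In01? x y)

  inside-noˡ : ∀ a b c d → ¬ Cl01 a c → inside (a , b , c , d) ≡ 0ℚ
  inside-noˡ a b c d h = trans (cong (λ t → t ℚ.* cl01 b d) (ind-no (Cl01? a c) h)) (ℚ.*-zeroˡ (cl01 b d))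

  inside-noʳ : ∀ a b c d → ¬ Cl01 b d → inside (a , b , c , d) ≡ 0ℚ
  inside-noʳ a b c d h = trans (cong (λ t → cl01 a c ℚ.* t) (ind-no (Cl01? b d) h)) (ℚ.*-zeroʳ (cl01 a c))

  inside-yes : ∀ a b c d → Cl01 a c → Cl01 b d → inside (a , b , c , d) ≡ 1ℚ
  inside-yes a b c d h h′ = cong₂ ℚ._*_ (ind-yes (Cl01? a c) h) (ind-yes (Cl01? b d) h′)

  outside : ∀ a b c d → ¬ Cl01 a c → ¬ a ≡ + 0 ⊎ c ≡ + 0 → ¬ a ≡ c ⊎ c ≡ + 0 → FareyCase (a , b , c , d)
  outside a b c d h s u = neither
    (λ k r → case₁ s k r) (λ k r → case₂ u k r)
    (trans (in01-no a c (λ { (inj₁ (p , q)) → h (inj₁ (p , ℤ.<⇒≤ q)) ; (inj₂ (p , q)) → h (inj₂ (ℤ.<⇒≤ p , q)) }))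
           (sym (inside-noˡ a b c d h)))
    where
    case₁ : ¬ a ≡ + 0 ⊎ c ≡ + 0 → ∀ k → ¬ ((a , b , c , d) ∼ STmat k)
    case₁ (inj₁ z) k r = z (ST-first k r)
    case₁ (inj₂ z) k r = ST-third k r z
    case₂ : ¬ a ≡ c ⊎ c ≡ + 0 → ∀ k → ¬ ((a , b , c , d) ∼ UTmat k)
    case₂ (inj₁ z) k r = z (UT-first k r)
    case₂ (inj₂ z) k r = UT-third k r z

  unit : ∀ m y → +[1+ m ] * y ≡ + 1 → m ≡ 0 × y ≡ + 1
  unit m (+ k) e with ℕ.m*n≡1⇒m≡1 (suc m) k (ℤ.+-injective (trans (ℤ.pos-* (suc m) k) e))
                    | ℕ.m*n≡1⇒n≡1 (suc m) k (ℤ.+-injective (trans (ℤ.pos-* (suc m) k) e))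
  ... | refl | refl = refl , refl
  unit m -[1+ k ] ()

  positive : ∀ m → 0ℤ ≤ +[1+ m ] - + 1
  positive m = ℤ.+≤+ ℕ.z≤n

  case-zero : ∀ m b d → + 0 * d - b * +[1+ m ] ≡ + 1 → FareyCase (+ 0 , b , +[1+ m ] , d)
  -- The determinant is -bc, which forces c = 1 and b = -1; the sign of d then decides whether the
  -- other end -1/d is outside [0,1].
  case-zero m b d e with unit m (ℤ.- b) (trans (l b d +[1+ m ]) e)
    where
    l : ∀ b d c → c * ℤ.- b ≡ + 0 * d - b * c
    l = ℤ-ring
  ... | refl , f with trans (sym (ℤ.neg-involutive b)) (cong ℤ.-_ f)
  case-zero .0 .(-[1+ 0 ]) (+ k) e | refl , f | refl = ST-case k ∼-refl refl (inside-noʳ (+ 0) -[1+ 0 ] (+ 1) (+ k)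
    λ { (inj₁ (() , _)) ; (inj₂ (() , _)) })
  case-zero .0 .(-[1+ 0 ]) -[1+ k ] e | refl , f | refl = neither
    (λ { j (inj₁ ()) ; j (inj₂ ()) }) (λ { j (inj₁ ()) ; j (inj₂ ()) })
    (trans (in01-yes (+ 0) (+ 1) (inj₁ (ℤ.≤-refl , ℤ.+<+ (ℕ.s≤s ℕ.z≤n))))
      (sym (inside-yes (+ 0) -[1+ 0 ] (+ 1) -[1+ k ] (inj₁ (ℤ.≤-refl , ℤ.+≤+ ℕ.z≤n)) (inj₂ (ℤ.-≤- ℕ.z≤n , ℤ.-≤+)))))

  case-one : ∀ m b d → +[1+ m ] * d - b * +[1+ m ] ≡ + 1 → FareyCase (+[1+ m ] , b , +[1+ m ] , d)
  case-one m b d e with unit m (d - b) (trans (l +[1+ m ] b d) e)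
    where
    l : ∀ c b d → c * (d - b) ≡ c * d - b * c
    l = ℤ-ring
  ... | refl , f with trans (l′ b d) (cong (_+ b) f)
    where
    l′ : ∀ b d → d ≡ d - b + b
    l′ = ℤ-ring
  case-one .0 (+ k) .(+ suc k) e | refl , f | refl = UT-case k ∼-refl refl
    (inside-yes (+ 1) (+ k) (+ 1) (+ suc k) (inj₁ (ℤ.+≤+ ℕ.z≤n , ℤ.≤-refl)) (inj₁ (ℤ.+≤+ ℕ.z≤n , ℤ.+≤+ (ℕ.n≤1+n k))))
  case-one .0 -[1+ k ] d e | refl , f | g = neither
    (λ { j (inj₁ ()) ; j (inj₂ ()) }) (λ { j (inj₁ ()) ; j (inj₂ ()) })
    (sym (inside-noʳ (+ 1) -[1+ k ] (+ 1) d
      λ { (inj₁ (() , _)) ; (inj₂ (p , _)) → ¬nn {k = 0} (nn+ (≤⇒nn p) (≡⇒nn (+ 1) g)) (l″ -[1+ k ] d) }))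
    where
    l″ : ∀ b d → b - d + + 1 * (d - (+ 1 + b)) ≡ -[1+ 0 ]
    l″ = ℤ-ring

  -- From 0 < a < c follows c ≥ 2, and then each way for b/d to leave [0,1] keeps ad - bc away from
  -- 1. This is the non-crossing of Farey edges in coordinates.
  case-interior : ∀ a b c d → 0ℤ < a → a < c → a * d - b * c ≡ + 1 → FareyCase (a , b , c , d)
  case-interior a b c d a>0 a<c e = neither (λ k r → ℤ.<-irrefl (sym (ST-first k r)) a>0) (λ k r → ℤ.<-irrefl (UT-first k r) a<c)
    (trans (in01-yes a c (inj₁ (ℤ.<⇒≤ a>0 , a<c)))
      (sym (inside-yes a b c d (inj₁ (ℤ.<⇒≤ a>0 , ℤ.<⇒≤ a<c)) (between d refl))))
    where
    a-1 = <⇒nn a>0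
    c-a-1 = <⇒nn a<c
    between : ∀ y → d ≡ y → Cl01 b d
    between (+ y) refl = inj₁ (lower (0ℤ ≤? b) , upper (b ≤? + y))
      where
      nd : 0ℤ ≤ + y
      nd = ℤ.+≤+ ℕ.z≤n
      lower : Dec (0ℤ ≤ b) → 0ℤ ≤ b
      lower (yes p) = p
      -- 1 = a d + (−b) c with −b ≥ 1 and c ≥ 2
      lower (no p) = ⊥-elim (¬nn {k = 0} (nn+ (≡⇒nn (+ 1) (sym e)) (nn+ (nn* (nn+ a-1 (ℤ.+≤+ {0} {1} ℕ.z≤n)) nd)
        (nn+ (nn* (<⇒nn (ℤ.≰⇒> p)) (nn+ (nn+ a-1 c-a-1) (ℤ.+≤+ {0} {2} ℕ.z≤n))) (nn+ a-1 c-a-1)))) (l a b c (+ y)))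
        where
        l : ∀ a b c d → + 1 * (+ 1 - (a * d - b * c)) + ((a - 0ℤ - + 1 + + 1) * d +
            ((0ℤ - b - + 1) * (a - 0ℤ - + 1 + (c - a - + 1) + + 2) + (a - 0ℤ - + 1 + (c - a - + 1)))) ≡ -[1+ 0 ]
        l = ℤ-ring
      upper : Dec (b ≤ + y) → b ≤ + y
      upper (yes p) = p
      upper (no p) = ⊥-elim (¬nn {k = 2} (nn+ (≡⇒nn -[1+ 0 ] (sym e)) (nn+ (nn* (<⇒nn (ℤ.≰⇒> p)) (nn+ (nn+ a-1 c-a-1) (ℤ.+≤+ {0} {2} ℕ.z≤n)))
        (nn+ (nn+ a-1 c-a-1) (nn* nd (nn+ c-a-1 (ℤ.+≤+ {0} {1} ℕ.z≤n)))))) (l a b c (+ y)))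
        where
        l : ∀ a b c d → -[1+ 0 ] * (+ 1 - (a * d - b * c)) + ((b - d - + 1) * (a - 0ℤ - + 1 + (c - a - + 1) + + 2) +
            ((a - 0ℤ - + 1 + (c - a - + 1)) + d * (c - a - + 1 + + 1))) ≡ -[1+ 2 ]
        l = ℤ-ring
    between -[1+ y ] refl = inj₂ (lower (d ≤? b) , upper (b ≤? 0ℤ))
      where
      nd : 0ℤ ≤ 0ℤ - d - + 1
      nd = <⇒nn { -[1+ y ]} {0ℤ} ℤ.-<+
      lower : Dec (d ≤ b) → d ≤ b
      lower (yes p) = p
      lower (no p) = ⊥-elim (¬nn {k = 1} (nn+ (≡⇒nn (+ 1) (sym e)) (nn+ (nn* (<⇒nn (ℤ.≰⇒> p)) (nn+ (nn+ a-1 c-a-1) (ℤ.+≤+ {0} {2} ℕ.z≤n)))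
        (nn+ (nn+ a-1 (nn+ c-a-1 c-a-1)) (nn* nd (nn+ c-a-1 (ℤ.+≤+ {0} {1} ℕ.z≤n)))))) (l a b c d))
        where
        l : ∀ a b c d → + 1 * (+ 1 - (a * d - b * c)) + ((d - b - + 1) * (a - 0ℤ - + 1 + (c - a - + 1) + + 2) +
            ((a - 0ℤ - + 1 + ((c - a - + 1) + (c - a - + 1))) + (0ℤ - d - + 1) * (c - a - + 1 + + 1))) ≡ -[1+ 1 ]
        l = ℤ-ring
      upper : Dec (b ≤ 0ℤ) → b ≤ 0ℤ
      upper (yes p) = p
      upper (no p) = ⊥-elim (¬nn {k = 3} (nn+ (≡⇒nn -[1+ 0 ] (sym e)) (nn+ (nn* (<⇒nn (ℤ.≰⇒> p)) (nn+ (nn+ a-1 c-a-1) (ℤ.+≤+ {0} {2} ℕ.z≤n)))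
        (nn+ (nn* nd (nn+ a-1 (ℤ.+≤+ {0} {1} ℕ.z≤n))) (nn+ a-1 (nn+ a-1 c-a-1))))) (l a b c d))
        where
        l : ∀ a b c d → -[1+ 0 ] * (+ 1 - (a * d - b * c)) + ((b - 0ℤ - + 1) * (a - 0ℤ - + 1 + (c - a - + 1) + + 2) +
            ((0ℤ - d - + 1) * (a - 0ℤ - + 1 + + 1) + (a - 0ℤ - + 1 + (a - 0ℤ - + 1 + (c - a - + 1))))) ≡ -[1+ 3 ]
        l = ℤ-ring

  farey⁺ : ∀ a b m d → a * d - b * +[1+ m ] ≡ + 1 → FareyCase (a , b , +[1+ m ] , d)
  farey⁺ +0 b m d e = case-zero m b d e
  farey⁺ -[1+ k ] b m d e = outside -[1+ k ] b +[1+ m ] d (λ { (inj₁ (() , _)) ; (inj₂ (() , _)) }) (inj₁ λ ()) (inj₁ λ ())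
  farey⁺ +[1+ k ] b m d e with ℤ.<-cmp +[1+ k ] +[1+ m ]
  ... | tri< p _ _ = case-interior +[1+ k ] b +[1+ m ] d (ℤ.+<+ (ℕ.s≤s ℕ.z≤n)) p e
  ... | tri≈ _ refl _ = case-one k b d e
  ... | tri> _ ne p = outside +[1+ k ] b +[1+ m ] d
    (λ { (inj₁ (_ , q)) → ℤ.<-irrefl refl (ℤ.<-≤-trans p q) ; (inj₂ (_ , ℤ.+≤+ ())) }) (inj₁ λ ()) (inj₁ ne)

farey : ∀ a b c d → a * d - b * c ≡ + 1 → FareyCase (a , b , c , d)
farey a b +[1+ m ] d e = farey⁺ a b m d e
farey a b -[1+ m ] d e = FareyCase-negM (a , b , -[1+ m ] , d) (farey⁺ (ℤ.- a) (ℤ.- b) m (ℤ.- d)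
  (trans (det-negM (a , b , -[1+ m ] , d)) e))
farey +0 b +0 d e = ⊥-elim (contra b d e)
  where
  l : ∀ b d → + 0 * d - b * + 0 ≡ + 0
  l = ℤ-ring
  contra : ∀ b d → + 0 * d - b * + 0 ≡ + 1 → ⊥
  contra b d e with trans (sym (l b d)) e
  ... | ()
farey +[1+ k ] b +0 d e = outside +[1+ k ] b +0 d (λ { (inj₁ (_ , ℤ.+≤+ ())) ; (inj₂ (_ , ℤ.+≤+ ())) }) (inj₂ refl) (inj₂ refl)
farey -[1+ k ] b +0 d e = outside -[1+ k ] b +0 d (λ { (inj₁ (() , _)) ; (inj₂ (() , _)) }) (inj₂ refl) (inj₂ refl)

right01 : Mat → ℚ
right01 (a , b , c , d) = in01 b d

-- Sums over a ball against the cosets ΓN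

scale-∼-injective : ∀ k .{{_ : ℤ.NonZero k}} {M N} → scale k M ∼ scale k N → M ∼ N
scale-∼-injective k {M} {N} (inj₁ e) = inj₁ (scale-injective k e)
scale-∼-injective k {M} {N} (inj₂ e) = inj₂ (scale-injective k {M} {negM N} (trans e (sym (scale-negM k N))))

STmat-injective : ∀ j k → STmat j ∼ STmat k → j ≡ k
STmat-injective j k (inj₁ e) = ℤ.+-injective (cong (λ M → proj₂ (proj₂ (proj₂ M))) e)
STmat-injective j k (inj₂ ())

UTmat-injective : ∀ j k → UTmat j ∼ UTmat k → j ≡ k
UTmat-injective j k (inj₁ e) = ℤ.+-injective (cong (λ M → proj₁ (proj₂ M)) e)
UTmat-injective j k (inj₂ ())

ST≁UT : ∀ j k → ¬ (STmat j ∼ UTmat k)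
ST≁UT j k (inj₁ ())
ST≁UT j k (inj₂ ())

self-opposite : ∀ z → z ≡ ℤ.- z → z ≡ + 0
self-opposite +0 _ = refl
self-opposite +[1+ _ ] ()
self-opposite -[1+ _ ] ()

module _ (n : ℕ) .{{n≢0 : NonZero n}} where

  private instance
    +n≢0 : ℤ.NonZero (+ n)
    +n≢0 = ℤ.≢-nonZero (λ e → ℕ.≢-nonZero⁻¹ n {{n≢0}} (ℤ.+-injective e))

  ⊗-∼-cancelʳ : ∀ X Y N → det N ≡ + n → (X ⊗ N) ∼ (Y ⊗ N) → X ∼ Y
  ⊗-∼-cancelʳ X Y N d r = scale-∼-injective (+ n) {X} {Y}
    (subst₂ _∼_ (trans (⊗-cancel-invʳ X N) (cong (λ k → scale k X) d)) (trans (⊗-cancel-invʳ Y N) (cong (λ k → scale k Y) d))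
      (∼-⊗ʳ (inv N) r))

  negM-≢ : ∀ X → det X ≡ + n → ¬ (X ≡ negM X)
  negM-≢ (a , b , c , d) e p = column-nonzero a b c d e (self-opposite a (cong proj₁ p) , self-opposite c (cong lowerLeft p))

  -- A ball consists of matrices and not of classes modulo ±1, so a single class contributes twice;
  -- X and -X are distinct because n > 0.
  ∑-ball-pair : ∀ R X → det X ≡ + n → norm X ℕ.≤ R → ∀ f → (∀ Q → Q ∼ X ⊎ f Q ≡ 0ℚ) →
    ∑ (ball R) f ≡ f X ℚ.+ f (negM X)
  ∑-ball-pair R X d h f supp = trans (∑-same-support (ball R) (X ∷ negM X ∷ []) {f} (unique-ball R)
      ((negM-≢ X d ∷ []) ∷ [] ∷ []) to from) (cong (f X ℚ.+_) (ℚ.+-identityʳ (f (negM X))))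
    where
    to : ∀ Q → Q ∈ ball R → Q ∈ (X ∷ negM X ∷ []) ⊎ f Q ≡ 0ℚ
    to Q _ with supp Q
    ... | inj₂ z = inj₂ z
    ... | inj₁ (inj₁ e) = inj₁ (here e)
    ... | inj₁ (inj₂ e) = inj₁ (there (here e))
    from : ∀ Q → Q ∈ (X ∷ negM X ∷ []) → Q ∈ ball R ⊎ f Q ≡ 0ℚ
    from Q (here refl) = inj₁ (∈-ball h)
    from Q (there (here refl)) = inj₁ (∈-ball (subst (ℕ._≤ R) (sym (norm-negM X)) h))

  module _ (w : Mat → ℚ) (w-even : Even w) (w-det : ∀ Q → det Q ≡ + n ⊎ w Q ≡ 0ℚ) where

    -- The exceptional Farey edges, at which `left01` and `inside` differ, transported to the coset
    -- ΓN, weighted by w and cut off at K.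
    Λ : ℕ → Mat → ℚ
    Λ K N = ∑ (downFrom K) (λ k → w (STmat k ⊗ N) ℚ.- w (UTmat k ⊗ N))

    -- All nonzero terms of both series occur before K, and the matrices before K lie in the ball:
    -- neither truncation loses anything.
    record Adequate (K R : ℕ) (N : Mat) : Set where
      field
        ST-tail : ∀ k → K ℕ.≤ k → w (STmat k ⊗ N) ≡ 0ℚ
        UT-tail : ∀ k → K ℕ.≤ k → w (UTmat k ⊗ N) ≡ 0ℚ
        ST-norm : ∀ k → k ℕ.< K → norm (STmat k ⊗ N) ℕ.≤ R
        UT-norm : ∀ k → k ℕ.< K → norm (UTmat k ⊗ N) ℕ.≤ R

    private
      -- On Q = gN the matrix `Q ⊗ inv N` is n g. Hence h recognises the coset ΓN and tests there
      -- whether g∞ lies in [0,1); the factor n does not change a cusp.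
      h : Mat → ℚ
      h G = ind (n ∣M? G) ℚ.* left01 G

      h-even : Even h
      h-even G = cong₂ ℚ._*_ (ind-∣M-negM n G) (left01-even G)

      -- Replacing N by TN replaces g = Q N⁻¹ by g T⁻¹, which sends ∞ to the same cusp. This makes H
      -- admissible in (A).
      H : ℕ → Mat → ℚ
      H R N = ∑ (ball R) (λ Q → w Q ℚ.* h (Q ⊗ inv N))

      ℓ : ℕ → Mat → Mat → ℚ
      ℓ K Q N = ∑ (downFrom K) (λ k → ind (Q ∼? (STmat k ⊗ N)) ℚ.- ind (Q ∼? (UTmat k ⊗ N)))

      pick : ∀ R X → det X ≡ + n → norm X ℕ.≤ R → ∑ (ball R) (λ Q → w Q ℚ.* ind (Q ∼? X)) ≡ w X ℚ.+ w X
      pick R X d p = trans (∑-ball-pair R X d p (λ Q → w Q ℚ.* ind (Q ∼? X)) (λ Q → supp Q (Q ∼? X)))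
        (cong₂ ℚ._+_ (trans (cong (w X ℚ.*_) (ind-yes (X ∼? X) ∼-refl)) (ℚ.*-identityʳ (w X)))
          (trans (cong₂ ℚ._*_ (w-even X) (ind-yes (negM X ∼? X) ∼-neg)) (ℚ.*-identityʳ (w X))))
        where
        supp : ∀ Q (r : Dec (Q ∼ X)) → Q ∼ X ⊎ w Q ℚ.* ind r ≡ 0ℚ
        supp Q (yes r) = inj₁ r
        supp Q (no _) = inj₂ (ℚ.*-zeroʳ (w Q))

      det-Γ : ∀ γ N → InΓ γ → det N ≡ + n → det (γ ⊗ N) ≡ + n
      det-Γ γ N g d = trans (det-⊗ γ N) (trans (cong₂ _*_ g d) (ℤ.*-identityˡ (+ n)))

      -- Each class ±X with X = S T^k N or X = U T^(k+1) N meets the ball in two matrices, hence the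
      -- doubled `Λ`.
      ∑-ℓ : ∀ K R N → det N ≡ + n → Adequate K R N → ∑ (ball R) (λ Q → w Q ℚ.* ℓ K Q N) ≡ Λ K N ℚ.+ Λ K N
      ∑-ℓ K R N d ad = trans (∑-ext (ball R) (λ Q → sym (∑-*ˡ (downFrom K) (w Q) (λ k → ind (Q ∼? (STmat k ⊗ N)) ℚ.- ind (Q ∼? (UTmat k ⊗ N))))))
        (trans (∑-swap (ball R) (downFrom K) (λ Q k → w Q ℚ.* (ind (Q ∼? (STmat k ⊗ N)) ℚ.- ind (Q ∼? (UTmat k ⊗ N)))))
        (trans (∑-∈ (downFrom K) (λ k m → term k (∈-downFrom⁻ m)))
          (∑-+ (downFrom K) (λ k → w (STmat k ⊗ N) ℚ.- w (UTmat k ⊗ N)) (λ k → w (STmat k ⊗ N) ℚ.- w (UTmat k ⊗ N)))))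
        where
        open Adequate ad
        l : ∀ a b c → a ℚ.* (b ℚ.- c) ≡ a ℚ.* b ℚ.- a ℚ.* c
        l = ring-of ringℚ
        l′ : ∀ a b → (a ℚ.+ a) ℚ.- (b ℚ.+ b) ≡ (a ℚ.- b) ℚ.+ (a ℚ.- b)
        l′ = ring-of ringℚ
        term : ∀ k → k ℕ.< K → ∑ (ball R) (λ Q → w Q ℚ.* (ind (Q ∼? (STmat k ⊗ N)) ℚ.- ind (Q ∼? (UTmat k ⊗ N))))
          ≡ (w (STmat k ⊗ N) ℚ.- w (UTmat k ⊗ N)) ℚ.+ (w (STmat k ⊗ N) ℚ.- w (UTmat k ⊗ N))
        term k k<K = trans (∑-ext (ball R) (λ Q → l (w Q) (ind (Q ∼? (STmat k ⊗ N))) (ind (Q ∼? (UTmat k ⊗ N)))))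
          (trans (∑-- (ball R) (λ Q → w Q ℚ.* ind (Q ∼? (STmat k ⊗ N))) (λ Q → w Q ℚ.* ind (Q ∼? (UTmat k ⊗ N))))
          (trans (cong₂ ℚ._-_ (pick R (STmat k ⊗ N) (det-Γ (STmat k) N (STmat-Γ k) d) (ST-norm k k<K))
                              (pick R (UTmat k ⊗ N) (det-Γ (UTmat k) N (UTmat-Γ k) d) (UT-norm k k<K)))
            (l′ (w (STmat k ⊗ N)) (w (UTmat k ⊗ N)))))

      ∑-none : ∀ K {P : ℕ → Set} (P? : ∀ k → Dec (P k)) → (∀ k → ¬ P k) → ∑ (downFrom K) (λ k → ind (P? k)) ≡ 0ℚ
      ∑-none K P? no-P = trans (∑-ext (downFrom K) (λ k → ind-no (P? k) (no-P k))) (∑-zero (downFrom K))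

      ∑-one : ∀ K {P : ℕ → Set} (P? : ∀ k → Dec (P k)) → ∀ k → k ℕ.< K → P k → (∀ i j → P i → P j → i ≡ j) →
        ∑ (downFrom K) (λ k → ind (P? k)) ≡ 1ℚ
      ∑-one K {P} P? k k<K p only = ∑-indicator P? (downFrom K) (Any.map (λ { refl → p }) (∈-downFrom⁺ k<K))
        (AllPairs.map (λ {i} {j} ne (a , b) → ne (only i j a b)) (Unique.downFrom⁺ K))

      module _ (K R : ℕ) (g N : Mat) (d : det N ≡ + n) (ad : Adequate K R N) where
        open Adequate ad
        private
          Q = g ⊗ N
          to-g : ∀ X → Q ∼ (X ⊗ N) → g ∼ X
          to-g X = ⊗-∼-cancelʳ g X N d
          ST-only : ∀ i j → Q ∼ (STmat i ⊗ N) → Q ∼ (STmat j ⊗ N) → i ≡ j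
          ST-only i j r s = STmat-injective i j (∼-trans (∼-sym (to-g (STmat i) r)) (to-g (STmat j) s))
          UT-only : ∀ i j → Q ∼ (UTmat i ⊗ N) → Q ∼ (UTmat j ⊗ N) → i ≡ j
          UT-only i j r s = UTmat-injective i j (∼-trans (∼-sym (to-g (UTmat i) r)) (to-g (UTmat j) s))
          sums : ∀ {x y} → ∑ (downFrom K) (λ k → ind (Q ∼? (STmat k ⊗ N))) ≡ x →
            ∑ (downFrom K) (λ k → ind (Q ∼? (UTmat k ⊗ N))) ≡ y → ℓ K Q N ≡ x ℚ.- y
          sums e f = trans (∑-- (downFrom K) (λ k → ind (Q ∼? (STmat k ⊗ N))) (λ k → ind (Q ∼? (UTmat k ⊗ N)))) (cong₂ ℚ._-_ e f)
          early : ∀ k X → Q ∼ X → (K ℕ.≤ k → w X ≡ 0ℚ) → ¬ w Q ≡ 0ℚ → k ℕ.< K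
          early k X r tail nz with ℕ.<-≤-connex k K
          ... | inj₁ p = p
          ... | inj₂ p = ⊥-elim (nz (trans (even-∼ w-even r) (tail p)))

        -- Cancelling N on the right recovers g from Q up to sign, so at most one index k occurs,
        -- and the nonzero weight of Q forces k < K.
        left01-split : ¬ w Q ≡ 0ℚ → FareyCase g → left01 g ≡ inside g ℚ.+ ℓ K Q N
        left01-split nz (ST-case k r p q) = trans p (sym (cong₂ ℚ._+_ q (sums
          (∑-one K (λ j → Q ∼? (STmat j ⊗ N)) k (early k (STmat k ⊗ N) rN (ST-tail k) nz) rN ST-only)
          (∑-none K (λ j → Q ∼? (UTmat j ⊗ N)) (λ j s → ST≁UT k j (∼-trans (∼-sym r) (to-g (UTmat j) s)))))))
          where
          rN : Q ∼ (STmat k ⊗ N)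
          rN = ∼-⊗ʳ N r
        left01-split nz (UT-case k r p q) = trans p (sym (cong₂ ℚ._+_ q (sums
          (∑-none K (λ j → Q ∼? (STmat j ⊗ N)) (λ j s → ST≁UT j k (∼-trans (∼-sym (to-g (STmat j) s)) r)))
          (∑-one K (λ j → Q ∼? (UTmat j ⊗ N)) k (early k (UTmat k ⊗ N) rN (UT-tail k) nz) rN UT-only))))
          where
          rN : Q ∼ (UTmat k ⊗ N)
          rN = ∼-⊗ʳ N r
        left01-split nz (neither s u p) = trans p (sym (trans (cong (inside g ℚ.+_) (sums
          (∑-none K (λ j → Q ∼? (STmat j ⊗ N)) (λ j r → s j (to-g (STmat j) r)))
          (∑-none K (λ j → Q ∼? (UTmat j ⊗ N)) (λ j r → u j (to-g (UTmat j) r))))) (ℚ.+-identityʳ (inside g))))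

      left01-scale : ∀ k → ¬ k ≡ + 0 → ∀ g → left01 (scale k g) ≡ left01 g
      left01-scale k nz (a , b , c , d) = in01-scale k a c nz

      n≢0ℤ : ¬ + n ≡ + 0
      n≢0ℤ e = ℕ.≢-nonZero⁻¹ n {{n≢0}} (ℤ.+-injective e)

      h-multiple : ∀ g N → det N ≡ + n → h ((g ⊗ N) ⊗ inv N) ≡ left01 g
      h-multiple g N d = trans (cong h (trans (⊗-cancel-invʳ g N) (cong (λ k → scale k g) d)))
        (trans (cong₂ ℚ._*_ (ind-yes (n ∣M? scale (+ n) g) (g , refl)) (left01-scale (+ n) n≢0ℤ g)) (ℚ.*-identityˡ (left01 g)))

      ℓ-none : ∀ K Q N → det N ≡ + n → ¬ (n ∣M (Q ⊗ inv N)) → ℓ K Q N ≡ 0ℚ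
      ℓ-none K Q N d nd = trans (∑-- (downFrom K) (λ k → ind (Q ∼? (STmat k ⊗ N))) (λ k → ind (Q ∼? (UTmat k ⊗ N))))
        (cong₂ ℚ._-_ (∑-none K (λ k → Q ∼? (STmat k ⊗ N)) (λ k r → nd (LeftEquiv⇒∣M n Q N d (STmat k , STmat-Γ k , r))))
                     (∑-none K (λ k → Q ∼? (UTmat k ⊗ N)) (λ k r → nd (LeftEquiv⇒∣M n Q N d (UTmat k , UTmat-Γ k , r)))))

      det-S : ∀ N → det N ≡ + n → det (Smat ⊗ N) ≡ + n
      det-S N d = det-Γ Smat N refl d

      SN-divides : ∀ Q N → det N ≡ + n → det Q ≡ + n → n ∣M (Q ⊗ inv (Smat ⊗ N)) → n ∣M (Q ⊗ inv N)
      SN-divides Q N d dQ p = subst (n ∣M_) e (∣M-⊗ʳ Smat p)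
        where
        e : (Q ⊗ inv (Smat ⊗ N)) ⊗ Smat ≡ Q ⊗ inv N
        e = trans (cong (_⊗ Smat) (trans (cong (Q ⊗_) (inv-⊗ Smat N)) (sym (⊗-assoc Q (inv N) (inv Smat)))))
          (Γ-inv-cancelʳ Smat refl (Q ⊗ inv N))

      inside-S : ∀ g → inside (g ⊗ inv Smat) ≡ inside g
      inside-S (a , b , c , d) = trans (cong inside (mat≡ (l₁ a b) (l₂ a b) (l₁ c d) (l₂ c d)))
        (trans (cong (λ t → t ℚ.* cl01 a c) (cl01-neg b d)) (ℚ.*-comm (cl01 b d) (cl01 a c)))
        where
        l₁ : ∀ a b → a * + 0 + b * -[1+ 0 ] ≡ ℤ.- b
        l₁ = ℤ-ring
        l₂ : ∀ a b → a * + 1 + b * + 0 ≡ a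
        l₂ = ℤ-ring

      -- h and ℓ differ by the invariant `inside`, which does not see the orientation of a Farey edge.
      exchange : ∀ K R N → det N ≡ + n → Adequate K R N → Adequate K R (Smat ⊗ N) → ∀ Q →
        w Q ℚ.* (h (Q ⊗ inv N) ℚ.- h (Q ⊗ inv (Smat ⊗ N))) ≡ w Q ℚ.* (ℓ K Q N ℚ.- ℓ K Q (Smat ⊗ N))
      exchange K R N d ad adS Q = go (w Q ℚ.≟ 0ℚ) (w-det Q)
        where
        SN = Smat ⊗ N
        goal = w Q ℚ.* (h (Q ⊗ inv N) ℚ.- h (Q ⊗ inv SN)) ≡ w Q ℚ.* (ℓ K Q N ℚ.- ℓ K Q SN)
        vanishing : w Q ≡ 0ℚ → goal
        vanishing z = trans (cong (λ t → t ℚ.* (h (Q ⊗ inv N) ℚ.- h (Q ⊗ inv SN))) z)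
          (trans (ℚ.*-zeroˡ (h (Q ⊗ inv N) ℚ.- h (Q ⊗ inv SN))) (sym (trans (cong (λ t → t ℚ.* (ℓ K Q N ℚ.- ℓ K Q SN)) z)
          (ℚ.*-zeroˡ (ℓ K Q N ℚ.- ℓ K Q SN)))))
        l : ∀ i x y → (i ℚ.+ x) ℚ.- (i ℚ.+ y) ≡ x ℚ.- y
        l = ring-of ringℚ
        divisible : ¬ w Q ≡ 0ℚ → det Q ≡ + n → n ∣M (Q ⊗ inv N) → h (Q ⊗ inv N) ℚ.- h (Q ⊗ inv SN) ≡ ℓ K Q N ℚ.- ℓ K Q SN
        divisible nz dQ (g , e) = trans (cong₂ ℚ._-_ hN hSN) (l (inside g) (ℓ K Q N) (ℓ K Q SN))
          where
          q : InΓ g × Q ≡ g ⊗ N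
          q = quotient-Γ n Q N dQ d e
          g′ = g ⊗ inv Smat
          g′Γ : InΓ g′
          g′Γ = Γ-⊗ g (inv Smat) (proj₁ q) refl
          Q≡ : Q ≡ g′ ⊗ SN
          Q≡ = trans (proj₂ q) (sym (trans (⊗-assoc g (inv Smat) SN) (cong (g ⊗_) (Γ-inv-cancelˡ Smat refl N))))
          hN : h (Q ⊗ inv N) ≡ inside g ℚ.+ ℓ K Q N
          hN = trans (cong (λ M → h (M ⊗ inv N)) (proj₂ q)) (trans (h-multiple g N d)
            (trans (left01-split K R g N d ad (subst (λ M → ¬ w M ≡ 0ℚ) (proj₂ q) nz) (farey _ _ _ _ (proj₁ q)))
            (cong (λ M → inside g ℚ.+ ℓ K M N) (sym (proj₂ q)))))
          hSN : h (Q ⊗ inv SN) ≡ inside g ℚ.+ ℓ K Q SN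
          hSN = trans (cong (λ M → h (M ⊗ inv SN)) Q≡) (trans (h-multiple g′ SN (det-S N d))
            (trans (left01-split K R g′ SN (det-S N d) adS (subst (λ M → ¬ w M ≡ 0ℚ) Q≡ nz) (farey _ _ _ _ g′Γ))
            (cong₂ (λ s M → s ℚ.+ ℓ K M SN) (inside-S g) (sym Q≡))))
        indivisible : det Q ≡ + n → ¬ (n ∣M (Q ⊗ inv N)) → h (Q ⊗ inv N) ℚ.- h (Q ⊗ inv SN) ≡ ℓ K Q N ℚ.- ℓ K Q SN
        indivisible dQ nd = trans (cong₂ ℚ._-_ (zero-h N nd) (zero-h SN (λ p → nd (SN-divides Q N d dQ p))))
          (sym (cong₂ ℚ._-_ (ℓ-none K Q N d nd) (ℓ-none K Q SN (det-S N d) (λ p → nd (SN-divides Q N d dQ p)))))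
          where
          zero-h : ∀ N → ¬ (n ∣M (Q ⊗ inv N)) → h (Q ⊗ inv N) ≡ 0ℚ
          zero-h N nd = trans (cong (λ t → t ℚ.* left01 (Q ⊗ inv N)) (ind-no (n ∣M? (Q ⊗ inv N)) nd)) (ℚ.*-zeroˡ (left01 (Q ⊗ inv N)))
        by : ¬ w Q ≡ 0ℚ → det Q ≡ + n → Dec (n ∣M (Q ⊗ inv N)) → goal
        by nz dQ (yes p) = cong (w Q ℚ.*_) (divisible nz dQ p)
        by nz dQ (no p) = cong (w Q ℚ.*_) (indivisible dQ p)
        go : Dec (w Q ≡ 0ℚ) → det Q ≡ + n ⊎ w Q ≡ 0ℚ → goal
        go (yes z) _ = vanishing z
        go (no nz) (inj₂ z) = vanishing z
        go (no nz) (inj₁ dQ) = by nz dQ (n ∣M? (Q ⊗ inv N))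

      H-difference : ∀ K R N → det N ≡ + n → Adequate K R N → Adequate K R (Smat ⊗ N) →
        H R N ℚ.- H R (Smat ⊗ N) ≡ (Λ K N ℚ.- Λ K (Smat ⊗ N)) ℚ.+ (Λ K N ℚ.- Λ K (Smat ⊗ N))
      H-difference K R N d ad adS = trans (sym (distribute (λ Q → h (Q ⊗ inv N)) (λ Q → h (Q ⊗ inv SN))))
        (trans (∑-ext (ball R) (exchange K R N d ad adS))
        (trans (distribute (λ Q → ℓ K Q N) (λ Q → ℓ K Q SN))
        (trans (cong₂ ℚ._-_ (∑-ℓ K R N d ad) (∑-ℓ K R SN (det-S N d) adS)) (l′ (Λ K N) (Λ K SN)))))
        where
        SN = Smat ⊗ N
        l : ∀ a b c → a ℚ.* (b ℚ.- c) ≡ a ℚ.* b ℚ.- a ℚ.* c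
        l = ring-of ringℚ
        l′ : ∀ a b → (a ℚ.+ a) ℚ.- (b ℚ.+ b) ≡ (a ℚ.- b) ℚ.+ (a ℚ.- b)
        l′ = ring-of ringℚ
        distribute : ∀ (f g : Mat → ℚ) → ∑ (ball R) (λ Q → w Q ℚ.* (f Q ℚ.- g Q)) ≡ ∑ (ball R) (λ Q → w Q ℚ.* f Q) ℚ.- ∑ (ball R) (λ Q → w Q ℚ.* g Q)
        distribute f g = trans (∑-ext (ball R) (λ Q → l (w Q) (f Q) (g Q))) (∑-- (ball R) (λ Q → w Q ℚ.* f Q) (λ Q → w Q ℚ.* g Q))

      H-even : ∀ R → Even (H R)
      H-even R N = ∑-ext (ball R) (λ Q → cong (w Q ℚ.*_) (trans (cong h (negM-⊗ʳ Q (inv N))) (h-even (Q ⊗ inv N))))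

      h-T : ∀ G → h (G ⊗ inv Tmat) ≡ h G
      h-T G@(a , b , c , d) = cong₂ ℚ._*_ (ind-cong (n ∣M? (G ⊗ inv Tmat)) (n ∣M? G)
          (λ p → subst (n ∣M_) (Γ-inv-cancelʳ Tmat refl G) (∣M-⊗ʳ Tmat p)) (∣M-⊗ʳ (inv Tmat)))
        (cong left01 (⊗-Tz -[1+ 0 ] a b c d))

      H-T : ∀ R N → H R (Tmat ⊗ N) ≡ H R N
      H-T R N = ∑-ext (ball R) (λ Q → cong (w Q ℚ.*_) (trans
        (cong h (trans (cong (Q ⊗_) (inv-⊗ Tmat N)) (sym (⊗-assoc Q (inv N) (inv Tmat))))) (h-T (Q ⊗ inv N))))

    module _ (Tinf : List Mat) (reps : IsRepsInfty n Tinf) where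

      private
        -- N fixes ∞, so Q N⁻¹ and Q send ∞ to the same cusp; the lower right entry d of N is the
        -- common nonzero factor.
        upper-left01 : ∀ Q N → det N ≡ + n × lowerLeft N ≡ + 0 → left01 (Q ⊗ inv N) ≡ left01 Q
        upper-left01 (A , B , C , D) (a , b , .(+ 0) , d) (e , refl) =
          trans (cong₂ in01 (l A B d) (l C D d)) (in01-scale d A C d≢0)
          where
          l : ∀ A B d → A * d + B * + 0 ≡ d * A
          l = ℤ-ring
          d≢0 : ¬ d ≡ + 0
          d≢0 refl = n≢0ℤ (trans (sym e) (l₀ a b))
            where
            l₀ : ∀ a b → a * + 0 - b * + 0 ≡ + 0
            l₀ = ℤ-ring

        ∑-h : ∀ Q → det Q ≡ + n → ∑ Tinf (λ N → h (Q ⊗ inv N)) ≡ left01 Q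
        ∑-h Q dQ = trans (∑-∈ Tinf (λ N m → cong (ind (n ∣M? (Q ⊗ inv N)) ℚ.*_) (upper-left01 Q N (All.lookup (proj₁ reps) m))))
          (trans (∑-*ʳ Tinf (λ N → ind (n ∣M? (Q ⊗ inv N))) (left01 Q))
          (trans (cong (λ t → t ℚ.* left01 Q) (∑-left-representatives n reps Q dQ)) (ℚ.*-identityˡ (left01 Q))))

        left01-S : ∀ Q → left01 (Q ⊗ inv Smat) ≡ right01 Q
        left01-S (A , B , C , D) = trans (cong₂ in01 (l A B) (l C D)) (in01-neg B D)
          where
          l : ∀ A B → A * + 0 + B * -[1+ 0 ] ≡ ℤ.- B
          l = ℤ-ring

        weighted : ∀ (f g : Mat → ℚ) → (∀ Q → det Q ≡ + n → f Q ≡ g Q) → ∀ Q → w Q ℚ.* f Q ≡ w Q ℚ.* g Q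
        weighted f g e Q with w-det Q
        ... | inj₁ d = cong (w Q ℚ.*_) (e Q d)
        ... | inj₂ z = trans (cong (λ t → t ℚ.* f Q) z) (trans (ℚ.*-zeroˡ (f Q)) (sym (trans (cong (λ t → t ℚ.* g Q) z) (ℚ.*-zeroˡ (g Q)))))

        ∑-H : ∀ R (φ : Mat → Mat) (g : Mat → ℚ) → (∀ Q → det Q ≡ + n → ∑ Tinf (λ N → h (Q ⊗ φ N)) ≡ g Q) →
          ∑ Tinf (λ N → ∑ (ball R) (λ Q → w Q ℚ.* h (Q ⊗ φ N))) ≡ ∑ (ball R) (λ Q → w Q ℚ.* g Q)
        ∑-H R φ g e = trans (∑-swap Tinf (ball R) (λ N Q → w Q ℚ.* h (Q ⊗ φ N)))
          (∑-ext (ball R) (λ Q → trans (∑-*ˡ Tinf (w Q) (λ N → h (Q ⊗ φ N)))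
            (weighted (λ Q → ∑ Tinf (λ N → h (Q ⊗ φ N))) g e Q)))

        -- Every Q of determinant n lies in exactly one ΓN. Since (NS)⁻¹ sends ∞ to 0, the second
        -- part sees the cusp Q0 where the first sees Q∞.
        boundary : ∀ R → ∑ Tinf (λ N → H R N ℚ.- H R (N ⊗ Smat)) ≡ ∑ (ball R) (λ Q → w Q ℚ.* (left01 Q ℚ.- right01 Q))
        boundary R = trans (∑-- Tinf (H R) (λ N → H R (N ⊗ Smat)))
          (trans (cong₂ ℚ._-_ (∑-H R inv left01 ∑-h) (∑-H R (λ N → inv (N ⊗ Smat)) right01 ∑-hS))
          (trans (sym (∑-- (ball R) (λ Q → w Q ℚ.* left01 Q) (λ Q → w Q ℚ.* right01 Q)))
            (∑-ext (ball R) (λ Q → l (w Q) (left01 Q) (right01 Q)))))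
          where
          l : ∀ a b c → a ℚ.* b ℚ.- a ℚ.* c ≡ a ℚ.* (b ℚ.- c)
          l = ring-of ringℚ
          ∑-hS : ∀ Q → det Q ≡ + n → ∑ Tinf (λ N → h (Q ⊗ inv (N ⊗ Smat))) ≡ right01 Q
          ∑-hS Q dQ = trans (∑-ext Tinf (λ N → cong h (trans (cong (Q ⊗_) (inv-⊗ N Smat)) (sym (⊗-assoc Q (inv Smat) (inv N))))))
            (trans (∑-h (Q ⊗ inv Smat) (trans (det-⊗ Q (inv Smat)) (trans (ℤ.*-identityʳ (det Q)) dQ))) (left01-S Q))

      pair-Λ : ∀ ξ → InR n ξ → CondA n Tinf ξ → ∀ K R →
        All (λ p → Adequate K R (proj₂ p) × Adequate K R (Smat ⊗ proj₂ p)) ξ →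
        ⟪ ξ ∣ (λ N → Λ K N ℚ.- Λ K (Smat ⊗ N)) ⟫ ℚ.+ ⟪ ξ ∣ (λ N → Λ K N ℚ.- Λ K (Smat ⊗ N)) ⟫
          ≡ ∑ (ball R) (λ Q → w Q ℚ.* (left01 Q ℚ.- right01 Q))
      pair-Λ ξ ξR A K R ad = trans (sym (pair-+ ξ (λ N → Λ K N ℚ.- Λ K (Smat ⊗ N)) (λ N → Λ K N ℚ.- Λ K (Smat ⊗ N))))
        (trans (pair-cong ξ (All.zipWith (λ {p} (d , (a , b)) → sym (H-difference K R (proj₂ p) d a b)) (ξR , ad)))
        (trans (pair-A n ξ Tinf A {H R} (H-even R) (λ N _ → H-T R N)) (boundary R)))

-- Eventually true statements about natural numbers

Eventually : (ℕ → Set) → Set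
Eventually P = ∃[ K ] (∀ k → K ℕ.≤ k → P k)

eventually-map : ∀ {P Q : ℕ → Set} → (∀ k → P k → Q k) → Eventually P → Eventually Q
eventually-map f (K , h) = K , λ k p → f k (h k p)

eventually-× : ∀ {P Q : ℕ → Set} → Eventually P → Eventually Q → Eventually (λ k → P k × Q k)
eventually-× (K , p) (L , q) = K ℕ.⊔ L , λ k h → p k (ℕ.≤-trans (ℕ.m≤m⊔n K L) h) , q k (ℕ.≤-trans (ℕ.m≤n⊔m K L) h)

eventually-All : ∀ {A : Set} {P : A → ℕ → Set} (L : List A) → All (λ x → Eventually (P x)) L → Eventually (λ k → All (λ x → P x k) L)
eventually-All [] [] = 0 , λ _ _ → []
eventually-All (x ∷ L) (p ∷ ps) = eventually-map (λ k (a , b) → a ∷ b) (eventually-× p (eventually-All L ps))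

eventually-below : ∀ {P : ℕ → ℕ → Set} K → (∀ k → Eventually (P k)) → Eventually (λ R → ∀ k → k ℕ.< K → P k R)
eventually-below zero h = 0 , λ _ _ _ ()
eventually-below {P} (suc K) h = eventually-map both (eventually-× (h K) (eventually-below {P} K h))
  where
  both : ∀ R → P K R × (∀ k → k ℕ.< K → P k R) → ∀ k → k ℕ.< suc K → P k R
  both R (a , b) k p with ℕ.m≤n⇒m<n∨m≡n (ℕ.≤-pred p)
  ... | inj₁ q = b k q
  ... | inj₂ refl = a

Tail : (ℕ → ℚ) → Set
Tail f = Eventually (λ k → f k ≡ 0ℚ)

tail-suc : ∀ {f} → Tail f → Tail (λ k → f (suc k))
tail-suc (K , h) = K , λ k p → h (suc k) (ℕ.≤-trans p (ℕ.n≤1+n k))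

eventually-tail : ∀ {f} → Tail f → Eventually (λ K → ∀ k → K ℕ.≤ k → f k ≡ 0ℚ)
eventually-tail (K , h) = K , λ L p k q → h k (ℕ.≤-trans p q)

-- Telescoping the relations from (B) against (A)

module _ (n : ℕ) .{{n≢0 : NonZero n}} (Tinf : List Mat) (reps : IsRepsInfty n Tinf)
         (ξ : Formal) (ξR : InR n ξ) (A : CondA n Tinf ξ)
         (w : Mat → ℚ) (w-even : Even w) (w-det : ∀ Q → det Q ≡ + n ⊎ w Q ≡ 0ℚ)
         (ST-tails : ∀ N → det N ≡ + n → Tail (λ k → w (STmat k ⊗ N)))
         (UT-tails : ∀ N → det N ≡ + n → Tail (λ k → w (UTmat k ⊗ N)))
         (ρ : ℕ → Mat → ℚ) (ρ-tails : ∀ N → det N ≡ + n → Tail (λ k → ρ k N))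
         (relation : ∀ k → ⟪ ξ ∣ (λ N → (ρ k N ℚ.- ρ (suc k) N) ℚ.+
            ((w (STmat k ⊗ N) ℚ.- w (UTmat k ⊗ N)) ℚ.- (w (STmat k ⊗ (Smat ⊗ N)) ℚ.- w (UTmat k ⊗ (Smat ⊗ N))))) ⟫ ≡ 0ℚ)
         where

  private
    Λw = Λ n w w-even w-det
    Ad = Adequate n w w-even w-det

    δ : ℕ → Mat → ℚ
    δ K N = Λw K N ℚ.- Λw K (Smat ⊗ N)

    telescope : ∀ K → ⟪ ξ ∣ (λ N → (ρ 0 N ℚ.- ρ K N) ℚ.+ δ K N) ⟫ ≡ 0ℚ
    telescope zero = trans (pair-ext ξ (λ N → l (ρ 0 N))) (trans (∑-ext ξ (λ p → ℚ.*-zeroʳ (proj₁ p))) (∑-zero ξ))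
      where
      l : ∀ x → (x ℚ.- x) ℚ.+ (0ℚ ℚ.- 0ℚ) ≡ 0ℚ
      l = ring-of ringℚ
    telescope (suc K) = trans (pair-ext ξ (λ N → l (ρ 0 N) (ρ K N) (ρ (suc K) N)
        (w (STmat K ⊗ N) ℚ.- w (UTmat K ⊗ N)) (Λw K N) (w (STmat K ⊗ (Smat ⊗ N)) ℚ.- w (UTmat K ⊗ (Smat ⊗ N))) (Λw K (Smat ⊗ N))))
      (trans (pair-+ ξ (λ N → (ρ 0 N ℚ.- ρ K N) ℚ.+ δ K N) (λ N → (ρ K N ℚ.- ρ (suc K) N) ℚ.+
            ((w (STmat K ⊗ N) ℚ.- w (UTmat K ⊗ N)) ℚ.- (w (STmat K ⊗ (Smat ⊗ N)) ℚ.- w (UTmat K ⊗ (Smat ⊗ N))))))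
      (cong₂ ℚ._+_ (telescope K) (relation K)))
      where
      l : ∀ x y z a b c d → (x ℚ.- z) ℚ.+ ((a ℚ.+ b) ℚ.- (c ℚ.+ d)) ≡ ((x ℚ.- y) ℚ.+ (b ℚ.- d)) ℚ.+ ((y ℚ.- z) ℚ.+ (a ℚ.- c))
      l = ring-of ringℚ

    det-S′ : ∀ N → det N ≡ + n → det (Smat ⊗ N) ≡ + n
    det-S′ N d = trans (det-⊗ Smat N) (trans (ℤ.*-identityˡ (det N)) d)

    norm-bound : ∀ M → Eventually (λ R → norm M ℕ.≤ R)
    norm-bound M = norm M , λ _ p → p

    adequate : ∀ N → det N ≡ + n → Eventually (λ K → Eventually (λ R → Ad K R N))
    adequate N d = eventually-map
      (λ K (s , u) → eventually-map (λ R (a , b) → record { ST-tail = s ; UT-tail = u ; ST-norm = a ; UT-norm = b })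
        (eventually-× (eventually-below K (λ k → norm-bound (STmat k ⊗ N))) (eventually-below K (λ k → norm-bound (UTmat k ⊗ N)))))
      (eventually-× (eventually-tail (ST-tails N d)) (eventually-tail (UT-tails N d)))

  -- K is chosen once for the finitely many matrices of ξ, so that `ρ K` vanishes on all of them,
  -- and R depends on K. The ball sum is evaluated later, again for large R, so the identity is kept
  -- in this eventual form.
  pair-ρ : Eventually (λ R → (⟪ ξ ∣ ρ 0 ⟫ ℚ.+ ⟪ ξ ∣ ρ 0 ⟫) ℚ.+ ∑ (ball R) (λ Q → w Q ℚ.* (left01 Q ℚ.- right01 Q)) ≡ 0ℚ)
  pair-ρ = eventually-map conclude (eventually-All ξ (proj₂ allK K₀ ℕ.≤-refl .proj₁))
    where
    AdBoth : ℕ → ℕ → ℚ × Mat → Set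
    AdBoth K R p = Ad K R (proj₂ p) × Ad K R (Smat ⊗ proj₂ p)
    allK : Eventually (λ K → All (λ p → Eventually (λ R → AdBoth K R p)) ξ × All (λ p → ρ K (proj₂ p) ≡ 0ℚ) ξ)
    allK = eventually-×
      (eventually-All ξ (All.map (λ {p} d → eventually-map (λ K (a , b) → eventually-× a b)
        (eventually-× (adequate (proj₂ p) d) (adequate (Smat ⊗ proj₂ p) (det-S′ (proj₂ p) d)))) ξR))
      (eventually-All ξ (All.map (λ {p} d → ρ-tails (proj₂ p) d) ξR))
    K₀ = proj₁ allK
    ρ-zero : All (λ p → ρ K₀ (proj₂ p) ≡ 0ℚ) ξ
    ρ-zero = proj₂ (proj₂ allK K₀ ℕ.≤-refl)
    sum-zero : ⟪ ξ ∣ ρ 0 ⟫ ℚ.+ ⟪ ξ ∣ δ K₀ ⟫ ≡ 0ℚ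
    sum-zero = trans (sym (pair-+ ξ (ρ 0) (δ K₀))) (trans (pair-cong ξ (All.map (λ {p} z →
      sym (trans (cong (λ t → (ρ 0 (proj₂ p) ℚ.- t) ℚ.+ δ K₀ (proj₂ p)) z) (l (ρ 0 (proj₂ p)) (δ K₀ (proj₂ p))))) ρ-zero)) (telescope K₀))
      where
      l : ∀ x y → (x ℚ.- 0ℚ) ℚ.+ y ≡ x ℚ.+ y
      l = ring-of ringℚ
    conclude : ∀ R → All (AdBoth K₀ R) ξ → (⟪ ξ ∣ ρ 0 ⟫ ℚ.+ ⟪ ξ ∣ ρ 0 ⟫) ℚ.+ ∑ (ball R) (λ Q → w Q ℚ.* (left01 Q ℚ.- right01 Q)) ≡ 0ℚ
    conclude R ad = trans (cong ((⟪ ξ ∣ ρ 0 ⟫ ℚ.+ ⟪ ξ ∣ ρ 0 ⟫) ℚ.+_) (sym (pair-Λ n w w-even w-det Tinf reps ξ ξR A K₀ R ad)))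
      (trans (l ⟪ ξ ∣ ρ 0 ⟫ ⟪ ξ ∣ δ K₀ ⟫) (cong₂ ℚ._+_ sum-zero sum-zero))
      where
      l : ∀ x y → (x ℚ.+ x) ℚ.+ (y ℚ.+ y) ≡ (x ℚ.+ y) ℚ.+ (x ℚ.+ y)
      l = ring-of ringℚ

-- Conjugation-equivariant masses

-- The indicator of the open arc (∞,0] without 0, that is, of the negative cusps x/y.
opp : ℤ → ℤ → ℚ
opp +[1+ _ ] -[1+ _ ] = 1ℚ
opp -[1+ _ ] +[1+ _ ] = 1ℚ
opp +[1+ _ ] +[1+ _ ] = 0ℚ
opp -[1+ _ ] -[1+ _ ] = 0ℚ
opp +0 _ = 0ℚ
opp +[1+ _ ] +0 = 0ℚ
opp -[1+ _ ] +0 = 0ℚ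

opp-neg : ∀ x y → opp (ℤ.- x) (ℤ.- y) ≡ opp x y
opp-neg +0 y = refl
opp-neg +[1+ _ ] +0 = refl
opp-neg +[1+ _ ] +[1+ _ ] = refl
opp-neg +[1+ _ ] -[1+ _ ] = refl
opp-neg -[1+ _ ] +0 = refl
opp-neg -[1+ _ ] +[1+ _ ] = refl
opp-neg -[1+ _ ] -[1+ _ ] = refl

opp-zeroʳ : ∀ x → opp x +0 ≡ 0ℚ
opp-zeroʳ +0 = refl
opp-zeroʳ +[1+ _ ] = refl
opp-zeroʳ -[1+ _ ] = refl

opp-yes : ∀ {x m} → x < 0ℤ → opp x +[1+ m ] ≡ 1ℚ
opp-yes {+ _} (ℤ.+<+ ())
opp-yes { -[1+ _ ]} _ = refl

opp-no : ∀ {x m} → 0ℤ ≤ x → opp x +[1+ m ] ≡ 0ℚ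
opp-no {+0} _ = refl
opp-no {+[1+ _ ]} _ = refl
opp-no { -[1+ _ ]} ()

private

  below : ∀ a c → a < c → a - c < 0ℤ
  below a c p = nn⇒< (nn-≡ (<⇒nn p) (l a c))
    where
    l : ∀ a c → c - a - + 1 ≡ 0ℤ - (a - c) - + 1
    l = ℤ-ring

  nonpos-pos : ∀ {x m} → +[1+ m ] < x → x ≤ 0ℤ → ⊥
  nonpos-pos r s with ℤ.<-≤-trans r s
  ... | ℤ.+<+ ()

  neg-below : ∀ {a m} → a < 0ℤ → a < +[1+ m ]
  neg-below p = ℤ.<-trans p (ℤ.+<+ (ℕ.s≤s ℕ.z≤n))

  neg-sub : ∀ a c → ℤ.- a - c ≡ ℤ.- (a - ℤ.- c)
  neg-sub = ℤ-ring

  neg-add : ∀ a c → ℤ.- a + c ≡ ℤ.- (a + ℤ.- c)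
  neg-add = ℤ-ring

  in01-opp⁺ : ∀ a m → in01 a +[1+ m ] ≡ opp (a - +[1+ m ]) +[1+ m ] ℚ.- opp a +[1+ m ]
  in01-opp⁺ a m = go (0ℤ ≤? a) (a <? +[1+ m ])
    where
    go : Dec (0ℤ ≤ a) → Dec (a < +[1+ m ]) → in01 a +[1+ m ] ≡ opp (a - +[1+ m ]) +[1+ m ] ℚ.- opp a +[1+ m ]
    go (yes p) (yes q) = trans (ind-yes (In01? a +[1+ m ]) (inj₁ (p , q)))
        (sym (cong₂ ℚ._-_ (opp-yes {m = m} (below a +[1+ m ] q)) (opp-no {m = m} p)))
    go (yes p) (no q) = trans (ind-no (In01? a +[1+ m ]) λ { (inj₁ (_ , r)) → q r ; (inj₂ (r , s)) → nonpos-pos r s })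
        (sym (cong₂ ℚ._-_ (opp-no {m = m} (≤⇒nn (ℤ.≮⇒≥ q))) (opp-no {m = m} p)))
    go (no p) _ = trans (ind-no (In01? a +[1+ m ]) λ { (inj₁ (r , _)) → p r ; (inj₂ (r , s)) → nonpos-pos r s })
        (sym (cong₂ ℚ._-_ (opp-yes {m = m} (below a +[1+ m ] (neg-below (ℤ.≰⇒> p)))) (opp-yes {m = m} (ℤ.≰⇒> p))))

  in01-opp′⁺ : ∀ a m → in01 -[1+ m ] a ≡ 0ℚ ℚ.+ opp (a + +[1+ m ]) +[1+ m ]
  in01-opp′⁺ a m with a + +[1+ m ] <? 0ℤ
  ... | yes p = trans (ind-yes (In01? -[1+ m ] a) (inj₂ (nn⇒< (nn-≡ (<⇒nn p) (l a +[1+ m ])) , ℤ.-≤+)))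
        (sym (cong (0ℚ ℚ.+_) (opp-yes {m = m} p)))
    where
    l : ∀ a c → 0ℤ - (a + c) - + 1 ≡ ℤ.- c - a - + 1
    l = ℤ-ring
  ... | no p = trans (ind-no (In01? -[1+ m ] a) λ { (inj₁ (() , _)) ; (inj₂ (r , _)) → p (nn⇒< (nn-≡ (<⇒nn r) (l a +[1+ m ]))) })
        (sym (cong (0ℚ ℚ.+_) (opp-no {m = m} (ℤ.≮⇒≥ p))))
    where
    l : ∀ a c → ℤ.- c - a - + 1 ≡ 0ℤ - (a + c) - + 1
    l = ℤ-ring

  opp-shift⁺ : ∀ a m → opp (a - +[1+ m ]) +[1+ m ] ≡ 0ℚ → opp a +[1+ m ] ≡ 0ℚ
  opp-shift⁺ a m e = go (0ℤ ≤? a)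
    where
    go : Dec (0ℤ ≤ a) → opp a +[1+ m ] ≡ 0ℚ
    go (yes p) = opp-no p
    go (no p) with trans (sym (opp-yes {m = m} (below a +[1+ m ] (neg-below (ℤ.≰⇒> p))))) e
    ... | ()

-- A cusp lies in [0,1) if subtracting 1 makes it negative and it was not negative before.
in01-opp : ∀ a c → in01 a c ≡ opp (a - c) c ℚ.- opp a c
in01-opp a +0 = trans (ind-no (In01? a +0)
    (λ { (inj₁ (p , q)) → ℤ.<-irrefl refl (ℤ.≤-<-trans p q) ; (inj₂ (p , q)) → ℤ.<-irrefl refl (ℤ.<-≤-trans p q) }))
    (sym (cong₂ ℚ._-_ (opp-zeroʳ (a - +0)) (opp-zeroʳ a)))
in01-opp a +[1+ m ] = in01-opp⁺ a m
in01-opp a -[1+ m ] = trans (sym (in01-neg a -[1+ m ])) (trans (in01-opp⁺ (ℤ.- a) m)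
    (cong₂ ℚ._-_ (trans (cong (λ t → opp t +[1+ m ]) (neg-sub a +[1+ m ])) (opp-neg (a - -[1+ m ]) -[1+ m ])) (opp-neg a -[1+ m ])))

-- S carries [∞,-1) onto [0,1): the cusp ∞ gives the first term, and a/c < -1 gives the second.
in01-opp′ : ∀ a c → NonzeroPair a c → in01 (ℤ.- c) a ≡ ind (c ≟ + 0) ℚ.+ opp (a + c) c
in01-opp′ a +0 nz = trans (ind-yes (In01? +0 a) (axis a (λ e → nz (e , refl)))) (sym (cong (1ℚ ℚ.+_) (opp-zeroʳ (a + +0))))
  where
  axis : ∀ a → ¬ a ≡ + 0 → In01 +0 a
  axis +0 ne = ⊥-elim (ne refl)
  axis +[1+ _ ] _ = inj₁ (ℤ.≤-refl , ℤ.+<+ (ℕ.s≤s ℕ.z≤n))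
  axis -[1+ _ ] _ = inj₂ (ℤ.-<+ , ℤ.≤-refl)
in01-opp′ a +[1+ m ] nz = in01-opp′⁺ a m
in01-opp′ a -[1+ m ] nz = trans (sym (in01-neg +[1+ m ] a)) (trans (in01-opp′⁺ (ℤ.- a) m)
    (cong (0ℚ ℚ.+_) (trans (cong (λ t → opp t +[1+ m ]) (neg-add a +[1+ m ])) (opp-neg (a + -[1+ m ]) -[1+ m ]))))

opp-shift : ∀ a c → opp (a - c) c ≡ 0ℚ → opp a c ≡ 0ℚ
opp-shift a +0 _ = opp-zeroʳ a
opp-shift a +[1+ m ] e = opp-shift⁺ a m e
opp-shift a -[1+ m ] e = trans (sym (opp-neg a -[1+ m ])) (opp-shift⁺ (ℤ.- a) m
    (trans (cong (λ t → opp t +[1+ m ]) (neg-sub a +[1+ m ])) (trans (opp-neg (a - -[1+ m ]) -[1+ m ]) e)))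

-- Matrix words

U²U⊗ : ∀ N → U²mat ⊗ (Umat ⊗ N) ≡ negM N
U²U⊗ (a , b , c , d) = trans (cong (U²mat ⊗_) (Umat-⊗ a b c d))
  (trans (U²mat-⊗ (a - c) (b - d) a b) (mat≡ refl refl (l a c) (l b d)))
  where
  l : ∀ a c → a - c - a ≡ ℤ.- c
  l = ℤ-ring

conjS conjU conjU² τ τ⁻¹ : Mat → Mat
conjS Q = (Smat ⊗ Q) ⊗ Smat
conjU Q = (Umat ⊗ Q) ⊗ U²mat
conjU² Q = (U²mat ⊗ Q) ⊗ Umat
τ Q = (Tmat ⊗ Q) ⊗ Tz -[1+ 0 ]
τ⁻¹ Q = (Tz -[1+ 0 ] ⊗ Q) ⊗ Tmat

T⊗Tz : ∀ k N → Tz k ⊗ (Tmat ⊗ N) ≡ Tz (+ 1 + k) ⊗ N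
T⊗Tz k N = trans (sym (⊗-assoc (Tz k) Tmat N)) (cong (_⊗ N) (trans (Tz-+ k (+ 1)) (cong Tz (ℤ.+-comm k (+ 1)))))

Tz-pow : ℕ → Mat
Tz-pow k = Tz (+ k)

T-Tz : ∀ k N → Tmat ⊗ (Tz-pow k ⊗ N) ≡ Tz-pow (suc k) ⊗ N
T-Tz k N = trans (sym (⊗-assoc Tmat (Tz-pow k) N)) (cong (_⊗ N) (Tz-+ (+ 1) (+ k)))

Tk-U : ∀ k N → Tz-pow k ⊗ (Umat ⊗ N) ≡ Tz-pow (suc k) ⊗ (Smat ⊗ N)
Tk-U k N = trans (cong (Tz-pow k ⊗_) (sym (T⊗S⊗ N))) (T⊗Tz (+ k) (Smat ⊗ N))

-- P Q is the mass of the arc (∞,0] for a measure on P¹ of total mass e Q attached to Q, equivariantly for conjugation: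
-- S maps this arc to its complement, and U and U² map it to the other two arcs cut out by 0, 1, ∞.
record EquivariantMass (n : ℕ) : Set where
  field
    P e : Mat → ℚ
    P-even : Even P
    P-S : ∀ Q → P Q ℚ.+ P (conjS Q) ≡ e Q
    P-U : ∀ Q → P Q ℚ.+ P (conjU Q) ℚ.+ P (conjU² Q) ≡ e Q
    P-det : ∀ Q → det Q ≡ + n ⊎ P Q ≡ 0ℚ
    P-tail : ∀ N → det N ≡ + n → Tail (λ k → P (Tz-pow k ⊗ N))

  -- The mass of U(∞,0] = (1,∞], which together with (∞,0] and (0,1] makes up the total.
  w : Mat → ℚ
  w Q = P (conjU² Q)

  w-even : Even w
  w-even Q = trans (cong P (trans (cong (_⊗ Umat) (negM-⊗ʳ U²mat Q)) (negM-⊗ˡ (U²mat ⊗ Q) Umat))) (P-even (conjU² Q))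

  w-det : ∀ Q → det Q ≡ + n ⊎ w Q ≡ 0ℚ
  w-det Q with P-det (conjU² Q)
  ... | inj₂ z = inj₂ z
  ... | inj₁ d = inj₁ (trans (sym (trans (det-⊗ (U²mat ⊗ Q) Umat) (trans (ℤ.*-identityʳ (det (U²mat ⊗ Q)))
    (trans (det-⊗ U²mat Q) (ℤ.*-identityˡ (det Q)))))) d)

  private
    tail-⊗ : ∀ γ → InΓ γ → ∀ N → det N ≡ + n → Tail (λ k → P (Tz-pow k ⊗ (N ⊗ γ)))
    tail-⊗ γ g N d = P-tail (N ⊗ γ) (trans (det-⊗ N γ) (trans (cong (det N *_) g) (trans (ℤ.*-identityʳ (det N)) d)))

    tail-+ : ∀ {f g} → Tail f → Tail g → Tail (λ k → f k ℚ.+ g k)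
    tail-+ p q = eventually-map (λ k (a , b) → cong₂ ℚ._+_ a b) (eventually-× p q)

    tail-- : ∀ {f g} → Tail f → Tail g → Tail (λ k → f k ℚ.- g k)
    tail-- p q = eventually-map (λ k (a , b) → cong₂ ℚ._-_ a b) (eventually-× p q)

    tail-≡ : ∀ {f g} → (∀ k → f k ≡ g k) → Tail f → Tail g
    tail-≡ h = eventually-map (λ k p → trans (sym (h k)) p)

  w-UT : ∀ k N → w (UTmat k ⊗ N) ≡ P (Tz-pow (suc k) ⊗ (N ⊗ Umat))
  w-UT k N = trans (cong w (UTmat-⊗ k N)) (trans (cong (λ M → P (M ⊗ Umat)) (U²U⊗ (Tz-pow (suc k) ⊗ N)))
    (trans (cong P (trans (negM-⊗ˡ (Tz-pow (suc k) ⊗ N) Umat) (cong negM (⊗-assoc (Tz-pow (suc k)) N Umat))))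
      (P-even (Tz-pow (suc k) ⊗ (N ⊗ Umat)))))

  -- For Y = S T^k N the total mass is cut in two by `P-S` and in three by `P-U`; comparing the two
  -- cancels P(Y) and identifies the conjugates of Y.
  w-ST : ∀ k N → P (Tz-pow k ⊗ (N ⊗ Smat)) ≡ P (Tz-pow (suc k) ⊗ (N ⊗ U²mat)) ℚ.+ w (STmat k ⊗ N)
  w-ST k N = cancel (P Y) (P (Tz-pow k ⊗ (N ⊗ Smat))) (P (Tz-pow (suc k) ⊗ (N ⊗ U²mat))) (w Y)
    (trans (cong (λ t → P Y ℚ.+ t) (sym eqS)) (trans (P-S Y) (trans (sym (P-U Y)) (cong (λ t → P Y ℚ.+ t ℚ.+ w Y) eqU))))
    where
    Y = STmat k ⊗ N
    X = Tz-pow k ⊗ N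
    cancel : ∀ y a b c → y ℚ.+ a ≡ y ℚ.+ b ℚ.+ c → a ≡ b ℚ.+ c
    cancel y a b c p = trans (l₁ y a) (trans (cong (λ t → t ℚ.- y) p) (l₂ y b c))
      where
      l₁ : ∀ y a → a ≡ y ℚ.+ a ℚ.- y
      l₁ = ring-of ringℚ
      l₂ : ∀ y b c → y ℚ.+ b ℚ.+ c ℚ.- y ≡ b ℚ.+ c
      l₂ = ring-of ringℚ
    eqS : P (conjS Y) ≡ P (Tz-pow k ⊗ (N ⊗ Smat))
    eqS = trans (cong (λ M → P ((Smat ⊗ M) ⊗ Smat)) (STmat-⊗ k N)) (trans (cong (λ M → P (M ⊗ Smat)) (SS⊗ X))
      (trans (cong P (trans (negM-⊗ˡ X Smat) (cong negM (⊗-assoc (Tz-pow k) N Smat)))) (P-even (Tz-pow k ⊗ (N ⊗ Smat)))))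
    eqU : P (conjU Y) ≡ P (Tz-pow (suc k) ⊗ (N ⊗ U²mat))
    eqU = trans (cong (λ M → P ((Umat ⊗ M) ⊗ U²mat)) (STmat-⊗ k N)) (trans (cong (λ M → P (M ⊗ U²mat)) (U⊗S⊗ X))
      (trans (cong P (trans (negM-⊗ˡ (Tmat ⊗ X) U²mat) (cong negM (trans (cong (_⊗ U²mat) (T-Tz k N)) (⊗-assoc (Tz-pow (suc k)) N U²mat)))))
        (P-even (Tz-pow (suc k) ⊗ (N ⊗ U²mat)))))

  UT-tails : ∀ N → det N ≡ + n → Tail (λ k → w (UTmat k ⊗ N))
  UT-tails N d = tail-≡ (λ k → sym (w-UT k N)) (tail-suc (tail-⊗ Umat refl N d))

  ST-tails : ∀ N → det N ≡ + n → Tail (λ k → w (STmat k ⊗ N))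
  ST-tails N d = tail-≡ (λ k → move k) (tail-- (tail-⊗ Smat refl N d) (tail-suc (tail-⊗ U²mat refl N d)))
    where
    l : ∀ b c → b ℚ.+ c ℚ.- b ≡ c
    l = ring-of ringℚ
    move : ∀ k → P (Tz-pow k ⊗ (N ⊗ Smat)) ℚ.- P (Tz-pow (suc k) ⊗ (N ⊗ U²mat)) ≡ w (STmat k ⊗ N)
    move k = trans (cong (λ t → t ℚ.- P (Tz-pow (suc k) ⊗ (N ⊗ U²mat))) (w-ST k N)) (l (P (Tz-pow (suc k) ⊗ (N ⊗ U²mat))) (w (STmat k ⊗ N)))

  -- At k = 0 the two terms add up to the total mass by `P-S`, and for large k both vanish on a
  -- given matrix of determinant n.
  ρ : ℕ → Mat → ℚ
  ρ k N = P (Tz-pow k ⊗ N) ℚ.+ P (Tz-pow k ⊗ ((Smat ⊗ N) ⊗ Smat))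

  ρ-tails : ∀ N → det N ≡ + n → Tail (λ k → ρ k N)
  ρ-tails N d = tail-+ (P-tail N d) (tail-⊗ Smat refl (Smat ⊗ N) (trans (det-⊗ Smat N) (trans (ℤ.*-identityˡ (det N)) d)))

  ρ-zero : ∀ N → ρ 0 N ≡ e N
  ρ-zero N = trans (cong₂ ℚ._+_ (cong P (⊗-identityˡ N)) (cong P (⊗-identityˡ (conjS N)))) (P-S N)

  -- The first part of (B) is used for φ_k = P(T^k ·) and the second for φ_(k+1). The shift comes
  -- from U = TS, that is T^k U = T^(k+1) S, which makes terms of the two relations cancel; `w-ST`
  -- and `w-UT` absorb the others.
  relation : ∀ ξ → CondB n ξ → ∀ k → ⟪ ξ ∣ (λ N → (ρ k N ℚ.- ρ (suc k) N) ℚ.+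
            ((w (STmat k ⊗ N) ℚ.- w (UTmat k ⊗ N)) ℚ.- (w (STmat k ⊗ (Smat ⊗ N)) ℚ.- w (UTmat k ⊗ (Smat ⊗ N))))) ⟫ ≡ 0ℚ
  relation ξ B k = trans (sym (pair-ext ξ pointwise)) (trans (pair-+ ξ b₁ b₂)
    (cong₂ ℚ._+_ (pair-B₁-difference n ξ B (φ-even k)) (pair-B₂-difference n ξ B (φ-even (suc k)))))
    where
    φ : ℕ → Mat → ℚ
    φ k M = P (Tz-pow k ⊗ M)
    φ-even : ∀ k → Even (φ k)
    φ-even k M = trans (cong P (negM-⊗ʳ (Tz-pow k) M)) (P-even (Tz-pow k ⊗ M))
    b₁ b₂ : Mat → ℚ
    b₁ N = φ k N ℚ.- φ k (Umat ⊗ N) ℚ.+ (φ k (N ⊗ Smat) ℚ.- φ k (Umat ⊗ (N ⊗ Smat)))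
    b₂ N = (φ (suc k) (Smat ⊗ N) ℚ.- φ (suc k) N) ℚ.+ (φ (suc k) (Smat ⊗ (N ⊗ Umat)) ℚ.- φ (suc k) (N ⊗ Umat))
                 ℚ.+ (φ (suc k) (Smat ⊗ (N ⊗ U²mat)) ℚ.- φ (suc k) (N ⊗ U²mat))
    l : ∀ a b d a′ uS u vS v sN sS →
      (a ℚ.- b ℚ.+ ((v ℚ.+ sN) ℚ.- d)) ℚ.+ ((b ℚ.- a′) ℚ.+ (uS ℚ.- u) ℚ.+ (vS ℚ.- v))
      ≡ ((a ℚ.+ (vS ℚ.+ sS)) ℚ.- (a′ ℚ.+ d)) ℚ.+ ((sN ℚ.- u) ℚ.- (sS ℚ.- uS))
    l = ring-of ringℚ
    pointwise : ∀ N → b₁ N ℚ.+ b₂ N ≡ (ρ k N ℚ.- ρ (suc k) N) ℚ.+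
            ((w (STmat k ⊗ N) ℚ.- w (UTmat k ⊗ N)) ℚ.- (w (STmat k ⊗ (Smat ⊗ N)) ℚ.- w (UTmat k ⊗ (Smat ⊗ N))))
    pointwise N = trans
      (cong₂ ℚ._+_
        (cong₂ (λ s t → φ k N ℚ.- s ℚ.+ t) (cong P (Tk-U k N))
          (cong₂ ℚ._-_ (w-ST k N) (cong P (trans (Tk-U k (N ⊗ Smat)) (cong (Tz-pow (suc k) ⊗_) (sym (⊗-assoc Smat N Smat)))))))
        (cong₂ (λ s t → (φ (suc k) SN ℚ.- φ (suc k) N) ℚ.+ (s ℚ.- φ (suc k) (N ⊗ Umat)) ℚ.+ (t ℚ.- φ (suc k) (N ⊗ U²mat)))
          (cong (φ (suc k)) (sym (⊗-assoc Smat N Umat))) (cong (φ (suc k)) (sym (⊗-assoc Smat N U²mat)))))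
      (trans (l (φ k N) (φ (suc k) SN) (φ (suc k) (SN ⊗ Smat)) (φ (suc k) N) (φ (suc k) (SN ⊗ Umat)) (φ (suc k) (N ⊗ Umat))
                (φ (suc k) (SN ⊗ U²mat)) (φ (suc k) (N ⊗ U²mat)) (w (STmat k ⊗ N)) (w (STmat k ⊗ SN)))
      (cong₂ ℚ._+_
        (cong (λ s → (φ k N ℚ.+ s) ℚ.- (φ (suc k) N ℚ.+ φ (suc k) (SN ⊗ Smat))) (sym (w-ST k SN)))
        (cong₂ (λ s t → (w (STmat k ⊗ N) ℚ.- s) ℚ.- (w (STmat k ⊗ SN) ℚ.- t)) (sym (w-UT k N)) (sym (w-UT k SN)))))
      where SN = Smat ⊗ N

τ-entries : ∀ a b c d → τ (a , b , c , d) ≡ (a + c , b + d - (a + c) , c , d - c)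
τ-entries a b c d = trans (cong (_⊗ Tz -[1+ 0 ]) (Tz-⊗ (+ 1) a b c d))
  (trans (⊗-Tz -[1+ 0 ] (a + + 1 * c) (b + + 1 * d) c d) (mat≡ (l₁ a c) (l₂ a b c d) refl (l₃ c d)))
  where
  l₁ : ∀ a c → a + + 1 * c ≡ a + c
  l₁ = ℤ-ring
  l₂ : ∀ a b c d → b + + 1 * d + -[1+ 0 ] * (a + + 1 * c) ≡ b + d - (a + c)
  l₂ = ℤ-ring
  l₃ : ∀ c d → d + -[1+ 0 ] * c ≡ d - c
  l₃ = ℤ-ring

τ⁻¹-entries : ∀ a b c d → τ⁻¹ (a , b , c , d) ≡ (a - c , b - d + (a - c) , c , d + c)
τ⁻¹-entries a b c d = trans (cong (_⊗ Tmat) (Tz-⊗ -[1+ 0 ] a b c d))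
  (trans (⊗-Tz (+ 1) (a + -[1+ 0 ] * c) (b + -[1+ 0 ] * d) c d) (mat≡ (l₁ a c) (l₂ a b c d) refl (l₃ c d)))
  where
  l₁ : ∀ a c → a + -[1+ 0 ] * c ≡ a - c
  l₁ = ℤ-ring
  l₂ : ∀ a b c d → b + -[1+ 0 ] * d + + 1 * (a + -[1+ 0 ] * c) ≡ b - d + (a - c)
  l₂ = ℤ-ring
  l₃ : ∀ c d → d + + 1 * c ≡ d + c
  l₃ = ℤ-ring

conjS-entries : ∀ a b c d → conjS (a , b , c , d) ≡ (ℤ.- d , c , b , ℤ.- a)
conjS-entries a b c d = trans (cong (_⊗ Smat) (Smat-⊗ a b c d)) (trans (⊗-Smat (ℤ.- c) (ℤ.- d) a b)
  (mat≡ refl (ℤ.neg-involutive c) refl refl))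

ττ⁻¹ : ∀ Q → τ (τ⁻¹ Q) ≡ Q
ττ⁻¹ (a , b , c , d) = trans (cong τ (τ⁻¹-entries a b c d))
  (trans (τ-entries (a - c) (b - d + (a - c)) c (d + c)) (mat≡ (l₁ a c) (l₂ a b c d) refl (l₃ c d)))
  where
  l₁ : ∀ a c → a - c + c ≡ a
  l₁ = ℤ-ring
  l₂ : ∀ a b c d → b - d + (a - c) + (d + c) - (a - c + c) ≡ b
  l₂ = ℤ-ring
  l₃ : ∀ c d → d + c - c ≡ d
  l₃ = ℤ-ring

τ⁻¹τ : ∀ Q → τ⁻¹ (τ Q) ≡ Q
τ⁻¹τ (a , b , c , d) = trans (cong τ⁻¹ (τ-entries a b c d))
  (trans (τ⁻¹-entries (a + c) (b + d - (a + c)) c (d - c)) (mat≡ (l₁ a c) (l₂ a b c d) refl (l₃ c d)))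
  where
  l₁ : ∀ a c → a + c - c ≡ a
  l₁ = ℤ-ring
  l₂ : ∀ a b c d → b + d - (a + c) - (d - c) + (a + c - c) ≡ b
  l₂ = ℤ-ring
  l₃ : ∀ c d → d - c + c ≡ d
  l₃ = ℤ-ring

conjS-involutive : ∀ Q → conjS (conjS Q) ≡ Q
conjS-involutive (a , b , c , d) = trans (cong conjS (conjS-entries a b c d))
  (trans (conjS-entries (ℤ.- d) c b (ℤ.- a)) (mat≡ (ℤ.neg-involutive a) refl refl (ℤ.neg-involutive d)))

norm-conjS : ∀ Q → norm (conjS Q) ≡ norm Q
norm-conjS (a , b , c , d) = trans (cong norm (conjS-entries a b c d))
  (trans (cong₂ (λ s t → s ℕ.+ ℤ.∣ c ∣ ℕ.+ (ℤ.∣ b ∣ ℕ.+ t)) (ℤ.∣-i∣≡∣i∣ d) (ℤ.∣-i∣≡∣i∣ a)) (l ℤ.∣ a ∣ ℤ.∣ b ∣ ℤ.∣ c ∣ ℤ.∣ d ∣))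
  where
  l : ∀ a b c d → d ℕ.+ c ℕ.+ (b ℕ.+ a) ≡ a ℕ.+ b ℕ.+ (c ℕ.+ d)
  l = ℕ-ring

conjS-τ⁻¹ : ∀ Q → conjS (τ⁻¹ Q) ≡ conjU² Q
conjS-τ⁻¹ Q = trans (cong (_⊗ Smat) (sym (⊗-assoc Smat (Tz -[1+ 0 ] ⊗ Q) Tmat)))
  (trans (⊗-assoc (Smat ⊗ (Tz -[1+ 0 ] ⊗ Q)) Tmat Smat) (cong (_⊗ Umat) (sym (⊗-assoc Smat (Tz -[1+ 0 ]) Q))))

conjU-conjS : ∀ Q → conjU (conjS Q) ≡ τ Q
conjU-conjS Q = trans (cong (_⊗ U²mat) (trans (sym (⊗-assoc Umat (Smat ⊗ Q) Smat)) (cong (_⊗ Smat) (U⊗S⊗ Q))))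
  (trans (⊗-assoc (negM (Tmat ⊗ Q)) Smat U²mat) (trans (negM-⊗ˡ (Tmat ⊗ Q) (negM (Tz -[1+ 0 ])))
    (trans (cong negM (negM-⊗ʳ (Tmat ⊗ Q) (Tz -[1+ 0 ]))) (negM-involutive (τ Q)))))

-- Conjugation by T or T⁻¹ enlarges the norm at most by this factor: the entry c contributes to all
-- four entries of the result.
four : ℕ → ℕ
four x = x ℕ.+ x ℕ.+ (x ℕ.+ x)

four-mono : ∀ {x y} → x ℕ.≤ y → four x ℕ.≤ four y
four-mono p = ℕ.+-mono-≤ (ℕ.+-mono-≤ p p) (ℕ.+-mono-≤ p p)

private
  norm-shift : ∀ a b c d {x y z} → x ℕ.≤ a ℕ.+ c → y ℕ.≤ (b ℕ.+ d) ℕ.+ (a ℕ.+ c) → z ℕ.≤ d ℕ.+ c →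
    x ℕ.+ y ℕ.+ (c ℕ.+ z) ℕ.≤ four (a ℕ.+ b ℕ.+ (c ℕ.+ d))
  norm-shift a b c d {x} {y} {z} p q r = ℕ.≤-trans
    (ℕ.+-mono-≤ (ℕ.+-mono-≤ p q) (ℕ.+-mono-≤ (ℕ.≤-refl {c}) r))
    (ℕ.≤-trans (ℕ.m≤m+n _ ((a ℕ.+ a) ℕ.+ (b ℕ.+ b ℕ.+ b) ℕ.+ (d ℕ.+ d))) (ℕ.≤-reflexive (l a b c d)))
    where
    l : ∀ a b c d → (a ℕ.+ c) ℕ.+ ((b ℕ.+ d) ℕ.+ (a ℕ.+ c)) ℕ.+ (c ℕ.+ (d ℕ.+ c)) ℕ.+ ((a ℕ.+ a) ℕ.+ (b ℕ.+ b ℕ.+ b) ℕ.+ (d ℕ.+ d))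
      ≡ (a ℕ.+ b ℕ.+ (c ℕ.+ d)) ℕ.+ (a ℕ.+ b ℕ.+ (c ℕ.+ d)) ℕ.+ ((a ℕ.+ b ℕ.+ (c ℕ.+ d)) ℕ.+ (a ℕ.+ b ℕ.+ (c ℕ.+ d)))
    l = ℕ-ring

norm-τ : ∀ Q → norm (τ Q) ℕ.≤ four (norm Q)
norm-τ (a , b , c , d) = subst (λ M → norm M ℕ.≤ four (norm (a , b , c , d))) (sym (τ-entries a b c d))
  (norm-shift ℤ.∣ a ∣ ℤ.∣ b ∣ ℤ.∣ c ∣ ℤ.∣ d ∣ (ℤ.∣i+j∣≤∣i∣+∣j∣ a c)
    (ℕ.≤-trans (ℤ.∣i-j∣≤∣i∣+∣j∣ (b + d) (a + c)) (ℕ.+-mono-≤ (ℤ.∣i+j∣≤∣i∣+∣j∣ b d) (ℤ.∣i+j∣≤∣i∣+∣j∣ a c))) (ℤ.∣i-j∣≤∣i∣+∣j∣ d c))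

norm-τ⁻¹ : ∀ Q → norm (τ⁻¹ Q) ℕ.≤ four (norm Q)
norm-τ⁻¹ (a , b , c , d) = subst (λ M → norm M ℕ.≤ four (norm (a , b , c , d))) (sym (τ⁻¹-entries a b c d))
  (norm-shift ℤ.∣ a ∣ ℤ.∣ b ∣ ℤ.∣ c ∣ ℤ.∣ d ∣ (ℤ.∣i-j∣≤∣i∣+∣j∣ a c)
    (ℕ.≤-trans (ℤ.∣i+j∣≤∣i∣+∣j∣ (b - d) (a - c)) (ℕ.+-mono-≤ (ℤ.∣i-j∣≤∣i∣+∣j∣ b d) (ℤ.∣i-j∣≤∣i∣+∣j∣ a c))) (ℤ.∣i+j∣≤∣i∣+∣j∣ d c))

-- Evaluation of the ball sum by translation

crossing : Mat → ℚ
crossing (a , _ , c , _) = opp a c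

fixes∞ : Mat → ℚ
fixes∞ (_ , _ , c , _) = ind (c ≟ + 0)

module _ (n : ℕ) .{{n≢0 : NonZero n}} (mass : EquivariantMass n) where
  open EquivariantMass mass

  -- `bounded` is the finiteness input: if Q∞ is negative and the mass `fin` does not equal the mass
  -- of (∞,0], then Q lies in a fixed ball. `inf` sets aside mass at ∞, which is never on that arc
  -- and would break the bound.
  module _ (fin inf : Mat → ℚ) (split-e : ∀ Q → e Q ≡ fin Q ℚ.+ inf Q)
           (fin-τ : ∀ Q → fin (τ Q) ≡ fin Q) (e-τ : ∀ Q → e (τ Q) ≡ e Q)
           (R₀ : ℕ) (bounded : ∀ Q → crossing Q ≡ 0ℚ ⊎ fin Q ≡ P Q ⊎ norm Q ℕ.≤ R₀) where

    private
      difference : ∀ x y z → x ℚ.+ y ≡ z → y ≡ z ℚ.- x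
      difference x y z p = trans (l x y) (cong (λ t → t ℚ.- x) p)
        where
        l : ∀ x y → y ≡ x ℚ.+ y ℚ.- x
        l = ring-of ringℚ

      -- The arc (1,∞] is the complement of T(∞,0] = (∞,1].
      w-left : ∀ Q → w Q ≡ e Q ℚ.- P (τ⁻¹ Q)
      w-left Q = trans (cong P (sym (conjS-τ⁻¹ Q))) (trans (difference (P (τ⁻¹ Q)) (P (conjS (τ⁻¹ Q))) (e (τ⁻¹ Q)) (P-S (τ⁻¹ Q)))
        (cong (λ t → t ℚ.- P (τ⁻¹ Q)) (trans (sym (e-τ (τ⁻¹ Q))) (cong e (ττ⁻¹ Q)))))

      -- Conjugation by S turns the arc (1,∞] into (-1,0], the difference between (∞,0] and its
      -- translate (∞,-1].
      w-right : ∀ Q → w (conjS Q) ≡ P Q ℚ.- P (τ Q)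
      w-right Q = trans (difference (P (conjS Q) ℚ.+ P (conjU (conjS Q))) (w (conjS Q)) (e (conjS Q)) (P-U (conjS Q)))
        (trans (cong₂ (λ s t → s ℚ.- (P (conjS Q) ℚ.+ t)) (sym (P-S (conjS Q))) (cong P (conjU-conjS Q)))
        (trans (cong (λ t → P (conjS Q) ℚ.+ P t ℚ.- (P (conjS Q) ℚ.+ P (τ Q))) (conjS-involutive Q))
          (l (P (conjS Q)) (P Q) (P (τ Q)))))
        where
        l : ∀ x y z → x ℚ.+ y ℚ.- (x ℚ.+ z) ≡ y ℚ.- z
        l = ring-of ringℚ

      -- A potential for translation. The indicators of Q∞ ∈ [0,1) and SQ∞ ∈ [0,1) are differences
      -- of `crossing` along τ, up to a term at ∞, and the arc masses come from P along τ. V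
      -- collects the products so that summation by parts leaves V Q - V(τ Q) and contributions at
      -- ∞.
      V : Mat → ℚ
      V Q = crossing (τ⁻¹ Q) ℚ.* (fin Q ℚ.- P (τ⁻¹ Q)) ℚ.+ crossing Q ℚ.* (P (τ⁻¹ Q) ℚ.- P Q)

      V-τ : ∀ Q → V (τ Q) ≡ crossing Q ℚ.* (fin Q ℚ.- P Q) ℚ.+ crossing (τ Q) ℚ.* (P Q ℚ.- P (τ Q))
      V-τ Q = cong₂ (λ M x → crossing M ℚ.* (x ℚ.- P M) ℚ.+ crossing (τ Q) ℚ.* (P M ℚ.- P (τ Q))) (τ⁻¹τ Q) (fin-τ Q)

      fin-τ⁻¹ : ∀ Q → fin (τ⁻¹ Q) ≡ fin Q
      fin-τ⁻¹ Q = trans (sym (fin-τ (τ⁻¹ Q))) (cong fin (ττ⁻¹ Q))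

      crossing-τ⁻¹ : ∀ Q → crossing (τ⁻¹ Q) ≡ 0ℚ → crossing Q ≡ 0ℚ
      crossing-τ⁻¹ (a , b , c , d) z = opp-shift a c (trans (sym (cong crossing (τ⁻¹-entries a b c d))) z)

      V-zero : ∀ Q → crossing Q ≡ 0ℚ ⊎ fin Q ≡ P Q → crossing (τ⁻¹ Q) ≡ 0ℚ ⊎ fin (τ⁻¹ Q) ≡ P (τ⁻¹ Q) → V Q ≡ 0ℚ
      V-zero Q h (inj₁ z) = trans (cong₂ (λ s t → s ℚ.* (fin Q ℚ.- P (τ⁻¹ Q)) ℚ.+ t ℚ.* (P (τ⁻¹ Q) ℚ.- P Q)) z (crossing-τ⁻¹ Q z))
        (l (fin Q ℚ.- P (τ⁻¹ Q)) (P (τ⁻¹ Q) ℚ.- P Q))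
        where
        l : ∀ x y → 0ℚ ℚ.* x ℚ.+ 0ℚ ℚ.* y ≡ 0ℚ
        l = ring-of ringℚ
      V-zero Q h (inj₂ f) = trans (cong (λ t → crossing (τ⁻¹ Q) ℚ.* (fin Q ℚ.- t) ℚ.+ crossing Q ℚ.* (t ℚ.- P Q)) (trans (sym f) (fin-τ⁻¹ Q)))
        (trans (l (crossing (τ⁻¹ Q)) (crossing Q) (fin Q) (P Q)) (by h))
        where
        l : ∀ a b x y → a ℚ.* (x ℚ.- x) ℚ.+ b ℚ.* (x ℚ.- y) ≡ b ℚ.* (x ℚ.- y)
        l = ring-of ringℚ
        by : crossing Q ≡ 0ℚ ⊎ fin Q ≡ P Q → crossing Q ℚ.* (fin Q ℚ.- P Q) ≡ 0ℚ
        by (inj₁ z) = trans (cong (λ t → t ℚ.* (fin Q ℚ.- P Q)) z) (ℚ.*-zeroˡ (fin Q ℚ.- P Q))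
        by (inj₂ z) = trans (cong (λ t → crossing Q ℚ.* (t ℚ.- P Q)) z) (trans (cong (crossing Q ℚ.*_) (ℚ.+-inverseʳ (P Q))) (ℚ.*-zeroʳ (crossing Q)))

      R₁ = four R₀

      ≤four : ∀ x → x ℕ.≤ four x
      ≤four x = ℕ.≤-trans (ℕ.m≤m+n x x) (ℕ.m≤m+n (x ℕ.+ x) (x ℕ.+ x))

      V-bounded : ∀ Q → norm Q ℕ.≤ R₁ ⊎ V Q ≡ 0ℚ
      V-bounded Q with bounded Q | bounded (τ⁻¹ Q)
      ... | inj₂ (inj₂ p) | _ = inj₁ (ℕ.≤-trans p (≤four R₀))
      ... | inj₁ z | inj₂ (inj₂ p) = inj₁ (subst (λ M → norm M ℕ.≤ R₁) (ττ⁻¹ Q) (ℕ.≤-trans (norm-τ (τ⁻¹ Q)) (four-mono p)))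
      ... | inj₂ (inj₁ z) | inj₂ (inj₂ p) = inj₁ (subst (λ M → norm M ℕ.≤ R₁) (ττ⁻¹ Q) (ℕ.≤-trans (norm-τ (τ⁻¹ Q)) (four-mono p)))
      ... | inj₁ z | inj₁ z′ = inj₂ (V-zero Q (inj₁ z) (inj₁ z′))
      ... | inj₁ z | inj₂ (inj₁ z′) = inj₂ (V-zero Q (inj₁ z) (inj₂ z′))
      ... | inj₂ (inj₁ z) | inj₁ z′ = inj₂ (V-zero Q (inj₂ z) (inj₁ z′))
      ... | inj₂ (inj₁ z) | inj₂ (inj₁ z′) = inj₂ (V-zero Q (inj₂ z) (inj₂ z′))

      -- The ball of radius R₁ contains the support of V, and R ≥ `four R₁` leaves room for its
      -- image under τ⁻¹.
      ∑-V-τ : ∀ R → four R₁ ℕ.≤ R → ∑ (ball R) (λ Q → V (τ Q)) ≡ ∑ (ball R) V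
      ∑-V-τ R h = ∑-ball-permute R τ τ⁻¹ ττ⁻¹ τ⁻¹τ V (λ Q _ → up Q (V-bounded (τ Q))) (λ Q _ → dn Q (V-bounded Q))
        where
        up : ∀ Q → norm (τ Q) ℕ.≤ R₁ ⊎ V (τ Q) ≡ 0ℚ → norm (τ Q) ℕ.≤ R ⊎ V (τ Q) ≡ 0ℚ
        up Q (inj₁ p) = inj₁ (ℕ.≤-trans p (ℕ.≤-trans (≤four R₁) h))
        up Q (inj₂ z) = inj₂ z
        dn : ∀ Q → norm Q ℕ.≤ R₁ ⊎ V Q ≡ 0ℚ → norm (τ⁻¹ Q) ℕ.≤ R ⊎ V Q ≡ 0ℚ
        dn Q (inj₁ p) = inj₁ (ℕ.≤-trans (norm-τ⁻¹ Q) (ℕ.≤-trans (four-mono p) h))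
        dn Q (inj₂ z) = inj₂ z

      det-τ : ∀ Q → det (τ Q) ≡ det Q
      det-τ Q = trans (det-⊗ (Tmat ⊗ Q) (Tz -[1+ 0 ])) (trans (ℤ.*-identityʳ (det (Tmat ⊗ Q))) (trans (det-⊗ Tmat Q) (ℤ.*-identityˡ (det Q))))

      right-term : ∀ Q → (P Q ℚ.- P (τ Q)) ℚ.* right01 (conjS Q) ≡ (P Q ℚ.- P (τ Q)) ℚ.* (fixes∞ Q ℚ.+ crossing (τ Q))
      right-term Q = go Q (P-det Q) (P-det (τ Q))
        where
        go : ∀ Q → det Q ≡ + n ⊎ P Q ≡ 0ℚ → det (τ Q) ≡ + n ⊎ P (τ Q) ≡ 0ℚ →
             (P Q ℚ.- P (τ Q)) ℚ.* right01 (conjS Q) ≡ (P Q ℚ.- P (τ Q)) ℚ.* (fixes∞ Q ℚ.+ crossing (τ Q))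
        go Q@(a , b , c , d) (inj₁ e) _ = cong ((P Q ℚ.- P (τ Q)) ℚ.*_)
          (trans (cong right01 (conjS-entries a b c d)) (trans (sym (in01-neg c (ℤ.- a)))
          (trans (cong (in01 (ℤ.- c)) (ℤ.neg-involutive a)) (trans (in01-opp′ a c (column-nonzero a b c d e))
          (cong (λ t → ind (c ≟ + 0) ℚ.+ crossing t) (sym (τ-entries a b c d)))))))
        go Q (inj₂ z) (inj₁ e) = go Q (inj₁ (trans (sym (det-τ Q)) e)) (inj₁ e)
        go Q (inj₂ z) (inj₂ z′) = trans (cong₂ (λ s t → (s ℚ.- t) ℚ.* right01 (conjS Q)) z z′)
          (trans (l (right01 (conjS Q)) (fixes∞ Q ℚ.+ crossing (τ Q))) (cong₂ (λ s t → (s ℚ.- t) ℚ.* (fixes∞ Q ℚ.+ crossing (τ Q))) (sym z) (sym z′)))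
          where
          l : ∀ x y → (0ℚ ℚ.- 0ℚ) ℚ.* x ≡ (0ℚ ℚ.- 0ℚ) ℚ.* y
          l = ring-of ringℚ

      left-crossing : ∀ Q → left01 Q ≡ crossing (τ⁻¹ Q) ℚ.- crossing Q
      left-crossing (a , b , c , d) = trans (in01-opp a c) (cong (λ t → crossing t ℚ.- opp a c) (sym (τ⁻¹-entries a b c d)))

      pointwise : ∀ Q → w Q ℚ.* left01 Q ℚ.- w (conjS Q) ℚ.* right01 (conjS Q)
        ≡ (V Q ℚ.- V (τ Q)) ℚ.+ (left01 Q ℚ.* inf Q ℚ.- fixes∞ Q ℚ.* (P Q ℚ.- P (τ Q)))
      pointwise Q = trans (cong₂ ℚ._-_
          (cong₂ ℚ._*_ (trans (w-left Q) (cong (λ t → t ℚ.- P (τ⁻¹ Q)) (split-e Q))) (left-crossing Q))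
          (trans (cong (λ t → t ℚ.* right01 (conjS Q)) (w-right Q)) (right-term Q)))
        (trans (l (fin Q) (inf Q) (P (τ⁻¹ Q)) (P Q) (P (τ Q)) (crossing (τ⁻¹ Q)) (crossing Q) (crossing (τ Q)) (fixes∞ Q))
        (cong₂ (λ s t → (V Q ℚ.- s) ℚ.+ (t ℚ.* inf Q ℚ.- fixes∞ Q ℚ.* (P Q ℚ.- P (τ Q)))) (sym (V-τ Q)) (sym (left-crossing Q))))
        where
        l : ∀ f ∞ p₋ p p₊ i₋ i i₊ z → ((f ℚ.+ ∞) ℚ.- p₋) ℚ.* (i₋ ℚ.- i) ℚ.- (p ℚ.- p₊) ℚ.* (z ℚ.+ i₊)
          ≡ ((i₋ ℚ.* (f ℚ.- p₋) ℚ.+ i ℚ.* (p₋ ℚ.- p)) ℚ.- (i ℚ.* (f ℚ.- p) ℚ.+ i₊ ℚ.* (p ℚ.- p₊)))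
            ℚ.+ ((i₋ ℚ.- i) ℚ.* ∞ ℚ.- z ℚ.* (p ℚ.- p₊))
        l = ring-of ringℚ

    evaluation : Eventually (λ R → ∑ (ball R) (λ Q → w Q ℚ.* (left01 Q ℚ.- right01 Q))
      ≡ ∑ (ball R) (λ Q → left01 Q ℚ.* inf Q ℚ.- fixes∞ Q ℚ.* (P Q ℚ.- P (τ Q))))
    evaluation = four R₁ , λ R h →
      trans (∑-ext (ball R) (λ Q → l (w Q) (left01 Q) (right01 Q)))
      (trans (∑-- (ball R) (λ Q → w Q ℚ.* left01 Q) (λ Q → w Q ℚ.* right01 Q))
      -- The half with Q0 is reindexed by conjugation with S, which preserves the norm and replaces
      -- Q0 by SQ∞.
      (trans (cong (λ t → ∑ (ball R) (λ Q → w Q ℚ.* left01 Q) ℚ.- t) (sym (∑-ball-permute R conjS conjS conjS-involutive conjS-involutive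
        (λ Q → w Q ℚ.* right01 Q) (iso R {λ Q → w (conjS Q) ℚ.* right01 (conjS Q) ≡ 0ℚ}) (iso R {λ Q → w Q ℚ.* right01 Q ≡ 0ℚ}))))
      (trans (sym (∑-- (ball R) (λ Q → w Q ℚ.* left01 Q) (λ Q → w (conjS Q) ℚ.* right01 (conjS Q))))
      (trans (∑-ext (ball R) pointwise)
      (trans (∑-+ (ball R) (λ Q → V Q ℚ.- V (τ Q)) rest)
      (trans (cong (λ t → t ℚ.+ ∑ (ball R) rest) (trans (∑-- (ball R) V (λ Q → V (τ Q)))
        (trans (cong (λ t → ∑ (ball R) V ℚ.- t) (∑-V-τ R h)) (ℚ.+-inverseʳ (∑ (ball R) V))))) (ℚ.+-identityˡ (∑ (ball R) rest))))))))
      where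
      rest : Mat → ℚ
      rest Q = left01 Q ℚ.* inf Q ℚ.- fixes∞ Q ℚ.* (P Q ℚ.- P (τ Q))
      l : ∀ a b c → a ℚ.* (b ℚ.- c) ≡ a ℚ.* b ℚ.- a ℚ.* c
      l = ring-of ringℚ
      iso : ∀ R {X : Mat → Set} Q → norm Q ℕ.≤ R → norm (conjS Q) ℕ.≤ R ⊎ X Q
      iso R Q p = inj₁ (subst (ℕ._≤ R) (sym (norm-conjS Q)) p)

    mass-formula : ∀ {Tinf ξ} → IsRepsInfty n Tinf → InR n ξ → CondA n Tinf ξ → CondB n ξ →
      Eventually (λ R → (⟪ ξ ∣ e ⟫ ℚ.+ ⟪ ξ ∣ e ⟫) ℚ.+ ∑ (ball R) (λ Q → left01 Q ℚ.* inf Q ℚ.- fixes∞ Q ℚ.* (P Q ℚ.- P (τ Q))) ≡ 0ℚ)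
    mass-formula {Tinf} {ξ} reps ξR A B = eventually-map
      (λ R (p , q) → trans (cong₂ (λ s t → (s ℚ.+ s) ℚ.+ t) (pair-ext ξ (λ N → sym (ρ-zero N))) (sym q)) p)
      (eventually-× (pair-ρ n Tinf reps ξ ξR A w w-even w-det ST-tails UT-tails ρ ρ-tails (relation ξ B)) evaluation)

-- Fixed points and quadratic forms of nonnegative discriminant

-- The arc (∞,0] contains the attracting fixed point of (a b; c d), for a + d > 0 and nonnegative discriminant.
-- Arguments: x = c, y = -b, e = d - a.

att : ℤ → ℤ → ℤ → ℚ
att -[1+ _ ] (+ _) _ = 1ℚ
att -[1+ _ ] -[1+ _ ] -[1+ _ ] = 1ℚ
att -[1+ _ ] -[1+ _ ] (+ _) = 0ℚ
att +0 -[1+ _ ] _ = 0ℚ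
att +0 (+ _) +[1+ _ ] = 1ℚ
att +0 (+ _) +0 = 0ℚ
att +0 (+ _) -[1+ _ ] = 0ℚ
att +[1+ _ ] -[1+ _ ] _ = 0ℚ
att +[1+ _ ] +0 (+ _) = 1ℚ
att +[1+ _ ] +0 -[1+ _ ] = 0ℚ
att +[1+ _ ] +[1+ _ ] +[1+ _ ] = 1ℚ
att +[1+ _ ] +[1+ _ ] +0 = 0ℚ
att +[1+ _ ] +[1+ _ ] -[1+ _ ] = 0ℚ

att-np : ∀ {x y} e → x < 0ℤ → 0ℤ ≤ y → att x y e ≡ 1ℚ
att-np {+ _} e (ℤ.+<+ ()) _
att-np { -[1+ _ ]} {+ _} e _ _ = refl
att-np { -[1+ _ ]} { -[1+ _ ]} e _ ()

att-pn : ∀ {x y} e → 0ℤ ≤ x → y < 0ℤ → att x y e ≡ 0ℚ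
att-pn {_} {+ _} e _ (ℤ.+<+ ())
att-pn {+0} { -[1+ _ ]} e _ _ = refl
att-pn {+[1+ _ ]} { -[1+ _ ]} e _ _ = refl
att-pn { -[1+ _ ]} e () _

att-nn⁻ : ∀ {x y e} → x < 0ℤ → y < 0ℤ → e < 0ℤ → att x y e ≡ 1ℚ
att-nn⁻ {+ _} (ℤ.+<+ ()) _ _
att-nn⁻ { -[1+ _ ]} {+ _} _ (ℤ.+<+ ()) _
att-nn⁻ { -[1+ _ ]} { -[1+ _ ]} {+ _} _ _ (ℤ.+<+ ())
att-nn⁻ { -[1+ _ ]} { -[1+ _ ]} { -[1+ _ ]} _ _ _ = refl

att-nn⁺ : ∀ {x y e} → x < 0ℤ → y < 0ℤ → 0ℤ ≤ e → att x y e ≡ 0ℚ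
att-nn⁺ {+ _} (ℤ.+<+ ()) _ _
att-nn⁺ { -[1+ _ ]} {+ _} _ (ℤ.+<+ ()) _
att-nn⁺ { -[1+ _ ]} { -[1+ _ ]} {+ _} _ _ _ = refl
att-nn⁺ { -[1+ _ ]} { -[1+ _ ]} { -[1+ _ ]} _ _ ()

att-pp⁺ : ∀ {x y e} → 0ℤ ≤ x → 0ℤ ≤ y → 0ℤ < e → att x y e ≡ 1ℚ
att-pp⁺ {_} {_} {+0} _ _ (ℤ.+<+ ())
att-pp⁺ {_} {_} { -[1+ _ ]} _ _ ()
att-pp⁺ { -[1+ _ ]} () _ _
att-pp⁺ {+ _} { -[1+ _ ]} _ () _
att-pp⁺ {+0} {+ _} {+[1+ _ ]} _ _ _ = refl
att-pp⁺ {+[1+ _ ]} {+0} {+[1+ _ ]} _ _ _ = refl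
att-pp⁺ {+[1+ _ ]} {+[1+ _ ]} {+[1+ _ ]} _ _ _ = refl

att-pp⁻ : ∀ {x y e} → 0ℤ ≤ x → 0ℤ ≤ y → e < 0ℤ → att x y e ≡ 0ℚ
att-pp⁻ {_} {_} {+ _} _ _ (ℤ.+<+ ())
att-pp⁻ { -[1+ _ ]} () _ _
att-pp⁻ {+ _} { -[1+ _ ]} _ () _
att-pp⁻ {+0} {+ _} { -[1+ _ ]} _ _ _ = refl
att-pp⁻ {+[1+ _ ]} {+0} { -[1+ _ ]} _ _ _ = refl
att-pp⁻ {+[1+ _ ]} {+[1+ _ ]} { -[1+ _ ]} _ _ _ = refl

-- Conjugation by S, with the sign chosen to keep the trace, turns (x,y,e) into (y,x,-e), and
-- exactly one of a point and its image under S lies on (∞,0]. The hypotheses leave out elliptic and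
-- scalar matrices, which have no such fixed point.
att-flip : ∀ x y e → 0ℤ ≤ e * e - + 4 * (x * y) → ¬ (x ≡ + 0 × y ≡ + 0 × e ≡ + 0) →
  att x y e ℚ.+ att y x (ℤ.- e) ≡ 1ℚ
att-flip +0 +0 +0 _ nz = ⊥-elim (nz (refl , refl , refl))
att-flip +0 +0 +[1+ _ ] _ _ = refl
att-flip +0 +0 -[1+ _ ] _ _ = refl
att-flip +0 +[1+ _ ] +0 _ _ = refl
att-flip +0 +[1+ _ ] +[1+ _ ] _ _ = refl
att-flip +0 +[1+ _ ] -[1+ _ ] _ _ = refl
att-flip +0 -[1+ _ ] e _ _ = refl
att-flip +[1+ _ ] +0 +0 _ _ = refl
att-flip +[1+ _ ] +0 +[1+ _ ] _ _ = refl
att-flip +[1+ _ ] +0 -[1+ _ ] _ _ = refl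
att-flip +[1+ _ ] +[1+ _ ] +0 () _
att-flip +[1+ _ ] +[1+ _ ] +[1+ _ ] _ _ = refl
att-flip +[1+ _ ] +[1+ _ ] -[1+ _ ] _ _ = refl
att-flip +[1+ _ ] -[1+ _ ] e _ _ = refl
att-flip -[1+ _ ] +0 e _ _ = refl
att-flip -[1+ _ ] +[1+ _ ] e _ _ = refl
att-flip -[1+ _ ] -[1+ _ ] +0 () _
att-flip -[1+ _ ] -[1+ _ ] +[1+ _ ] _ _ = refl
att-flip -[1+ _ ] -[1+ _ ] -[1+ _ ] _ _ = refl

private

  rotate-sum : ∀ a b c → b ℚ.+ c ℚ.+ a ≡ 1ℚ → a ℚ.+ b ℚ.+ c ≡ 1ℚ
  rotate-sum a b c p = trans (l a b c) p
    where
    l : ∀ a b c → a ℚ.+ b ℚ.+ c ≡ b ℚ.+ c ℚ.+ a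
    l = ring-of ringℚ

  sum₁ : ∀ {a b c} → a ≡ 1ℚ → b ≡ 0ℚ → c ≡ 0ℚ → a ℚ.+ b ℚ.+ c ≡ 1ℚ
  sum₁ refl refl refl = refl

  -- x, y, z are the values at the cusps ∞, 0, 1 of the form cX² + (d - a)XY - bY², whose roots are
  -- the fixed points. Its middle coefficient is z - x - y, and U permutes the three cusps, hence
  -- the three values, cyclically.
  E : ℤ → ℤ → ℤ → ℤ
  E x y z = z - x - y

  Rotated : ℤ → ℤ → ℤ → Set
  Rotated x y z = att x y (E x y z) ℚ.+ att y z (E y z x) ℚ.+ att z x (E z x y) ≡ 1ℚ

  rotate : ∀ x y z → Rotated y z x → Rotated x y z
  rotate x y z = rotate-sum (att x y (E x y z)) (att y z (E y z x)) (att z x (E z x y))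

  Δ : ℤ → ℤ → ℤ → ℤ
  Δ x y z = E x y z * E x y z - + 4 * (x * y)

  -- For c < 0 ≤ -b the product of the two roots is at most 0, and the attracting root is the
  -- smaller one, so it lies on (∞,0].
  mixed : ∀ x y z → x < 0ℤ → 0ℤ ≤ y → Rotated x y z
  mixed x y z x<0 y≥0 = sum₁ (att-np (E x y z) x<0 y≥0) (second (0ℤ ≤? z)) (third′ (0ℤ ≤? z))
    where
    second : Dec (0ℤ ≤ z) → att y z (E y z x) ≡ 0ℚ
    second (no p) = att-pn (E y z x) y≥0 (ℤ.≰⇒> p)
    second (yes p) = att-pp⁻ y≥0 p (nn⇒< (nn-≡ (nn+ (<⇒nn x<0) (nn+ y≥0 p)) (l x y z)))
      where
      l : ∀ x y z → 0ℤ - x - + 1 + (y + z) ≡ 0ℤ - (x - y - z) - + 1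
      l = ℤ-ring
    third′ : Dec (0ℤ ≤ z) → att z x (E z x y) ≡ 0ℚ
    third′ (yes p) = att-pn (E z x y) p x<0
    third′ (no p) = att-nn⁺ (ℤ.≰⇒> p) x<0 (nn-≡ (nn+ y≥0 (nn+ (nn+ (<⇒nn x<0) (<⇒nn (ℤ.≰⇒> p))) (ℤ.+≤+ {0} {2} ℕ.z≤n))) (l x y z))
      where
      l : ∀ x y z → y + ((0ℤ - x - + 1) + (0ℤ - z - + 1) + + 2) ≡ y - z - x
      l = ℤ-ring

  negative-one : ∀ x y z → x < 0ℤ → y < 0ℤ → z < 0ℤ → E x y z < 0ℤ → Rotated x y z
  negative-one x y z x<0 y<0 z<0 e<0 = sum₁ (att-nn⁻ x<0 y<0 e<0)
    (att-nn⁺ y<0 z<0 (nn-≡ (nn+ (nn+ (<⇒nn e<0) (ℤ.+≤+ {0} {3} ℕ.z≤n)) (nn+ (<⇒nn y<0) (<⇒nn y<0))) (l₁ x y z)))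
    (att-nn⁺ z<0 x<0 (nn-≡ (nn+ (nn+ (<⇒nn e<0) (ℤ.+≤+ {0} {3} ℕ.z≤n)) (nn+ (<⇒nn x<0) (<⇒nn x<0))) (l₂ x y z)))
    where
    l₁ : ∀ x y z → 0ℤ - (z - x - y) - + 1 + + 3 + ((0ℤ - y - + 1) + (0ℤ - y - + 1)) ≡ x - y - z
    l₁ = ℤ-ring
    l₂ : ∀ x y z → 0ℤ - (z - x - y) - + 1 + + 3 + ((0ℤ - x - + 1) + (0ℤ - x - + 1)) ≡ y - z - x
    l₂ = ℤ-ring

  -- Δ = x E₂ + y E₃ + z E₁, so Δ ≥ 0 forces a strict failure of the triangle inequalities for |x|, |y|, |z|.
  negative : ∀ x y z → x < 0ℤ → y < 0ℤ → z < 0ℤ → 0ℤ ≤ Δ x y z → Rotated x y z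
  negative x y z x<0 y<0 z<0 δ = go (0ℤ ≤? E x y z) (0ℤ ≤? E y z x) (0ℤ ≤? E z x y)
    where
    l : ∀ x y z → (z - x - y) * (z - x - y) - + 4 * (x * y) + ((0ℤ - x - + 1) * (x - y - z) + ((0ℤ - y - + 1) * (y - z - x) + (0ℤ - z - + 1) * (z - x - y)))
      + ((0ℤ - x - + 1) + (0ℤ - y - + 1) + (0ℤ - z - + 1)) ≡ -[1+ 2 ]
    l = ℤ-ring
    go : Dec (0ℤ ≤ E x y z) → Dec (0ℤ ≤ E y z x) → Dec (0ℤ ≤ E z x y) → Rotated x y z
    go (no p) _ _ = negative-one x y z x<0 y<0 z<0 (ℤ.≰⇒> p)
    go (yes _) (no p) _ = rotate x y z (negative-one y z x y<0 z<0 x<0 (ℤ.≰⇒> p))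
    go (yes _) (yes _) (no p) = rotate x y z (rotate y z x (negative-one z x y z<0 x<0 y<0 (ℤ.≰⇒> p)))
    go (yes p) (yes q) (yes r) = ⊥-elim (¬nn {k = 2} (nn+ (nn+ δ (nn+ (nn* (<⇒nn x<0) q) (nn+ (nn* (<⇒nn y<0) r) (nn* (<⇒nn z<0) p))))
      (nn+ (nn+ (<⇒nn x<0) (<⇒nn y<0)) (<⇒nn z<0))) (l x y z))

  nonneg-one : ∀ x y z → 0ℤ ≤ x → 0ℤ ≤ y → 0ℤ ≤ z → 0ℤ < E x y z → Rotated x y z
  nonneg-one x y z x≥0 y≥0 z≥0 e>0 = sum₁ (att-pp⁺ x≥0 y≥0 e>0)
    (att-pp⁻ y≥0 z≥0 (nn⇒< (nn-≡ (nn+ (<⇒nn e>0) (nn+ y≥0 y≥0)) (l₁ x y z))))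
    (att-pp⁻ z≥0 x≥0 (nn⇒< (nn-≡ (nn+ (<⇒nn e>0) (nn+ x≥0 x≥0)) (l₂ x y z))))
    where
    l₁ : ∀ x y z → z - x - y - 0ℤ - + 1 + (y + y) ≡ 0ℤ - (x - y - z) - + 1
    l₁ = ℤ-ring
    l₂ : ∀ x y z → z - x - y - 0ℤ - + 1 + (x + x) ≡ 0ℤ - (y - z - x) - + 1
    l₂ = ℤ-ring

  degenerate : ∀ m → Rotated +[1+ m ] +0 +[1+ m ]
  degenerate m = sum₁ first-term second-term (att-pp⁻ {+[1+ m ]} {+[1+ m ]} {E +[1+ m ] +[1+ m ] +0} (ℤ.+≤+ ℕ.z≤n) (ℤ.+≤+ ℕ.z≤n)
      (nn⇒< (nn-≡ {x = + suc m + + m} (ℤ.+≤+ ℕ.z≤n) (l₃ (+ m)))))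
    where
    l₃ : ∀ m → + 1 + m + m ≡ 0ℤ - (+0 - (+ 1 + m) - (+ 1 + m)) - + 1
    l₃ = ℤ-ring
    e₁ : ∀ x → x - x - + 0 ≡ + 0
    e₁ = ℤ-ring
    e₂ : ∀ x → x - + 0 - x ≡ + 0
    e₂ = ℤ-ring
    first-term : att +[1+ m ] +0 (E +[1+ m ] +0 +[1+ m ]) ≡ 1ℚ
    first-term = cong (att +[1+ m ] +0) (e₁ +[1+ m ])
    second-term : att +0 +[1+ m ] (E +0 +[1+ m ] +[1+ m ]) ≡ 0ℚ
    second-term = cong (att +0 +[1+ m ]) (e₂ +[1+ m ])

  -- With y = 0 the inequalities force x = z. The form is then xX², with the cusp 0 as double root,
  -- and 0 lies on the first of the three arcs only.
  tie : ∀ x z → 0ℤ ≤ x → E x +0 z ≤ 0ℤ → E +0 z x ≤ 0ℤ → ¬ (x ≡ + 0 × z ≡ + 0) → Rotated x +0 z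
  tie x z x≥0 p q nz with ℤ.≤-antisym (nn⇒≤ {z} {x} (nn-≡ (≤⇒nn p) (l₁ x z))) (nn⇒≤ {x} {z} (nn-≡ (≤⇒nn q) (l₂ x z)))
    where
    l₁ : ∀ x z → 0ℤ - (z - x - + 0) ≡ x - z
    l₁ = ℤ-ring
    l₂ : ∀ x z → 0ℤ - (x - + 0 - z) ≡ z - x
    l₂ = ℤ-ring
  tie +0 .(+ 0) x≥0 p q nz | refl = ⊥-elim (nz (refl , refl))
  tie +[1+ m ] .(+[1+ m ]) x≥0 p q nz | refl = degenerate m
  tie -[1+ m ] _ () p q nz | _

  nonneg : ∀ x y z → 0ℤ ≤ x → 0ℤ ≤ y → 0ℤ ≤ z → 0ℤ ≤ Δ x y z → ¬ (x ≡ + 0 × y ≡ + 0 × z ≡ + 0) → Rotated x y z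
  nonneg x y z x≥0 y≥0 z≥0 δ nz = go (E x y z ≤? 0ℤ) (E y z x ≤? 0ℤ) (E z x y ≤? 0ℤ)
    where
    l : ∀ x y z → (z - x - y) * (z - x - y) - + 4 * (x * y) + ((x - 0ℤ - + 1) * (0ℤ - (x - y - z)) + ((y - 0ℤ - + 1) * (0ℤ - (y - z - x)) + (z - 0ℤ - + 1) * (0ℤ - (z - x - y))))
      + ((x - 0ℤ - + 1) + (y - 0ℤ - + 1) + (z - 0ℤ - + 1)) ≡ -[1+ 2 ]
    l = ℤ-ring
    zeros : ∀ u → 0ℤ ≤ u → u ≡ + 0 ⊎ 0ℤ < u
    zeros +0 _ = inj₁ refl
    zeros +[1+ _ ] _ = inj₂ (ℤ.+<+ (ℕ.s≤s ℕ.z≤n))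
    zeros -[1+ _ ] ()
    last : E x y z ≤ 0ℤ → E y z x ≤ 0ℤ → E z x y ≤ 0ℤ → x ≡ + 0 ⊎ 0ℤ < x → y ≡ + 0 ⊎ 0ℤ < y → z ≡ + 0 ⊎ 0ℤ < z → Rotated x y z
    last p q r _ (inj₁ refl) _ = tie x z x≥0 p q (λ (a , b) → nz (a , refl , b))
    last p q r (inj₁ refl) _ _ = rotate x y z (rotate y z x (tie z y z≥0 r p (λ (a , b) → nz (refl , b , a))))
    last p q r _ _ (inj₁ refl) = rotate x y z (tie y x y≥0 q r (λ (a , b) → nz (b , a , refl)))
    last p q r (inj₂ a) (inj₂ b) (inj₂ c) = ⊥-elim (¬nn {k = 2} (nn+ (nn+ δ (nn+ (nn* (<⇒nn a) (≤⇒nn q)) (nn+ (nn* (<⇒nn b) (≤⇒nn r)) (nn* (<⇒nn c) (≤⇒nn p)))))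
      (nn+ (nn+ (<⇒nn a) (<⇒nn b)) (<⇒nn c))) (l x y z))
    go : Dec (E x y z ≤ 0ℤ) → Dec (E y z x ≤ 0ℤ) → Dec (E z x y ≤ 0ℤ) → Rotated x y z
    go (no p) _ _ = nonneg-one x y z x≥0 y≥0 z≥0 (ℤ.≰⇒> p)
    go (yes _) (no p) _ = rotate x y z (nonneg-one y z x y≥0 z≥0 x≥0 (ℤ.≰⇒> p))
    go (yes _) (yes _) (no p) = rotate x y z (rotate y z x (nonneg-one z x y z≥0 x≥0 y≥0 (ℤ.≰⇒> p)))
    go (yes p) (yes q) (yes r) = last p q r (zeros x x≥0) (zeros y y≥0) (zeros z z≥0)

att-rotate : ∀ x y z → 0ℤ ≤ (z - x - y) * (z - x - y) - + 4 * (x * y) → ¬ (x ≡ + 0 × y ≡ + 0 × z ≡ + 0) →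
  att x y (z - x - y) ℚ.+ att y z (x - y - z) ℚ.+ att z x (y - z - x) ≡ 1ℚ
att-rotate x y z δ nz = go (0ℤ ≤? x) (0ℤ ≤? y) (0ℤ ≤? z)
  where
  go : Dec (0ℤ ≤ x) → Dec (0ℤ ≤ y) → Dec (0ℤ ≤ z) → Rotated x y z
  go (yes p) (yes q) (yes r) = nonneg x y z p q r δ nz
  go (no p) (no q) (no r) = negative x y z (ℤ.≰⇒> p) (ℤ.≰⇒> q) (ℤ.≰⇒> r) δ
  -- If the signs are not all alike, some cyclic neighbours pass from a negative value to a
  -- nonnegative one.
  go (no p) (yes q) _ = mixed x y z (ℤ.≰⇒> p) q
  go _ (no q) (yes r) = rotate x y z (mixed y z x (ℤ.≰⇒> q) r)
  go (yes p) _ (no r) = rotate x y z (rotate y z x (mixed z x y (ℤ.≰⇒> r) p))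

-- Conjugacy classes

tr-comm : ∀ M N → tr (M ⊗ N) ≡ tr (N ⊗ M)
tr-comm (a , b , c , d) (a' , b' , c' , d') = l a b c d a' b' c' d'
  where
  l : ∀ a b c d a' b' c' d' → a * a' + b * c' + (c * b' + d * d') ≡ a' * a + b' * c + (c' * b + d' * d)
  l = ℤ-ring

tr-negM : ∀ M → tr (negM M) ≡ ℤ.- tr M
tr-negM (a , b , c , d) = sym (ℤ.neg-distrib-+ a d)

disc-negM : ∀ M → disc (negM M) ≡ disc M
disc-negM (a , b , c , d) = l a b c d
  where
  l : ∀ a b c d → (ℤ.- a + ℤ.- d) * (ℤ.- a + ℤ.- d) - + 4 * (ℤ.- a * ℤ.- d - ℤ.- b * ℤ.- c)
    ≡ (a + d) * (a + d) - + 4 * (a * d - b * c)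
  l = ℤ-ring

tr-conj : ∀ γ → InΓ γ → ∀ M → tr ((inv γ ⊗ M) ⊗ γ) ≡ tr M
tr-conj γ g M = trans (tr-comm (inv γ ⊗ M) γ) (cong tr (Γ-cancel-invˡ γ g M))

det-conj : ∀ γ → InΓ γ → ∀ M → det ((inv γ ⊗ M) ⊗ γ) ≡ det M
det-conj γ g M = trans (det-⊗ (inv γ ⊗ M) γ) (trans (cong₂ _*_ (trans (det-⊗ (inv γ) M)
  (trans (cong (_* det M) (Γ-inv γ g)) (ℤ.*-identityˡ (det M)))) g) (ℤ.*-identityʳ (det M)))

disc-conj : ∀ γ → InΓ γ → ∀ M → disc ((inv γ ⊗ M) ⊗ γ) ≡ disc M
disc-conj γ g M = cong₂ (λ t d → t * t - + 4 * d) (tr-conj γ g M) (det-conj γ g M)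

disc-∼ : ∀ {M N} → M ∼ N → disc M ≡ disc N
disc-∼ (inj₁ refl) = refl
disc-∼ {N = N} (inj₂ refl) = disc-negM N

scalar-scale : ∀ M → IsScalar M → M ≡ scale (proj₁ M) Imat
scalar-scale (a , .(+ 0) , .(+ 0) , .a) (refl , refl , refl) = sym (mat≡ (ℤ.*-identityʳ a) (ℤ.*-zeroʳ a) (ℤ.*-zeroʳ a) (ℤ.*-identityʳ a))

scale-I-scalar : ∀ k → IsScalar (scale k Imat)
scale-I-scalar k = ℤ.*-zeroʳ k , ℤ.*-zeroʳ k , refl

negM-scalar : ∀ M → IsScalar M → IsScalar (negM M)
negM-scalar (a , b , c , d) (refl , refl , refl) = refl , refl , refl

conj-scalar : ∀ γ → InΓ γ → ∀ M → IsScalar M → IsScalar ((inv γ ⊗ M) ⊗ γ)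
conj-scalar γ g M s = subst IsScalar (sym e) (scale-I-scalar (proj₁ M))
  where
  k = proj₁ M
  e : (inv γ ⊗ M) ⊗ γ ≡ scale k Imat
  e = trans (cong (λ N → (inv γ ⊗ N) ⊗ γ) (scalar-scale M s)) (trans (cong (_⊗ γ) (⊗-scale-Iʳ k (inv γ)))
    (trans (scale-⊗ˡ k (inv γ) γ) (cong (scale k) (trans (inv-⊗-self γ) (trans (cong (λ t → scale t Imat) g) (scale-one Imat))))))

conj-twice : ∀ γ δ M → (inv δ ⊗ ((inv γ ⊗ M) ⊗ γ)) ⊗ δ ≡ (inv (γ ⊗ δ) ⊗ M) ⊗ (γ ⊗ δ)
conj-twice γ δ M = trans (cong (_⊗ δ) (sym (⊗-assoc (inv δ) (inv γ ⊗ M) γ)))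
  (trans (⊗-assoc (inv δ ⊗ (inv γ ⊗ M)) γ δ) (cong (_⊗ (γ ⊗ δ)) (trans (sym (⊗-assoc (inv δ) (inv γ) M)) (cong (_⊗ M) (sym (inv-⊗ γ δ))))))

conj-undo : ∀ γ → InΓ γ → ∀ M → (inv (inv γ) ⊗ ((inv γ ⊗ M) ⊗ γ)) ⊗ inv γ ≡ M
conj-undo γ g M = trans (cong (_⊗ inv γ) (trans (cong (_⊗ ((inv γ ⊗ M) ⊗ γ)) (inv-involutive γ)) (trans (cong (γ ⊗_) (⊗-assoc (inv γ) M γ)) (Γ-cancel-invˡ γ g (M ⊗ γ))))) (Γ-cancel-invʳ γ g M)

conj-∼ : ∀ γ {M N} → M ∼ N → ((inv γ ⊗ M) ⊗ γ) ∼ ((inv γ ⊗ N) ⊗ γ)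
conj-∼ γ r = ∼-⊗ʳ γ (∼-⊗ˡ (inv γ) r)

conjS-∼ : ∀ Q → conjS Q ∼ ((inv Smat ⊗ Q) ⊗ Smat)
conjS-∼ Q = ∼-⊗ʳ Smat {Smat ⊗ Q} {inv Smat ⊗ Q} (inj₂ (sym (trans (cong negM (negM-⊗ˡ Smat Q)) (negM-involutive (Smat ⊗ Q)))))

conjU²-∼ : ∀ Q → conjU² Q ∼ ((inv Umat ⊗ Q) ⊗ Umat)
conjU²-∼ Q = ∼-⊗ʳ Umat {U²mat ⊗ Q} {inv Umat ⊗ Q} (inj₂ (negM-⊗ˡ (inv Umat) Q))

conjU-∼ : ∀ Q → conjU Q ∼ ((inv U²mat ⊗ Q) ⊗ U²mat)
conjU-∼ Q = ∼-⊗ʳ U²mat {Umat ⊗ Q} {inv U²mat ⊗ Q} (inj₂ (negM-⊗ˡ (inv U²mat) Q))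

module ConjugacyClass (M₀ : Mat) (X : Pred Mat 0ℓ) (X? : Decidable X) (X⇔ : ∀ M → X M ⇔ InConjClass M₀ M) where

  X-witness : ∀ M → X M → InConjClass M₀ M
  X-witness M = Equivalence.to (X⇔ M)

  X-∼ : ∀ {M N} → M ∼ N → X N → X M
  X-∼ {M} {N} r x = go (X-witness N x)
    where
    go : InConjClass M₀ N → X M
    go (γ , g , s) = Equivalence.from (X⇔ M) (γ , g , ∼-trans r s)

  X-base : X M₀
  X-base = Equivalence.from (X⇔ M₀) (Imat , refl , inj₁ (sym (trans (⊗-identityʳ (Imat ⊗ M₀)) (⊗-identityˡ M₀))))

  X-conj : ∀ δ → InΓ δ → ∀ M → X M → X ((inv δ ⊗ M) ⊗ δ)
  X-conj δ d M x = go (X-witness M x)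
    where
    go : InConjClass M₀ M → X ((inv δ ⊗ M) ⊗ δ)
    go (γ , g , r) = Equivalence.from (X⇔ ((inv δ ⊗ M) ⊗ δ)) (γ ⊗ δ , Γ-⊗ γ δ g d ,
      subst (((inv δ ⊗ M) ⊗ δ) ∼_) (conj-twice γ δ M₀) (conj-∼ δ r))

  X-conj⁻ : ∀ δ → InΓ δ → ∀ M → X ((inv δ ⊗ M) ⊗ δ) → X M
  X-conj⁻ δ d M x = subst X (conj-undo δ d M) (X-conj (inv δ) (Γ-inv δ d) ((inv δ ⊗ M) ⊗ δ) x)

  X-det : ∀ M → X M → det M ≡ det M₀
  X-det M x = go (X-witness M x)
    where
    go : InConjClass M₀ M → det M ≡ det M₀
    go (γ , g , r) = trans (det-∼ r) (det-conj γ g M₀)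

  X-disc : ∀ M → X M → disc M ≡ disc M₀
  X-disc M x = go (X-witness M x)
    where
    go : InConjClass M₀ M → disc M ≡ disc M₀
    go (γ , g , r) = trans (disc-∼ r) (disc-conj γ g M₀)

  X-scalar : ∀ M → X M → IsScalar M → IsScalar M₀
  X-scalar M x s = go (X-witness M x)
    where
    go : InConjClass M₀ M → IsScalar M₀
    go (γ , g , r) = subst IsScalar (conj-undo γ g M₀) (conj-scalar (inv γ) (Γ-inv γ g) ((inv γ ⊗ M₀) ⊗ γ) (pull r))
      where
      pull : M ∼ ((inv γ ⊗ M₀) ⊗ γ) → IsScalar ((inv γ ⊗ M₀) ⊗ γ)
      pull (inj₁ p) = subst IsScalar p s
      pull (inj₂ p) = subst IsScalar (trans (cong negM p) (negM-involutive ((inv γ ⊗ M₀) ⊗ γ))) (negM-scalar M s)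

  tr-X : ∀ Q → X Q → ℤ.∣ tr Q ∣ ≡ ℤ.∣ tr M₀ ∣
  tr-X Q x = go (X-witness Q x)
    where
    go : InConjClass M₀ Q → ℤ.∣ tr Q ∣ ≡ ℤ.∣ tr M₀ ∣
    go (γ , g , inj₁ p) = cong ℤ.∣_∣ (trans (cong tr p) (tr-conj γ g M₀))
    go (γ , g , inj₂ p) = trans (cong ℤ.∣_∣ (trans (cong tr p) (trans (tr-negM ((inv γ ⊗ M₀) ⊗ γ)) (cong ℤ.-_ (tr-conj γ g M₀))))) (ℤ.∣-i∣≡∣i∣ (tr M₀))

  -- Multiplication by T^k adds kγ to the trace, while |tr| is constant on the class.
  X-shift : ∀ α β γ δ k → ¬ γ ≡ + 0 → suc (ℤ.∣ α + δ ∣ ℕ.+ ℤ.∣ tr M₀ ∣) ℕ.≤ k →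
    ¬ X (α + + k * γ , β + + k * δ , γ , δ)
  X-shift α β γ δ k nz h x = ℕ.<-irrefl refl (ℕ.≤-trans (ℕ.s≤s chain) h)
    where
    Q : Mat
    Q = α + + k * γ , β + + k * δ , γ , δ
    l : ∀ α δ k γ → α + k * γ + δ - (α + δ) ≡ k * γ
    l = ℤ-ring
    chain : k ℕ.≤ ℤ.∣ α + δ ∣ ℕ.+ ℤ.∣ tr M₀ ∣
    chain = ℕ.≤-trans (ℕ.m≤m*n k ℤ.∣ γ ∣ {{ℕ.≢-nonZero (λ z → nz (ℤ.∣i∣≡0⇒i≡0 z))}})
      (ℕ.≤-trans (ℕ.≤-reflexive (trans (sym (ℤ.abs-* (+ k) γ)) (cong ℤ.∣_∣ (sym (l α δ (+ k) γ)))))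
      (ℕ.≤-trans (ℤ.∣i-j∣≤∣i∣+∣j∣ (tr Q) (α + δ)) (ℕ.≤-reflexive (trans (ℕ.+-comm ℤ.∣ tr Q ∣ ℤ.∣ α + δ ∣) (cong (ℤ.∣ α + δ ∣ ℕ.+_) (tr-X Q x))))))

  𝟙 : Mat → ℚ
  𝟙 M = ind (X? M)

  𝟙-∼ : ∀ {M N} → M ∼ N → 𝟙 M ≡ 𝟙 N
  𝟙-∼ {M} {N} r = ind-cong (X? M) (X? N) (X-∼ (∼-sym r)) (X-∼ r)

  𝟙-even : Even 𝟙
  𝟙-even M = 𝟙-∼ {negM M} {M} ∼-neg

  𝟙-conj : ∀ δ → InΓ δ → ∀ M → 𝟙 ((inv δ ⊗ M) ⊗ δ) ≡ 𝟙 M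
  𝟙-conj δ d M = ind-cong (X? ((inv δ ⊗ M) ⊗ δ)) (X? M) (X-conj⁻ δ d M) (X-conj δ d M)

  𝟙-S : ∀ Q → 𝟙 (conjS Q) ≡ 𝟙 Q
  𝟙-S Q = trans (𝟙-∼ (conjS-∼ Q)) (𝟙-conj Smat refl Q)

  𝟙-U : ∀ Q → 𝟙 (conjU Q) ≡ 𝟙 Q
  𝟙-U Q = trans (𝟙-∼ (conjU-∼ Q)) (𝟙-conj U²mat refl Q)

  𝟙-U² : ∀ Q → 𝟙 (conjU² Q) ≡ 𝟙 Q
  𝟙-U² Q = trans (𝟙-∼ (conjU²-∼ Q)) (𝟙-conj Umat refl Q)

  𝟙-τ : ∀ Q → 𝟙 (τ Q) ≡ 𝟙 Q
  𝟙-τ Q = 𝟙-conj (Tz -[1+ 0 ]) refl Q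

-- The mass at the attracting fixed point of a class with nonnegative discriminant

attM : Mat → ℚ
attM (a , b , c , d) = att c (ℤ.- b) (d - a)

sign⁺ : ℤ → ℚ
sign⁺ t = ind (0ℤ <? t)

-- `attM` selects the attracting fixed point only when the trace is positive. Of Q and -Q at most
-- one has positive trace, and the sum evaluates `attM` there, which makes the function even.
attracted : Mat → ℚ
attracted Q = sign⁺ (tr Q) ℚ.* attM Q ℚ.+ sign⁺ (tr (negM Q)) ℚ.* attM (negM Q)

attracted-even : Even attracted
attracted-even Q = trans (cong (λ M → sign⁺ (tr (negM Q)) ℚ.* attM (negM Q) ℚ.+ sign⁺ (tr M) ℚ.* attM M) (negM-involutive Q))
  (ℚ.+-comm (sign⁺ (tr (negM Q)) ℚ.* attM (negM Q)) (sign⁺ (tr Q) ℚ.* attM Q))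

attracted-positive : ∀ Q → 0ℤ < tr Q → attracted Q ≡ attM Q
attracted-positive Q p = trans (cong₂ (λ s t → s ℚ.* attM Q ℚ.+ t ℚ.* attM (negM Q)) (ind-yes (0ℤ <? tr Q) p)
    (ind-no (0ℤ <? tr (negM Q)) (λ q → ℤ.<-asym p (subst (_< 0ℤ) (trans (cong ℤ.-_ (tr-negM Q)) (ℤ.neg-involutive (tr Q))) (ℤ.neg-mono-< q)))))
  (l (attM Q) (attM (negM Q)))
  where
  l : ∀ x y → 1ℚ ℚ.* x ℚ.+ 0ℚ ℚ.* y ≡ x
  l = ring-of ringℚ

attM-S : ∀ Q → 0ℤ ≤ disc Q → ¬ IsScalar Q → attM Q ℚ.+ attM (negM (conjS Q)) ≡ 1ℚ
attM-S (a , b , c , d) δ ns = trans (cong (λ t → att c (ℤ.- b) (d - a) ℚ.+ t)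
    (trans (cong (λ M → attM (negM M)) (conjS-entries a b c d)) (cong₂ (λ s t → att (ℤ.- b) s t) (ℤ.neg-involutive c) (l₁ a d))))
  (att-flip c (ℤ.- b) (d - a) (nn-≡ δ (l₂ a b c d)) λ (p , q , r) → ns (trans (sym (ℤ.neg-involutive b)) (cong ℤ.-_ q) , p , sym (ℤ.i-j≡0⇒i≡j d a r)))
  where
  l₁ : ∀ a d → ℤ.- (ℤ.- a) - ℤ.- (ℤ.- d) ≡ ℤ.- (d - a)
  l₁ = ℤ-ring
  l₂ : ∀ a b c d → (a + d) * (a + d) - + 4 * (a * d - b * c) ≡ (d - a) * (d - a) - + 4 * (c * ℤ.- b)
  l₂ = ℤ-ring

conjU-entries : ∀ a b c d → negM (conjU (a , b , c , d)) ≡ (d - b , a - c + b - d , ℤ.- b , a + b)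
conjU-entries a b c d = trans (cong (λ M → negM (M ⊗ U²mat)) (Umat-⊗ a b c d)) (trans (cong negM (⊗-U²mat (a - c) (b - d) a b))
  (mat≡ (l₁ b d) (l₂ a b c d) refl (l₃ a b)))
  where
  l₁ : ∀ b d → ℤ.- (b - d) ≡ d - b
  l₁ = ℤ-ring
  l₂ : ∀ a b c d → ℤ.- (ℤ.- (a - c) - (b - d)) ≡ a - c + b - d
  l₂ = ℤ-ring
  l₃ : ∀ a b → ℤ.- (ℤ.- a - b) ≡ a + b
  l₃ = ℤ-ring

conjU²-entries : ∀ a b c d → negM (conjU² (a , b , c , d)) ≡ (c + d , ℤ.- c , c + d - a - b , a - c)
conjU²-entries a b c d = trans (cong (λ M → negM (M ⊗ Umat)) (U²mat-⊗ a b c d)) (trans (cong negM (⊗-Umat (ℤ.- c) (ℤ.- d) (a - c) (b - d)))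
  (mat≡ (l₁ c d) (cong ℤ.-_ (ℤ.neg-involutive c)) (l₂ a b c d) (ℤ.neg-involutive (a - c))))
  where
  l₁ : ∀ c d → ℤ.- (ℤ.- c + ℤ.- d) ≡ c + d
  l₁ = ℤ-ring
  l₂ : ∀ a b c d → ℤ.- (a - c + (b - d)) ≡ c + d - a - b
  l₂ = ℤ-ring

attM-U : ∀ Q → 0ℤ ≤ disc Q → ¬ IsScalar Q → attM Q ℚ.+ attM (negM (conjU Q)) ℚ.+ attM (negM (conjU² Q)) ≡ 1ℚ
attM-U (a , b , c , d) δ ns = trans (cong₂ ℚ._+_ (cong₂ ℚ._+_
    (cong (att c (ℤ.- b)) (l₁ a b c d))
    (trans (cong attM (conjU-entries a b c d)) (cong₂ (att (ℤ.- b)) (l₂ a b c d) (l₃ a b c d))))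
    (trans (cong attM (conjU²-entries a b c d)) (cong₂ (att z) (ℤ.neg-involutive c) (l₄ a b c d))))
  (att-rotate c (ℤ.- b) z (nn-≡ δ (l₅ a b c d)) λ (p , q , r) → ns (trans (sym (ℤ.neg-involutive b)) (cong ℤ.-_ q) , p ,
    sym (ℤ.i-j≡0⇒i≡j d a (trans (l₆ a b c d) (cong₂ (λ s t → s + ℤ.- t) r (cong₂ _+_ p q))))))
  where
  z = c + d - a - b
  l₁ : ∀ a b c d → d - a ≡ c + d - a - b - c - ℤ.- b
  l₁ = ℤ-ring
  l₂ : ∀ a b c d → ℤ.- (a - c + b - d) ≡ c + d - a - b
  l₂ = ℤ-ring
  l₃ : ∀ a b c d → a + b - (d - b) ≡ c - ℤ.- b - (c + d - a - b)
  l₃ = ℤ-ring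
  l₄ : ∀ a b c d → a - c - (c + d) ≡ ℤ.- b - (c + d - a - b) - c
  l₄ = ℤ-ring
  l₅ : ∀ a b c d → (a + d) * (a + d) - + 4 * (a * d - b * c)
    ≡ (c + d - a - b - c - ℤ.- b) * (c + d - a - b - c - ℤ.- b) - + 4 * (c * ℤ.- b)
  l₅ = ℤ-ring
  l₆ : ∀ a b c d → d - a ≡ c + d - a - b + ℤ.- (c + ℤ.- b)
  l₆ = ℤ-ring

tr-conjS : ∀ Q → tr (negM (conjS Q)) ≡ tr Q
tr-conjS (a , b , c , d) = trans (cong (λ M → tr (negM M)) (conjS-entries a b c d)) (l a d)
  where
  l : ∀ a d → ℤ.- (ℤ.- d) + ℤ.- (ℤ.- a) ≡ a + d
  l = ℤ-ring

tr-conjU : ∀ Q → tr (negM (conjU Q)) ≡ tr Q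
tr-conjU (a , b , c , d) = trans (cong tr (conjU-entries a b c d)) (l a b d)
  where
  l : ∀ a b d → d - b + (a + b) ≡ a + d
  l = ℤ-ring

tr-conjU² : ∀ Q → tr (negM (conjU² Q)) ≡ tr Q
tr-conjU² (a , b , c , d) = trans (cong tr (conjU²-entries a b c d)) (l a c d)
  where
  l : ∀ a c d → c + d + (a - c) ≡ a + d
  l = ℤ-ring

private
  attracted-conj : ∀ (φ : Mat → Mat) → (∀ Q → tr (negM (φ Q)) ≡ tr Q) → ∀ Q → 0ℤ < tr Q → attracted (φ Q) ≡ attM (negM (φ Q))
  attracted-conj φ h Q p = trans (sym (attracted-even (φ Q))) (attracted-positive (negM (φ Q)) (subst (0ℤ <_) (sym (h Q)) p))

  by-sign : ∀ (f : Mat → ℚ) (e : ℚ) → Even f → (∀ Q → 0ℤ < tr Q → 0ℤ ≤ disc Q → ¬ IsScalar Q → f Q ≡ e) →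
    ∀ Q → ¬ tr Q ≡ + 0 → 0ℤ ≤ disc Q → ¬ IsScalar Q → f Q ≡ e
  by-sign f e ef h Q tz δ ns with ℤ.<-cmp 0ℤ (tr Q)
  ... | tri< p _ _ = h Q p δ ns
  ... | tri≈ _ p _ = ⊥-elim (tz (sym p))
  ... | tri> _ _ p = trans (sym (ef Q)) (h (negM Q) (subst (0ℤ <_) (sym (tr-negM Q)) (ℤ.neg-mono-< p))
    (subst (0ℤ ≤_) (sym (disc-negM Q)) δ) (λ s → ns (subst IsScalar (negM-involutive Q) (negM-scalar (negM Q) s))))

attracted-S : ∀ Q → ¬ tr Q ≡ + 0 → 0ℤ ≤ disc Q → ¬ IsScalar Q → attracted Q ℚ.+ attracted (conjS Q) ≡ 1ℚ
attracted-S = by-sign (λ Q → attracted Q ℚ.+ attracted (conjS Q)) 1ℚ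
  (λ Q → cong₂ ℚ._+_ (attracted-even Q) (trans (cong attracted (trans (cong (_⊗ Smat) (negM-⊗ʳ Smat Q)) (negM-⊗ˡ (Smat ⊗ Q) Smat))) (attracted-even (conjS Q))))
  (λ Q p δ ns → trans (cong₂ ℚ._+_ (attracted-positive Q p) (attracted-conj conjS tr-conjS Q p)) (attM-S Q δ ns))

attracted-U : ∀ Q → ¬ tr Q ≡ + 0 → 0ℤ ≤ disc Q → ¬ IsScalar Q → attracted Q ℚ.+ attracted (conjU Q) ℚ.+ attracted (conjU² Q) ≡ 1ℚ
attracted-U = by-sign (λ Q → attracted Q ℚ.+ attracted (conjU Q) ℚ.+ attracted (conjU² Q)) 1ℚ
  (λ Q → cong₂ ℚ._+_ (cong₂ ℚ._+_ (attracted-even Q)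
      (trans (cong attracted (trans (cong (_⊗ U²mat) (negM-⊗ʳ Umat Q)) (negM-⊗ˡ (Umat ⊗ Q) U²mat))) (attracted-even (conjU Q))))
      (trans (cong attracted (trans (cong (_⊗ Umat) (negM-⊗ʳ U²mat Q)) (negM-⊗ˡ (U²mat ⊗ Q) Umat))) (attracted-even (conjU² Q))))
  (λ Q p δ ns → trans (cong₂ ℚ._+_ (cong₂ ℚ._+_ (attracted-positive Q p) (attracted-conj conjU tr-conjU Q p)) (attracted-conj conjU² tr-conjU² Q p)) (attM-U Q δ ns))

-- Classes of nonnegative discriminant

abs-bound : ∀ β → 0ℤ ≤ + ℤ.∣ β ∣ + β
abs-bound (+ k) = ℤ.+≤+ ℕ.z≤n
abs-bound -[1+ k ] = ℤ.≤-reflexive (sym (ℤ.+-inverseʳ (+ suc k)))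

abs-bound′ : ∀ β → 0ℤ ≤ + ℤ.∣ β ∣ ℤ.- β
abs-bound′ β = subst (λ k → 0ℤ ≤ + k + ℤ.- β) (ℤ.∣-i∣≡∣i∣ β) (abs-bound (ℤ.- β))

ℕ⇒nn : ∀ {a b} → suc a ℕ.≤ b → 0ℤ ≤ + b - + a - + 1
ℕ⇒nn p = <⇒nn (ℤ.+<+ p)

attM-upper : ∀ a y m → 0ℤ < y → attM (a , y , + 0 , m) ≡ 0ℚ
attM-upper a y m p = att-pn (m - a) ℤ.≤-refl (ℤ.neg-mono-< p)

attracted-upper : ∀ {α δ} y → SameSign α δ → (0ℤ < δ → 0ℤ < y) → (δ < 0ℤ → y < 0ℤ) → attracted (α , y , + 0 , δ) ≡ 0ℚ
attracted-upper {α} {δ} y (both+ {a} {d}) h _ = trans (cong (λ t → 1ℚ ℚ.* t ℚ.+ 0ℚ ℚ.* attM (negM (α , y , + 0 , δ))) (attM-upper α y δ (h (ℤ.+<+ (ℕ.s≤s ℕ.z≤n)))))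
  (l (attM (negM (α , y , + 0 , δ))))
  where
  l : ∀ x → 1ℚ ℚ.* 0ℚ ℚ.+ 0ℚ ℚ.* x ≡ 0ℚ
  l = ring-of ringℚ
attracted-upper {α} {δ} y (both- {a} {d}) _ h = trans (cong (λ t → 0ℚ ℚ.* attM (α , y , + 0 , δ) ℚ.+ 1ℚ ℚ.* t) (attM-upper (ℤ.- α) (ℤ.- y) (ℤ.- δ) (ℤ.neg-mono-< (h ℤ.-<+))))
  (l (attM (α , y , + 0 , δ)))
  where
  l : ∀ x → 0ℚ ℚ.* x ℚ.+ 1ℚ ℚ.* 0ℚ ≡ 0ℚ
  l = ring-of ringℚ

upper-sameSign : ∀ {n} .{{_ : NonZero n}} α β δ → det (α , β , + 0 , δ) ≡ + n → SameSign α δ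
upper-sameSign {n} {{n≢0}} α β δ e = sameSign α δ (subst (0ℤ <_) (trans (sym e) (l α β δ)) (ℤ.+<+ (ℕ.>-nonZero⁻¹ n {{n≢0}})))
  where
  l : ∀ α β δ → α * δ - β * + 0 ≡ α * δ
  l = ℤ-ring

Bounded : ℕ → Mat → Set
Bounded n Q = crossing Q ≡ 0ℚ ⊎ attM Q ≡ 1ℚ ⊎ norm Q ℕ.≤ four n

-- If the attracting fixed point is positive and Q∞ negative, then det Q is a sum of two products of positive integers.
attM-bounded : ∀ n Q → det Q ≡ + n → 0ℤ < tr Q → Bounded n Q
attM-bounded n (+0 , b , c , d) e t = inj₁ refl
attM-bounded n (+[1+ a ] , b , + 0 , d) e t = inj₁ refl
attM-bounded n (+[1+ a ] , b , +[1+ c ] , d) e t = inj₁ refl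
attM-bounded n ( -[1+ a ] , b , + 0 , d) e t = inj₁ refl
attM-bounded n ( -[1+ a ] , b , -[1+ c ] , d) e t = inj₁ refl
attM-bounded n (+[1+ a ] , b , -[1+ c ] , d) e t = go b d refl refl
  where
  A = +[1+ a ]
  C = -[1+ c ]
  size : ∀ p q r s → p ℕ.* s ℕ.+ q ℕ.* r ≡ n → 0 ℕ.< p → 0 ℕ.< q → 0 ℕ.< r → 0 ℕ.< s → p ℕ.+ q ℕ.+ (r ℕ.+ s) ℕ.≤ four n
  size p q r s f p⁺ q⁺ r⁺ s⁺ = ℕ.+-mono-≤ (ℕ.+-mono-≤ p≤n q≤n) (ℕ.+-mono-≤ r≤n s≤n)
    where
    ps≤n : p ℕ.* s ℕ.≤ n
    ps≤n = subst (p ℕ.* s ℕ.≤_) f (ℕ.m≤m+n (p ℕ.* s) (q ℕ.* r))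
    qr≤n : q ℕ.* r ℕ.≤ n
    qr≤n = subst (q ℕ.* r ℕ.≤_) f (ℕ.m≤n+m (q ℕ.* r) (p ℕ.* s))
    p≤n = ℕ.≤-trans (ℕ.m≤m*n p s {{ℕ.>-nonZero s⁺}}) ps≤n
    s≤n = ℕ.≤-trans (ℕ.m≤n*m s p {{ℕ.>-nonZero p⁺}}) ps≤n
    q≤n = ℕ.≤-trans (ℕ.m≤m*n q r {{ℕ.>-nonZero r⁺}}) qr≤n
    r≤n = ℕ.≤-trans (ℕ.m≤n*m r q {{ℕ.>-nonZero q⁺}}) qr≤n
  0<suc : ∀ {k} → 0 ℕ.< suc k
  0<suc = ℕ.s≤s ℕ.z≤n
  go : ∀ b′ d′ → b ≡ b′ → d ≡ d′ → Bounded n (A , b , C , d)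
  go (+0) d′ refl refl = inj₂ (inj₁ refl)
  go -[1+ _ ] d′ refl refl = inj₂ (inj₁ refl)
  go +[1+ b′ ] -[1+ d′ ] refl refl = inj₂ (inj₁ refl)
  go +[1+ b′ ] +0 refl refl = inj₂ (inj₁ refl)
  go +[1+ b′ ] +[1+ d′ ] refl refl = inj₂ (inj₂ (size (suc a) (suc b′) (suc c) (suc d′) (ℤ.+-injective (trans f e)) 0<suc 0<suc 0<suc 0<suc))
    where
    l : ∀ a b c d → a * d + b * c ≡ a * d - b * ℤ.- c
    l = ℤ-ring
    f : + (suc a ℕ.* suc d′ ℕ.+ suc b′ ℕ.* suc c) ≡ det (A , +[1+ b′ ] , C , +[1+ d′ ])
    f = trans (ℤ.pos-+ (suc a ℕ.* suc d′) (suc b′ ℕ.* suc c)) (trans (cong₂ _+_ (ℤ.pos-* (suc a) (suc d′)) (ℤ.pos-* (suc b′) (suc c)))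
      (l (+ suc a) (+ suc b′) (+ suc c) (+ suc d′)))
attM-bounded n ( -[1+ a ] , b , +[1+ c ] , d) e t = inj₂ (inj₁ (att-pp⁺ {+[1+ c ]} {ℤ.- b} {d - A} (ℤ.+≤+ ℕ.z≤n) b≤0 e>0))
  where
  A = -[1+ a ]
  C = +[1+ c ]
  A<0 : 0ℤ ≤ 0ℤ - A - + 1
  A<0 = <⇒nn {A} {0ℤ} ℤ.-<+
  C>0 : 0ℤ ≤ C - 0ℤ - + 1
  C>0 = <⇒nn {0ℤ} {C} (ℤ.+<+ (ℕ.s≤s ℕ.z≤n))
  t>0 = <⇒nn t
  e>0 : 0ℤ < d - A
  e>0 = nn⇒< (nn-≡ (nn+ t>0 (nn+ (nn+ A<0 A<0) (ℤ.+≤+ {0} {2} ℕ.z≤n))) (l A d))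
    where
    l : ∀ a d → a + d - 0ℤ - + 1 + ((0ℤ - a - + 1) + (0ℤ - a - + 1) + + 2) ≡ d - a - 0ℤ - + 1
    l = ℤ-ring
  b≤0 : 0ℤ ≤ ℤ.- b
  b≤0 with 0ℤ <? b
  ... | no p = ℤ.neg-mono-≤ (ℤ.≮⇒≥ p)
  ... | yes p = ⊥-elim (¬nn {k = 0} (nn+ (nn+ (≡⇒nn (+ 1) (e)) (ℤ.+≤+ {0} {n} ℕ.z≤n))
      (nn+ (nn* (nn+ A<0 (ℤ.+≤+ {0} {1} ℕ.z≤n)) (nn+ (nn+ t>0 (ℤ.+≤+ {0} {2} ℕ.z≤n)) A<0))
        (nn+ (nn* (<⇒nn p) C>0) (nn+ (<⇒nn p) C>0)))) (l A b C d (+ n)))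
    where
    l : ∀ a b c d n → + 1 * (a * d - b * c - n) + n + ((0ℤ - a - + 1 + + 1) * (a + d - 0ℤ - + 1 + + 2 + (0ℤ - a - + 1))
      + ((b - 0ℤ - + 1) * (c - 0ℤ - + 1) + ((b - 0ℤ - + 1) + (c - 0ℤ - + 1)))) ≡ -[1+ 0 ]
    l = ℤ-ring

crossing-even : Even crossing
crossing-even (a , b , c , d) = opp-neg a c

module NonnegativeDiscriminant (n : ℕ) .{{n≢0 : NonZero n}} (M₀ : Mat) (d₀ : det M₀ ≡ + n)
  (X : Pred Mat 0ℓ) (X? : Decidable X) (X⇔ : ∀ M → X M ⇔ InConjClass M₀ M)
  (δ₀ : 0ℤ ≤ disc M₀) (ns₀ : ¬ IsScalar M₀) where
  open ConjugacyClass M₀ X X? X⇔ public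

  X-n : ∀ {Q} → X Q → det Q ≡ + n
  X-n {Q} x = trans (X-det Q x) d₀

  X-δ : ∀ {Q} → X Q → 0ℤ ≤ disc Q
  X-δ {Q} x = subst (0ℤ ≤_) (sym (X-disc Q x)) δ₀

  X-ns : ∀ {Q} → X Q → ¬ IsScalar Q
  X-ns {Q} x s = ns₀ (X-scalar Q x s)

  tr≢0 : ∀ {Q} → X Q → ¬ tr Q ≡ + 0
  tr≢0 {Q} x z = absurd (subst₂ (λ t d → 0ℤ ≤ t * t - + 4 * d) z (X-n x) (X-δ x))
    where
    absurd : 0ℤ ≤ + 0 * + 0 - + 4 * + n → ⊥
    absurd p = ¬nn {k = 3} (nn+ p (nn* (ℤ.+≤+ {0} {4} ℕ.z≤n) (ℕ⇒nn {0} (ℕ.>-nonZero⁻¹ n {{n≢0}})))) (l (+ n))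
      where
      l : ∀ n → + 0 * + 0 - + 4 * n + + 4 * (n - + 0 - + 1) ≡ -[1+ 3 ]
      l = ℤ-ring

  P : Mat → ℚ
  P Q = 𝟙 Q ℚ.* attracted Q

  weighted-one : ∀ Q y → (X Q → y ≡ 1ℚ) → 𝟙 Q ℚ.* y ≡ 𝟙 Q
  weighted-one Q y h = go (X? Q)
    where
    go : (x? : Dec (X Q)) → ind x? ℚ.* y ≡ ind x?
    go (yes x) = cong (1ℚ ℚ.*_) (h x)
    go (no _) = ℚ.*-zeroˡ y

  weighted-zero : ∀ Q y → (X Q → y ≡ 0ℚ) → 𝟙 Q ℚ.* y ≡ 0ℚ
  weighted-zero Q y h = go (X? Q)
    where
    go : (x? : Dec (X Q)) → ind x? ℚ.* y ≡ 0ℚ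
    go (yes x) = cong (1ℚ ℚ.*_) (h x)
    go (no _) = ℚ.*-zeroˡ y

  P-even′ : Even P
  P-even′ Q = cong₂ ℚ._*_ (𝟙-even Q) (attracted-even Q)

  -- If γ ≠ 0, the growing trace leads out of the class. If γ = 0, the trace stays, but β + kδ
  -- eventually has the sign of δ; then the fixed point b/(d - a), where it is the attracting one,
  -- is positive.
  tail : ∀ N → det N ≡ + n → Tail (λ k → P (Tz-pow k ⊗ N))
  tail N@(α , β , γ , δ) dN = K , λ k h → trans (cong P (Tz-⊗ (+ k) α β γ δ)) (by k h (γ ≟ + 0))
    where
    K = suc (ℤ.∣ α + δ ∣ ℕ.+ ℤ.∣ tr M₀ ∣ ℕ.+ ℤ.∣ β ∣)
    by : ∀ k → K ℕ.≤ k → Dec (γ ≡ + 0) → P (α + + k * γ , β + + k * δ , γ , δ) ≡ 0ℚ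
    by k h (no nz) = trans (cong (ℚ._* attracted Q) (ind-no (X? Q) (X-shift α β γ δ k nz
        (ℕ.≤-trans (ℕ.s≤s (ℕ.m≤m+n (ℤ.∣ α + δ ∣ ℕ.+ ℤ.∣ tr M₀ ∣) ℤ.∣ β ∣)) h)))) (ℚ.*-zeroˡ (attracted Q))
      where Q = α + + k * γ , β + + k * δ , γ , δ
    by k h (yes refl) = trans (cong P (mat≡ {b = β + + k * δ} {c = + 0} {d = δ} (l α (+ k)) refl refl refl))
      (trans (cong (𝟙 Q ℚ.*_) (attracted-upper (β + + k * δ) (upper-sameSign α β δ dN) pos neg)) (ℚ.*-zeroʳ (𝟙 Q)))
      where
      Q = α , β + + k * δ , + 0 , δ
      l : ∀ α k → α + k * + 0 ≡ α
      l = ℤ-ring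
      k>β : 0ℤ ≤ + k - + ℤ.∣ β ∣ ℤ.- + 1
      k>β = ℕ⇒nn (ℕ.≤-trans (ℕ.s≤s (ℕ.m≤n+m ℤ.∣ β ∣ (ℤ.∣ α + δ ∣ ℕ.+ ℤ.∣ tr M₀ ∣))) h)
      k≥0 : 0ℤ ≤ + k
      k≥0 = ℤ.+≤+ ℕ.z≤n
      pos : 0ℤ < δ → 0ℤ < β + + k * δ
      pos p = nn⇒< (nn-≡ (nn+ (nn+ (abs-bound β) k>β) (nn* k≥0 (<⇒nn p))) (l′ β (+ k) δ (+ ℤ.∣ β ∣)))
        where
        l′ : ∀ β k δ u → u + β + (k - u - + 1) + k * (δ - 0ℤ - + 1) ≡ β + k * δ - 0ℤ - + 1
        l′ = ℤ-ring
      neg : δ < 0ℤ → β + + k * δ < 0ℤ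
      neg p = nn⇒< (nn-≡ (nn+ (nn+ (abs-bound′ β) k>β) (nn* k≥0 (<⇒nn p))) (l′ β (+ k) δ (+ ℤ.∣ β ∣)))
        where
        l′ : ∀ β k δ u → u - β + (k - u - + 1) + k * (0ℤ - δ - + 1) ≡ 0ℤ - (β + k * δ) - + 1
        l′ = ℤ-ring

  mass : EquivariantMass n
  mass = record
    { P = P
    ; e = 𝟙
    ; P-even = P-even′
    ; P-S = λ Q → trans (cong (λ t → P Q ℚ.+ t ℚ.* attracted (conjS Q)) (𝟙-S Q))
        (trans (sym (ℚ.*-distribˡ-+ (𝟙 Q) (attracted Q) (attracted (conjS Q))))
        (weighted-one Q (attracted Q ℚ.+ attracted (conjS Q)) (λ x → attracted-S Q (tr≢0 x) (X-δ x) (X-ns x))))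
    ; P-U = λ Q → trans (cong₂ (λ s t → P Q ℚ.+ s ℚ.* attracted (conjU Q) ℚ.+ t ℚ.* attracted (conjU² Q)) (𝟙-U Q) (𝟙-U² Q))
        (trans (l (𝟙 Q) (attracted Q) (attracted (conjU Q)) (attracted (conjU² Q)))
        (weighted-one Q (attracted Q ℚ.+ attracted (conjU Q) ℚ.+ attracted (conjU² Q)) (λ x → attracted-U Q (tr≢0 x) (X-δ x) (X-ns x))))
    ; P-det = λ Q → det? Q (X? Q)
    ; P-tail = tail }
    where
    l : ∀ a x y z → a ℚ.* x ℚ.+ a ℚ.* y ℚ.+ a ℚ.* z ≡ a ℚ.* (x ℚ.+ y ℚ.+ z)
    l = ring-of ringℚ
    det? : ∀ Q → Dec (X Q) → det Q ≡ + n ⊎ P Q ≡ 0ℚ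
    det? Q (yes x) = inj₁ (X-n x)
    det? Q (no ¬x) = inj₂ (trans (cong (ℚ._* attracted Q) (ind-no (X? Q) ¬x)) (ℚ.*-zeroˡ (attracted Q)))

  bounded : ∀ Q → crossing Q ≡ 0ℚ ⊎ 𝟙 Q ≡ P Q ⊎ norm Q ℕ.≤ four n
  bounded Q = go (X? Q)
    where
    conclude : ∀ {Q′} → Q′ ∼ Q → attracted Q′ ≡ attM Q′ → Bounded n Q′ → crossing Q ≡ 0ℚ ⊎ 𝟙 Q ≡ P Q ⊎ norm Q ℕ.≤ four n
    conclude r a (inj₁ z) = inj₁ (trans (sym (even-∼ crossing-even r)) z)
    conclude r a (inj₂ (inj₁ z)) = inj₂ (inj₁ (sym (weighted-one Q (attracted Q) (λ _ → trans (sym (even-∼ attracted-even r)) (trans a z)))))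
    conclude r a (inj₂ (inj₂ p)) = inj₂ (inj₂ (subst (ℕ._≤ four n) (norm-∼ r) p))
    go : Dec (X Q) → crossing Q ≡ 0ℚ ⊎ 𝟙 Q ≡ P Q ⊎ norm Q ℕ.≤ four n
    go (no ¬x) = inj₂ (inj₁ (trans (ind-no (X? Q) ¬x) (sym (trans (cong (ℚ._* attracted Q) (ind-no (X? Q) ¬x)) (ℚ.*-zeroˡ (attracted Q))))))
    go (yes x) with ℤ.<-cmp 0ℤ (tr Q)
    ... | tri< p _ _ = conclude {Q} ∼-refl (attracted-positive Q p) (attM-bounded n Q (X-n x) p)
    ... | tri≈ _ p _ = ⊥-elim (tr≢0 x (sym p))
    ... | tri> _ _ p = conclude {negM Q} ∼-neg (attracted-positive (negM Q) p′) (attM-bounded n (negM Q) (trans (det-negM Q) (X-n x)) p′)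
      where
      p′ : 0ℤ < tr (negM Q)
      p′ = subst (0ℤ <_) (sym (tr-negM Q)) (ℤ.neg-mono-< p)

  -- All that survives of the ball sum when no mass is set aside at ∞: the mass of (-1,0] for the
  -- members that fix ∞.
  cuspidal : Mat → ℚ
  cuspidal Q = fixes∞ Q ℚ.* (P Q ℚ.- P (τ Q))

  hyperbolic-formula : ∀ {Tinf ξ} → IsRepsInfty n Tinf → InR n ξ → CondA n Tinf ξ → CondB n ξ →
    Eventually (λ R → ⟪ ξ ∣ 𝟙 ⟫ ℚ.+ ⟪ ξ ∣ 𝟙 ⟫ ≡ ∑ (ball R) cuspidal)
  hyperbolic-formula {Tinf} {ξ} reps ξR A B = eventually-map
    (λ R p → difference-zero (⟪ ξ ∣ 𝟙 ⟫ ℚ.+ ⟪ ξ ∣ 𝟙 ⟫) (∑ (ball R) cuspidal) (trans (cong ((⟪ ξ ∣ 𝟙 ⟫ ℚ.+ ⟪ ξ ∣ 𝟙 ⟫) ℚ.+_) (sym (simplify R))) p))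
    (mass-formula n mass 𝟙 (λ _ → 0ℚ) (λ Q → sym (ℚ.+-identityʳ (𝟙 Q))) 𝟙-τ 𝟙-τ (four n) bounded reps ξR A B)
    where
    l : ∀ x y → x ℚ.* 0ℚ ℚ.- y ≡ 0ℚ ℚ.- y
    l = ring-of ringℚ
    l′ : ∀ x → 0ℚ ℚ.- x ≡ ℚ.- x
    l′ = ring-of ringℚ
    simplify : ∀ R → ∑ (ball R) (λ Q → left01 Q ℚ.* 0ℚ ℚ.- fixes∞ Q ℚ.* (P Q ℚ.- P (τ Q))) ≡ ℚ.- ∑ (ball R) cuspidal
    simplify R = trans (∑-ext (ball R) (λ Q → l (left01 Q) (cuspidal Q))) (trans (∑-- (ball R) (λ _ → 0ℚ) cuspidal)
      (trans (cong (λ t → t ℚ.- ∑ (ball R) cuspidal) (∑-zero (ball R))) (l′ (∑ (ball R) cuspidal))))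

-- Parabolic and nonsplit hyperbolic classes

attM-fixes∞ : ∀ a b d → d - a ≡ + 0 → attM (a , b , + 0 , d) ≡ 0ℚ
attM-fixes∞ a b d e = trans (cong (att (+ 0) (ℤ.- b)) e) (flat (ℤ.- b))
  where
  flat : ∀ y → att +0 y +0 ≡ 0ℚ
  flat (+ _) = refl
  flat -[1+ _ ] = refl

disc-upper : ∀ a b d → disc (a , b , + 0 , d) ≡ (d - a) * (d - a)
disc-upper = l
  where
  l : ∀ a b d → (a + d) * (a + d) - + 4 * (a * d - b * + 0) ≡ (d - a) * (d - a)
  l = ℤ-ring

square-zero : ∀ x → x * x ≡ + 0 → x ≡ + 0
square-zero x e with ℤ.i*j≡0⇒i≡0∨j≡0 x e
... | inj₁ z = z
... | inj₂ z = z

eventually-value : ∀ {A : Set} → Eventually (λ _ → A) → A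
eventually-value (K , h) = h K ℕ.≤-refl

module Vanishing (n : ℕ) .{{n≢0 : NonZero n}} (M₀ : Mat) (d₀ : det M₀ ≡ + n)
  (X : Pred Mat 0ℓ) (X? : Decidable X) (X⇔ : ∀ M → X M ⇔ InConjClass M₀ M)
  (δ₀ : 0ℤ ≤ disc M₀) (ns₀ : ¬ IsScalar M₀) (no-square : ∀ m → disc M₀ ≡ m * m → m ≡ + 0) where
  open NonnegativeDiscriminant n M₀ d₀ X X? X⇔ δ₀ ns₀

  -- An upper triangular member has discriminant (d - a)², hence d = a by `no-square`; its only
  -- fixed point is then ∞, outside the arc.
  P-fixes∞ : ∀ a b d → P (a , b , + 0 , d) ≡ 0ℚ
  P-fixes∞ a b d = weighted-zero (a , b , + 0 , d) (attracted (a , b , + 0 , d)) λ x →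
    trans (cong₂ (λ s t → sign⁺ (tr (a , b , + 0 , d)) ℚ.* s ℚ.+ sign⁺ (tr (negM (a , b , + 0 , d))) ℚ.* t)
      (attM-fixes∞ a b d (equal x)) (attM-fixes∞ (ℤ.- a) (ℤ.- b) (ℤ.- d) (trans (l a d) (cong ℤ.-_ (equal x)))))
    (l′ (sign⁺ (tr (a , b , + 0 , d))) (sign⁺ (tr (negM (a , b , + 0 , d)))))
    where
    equal : X (a , b , + 0 , d) → d - a ≡ + 0
    equal x = no-square (d - a) (trans (sym (X-disc (a , b , + 0 , d) x)) (disc-upper a b d))
    l : ∀ a d → ℤ.- d - ℤ.- a ≡ ℤ.- (d - a)
    l = ℤ-ring
    l′ : ∀ x y → x ℚ.* 0ℚ ℚ.+ y ℚ.* 0ℚ ≡ 0ℚ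
    l′ = ring-of ringℚ

  cuspidal-zero : ∀ Q → cuspidal Q ≡ 0ℚ
  cuspidal-zero Q@(a , b , c , d) = go (c ≟ + 0)
    where
    go : (z : Dec (c ≡ + 0)) → ind z ℚ.* (P Q ℚ.- P (τ Q)) ≡ 0ℚ
    go (no _) = ℚ.*-zeroˡ (P Q ℚ.- P (τ Q))
    go (yes refl) = cong (1ℚ ℚ.*_) (cong₂ ℚ._-_ (P-fixes∞ a b d) (trans (cong P (τ-entries a b (+ 0) d))
      (P-fixes∞ (a + + 0) (b + d - (a + + 0)) (d - + 0))))

  vanishes : ∀ {Tinf ξ} → IsRepsInfty n Tinf → InR n ξ → CondA n Tinf ξ → CondB n ξ → ⟪ ξ ∣ 𝟙 ⟫ ≡ 0ℚ
  vanishes {Tinf} {ξ} reps ξR A B = eventually-value (eventually-map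
    (λ R e → halve ⟪ ξ ∣ 𝟙 ⟫ 0ℚ (trans e (trans (∑-ext (ball R) cuspidal-zero) (∑-zero (ball R)))))
    (hyperbolic-formula reps ξR A B))

-- Split hyperbolic classes

-- A column vector padded with a zero column, so that products with vectors are instances of `⊗`.
column : ℤ → ℤ → Mat
column x y = x , + 0 , y , + 0

Eigen : ℤ → ℤ → ℤ → Mat → Set
Eigen k x y M = M ⊗ column x y ≡ scale k (column x y)

Eigen-conj : ∀ γ → InΓ γ → ∀ k x y x′ y′ M → γ ⊗ column x y ≡ column x′ y′ → Eigen k x y M → Eigen k x′ y′ ((γ ⊗ M) ⊗ inv γ)
Eigen-conj γ g k x y x′ y′ M v e = trans (cong (((γ ⊗ M) ⊗ inv γ) ⊗_) (sym v))
  (trans (⊗-assoc (γ ⊗ M) (inv γ) (γ ⊗ column x y)) (trans (cong ((γ ⊗ M) ⊗_) (Γ-inv-cancelˡ γ g (column x y)))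
  (trans (⊗-assoc γ M (column x y)) (trans (cong (γ ⊗_) e) (trans (scale-⊗ʳ k γ (column x y)) (cong (scale k) v))))))

Eigen-axis : ∀ k x a b c d → ¬ x ≡ + 0 → Eigen k x (+ 0) (a , b , c , d) → a ≡ k × c ≡ + 0
Eigen-axis k x a b c d nz e = cancel a k (trans (sym (l₁ a b x)) (cong proj₁ e)) ,
  cancel c (+ 0) (trans (sym (l₁ c d x)) (trans (cong (λ M → proj₁ (proj₂ (proj₂ M))) e) (l₂ k x)))
  where
  instance _ = ℤ.≢-nonZero nz
  l₁ : ∀ a b x → a * x + b * + 0 ≡ a * x
  l₁ = ℤ-ring
  l₂ : ∀ k x → k * + 0 ≡ + 0 * x
  l₂ = ℤ-ring
  cancel : ∀ u v → u * x ≡ v * x → u ≡ v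
  cancel u v = ℤ.*-cancelʳ-≡ u v x

record Triangular (k t D : ℤ) (X : Pred Mat 0ℓ) : Set where
  field
    b d : ℤ
    member : X (k , b , + 0 , d)
    trace : k + d ≡ t
    determinant : k * d ≡ D

-- The Euclidean algorithm on the eigenvector (x,y): conjugation by S T^(-q) replaces it by (-y,r)
-- with r < |y|, until the fixed cusp x/y has been moved to ∞.
triangularize : ∀ (X : Pred Mat 0ℓ) → (∀ γ → InΓ γ → ∀ M → X M → X ((γ ⊗ M) ⊗ inv γ)) → ∀ k m x y M →
  ℤ.∣ y ∣ ℕ.≤ m → NonzeroPair x y → X M → Eigen k x y M → Triangular k (tr M) (det M) X
triangularize X X-c k m x y M@(a , b , c , d) h nz mem e with y ≟ + 0
... | yes refl = axis (Eigen-axis k x a b c d (λ z → nz (z , refl)) e)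
  where
  l : ∀ a b d → a * d ≡ a * d - b * + 0
  l = ℤ-ring
  axis : a ≡ k × c ≡ + 0 → Triangular k (tr M) (det M) X
  axis (refl , refl) = record { b = b ; d = d ; member = mem ; trace = refl ; determinant = l a b d }
triangularize X X-c k zero x y M h nz mem e | no y≢0 = ⊥-elim (y≢0 (ℤ.∣i∣≡0⇒i≡0 (ℕ.n≤0⇒n≡0 h)))
triangularize X X-c k (suc m) x y M h nz mem e | no y≢0 with euclid y x y≢0
... | q , r , x≡ , r<y = subst₂ (λ t D → Triangular k t D X) tr-eq det-eq
  (triangularize X X-c k m (ℤ.- y) (+ r) ((γ ⊗ M) ⊗ inv γ) (ℕ.≤-pred (ℕ.≤-trans r<y h)) (λ (z , _) → y≢0 (ℤ.neg-injective z))
    (X-c γ γΓ M mem) (Eigen-conj γ γΓ k x y (ℤ.- y) (+ r) M image e))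
  where
  γ = Smat ⊗ Tz (ℤ.- q)
  γΓ : InΓ γ
  γΓ = Γ-⊗ Smat (Tz (ℤ.- q)) refl (Tz-Γ (ℤ.- q))
  l : ∀ r q y → r + q * y + ℤ.- q * y ≡ r
  l = ℤ-ring
  l₀ : ∀ q → + 0 + ℤ.- q * + 0 ≡ + 0
  l₀ = ℤ-ring
  image : γ ⊗ column x y ≡ column (ℤ.- y) (+ r)
  image = trans (⊗-assoc Smat (Tz (ℤ.- q)) (column x y)) (trans (cong (Smat ⊗_) (Tz-⊗ (ℤ.- q) x (+ 0) y (+ 0)))
    (trans (Smat-⊗ (x + ℤ.- q * y) (+ 0 + ℤ.- q * + 0) y (+ 0))
      (mat≡ refl refl (trans (cong (λ t → t + ℤ.- q * y) x≡) (l (+ r) q y)) (l₀ q))))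
  e′ : (γ ⊗ M) ⊗ inv γ ≡ (inv (inv γ) ⊗ M) ⊗ inv γ
  e′ = cong (λ ε → (ε ⊗ M) ⊗ inv γ) (sym (inv-involutive γ))
  tr-eq : tr ((γ ⊗ M) ⊗ inv γ) ≡ tr M
  tr-eq = trans (cong tr e′) (tr-conj (inv γ) (Γ-inv γ γΓ) M)
  det-eq : det ((γ ⊗ M) ⊗ inv γ) ≡ det M
  det-eq = trans (cong det e′) (det-conj (inv γ) (Γ-inv γ γΓ) M)

-- t² - m² is divisible by 4, so t and m have the same parity; q is the eigenvalue (t - m)/2.
half-difference : ∀ t m n → t * t - + 4 * n ≡ m * m → Σ ℤ λ q → t ≡ q + (q + m)
half-difference t m n e = go (euclid (+ 2) (t - m) (λ ()))
  where
  go : (Σ ℤ λ q → Σ ℕ λ r → t - m ≡ + r + q * + 2 × r ℕ.< 2) → Σ ℤ λ q → t ≡ q + (q + m)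
  go (q , 0 , p , _) = q , trans (l t m) (trans (cong (_+ m) p) (l′ q m))
    where
    l : ∀ t m → t ≡ t - m + m
    l = ℤ-ring
    l′ : ∀ q m → + 0 + q * + 2 + m ≡ q + (q + m)
    l′ = ℤ-ring
  go (q , 1 , p , _) = ⊥-elim (odd (n + n - (m + q * + 2 + q * q * + 2 + q * m * + 2))
      (trans (l₁ q m n) (trans (cong (λ x → + 1 - (x * x - + 4 * n - m * m)) (sym t≡)) (trans (cong (λ x → + 1 - (x - m * m)) e) (l₂ m)))))
    where
    l : ∀ t m → t ≡ t - m + m
    l = ℤ-ring
    t≡ : t ≡ + 1 + q * + 2 + m
    t≡ = trans (l t m) (cong (_+ m) p)
    l₁ : ∀ q m n → + 2 * (n + n - (m + q * + 2 + q * q * + 2 + q * m * + 2))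
      ≡ + 1 - ((+ 1 + q * + 2 + m) * (+ 1 + q * + 2 + m) - + 4 * n - m * m)
    l₁ = ℤ-ring
    l₂ : ∀ m → + 1 - (m * m - m * m) ≡ + 1
    l₂ = ℤ-ring
    odd : ∀ u → + 2 * u ≡ + 1 → ⊥
    odd +0 ()
    odd -[1+ k ] ()
    odd +[1+ k ] o with ℕ.m+n≡0⇒n≡0 k (ℕ.suc-injective (ℤ.+-injective o))
    ... | ()
  go (q , suc (suc r) , p , ℕ.s≤s (ℕ.s≤s ()))

unit-pair : ∀ p s → p * s ≡ + 1 → (p ≡ + 1 × s ≡ + 1) ⊎ (p ≡ -[1+ 0 ] × s ≡ -[1+ 0 ])
unit-pair p s e = signs p s (ℕ.m*n≡1⇒m≡1 ℤ.∣ p ∣ ℤ.∣ s ∣ abs) (ℕ.m*n≡1⇒n≡1 ℤ.∣ p ∣ ℤ.∣ s ∣ abs) e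
  where
  abs : ℤ.∣ p ∣ ℕ.* ℤ.∣ s ∣ ≡ 1
  abs = trans (sym (ℤ.abs-* p s)) (cong ℤ.∣_∣ e)
  signs : ∀ p s → ℤ.∣ p ∣ ≡ 1 → ℤ.∣ s ∣ ≡ 1 → p * s ≡ + 1 → (p ≡ + 1 × s ≡ + 1) ⊎ (p ≡ -[1+ 0 ] × s ≡ -[1+ 0 ])
  signs (+ _) (+ _) refl refl _ = inj₁ (refl , refl)
  signs (+ _) -[1+ _ ] refl refl ()
  signs -[1+ _ ] (+ _) refl refl ()
  signs -[1+ _ ] -[1+ _ ] refl refl _ = inj₂ (refl , refl)

-- The interval (-m,0] is inhabited, which makes m positive; a shift by a nonzero multiple of m then
-- leaves it.
window-unique : ∀ m b B j → b ≤ 0ℤ → 0ℤ < b + m → B ≤ 0ℤ → 0ℤ < B + m → b ≡ B + j * m → b ≡ B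
window-unique m b B (+ 0) _ _ _ _ e = trans e (l B m)
  where
  l : ∀ B m → B + + 0 * m ≡ B
  l = ℤ-ring
window-unique m b B +[1+ j ] b≤0 b>-m B≤0 B>-m e = ⊥-elim (¬nn {k = 0} (nn+ (nn+ (≡⇒nn (+ 1) e) (≤⇒nn b≤0)) (nn+ (<⇒nn B>-m) (nn* {+ j} (ℤ.+≤+ ℕ.z≤n) m≥0))) (l (+ j) m b B))
  where
  m≥0 : 0ℤ ≤ m
  m≥0 = nn-≡ (nn+ (nn+ (<⇒nn b>-m) (≤⇒nn b≤0)) (ℤ.+≤+ {0} {1} ℕ.z≤n)) (l₀ b m)
    where
    l₀ : ∀ b m → b + m - 0ℤ - + 1 + (0ℤ - b) + + 1 ≡ m
    l₀ = ℤ-ring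
  l : ∀ j m b B → + 1 * (b - (B + (+ 1 + j) * m)) + (0ℤ - b) + (B + m - 0ℤ - + 1 + j * m) ≡ -[1+ 0 ]
  l = ℤ-ring
window-unique m b B -[1+ j ] b≤0 b>-m B≤0 B>-m e = ⊥-elim (¬nn {k = 0} (nn+ (nn+ (≡⇒nn -[1+ 0 ] e) (≤⇒nn B≤0)) (nn+ (<⇒nn b>-m) (nn* {+ j} (ℤ.+≤+ ℕ.z≤n) m≥0))) (l (+ j) m b B))
  where
  m≥0 : 0ℤ ≤ m
  m≥0 = nn-≡ (nn+ (nn+ (<⇒nn b>-m) (≤⇒nn b≤0)) (ℤ.+≤+ {0} {1} ℕ.z≤n)) (l₀ b m)
    where
    l₀ : ∀ b m → b + m - 0ℤ - + 1 + (0ℤ - b) + + 1 ≡ m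
    l₀ = ℤ-ring
  l : ∀ j m b B → -[1+ 0 ] * (b - (B + (ℤ.- (+ 1 + j)) * m)) + (0ℤ - B) + (b + m - 0ℤ - + 1 + j * m) ≡ -[1+ 0 ]
  l = ℤ-ring

-- The data of an upper triangular (A B; 0 D) whose attracting fixed point lies in (-1,0]
record Window (A B D : ℤ) : Set where
  field
    A>0 : 0ℤ < A
    A<D : A < D
    B≤0 : B ≤ 0ℤ
    B>-m : 0ℤ < B + (D - A)

-- ε conjugates two triangular matrices whose eigenvalues come in the same order. It therefore fixes
-- ∞ and is ±T^q, which changes the upper right entry by a multiple of D - A; the window leaves one
-- value.
module _ {A B D a b d : ℤ} (W : Window A B D) (w : Window a b d) (p q r s : ℤ) (εΓ : p * s - q * r ≡ + 1)
  (e₁₂ : p * b + q * d ≡ A * q + B * s) (e₂₁ : r * a + s * + 0 ≡ + 0 * p + D * r)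
  (tr-e : a + d ≡ A + D) (det-e : a * d ≡ A * D) where
  open Window
  private
    shift : ∀ u v → u - v ≡ + 0 → u ≡ v
    shift u v = ℤ.i-j≡0⇒i≡j u v
    roots : (a - A) * (a - D) ≡ + 0
    roots = trans (l₁ a A D) (trans (cong₂ (λ x y → a * a - a * x + y) (sym tr-e) (sym det-e)) (l₂ a d))
      where
      l₁ : ∀ a A D → (a - A) * (a - D) ≡ a * a - a * (A + D) + A * D
      l₁ = ℤ-ring
      l₂ : ∀ a d → a * a - a * (a + d) + a * d ≡ + 0
      l₂ = ℤ-ring
    a≡A : a ≡ A
    a≡A = root (ℤ.i*j≡0⇒i≡0∨j≡0 (a - A) roots)
      where
      l : ∀ a d A D → D - A - + 1 + (d - a - + 1) + (+ 2 * (a - D) + -[1+ 0 ] * (a + d - (A + D))) ≡ -[1+ 1 ]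
      l = ℤ-ring
      root : a - A ≡ + 0 ⊎ a - D ≡ + 0 → a ≡ A
      root (inj₁ z) = shift a A z
      root (inj₂ z) = ⊥-elim (¬nn {k = 1} (nn+ (nn+ (<⇒nn (A<D W)) (<⇒nn (A<D w))) (nn+ (≡⇒nn (+ 2) (shift a D z)) (≡⇒nn -[1+ 0 ] tr-e))) (l a d A D))
    d≡D : d ≡ D
    d≡D = trans (l₁ a d) (trans (cong₂ _-_ tr-e a≡A) (l₂ A D))
      where
      l₁ : ∀ a d → d ≡ a + d - a
      l₁ = ℤ-ring
      l₂ : ∀ A D → A + D - A ≡ D
      l₂ = ℤ-ring
    m≢0 : ¬ D - A ≡ + 0
    m≢0 z = ℤ.<-irrefl (sym (shift D A z)) (A<D W)
    r≡0 : r ≡ + 0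
    r≡0 = root (ℤ.i*j≡0⇒i≡0∨j≡0 r (trans (l₁ r D A) (trans (cong₂ _-_ (trans (l₂ r D p) (sym e₂₁)) (cong (r *_) (sym a≡A))) (l₃ r a s))))
      where
      l₁ : ∀ r D A → r * (D - A) ≡ D * r - r * A
      l₁ = ℤ-ring
      l₂ : ∀ r D p → D * r ≡ + 0 * p + D * r
      l₂ = ℤ-ring
      l₃ : ∀ r a s → r * a + s * + 0 - r * a ≡ + 0
      l₃ = ℤ-ring
      root : r ≡ + 0 ⊎ D - A ≡ + 0 → r ≡ + 0
      root (inj₁ z) = z
      root (inj₂ z) = ⊥-elim (m≢0 z)
    ps : p * s ≡ + 1
    ps = trans (l p s q) (trans (cong (λ x → p * s - q * x) (sym r≡0)) εΓ)
      where
      l : ∀ p s q → p * s ≡ p * s - q * + 0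
      l = ℤ-ring
    e₁₂′ : p * b + q * D ≡ A * q + B * s
    e₁₂′ = trans (cong (λ x → p * b + q * x) (sym d≡D)) e₁₂
    unique : ∀ j → b ≡ B + j * (D - A) → b ≡ B
    unique j = window-unique (D - A) b B j (B≤0 w) (subst (λ x → 0ℤ < b + x) (cong₂ _-_ d≡D a≡A) (B>-m w)) (B≤0 W) (B>-m W)
    b≡B : b ≡ B
    b≡B = by (unit-pair p s ps)
      where
      l₁ : ∀ b q D → b ≡ + 1 * b + q * D - q * D
      l₁ = ℤ-ring
      l₂ : ∀ A B q D → A * q + B * + 1 - q * D ≡ B + ℤ.- q * (D - A)
      l₂ = ℤ-ring
      l₃ : ∀ b q D → b ≡ q * D - (-[1+ 0 ] * b + q * D)
      l₃ = ℤ-ring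
      l₄ : ∀ A B q D → q * D - (A * q + B * -[1+ 0 ]) ≡ B + q * (D - A)
      l₄ = ℤ-ring
      at : ∀ {x y} → p ≡ x → s ≡ y → x * b + q * D ≡ A * q + B * y
      at f g = subst₂ (λ x y → x * b + q * D ≡ A * q + B * y) f g e₁₂′
      by : (p ≡ + 1 × s ≡ + 1) ⊎ (p ≡ -[1+ 0 ] × s ≡ -[1+ 0 ]) → b ≡ B
      by (inj₁ (f , g)) = unique (ℤ.- q) (trans (l₁ b q D) (trans (cong (_- q * D) (at f g)) (l₂ A B q D)))
      by (inj₂ (f , g)) = unique q (trans (l₃ b q D) (trans (cong (λ x → q * D - x) (at f g)) (l₄ A B q D)))

  triangular-unique : a ≡ A × b ≡ B × d ≡ D
  triangular-unique = a≡A , b≡B , d≡D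

fixes∞-even : Even fixes∞
fixes∞-even (a , b , c , d) = ind-cong (ℤ.- c ≟ + 0) (c ≟ + 0) ℤ.neg-injective (λ e → cong (λ t → ℤ.- t) e)

τ-negM : ∀ Q → τ (negM Q) ≡ negM (τ Q)
τ-negM Q = trans (cong (_⊗ Tz -[1+ 0 ]) (negM-⊗ʳ Tmat Q)) (negM-⊗ˡ (Tmat ⊗ Q) (Tz -[1+ 0 ]))

τ-upper : ∀ a b d → τ (a , b , + 0 , d) ≡ (a , b + (d - a) , + 0 , d)
τ-upper a b d = trans (τ-entries a b (+ 0) d) (mat≡ (ℤ.+-identityʳ a) (l a b d) refl (l′ d))
  where
  l : ∀ a b d → b + d - (a + + 0) ≡ b + (d - a)
  l = ℤ-ring
  l′ : ∀ d → d - + 0 ≡ d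
  l′ = ℤ-ring

attM-upper-flat : ∀ a b d → d ≤ a → attM (a , b , + 0 , d) ≡ 0ℚ
attM-upper-flat a b d p = flat (ℤ.- b) (d - a) (ℤ.i≤j⇒i-j≤0 p)
  where
  flat : ∀ y e → e ≤ 0ℤ → att +0 y e ≡ 0ℚ
  flat (+ _) +0 _ = refl
  flat (+ _) -[1+ _ ] _ = refl
  flat (+ _) +[1+ _ ] (ℤ.+≤+ ())
  flat -[1+ _ ] e _ = refl

attM-upper-yes : ∀ a b d → a < d → b ≤ 0ℤ → attM (a , b , + 0 , d) ≡ 1ℚ
attM-upper-yes a b d p q = att-pp⁺ {+ 0} {ℤ.- b} {d - a} ℤ.≤-refl (ℤ.neg-mono-≤ q) (nn⇒< (nn-≡ (<⇒nn p) (l a d)))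
  where
  l : ∀ a d → d - a - + 1 ≡ d - a - 0ℤ - + 1
  l = ℤ-ring

∑-ball-2 : ∀ (n : ℕ) .{{_ : NonZero n}} R X → det X ≡ + n → norm X ℕ.≤ R → ∀ f → Even f → (∀ Q → Q ∼ X ⊎ f Q ≡ 0ℚ) →
  ∑ (ball R) f ≡ f X ℚ.+ f X
∑-ball-2 n R X d h f ef supp = trans (∑-ball-pair n R X d h f supp) (cong (f X ℚ.+_) (ef X))

disc-scalar : ∀ M → IsScalar M → disc M ≡ + 0
disc-scalar (a , .(+ 0) , .(+ 0) , .a) (refl , refl , refl) = l a
  where
  l : ∀ a → (a + a) * (a + a) - + 4 * (a * a - + 0 * + 0) ≡ + 0
  l = ℤ-ring

positive-factor : ∀ {u v} → SameSign u v → 0ℤ < u + v → 0ℤ < u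
positive-factor both+ _ = ℤ.+<+ (ℕ.s≤s ℕ.z≤n)
positive-factor both- ()

module Split (n : ℕ) .{{n≢0 : NonZero n}} (M₀ : Mat) (d₀ : det M₀ ≡ + n)
  (X : Pred Mat 0ℓ) (X? : Decidable X) (X⇔ : ∀ M → X M ⇔ InConjClass M₀ M)
  (μ : ℕ) (disc₀ : disc M₀ ≡ + suc μ * + suc μ) where

  private
    m : ℤ
    m = + suc μ

    nonneg-disc : 0ℤ ≤ disc M₀
    nonneg-disc = subst (0ℤ ≤_) (sym disc₀) (ℤ.+≤+ ℕ.z≤n)

    nonscalar : ¬ IsScalar M₀
    nonscalar s = absurd (trans (sym disc₀) (disc-scalar M₀ s))
      where
      absurd : + suc μ * + suc μ ≡ + 0 → ⊥
      absurd ()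

  open NonnegativeDiscriminant n M₀ d₀ X X? X⇔ nonneg-disc nonscalar

  private
    positive-member : Σ Mat λ M → X M × 0ℤ < tr M
    positive-member = go (ℤ.<-cmp 0ℤ (tr M₀))
      where
      go : Tri (0ℤ < tr M₀) (0ℤ ≡ tr M₀) (tr M₀ < 0ℤ) → Σ Mat λ M → X M × 0ℤ < tr M
      go (tri< p _ _) = M₀ , X-base , p
      go (tri≈ _ p _) = ⊥-elim (tr≢0 X-base (sym p))
      go (tri> _ _ p) = negM M₀ , X-∼ {negM M₀} {M₀} ∼-neg X-base , subst (0ℤ <_) (sym (tr-negM M₀)) (ℤ.neg-mono-< p)

    X-c : ∀ γ → InΓ γ → ∀ M → X M → X ((γ ⊗ M) ⊗ inv γ)
    X-c γ g M x = subst X (cong (λ ε → (ε ⊗ M) ⊗ inv γ) (inv-involutive γ)) (X-conj (inv γ) (Γ-inv γ g) M x)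

    record Reduced : Set where
      field
        A B D : ℤ
        window : Window A B D
        member : X (A , B , + 0 , D)

    module _ (k t : ℤ) (t≡ : t ≡ k + (k + m)) where

      root-product : t * t - + 4 * + n ≡ m * m → k * (k + m) ≡ + n
      root-product e = ℤ.*-cancelˡ-≡ (+ 4) (k * (k + m)) (+ n) (trans (l k m) (trans (cong (λ x → x * x - m * m) (sym t≡))
        (trans (cong (λ x → t * t - x) (sym e)) (l′ t (+ n)))))
        where
        l : ∀ k m → + 4 * (k * (k + m)) ≡ (k + (k + m)) * (k + (k + m)) - m * m
        l = ℤ-ring
        l′ : ∀ t n → t * t - (t * t - + 4 * n) ≡ + 4 * n
        l′ = ℤ-ring

      module _ (a b c d : ℤ) (x : X (a , b , c , d)) (tr-e : a + d ≡ t) (prod : k * (k + m) ≡ + n) where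

        private
          D = k + m
          sum : a + d ≡ k + D
          sum = trans tr-e t≡
          det-e : a * d - b * c ≡ k * D
          det-e = trans (X-n x) (sym prod)

          -- By Cayley-Hamilton (M - k)(M - D) = 0, so the columns of M - D are eigenvectors for k.
          -- They are not both zero, since M is not scalar.
          column₁ : Eigen k (a - D) c (a , b , c , d)
          column₁ = mat≡ (trans (l₁ a b c d D) (trans (cong₂ (λ s t → a * s - t - a * D) sum det-e) (l₂ a k D))) (l₀ k a b)
            (trans (l₃ a c d D) (trans (cong (λ s → c * (s - D)) sum) (l₄ c k D))) (l₀ k c d)
            where
            l₀ : ∀ k a b → a * + 0 + b * + 0 ≡ k * + 0
            l₀ = ℤ-ring
            l₁ : ∀ a b c d D → a * (a - D) + b * c ≡ a * (a + d) - (a * d - b * c) - a * D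
            l₁ = ℤ-ring
            l₂ : ∀ a k D → a * (k + D) - k * D - a * D ≡ k * (a - D)
            l₂ = ℤ-ring
            l₃ : ∀ a c d D → c * (a - D) + d * c ≡ c * (a + d - D)
            l₃ = ℤ-ring
            l₄ : ∀ c k D → c * (k + D - D) ≡ k * c
            l₄ = ℤ-ring

          column₂ : Eigen k b (d - D) (a , b , c , d)
          column₂ = mat≡ (trans (l₃ a b d D) (trans (cong (λ s → b * (s - D)) sum) (l₄ b k D))) (l₀ k a b)
            (trans (l₁ a b c d D) (trans (cong₂ (λ s t → d * s - t - d * D) sum det-e) (l₂ d k D))) (l₀ k c d)
            where
            l₀ : ∀ k a b → a * + 0 + b * + 0 ≡ k * + 0
            l₀ = ℤ-ring
            l₁ : ∀ a b c d D → c * b + d * (d - D) ≡ d * (a + d) - (a * d - b * c) - d * D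
            l₁ = ℤ-ring
            l₂ : ∀ a k D → a * (k + D) - k * D - a * D ≡ k * (a - D)
            l₂ = ℤ-ring
            l₃ : ∀ a b d D → a * b + b * (d - D) ≡ b * (a + d - D)
            l₃ = ℤ-ring
            l₄ : ∀ c k D → c * (k + D - D) ≡ k * c
            l₄ = ℤ-ring

        triangular : Triangular k (a + d) (a * d - b * c) X
        triangular = go (a - D ≟ + 0) (c ≟ + 0) (b ≟ + 0)
          where
          run : ∀ u v → NonzeroPair u v → Eigen k u v (a , b , c , d) → Triangular k (a + d) (a * d - b * c) X
          run u v nz e = triangularize X X-c k ℤ.∣ v ∣ u v (a , b , c , d) ℕ.≤-refl nz x e
          go : Dec (a - D ≡ + 0) → Dec (c ≡ + 0) → Dec (b ≡ + 0) → Triangular k (a + d) (a * d - b * c) X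
          go (no p) _ _ = run (a - D) c (λ (z , _) → p z) column₁
          go (yes _) (no p) _ = run (a - D) c (λ (_ , z) → p z) column₁
          go (yes _) (yes _) (no p) = run b (d - D) (λ (z , _) → p z) column₂
          go (yes p) (yes q) (yes r) = run b (d - D) (λ (_ , z) → X-ns x (r , q , trans (ℤ.i-j≡0⇒i≡j a D p) (sym (ℤ.i-j≡0⇒i≡j d D z)))) column₂

        -- The smaller eigenvalue k is put at ∞, which makes the finite fixed point B/(D - A) the
        -- attracting one; a translation then brings it into (-1,0].
        reduced : 0ℤ < t → Reduced
        reduced t>0 = record { A = k ; B = ℤ.- + r ; D = D ; member = subst X entries (X-c (Tz q) (Tz-Γ q) (k , b₁ , + 0 , D) (subst (λ z → X (k , b₁ , + 0 , z)) d≡ mem))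
                             ; window = record { A>0 = k>0 ; A<D = nn⇒< (nn-≡ (ℤ.+≤+ {0} {μ} ℕ.z≤n) (l₂ k (+ μ)))
                                               ; B≤0 = ℤ.neg-mono-≤ (ℤ.+≤+ {0} {r} ℕ.z≤n) ; B>-m = nn⇒< (nn-≡ (<⇒nn (ℤ.+<+ r<m)) (l₁ (+ r) k m)) } }
          where
          open Triangular triangular renaming (b to b₁; d to d₁; member to mem; trace to tr₁; determinant to det₁)
          d≡ : d₁ ≡ D
          d≡ = trans (l k d₁) (trans (cong (_- k) (trans tr₁ sum)) (l′ k D))
            where
            l : ∀ k d → d ≡ k + d - k
            l = ℤ-ring
            l′ : ∀ k D → k + D - k ≡ D
            l′ = ℤ-ring
          division : Σ ℤ λ q → Σ ℕ λ r → ℤ.- b₁ ≡ + r + q * m × r ℕ.< suc μ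
          division = euclid m (ℤ.- b₁) (λ ())
          q = proj₁ division
          r = proj₁ (proj₂ division)
          r<m = proj₂ (proj₂ (proj₂ division))
          l₁ : ∀ r k m → m - r - + 1 ≡ ℤ.- r + (k + m - k) - 0ℤ - + 1
          l₁ = ℤ-ring
          l₂ : ∀ k u → u ≡ k + (+ 1 + u) - k - + 1
          l₂ = ℤ-ring
          entries : (Tz q ⊗ (k , b₁ , + 0 , D)) ⊗ inv (Tz q) ≡ (k , ℤ.- + r , + 0 , D)
          entries = trans (cong (_⊗ Tz (ℤ.- q)) (Tz-⊗ q k b₁ (+ 0) D)) (trans (⊗-Tz (ℤ.- q) (k + q * + 0) (b₁ + q * D) (+ 0) D)
            (mat≡ (l₃ k q) (trans (l₄ b₁ q k m) (trans (cong (λ x → ℤ.- x + q * m) (proj₁ (proj₂ (proj₂ division)))) (l₅ (+ r) q m))) refl (l₆ D q)))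
            where
            l₃ : ∀ k q → k + q * + 0 ≡ k
            l₃ = ℤ-ring
            l₄ : ∀ b q k m → b + q * (k + m) + ℤ.- q * (k + q * + 0) ≡ ℤ.- (ℤ.- b) + q * m
            l₄ = ℤ-ring
            l₅ : ∀ r q m → ℤ.- (r + q * m) + q * m ≡ ℤ.- r
            l₅ = ℤ-ring
            l₆ : ∀ D q → D + ℤ.- q * + 0 ≡ D
            l₆ = ℤ-ring
          k>0 : 0ℤ < k
          k>0 = positive-factor (sameSign k D (subst (0ℤ <_) (sym prod) (ℤ.+<+ (ℕ.>-nonZero⁻¹ n {{n≢0}})))) (subst (0ℤ <_) t≡ t>0)

    reduced-member : Reduced
    reduced-member = go positive-member
      where
      go : (Σ Mat λ M → X M × 0ℤ < tr M) → Reduced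
      go ((a , b , c , d) , x , p) = reduced (proj₁ h) (a + d) (proj₂ h) a b c d x refl (root-product (proj₁ h) (a + d) (proj₂ h) e) p
        where
        e : (a + d) * (a + d) - + 4 * + n ≡ m * m
        e = trans (cong (λ z → (a + d) * (a + d) - + 4 * z) (sym (X-n x))) (trans (X-disc (a , b , c , d) x) disc₀)
        h : Σ ℤ λ q → a + d ≡ q + (q + m)
        h = half-difference (a + d) m (+ n) e

    open Reduced reduced-member
    X* : Mat
    X* = A , B , + 0 , D

    tr*>0 : 0ℤ < A + D
    tr*>0 = ℤ.+-mono-< (Window.A>0 window) (ℤ.<-trans (Window.A>0 window) (Window.A<D window))

    det-upper : ∀ a b d → X (a , b , + 0 , d) → a * d ≡ + n
    det-upper a b d x = trans (l a b d) (X-n x)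
      where
      l : ∀ a b d → a * d ≡ a * d - b * + 0
      l = ℤ-ring

    conjugator : ∀ Q → X Q → ∃[ ε ] (InΓ ε × Q ∼ ((inv ε ⊗ X*) ⊗ ε))
    conjugator Q x = go (X-witness Q x) (X-witness X* member)
      where
      go : InConjClass M₀ Q → InConjClass M₀ X* → ∃[ ε ] (InΓ ε × Q ∼ ((inv ε ⊗ X*) ⊗ ε))
      go (γ , g , r) (δ , h , s) = inv δ ⊗ γ , Γ-⊗ (inv δ) γ (Γ-inv δ h) g ,
        ∼-trans {Q} r (subst (((inv γ ⊗ M₀) ⊗ γ) ∼_) (conj-twice (inv δ) γ X*) (conj-∼ γ back))
        where
        back : M₀ ∼ ((inv (inv δ) ⊗ X*) ⊗ inv δ)
        back = ∼-sym (subst (((inv (inv δ) ⊗ X*) ⊗ inv δ) ∼_)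
          (conj-undo δ h M₀) (conj-∼ (inv δ) s))

    unique : ∀ a b d → Window a b d → X (a , b , + 0 , d) → (a , b , + 0 , d) ≡ X*
    unique a b d w x = go (conjugator (a , b , + 0 , d) x)
      where
      t>0 : 0ℤ < a + d
      t>0 = ℤ.+-mono-< (Window.A>0 w) (ℤ.<-trans (Window.A>0 w) (Window.A<D w))
      go : ∃[ ε ] (InΓ ε × (a , b , + 0 , d) ∼ ((inv ε ⊗ X*) ⊗ ε)) → (a , b , + 0 , d) ≡ X*
      go (ε , g , inj₂ e) = ⊥-elim (ℤ.<-asym t>0 (subst (_< 0ℤ) (sym (trans (cong tr e) (trans (tr-negM ((inv ε ⊗ X*) ⊗ ε))
        (cong (λ t → ℤ.- t) (tr-conj ε g X*))))) (ℤ.neg-mono-< tr*>0)))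
      go (ε@(p , q , r , s) , g , inj₁ e) = finish (triangular-unique window w p q r s g (cong (λ M → proj₁ (proj₂ M)) commute)
          (cong (λ M → proj₁ (proj₂ (proj₂ M))) commute) (trans (cong tr e) (tr-conj ε g X*)) (trans (det-upper a b d x) (sym (det-upper A B D member))))
        where
        commute : ε ⊗ (a , b , + 0 , d) ≡ X* ⊗ ε
        commute = trans (cong (ε ⊗_) (trans e (⊗-assoc (inv ε) X* ε))) (Γ-cancel-invˡ ε g (X* ⊗ ε))
        finish : a ≡ A × b ≡ B × d ≡ D → (a , b , + 0 , d) ≡ X*
        finish (u , v , w) = mat≡ u v refl w

    cuspidal-even : Even cuspidal
    cuspidal-even Q = cong₂ ℚ._*_ (fixes∞-even Q) (cong₂ ℚ._-_ (P-even′ Q) (trans (cong P (τ-negM Q)) (P-even′ (τ Q))))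

    cuspidal-upper : ∀ a b d → X (a , b , + 0 , d) → 0ℤ < a + d →
      cuspidal (a , b , + 0 , d) ≡ attM (a , b , + 0 , d) ℚ.- attM (a , b + (d - a) , + 0 , d)
    cuspidal-upper a b d x p = trans (ℚ.*-identityˡ (P Q ℚ.- P (τ Q))) (cong₂ ℚ._-_
        (trans (cong₂ ℚ._*_ (ind-yes (X? Q) x) (attracted-positive Q p)) (ℚ.*-identityˡ (attM Q)))
        (trans (cong₂ ℚ._*_ (trans (𝟙-τ Q) (ind-yes (X? Q) x)) (trans (cong attracted (τ-upper a b d)) (attracted-positive Q′ p))) (ℚ.*-identityˡ (attM Q′))))
      where
      Q Q′ : Mat
      Q = a , b , + 0 , d
      Q′ = a , b + (d - a) , + 0 , d

    cuspidal-one : cuspidal X* ≡ 1ℚ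
    cuspidal-one = trans (cuspidal-upper A B D member tr*>0)
      (cong₂ ℚ._-_ (attM-upper-yes A B D (Window.A<D window) (Window.B≤0 window)) (attM-upper A (B + (D - A)) D (Window.B>-m window)))

    -- For a < d the attracting point is b/(d - a), and τ moves it by 1, so the two masses agree
    -- unless it lies in (-1,0]. For a ≥ d it is ∞ before and after.
    support-positive : ∀ a b d → X (a , b , + 0 , d) → 0ℤ < a + d → (a , b , + 0 , d) ≡ X* ⊎ cuspidal (a , b , + 0 , d) ≡ 0ℚ
    support-positive a b d x p = go (a <? d) (b ≤? 0ℤ) (0ℤ <? b + (d - a))
      where
      both-equal : ∀ y → attM (a , b , + 0 , d) ≡ y → attM (a , b + (d - a) , + 0 , d) ≡ y → cuspidal (a , b , + 0 , d) ≡ 0ℚ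
      both-equal y e f = trans (cuspidal-upper a b d x p) (trans (cong₂ ℚ._-_ e f) (ℚ.+-inverseʳ y))
      l : ∀ a b d → b - 0ℤ - + 1 + (d - a - + 1) + + 1 ≡ b + (d - a) - 0ℤ - + 1
      l = ℤ-ring
      go : Dec (a < d) → Dec (b ≤ 0ℤ) → Dec (0ℤ < b + (d - a)) → (a , b , + 0 , d) ≡ X* ⊎ cuspidal (a , b , + 0 , d) ≡ 0ℚ
      go (no q) _ _ = inj₂ (both-equal 0ℚ (attM-upper-flat a b d (ℤ.≮⇒≥ q)) (attM-upper-flat a (b + (d - a)) d (ℤ.≮⇒≥ q)))
      go (yes q) (no r) _ = inj₂ (both-equal 0ℚ (attM-upper a b d (ℤ.≰⇒> r))
        (attM-upper a (b + (d - a)) d (nn⇒< (nn-≡ (nn+ (nn+ (<⇒nn (ℤ.≰⇒> r)) (<⇒nn q)) (ℤ.+≤+ {0} {1} ℕ.z≤n)) (l a b d)))))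
      go (yes q) (yes r) (no u) = inj₂ (both-equal 1ℚ (attM-upper-yes a b d q r) (attM-upper-yes a (b + (d - a)) d q (ℤ.≮⇒≥ u)))
      go (yes q) (yes r) (yes u) = inj₁ (unique a b d (record { A>0 = a>0 ; A<D = q ; B≤0 = r ; B>-m = u }) x)
        where
        a>0 : 0ℤ < a
        a>0 = positive-factor (sameSign a d (subst (0ℤ <_) (sym (det-upper a b d x)) (ℤ.+<+ (ℕ.>-nonZero⁻¹ n {{n≢0}})))) p

    support : ∀ Q → Q ∼ X* ⊎ cuspidal Q ≡ 0ℚ
    support (a , b , c , d) = go (c ≟ + 0) (X? (a , b , c , d))
      where
      Q : Mat
      Q = a , b , c , d
      go : (z : Dec (c ≡ + 0)) → Dec (X Q) → Q ∼ X* ⊎ ind z ℚ.* (P Q ℚ.- P (τ Q)) ≡ 0ℚ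
      go (no _) _ = inj₂ (ℚ.*-zeroˡ (P Q ℚ.- P (τ Q)))
      go (yes z) (no ¬x) = inj₂ (trans (cong (1ℚ ℚ.*_) (cong₂ ℚ._-_
        (trans (cong (ℚ._* attracted Q) (ind-no (X? Q) ¬x)) (ℚ.*-zeroˡ (attracted Q)))
        (trans (cong (ℚ._* attracted (τ Q)) (trans (𝟙-τ Q) (ind-no (X? Q) ¬x))) (ℚ.*-zeroˡ (attracted (τ Q)))))) refl)
      go (yes refl) (yes x) = by (ℤ.<-cmp 0ℤ (a + d))
        where
        by : Tri (0ℤ < a + d) (0ℤ ≡ a + d) (a + d < 0ℤ) → (a , b , + 0 , d) ∼ X* ⊎ cuspidal (a , b , + 0 , d) ≡ 0ℚ
        by (tri< p _ _) = wrap (support-positive a b d x p)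
          where
          wrap : (a , b , + 0 , d) ≡ X* ⊎ cuspidal (a , b , + 0 , d) ≡ 0ℚ → (a , b , + 0 , d) ∼ X* ⊎ cuspidal (a , b , + 0 , d) ≡ 0ℚ
          wrap (inj₁ e) = inj₁ (inj₁ e)
          wrap (inj₂ z) = inj₂ z
        by (tri≈ _ p _) = ⊥-elim (tr≢0 x (sym p))
        by (tri> _ _ p) = wrap (support-positive (ℤ.- a) (ℤ.- b) (ℤ.- d) (X-∼ {negM (a , b , + 0 , d)} {a , b , + 0 , d} ∼-neg x)
            (subst (0ℤ <_) (ℤ.neg-distrib-+ a d) (ℤ.neg-mono-< p)))
          where
          wrap : negM (a , b , + 0 , d) ≡ X* ⊎ cuspidal (negM (a , b , + 0 , d)) ≡ 0ℚ → (a , b , + 0 , d) ∼ X* ⊎ cuspidal (a , b , + 0 , d) ≡ 0ℚ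
          wrap (inj₁ e) = inj₁ (inj₂ (trans (sym (negM-involutive (a , b , + 0 , d))) (cong negM e)))
          wrap (inj₂ z) = inj₂ (trans (sym (cuspidal-even (a , b , + 0 , d))) z)

  split-mass : ∀ {Tinf ξ} → IsRepsInfty n Tinf → InR n ξ → CondA n Tinf ξ → CondB n ξ → ⟪ ξ ∣ 𝟙 ⟫ ≡ 1ℚ
  split-mass {Tinf} {ξ} reps ξR A B = eventually-value (eventually-map
    (λ R (e , h) → halve ⟪ ξ ∣ 𝟙 ⟫ 1ℚ (trans e (trans (∑-ball-2 n R X* (X-n member) h cuspidal cuspidal-even support)
      (cong₂ ℚ._+_ cuspidal-one cuspidal-one))))
    (eventually-× (hyperbolic-formula reps ξR A B) (norm X* , λ _ p → p)))

-- Reciprocals of natural numbers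

natℚ : ℕ → ℚ
natℚ zero = 0ℚ
natℚ (suc k) = 1ℚ ℚ.+ natℚ k

∑-ones : ∀ {A : Set} (L : List A) → ∑ L (λ _ → 1ℚ) ≡ natℚ (length L)
∑-ones [] = refl
∑-ones (x ∷ L) = cong (1ℚ ℚ.+_) (∑-ones L)

fromℚᵘ-+ : ∀ p q → ℚ.fromℚᵘ p ℚ.+ ℚ.fromℚᵘ q ≡ ℚ.fromℚᵘ (p ℚᵘ.+ q)
fromℚᵘ-+ p q = ℚ.toℚᵘ-injective (ℚᵘ.≃-trans (ℚ.toℚᵘ-homo-+ (ℚ.fromℚᵘ p) (ℚ.fromℚᵘ q))
  (ℚᵘ.≃-trans (ℚᵘ.+-cong (ℚ.toℚᵘ-fromℚᵘ p) (ℚ.toℚᵘ-fromℚᵘ q)) (ℚᵘ.≃-sym (ℚ.toℚᵘ-fromℚᵘ (p ℚᵘ.+ q)))))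

natℚ-* : ∀ m k → natℚ m ℚ.* (+ 1 ℚ./ suc k) ≡ + m ℚ./ suc k
natℚ-* zero k = trans (ℚ.*-zeroˡ (+ 1 ℚ./ suc k)) (sym (ℚ.0/n≡0 (suc k)))
natℚ-* (suc m) k = trans (l (natℚ m) (+ 1 ℚ./ suc k)) (trans (cong ((+ 1 ℚ./ suc k) ℚ.+_) (natℚ-* m k))
  (trans (fromℚᵘ-+ (ℚᵘ.mkℚᵘ (+ 1) k) (ℚᵘ.mkℚᵘ (+ m) k)) (ℚ.fromℚᵘ-cong {ℚᵘ.mkℚᵘ (+ 1) k ℚᵘ.+ ℚᵘ.mkℚᵘ (+ m) k} {ℚᵘ.mkℚᵘ (+ suc m) k} (ℚᵘ.*≡* (l′ (+ m) (+ suc k))))))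
  where
  l : ∀ x y → (1ℚ ℚ.+ x) ℚ.* y ≡ y ℚ.+ x ℚ.* y
  l = ring-of ringℚ
  l′ : ∀ m k → (+ 1 * k + m * k) * k ≡ (+ 1 + m) * (k * k)
  l′ = ℤ-ring

natℚ-inverse : ∀ k → natℚ (suc k) ℚ.* (+ 1 ℚ./ suc k) ≡ 1ℚ
natℚ-inverse k = trans (natℚ-* (suc k) k) (ℚ.fromℚᵘ-cong {ℚᵘ.mkℚᵘ (+ suc k) k} {ℚᵘ.1ℚᵘ} (ℚᵘ.*≡* (l (+ suc k))))
  where
  l : ∀ k → k * + 1 ≡ + 1 * k
  l = ℤ-ring

divide-by-suc : ∀ k x y → natℚ (suc k) ℚ.* x ≡ y → x ≡ (+ 1 ℚ./ suc k) ℚ.* y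
divide-by-suc k x y e = trans (sym (ℚ.*-identityˡ x)) (trans (cong (ℚ._* x) (sym (natℚ-inverse k)))
  (trans (l (natℚ (suc k)) (+ 1 ℚ./ suc k) x) (cong ((+ 1 ℚ./ suc k) ℚ.*_) e)))
  where
  l : ∀ a b x → a ℚ.* b ℚ.* x ≡ b ℚ.* (a ℚ.* x)
  l = ring-of ringℚ

-- Bounds for definite forms

private

  abs≤ : ∀ m z → 0ℤ ≤ + m - z → 0ℤ ≤ + m + z → ℤ.∣ z ∣ ℕ.≤ m
  abs≤ m (+ k) p _ = ℤ.drop‿+≤+ (nn⇒≤ p)
  abs≤ m -[1+ k ] _ q = ℤ.drop‿+≤+ (nn⇒≤ q)

  ℕnn : ∀ {k} → 0ℤ ≤ + k
  ℕnn = ℤ.+≤+ ℕ.z≤n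

  norm≤ : ∀ a b c d p q → ℤ.∣ a ∣ ℕ.≤ p → ℤ.∣ b ∣ ℕ.≤ p → ℤ.∣ c ∣ ℕ.≤ p → ℤ.∣ d ∣ ℕ.≤ q → norm (a , b , c , d) ℕ.≤ p ℕ.+ p ℕ.+ (p ℕ.+ q)
  norm≤ a b c d p q α β γ δ = ℕ.+-mono-≤ (ℕ.+-mono-≤ α β) (ℕ.+-mono-≤ γ δ)

-- The bounds n + h for |a|, |b|, |c| and 2(n + h) for |d|, added up.
definite-bound : ℕ → ℕ → ℕ
definite-bound n h = (n ℕ.+ h) ℕ.+ (n ℕ.+ h) ℕ.+ ((n ℕ.+ h) ℕ.+ ((n ℕ.+ h) ℕ.+ (n ℕ.+ h)))

-- Here k = -a and f = -b; the form is (c, d - a, f), with value h at (x,y).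
module _ (n h : ℕ) (k c f d x y : ℤ) (k>0 : 0ℤ < k) (c>0 : 0ℤ < c) (f>0 : 0ℤ < f)
  (det-e : ℤ.- k * d + f * c ≡ + n) (value : c * (x * x) + (d + k) * (x * y) + f * (y * y) ≡ + h)
  (xx : 0ℤ < x * x) (xy : 0ℤ < x * y) (yy : 0ℤ < y * y) where

  private
    B = n ℕ.+ h
    Goal = norm (ℤ.- k , ℤ.- f , c , d) ℕ.≤ definite-bound n h
    K = <⇒nn k>0
    C = <⇒nn c>0
    F = <⇒nn f>0
    nn1 : 0ℤ ≤ + 1
    nn1 = ℕnn

    abs-pos : ∀ {z} m → 0ℤ < z → 0ℤ ≤ + m - z → ℤ.∣ z ∣ ℕ.≤ m
    abs-pos {z} m p q = abs≤ m z q (nn+ {+ m} ℕnn (ℤ.<⇒≤ p))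

    abs-neg : ∀ {z} m → 0ℤ < z → 0ℤ ≤ + m - z → ℤ.∣ ℤ.- z ∣ ℕ.≤ m
    abs-neg {z} m p q = subst (ℕ._≤ m) (sym (ℤ.∣-i∣≡∣i∣ z)) (abs-pos m p q)

    finish : 0ℤ ≤ + n + + h - k → 0ℤ ≤ + n + + h - c → 0ℤ ≤ + n + + h - f →
      0ℤ ≤ + n + + h + (+ n + + h) - d → 0ℤ ≤ + n + + h + (+ n + + h) + d → Goal
    finish p q r s t = norm≤ (ℤ.- k) (ℤ.- f) c d B (B ℕ.+ B)
      (abs-neg B k>0 p) (abs-neg B f>0 r) (abs-pos B c>0 q) (abs≤ (B ℕ.+ B) d s t)

    -- d + k ≤ 0: then n = k² + k (-d - k) + f c is a sum of nonnegative terms.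
    case-nonpos : 0ℤ ≤ ℤ.- (d + k) → Goal
    case-nonpos e = finish
      (nn-≡ (nn+ (nn+ (≡⇒nn -[1+ 0 ] det-e) (ℕnn {h})) (nn+ (nn* K (nn+ K nn1)) (nn+ (nn* (nn+ K nn1) e) (nn* (nn+ F nn1) (nn+ C nn1))))) (l₁ k c f d (+ n) (+ h)))
      (nn-≡ (nn+ (nn+ (≡⇒nn -[1+ 0 ] det-e) (ℕnn {h})) (nn+ (nn* (nn+ K nn1) (nn+ K nn1)) (nn+ (nn* (nn+ K nn1) e) (nn* F (nn+ C nn1))))) (l₂ k c f d (+ n) (+ h)))
      (nn-≡ (nn+ (nn+ (≡⇒nn -[1+ 0 ] det-e) (ℕnn {h})) (nn+ (nn* (nn+ K nn1) (nn+ K nn1)) (nn+ (nn* (nn+ K nn1) e) (nn* (nn+ F nn1) C)))) (l₃ k c f d (+ n) (+ h)))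
      (nn-≡ (nn+ (nn+ (ℕnn {n}) (ℕnn {h})) (nn+ (nn+ (ℕnn {n}) (ℕnn {h})) (nn+ e (nn+ K nn1)))) (l₄ k d (+ n) (+ h)))
      (nn-≡ (nn+ (nn+ (≡⇒nn -[1+ 1 ] det-e) (nn+ (ℕnn {h}) (ℕnn {h}))) (nn+ (nn+ (nn* K (nn+ K nn1)) (nn+ (nn* K (nn+ K nn1)) (nn+ K nn1)))
        (nn+ (nn+ (nn* (nn+ K nn1) e) (nn* K e)) (nn+ (nn* (nn+ F nn1) (nn+ C nn1)) (nn* (nn+ F nn1) (nn+ C nn1)))))) (l₅ k c f d (+ n) (+ h)))
      where
      l₁ : ∀ k c f d n h → -[1+ 0 ] * (ℤ.- k * d + f * c - n) + h + ((k - 0ℤ - + 1) * (k - 0ℤ - + 1 + + 1) + ((k - 0ℤ - + 1 + + 1) * ℤ.- (d + k) + (f - 0ℤ - + 1 + + 1) * (c - 0ℤ - + 1 + + 1))) ≡ n + h - k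
      l₁ = ℤ-ring
      l₂ : ∀ k c f d n h → -[1+ 0 ] * (ℤ.- k * d + f * c - n) + h + ((k - 0ℤ - + 1 + + 1) * (k - 0ℤ - + 1 + + 1) + ((k - 0ℤ - + 1 + + 1) * ℤ.- (d + k) + (f - 0ℤ - + 1) * (c - 0ℤ - + 1 + + 1))) ≡ n + h - c
      l₂ = ℤ-ring
      l₃ : ∀ k c f d n h → -[1+ 0 ] * (ℤ.- k * d + f * c - n) + h + ((k - 0ℤ - + 1 + + 1) * (k - 0ℤ - + 1 + + 1) + ((k - 0ℤ - + 1 + + 1) * ℤ.- (d + k) + (f - 0ℤ - + 1 + + 1) * (c - 0ℤ - + 1))) ≡ n + h - f
      l₃ = ℤ-ring
      l₄ : ∀ k d n h → n + h + (n + h + (ℤ.- (d + k) + (k - 0ℤ - + 1 + + 1))) ≡ n + h + (n + h) - d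
      l₄ = ℤ-ring
      l₅ : ∀ k c f d n h → -[1+ 1 ] * (ℤ.- k * d + f * c - n) + (h + h) + ((k - 0ℤ - + 1) * (k - 0ℤ - + 1 + + 1) + ((k - 0ℤ - + 1) * (k - 0ℤ - + 1 + + 1) + (k - 0ℤ - + 1 + + 1))
        + ((k - 0ℤ - + 1 + + 1) * ℤ.- (d + k) + (k - 0ℤ - + 1) * ℤ.- (d + k) + ((f - 0ℤ - + 1 + + 1) * (c - 0ℤ - + 1 + + 1) + (f - 0ℤ - + 1 + + 1) * (c - 0ℤ - + 1 + + 1)))) ≡ n + h + (n + h) + d
      l₅ = ℤ-ring

    -- d + k > 0: all three coefficients are bounded by the value h.
    case-pos : 0ℤ < d + k → Goal
    case-pos e>0 = finish k≤ (nn-≡ (nn+ (ℕnn {n}) c≤h) (l₁ c (+ n) (+ h))) (nn-≡ (nn+ (ℕnn {n}) f≤h) (l₁ f (+ n) (+ h)))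
        (nn-≡ (nn+ (nn+ (nn+ (ℕnn {n}) (ℕnn {n})) (ℕnn {h})) (nn+ e≤h (nn+ K nn1))) (l₂ d k (+ n) (+ h)))
        (nn-≡ (nn+ k≤ (nn+ (nn+ (ℕnn {n}) (ℕnn {h})) (nn+ E⁺ nn1))) (l₃ d k (+ n) (+ h)))
      where
      E⁺ = <⇒nn e>0
      X⁺ = <⇒nn xx
      Y⁺ = <⇒nn yy
      Z⁺ = <⇒nn xy
      c≤h : 0ℤ ≤ + h - c
      c≤h = nn-≡ (nn+ (≡⇒nn -[1+ 0 ] value) (nn+ (nn* (nn+ C nn1) X⁺) (nn+ (nn* (nn+ E⁺ nn1) (nn+ Z⁺ nn1)) (nn* (nn+ F nn1) (nn+ Y⁺ nn1))))) (l k c f d (x * x) (x * y) (y * y) (+ h))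
        where
        l : ∀ k c f d X Z Y h → -[1+ 0 ] * (c * X + (d + k) * Z + f * Y - h) + ((c - 0ℤ - + 1 + + 1) * (X - 0ℤ - + 1) + ((d + k - 0ℤ - + 1 + + 1) * (Z - 0ℤ - + 1 + + 1) + (f - 0ℤ - + 1 + + 1) * (Y - 0ℤ - + 1 + + 1))) ≡ h - c
        l = ℤ-ring
      f≤h : 0ℤ ≤ + h - f
      f≤h = nn-≡ (nn+ (≡⇒nn -[1+ 0 ] value) (nn+ (nn* (nn+ C nn1) (nn+ X⁺ nn1)) (nn+ (nn* (nn+ E⁺ nn1) (nn+ Z⁺ nn1)) (nn* (nn+ F nn1) Y⁺)))) (l k c f d (x * x) (x * y) (y * y) (+ h))
        where
        l : ∀ k c f d X Z Y h → -[1+ 0 ] * (c * X + (d + k) * Z + f * Y - h) + ((c - 0ℤ - + 1 + + 1) * (X - 0ℤ - + 1 + + 1) + ((d + k - 0ℤ - + 1 + + 1) * (Z - 0ℤ - + 1 + + 1) + (f - 0ℤ - + 1 + + 1) * (Y - 0ℤ - + 1))) ≡ h - f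
        l = ℤ-ring
      e≤h : 0ℤ ≤ + h - (d + k)
      e≤h = nn-≡ (nn+ (≡⇒nn -[1+ 0 ] value) (nn+ (nn* (nn+ C nn1) (nn+ X⁺ nn1)) (nn+ (nn* (nn+ E⁺ nn1) Z⁺) (nn* (nn+ F nn1) (nn+ Y⁺ nn1))))) (l k c f d (x * x) (x * y) (y * y) (+ h))
        where
        l : ∀ k c f d X Z Y h → -[1+ 0 ] * (c * X + (d + k) * Z + f * Y - h) + ((c - 0ℤ - + 1 + + 1) * (X - 0ℤ - + 1 + + 1) + ((d + k - 0ℤ - + 1 + + 1) * (Z - 0ℤ - + 1) + (f - 0ℤ - + 1 + + 1) * (Y - 0ℤ - + 1 + + 1))) ≡ h - (d + k)
        l = ℤ-ring
      k≤ : 0ℤ ≤ + n + + h - k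
      k≤ = go (0ℤ ≤? + n + + h - k)
        where
        go : Dec (0ℤ ≤ + n + + h - k) → 0ℤ ≤ + n + + h - k
        go (yes p) = p
        -- otherwise -d = k - (d + k) > n, so that -k d > n
        go (no p) = ⊥-elim (¬nn {k = 0} (nn+ (≡⇒nn -[1+ 0 ] det-e) (nn+ (nn+ (nn* K (nn+ (nn+ (nn+ P e≤h) (ℕnn {n})) nn1)) (nn+ P e≤h)) (nn* (nn+ F nn1) (nn+ C nn1)))) (l k c f d (+ n) (+ h)))
          where
          P = <⇒nn (ℤ.≰⇒> p)
          l : ∀ k c f d n h → -[1+ 0 ] * (ℤ.- k * d + f * c - n) + ((k - 0ℤ - + 1) * (0ℤ - (n + h - k) - + 1 + (h - (d + k)) + n + + 1) + (0ℤ - (n + h - k) - + 1 + (h - (d + k)))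
            + (f - 0ℤ - + 1 + + 1) * (c - 0ℤ - + 1 + + 1)) ≡ -[1+ 0 ]
          l = ℤ-ring
      l₁ : ∀ c n h → n + (h - c) ≡ n + h - c
      l₁ = ℤ-ring
      l₂ : ∀ d k n h → n + n + h + (h - (d + k) + (k - 0ℤ - + 1 + + 1)) ≡ n + h + (n + h) - d
      l₂ = ℤ-ring
      l₃ : ∀ d k n h → n + h - k + (n + h + (d + k - 0ℤ - + 1 + + 1)) ≡ n + h + (n + h) + d
      l₃ = ℤ-ring

  definite-norm : norm (ℤ.- k , ℤ.- f , c , d) ℕ.≤ definite-bound n h
  definite-norm = go (0ℤ <? d + k)
    where
    go : Dec (0ℤ < d + k) → Goal
    go (yes p) = case-pos p
    go (no p) = case-nonpos (ℤ.neg-mono-≤ (ℤ.≮⇒≥ p))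

-- Elliptic classes

finite-arc : Mat → ℚ
finite-arc g = 1ℚ ℚ.- fixes∞ g

arcM : Mat → ℚ
arcM (x , _ , y , _) = arc x y

arcM-even : Even arcM
arcM-even (x , _ , y , _) = arc-neg x y

finite-arc-even : Even finite-arc
finite-arc-even g = cong (λ t → 1ℚ ℚ.- t) (fixes∞-even g)

Γ-column : ∀ a b c d → InΓ (a , b , c , d) → NonzeroPair a c
Γ-column a b c d = column-nonzero {1} a b c d

arcM-S : ∀ g → InΓ g → arcM g ℚ.+ arcM (inv Smat ⊗ g) ≡ 1ℚ
arcM-S g@(a , b , c , d) e = trans (cong (λ t → arcM g ℚ.+ t) (trans (cong arcM (negM-⊗ˡ Smat g))
  (trans (arcM-even (Smat ⊗ g)) (cong arcM (Smat-⊗ a b c d))))) (arc-S a c (Γ-column a b c d e))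

arcM-U : ∀ g → InΓ g → arcM g ℚ.+ arcM (inv U²mat ⊗ g) ℚ.+ arcM (inv Umat ⊗ g) ≡ 1ℚ
arcM-U g@(a , b , c , d) e = trans (cong₂ (λ s t → arcM g ℚ.+ s ℚ.+ t)
    (trans (cong arcM (negM-⊗ˡ Umat g)) (trans (arcM-even (Umat ⊗ g)) (cong arcM (Umat-⊗ a b c d))))
    (trans (cong arcM (negM-⊗ˡ U²mat g)) (trans (arcM-even (U²mat ⊗ g)) (cong arcM (U²mat-⊗ a b c d)))))
  (arc-U a c (Γ-column a b c d e))

arc-or-sameSign : ∀ x y → 1ℚ ℚ.- ind (y ≟ + 0) ≡ arc x y ⊎ SameSign x y
arc-or-sameSign x +0 = inj₁ refl
arc-or-sameSign +0 +[1+ _ ] = inj₁ refl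
arc-or-sameSign +0 -[1+ _ ] = inj₁ refl
arc-or-sameSign +[1+ _ ] +[1+ _ ] = inj₂ both+
arc-or-sameSign +[1+ _ ] -[1+ _ ] = inj₁ refl
arc-or-sameSign -[1+ _ ] +[1+ _ ] = inj₁ refl
arc-or-sameSign -[1+ _ ] -[1+ _ ] = inj₂ both-

sameSign-positive : ∀ {x y} → SameSign x y → 0ℤ < x * x × 0ℤ < x * y × 0ℤ < y * y
sameSign-positive both+ = ℤ.+<+ (ℕ.s≤s ℕ.z≤n) , ℤ.+<+ (ℕ.s≤s ℕ.z≤n) , ℤ.+<+ (ℕ.s≤s ℕ.z≤n)
sameSign-positive both- = ℤ.+<+ (ℕ.s≤s ℕ.z≤n) , ℤ.+<+ (ℕ.s≤s ℕ.z≤n) , ℤ.+<+ (ℕ.s≤s ℕ.z≤n)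

-- The quadratic form whose roots are the fixed points of the matrix.
form : Mat → ℤ → ℤ → ℤ
form (a , b , c , d) x y = c * (x * x) + (d - a) * (x * y) - b * (y * y)

form-negM : ∀ Q x y → form (negM Q) x y ≡ ℤ.- form Q x y
form-negM (a , b , c , d) x y = l a b c d x y
  where
  l : ∀ a b c d x y → ℤ.- c * (x * x) + (ℤ.- d - ℤ.- a) * (x * y) - ℤ.- b * (y * y)
    ≡ ℤ.- (c * (x * x) + (d - a) * (x * y) - b * (y * y))
  l = ℤ-ring

-- Covariance: the form of gMg⁻¹ at g(1,0) is the form of M at (1,0). Along the orbit of cusps
-- attached to Q the value is thus `lowerLeft M₀` up to sign, the same for the whole class, and this
-- bounds the exceptional Q.
form-conj : ∀ M x p y q → InΓ (x , p , y , q) → form (((x , p , y , q) ⊗ M) ⊗ inv (x , p , y , q)) x y ≡ lowerLeft M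
form-conj (a , b , c , d) x p y q g = trans (l a b c d x p y q) (trans (cong (λ t → t * t * c) g) (ℤ.*-identityˡ c))
  where
  l : ∀ a b c d x p y q →
    (((y * a + q * c) * q + (y * b + q * d) * ℤ.- y) * (x * x)
    + ((y * a + q * c) * ℤ.- p + (y * b + q * d) * x - ((x * a + p * c) * q + (x * b + p * d) * ℤ.- y)) * (x * y)
    ℤ.- ((x * a + p * c) * ℤ.- p + (x * b + p * d) * x) * (y * y))
    ≡ (x * q - p * y) * (x * q - p * y) * c
  l = ℤ-ring

disc-form : ∀ a b c d → disc (a , b , c , d) ≡ (d - a) * (d - a) - + 4 * (c * ℤ.- b)
disc-form = l
  where
  l : ∀ a b c d → (a + d) * (a + d) - + 4 * (a * d - b * c) ≡ (d - a) * (d - a) - + 4 * (c * ℤ.- b)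
  l = ℤ-ring

module _ (n h : ℕ) where

  private
    coefficient-positive : ∀ e c f → e * e - + 4 * (c * f) < 0ℤ → 0ℤ < c * f
    coefficient-positive e c f p with 0ℤ <? c * f
    ... | yes q = q
    ... | no q = ⊥-elim (¬nn {k = 0} (nn+ (<⇒nn p) (nn+ (square-nn e) (nn* (ℤ.+≤+ {0} {4} ℕ.z≤n) (≤⇒nn (ℤ.≮⇒≥ q))))) (l e c f))
      where
      l : ∀ e c f → 0ℤ - (e * e - + 4 * (c * f)) - + 1 + (e * e + + 4 * (0ℤ - c * f)) ≡ -[1+ 0 ]
      l = ℤ-ring

    -- Completing the square: 4c times the form is (2cx + ey)² plus -(e² - 4cf) times y².
    value-positive : ∀ e c f x y → 0ℤ < c → e * e - + 4 * (c * f) < 0ℤ → 0ℤ < y * y → 0ℤ < c * (x * x) + e * (x * y) + f * (y * y)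
    value-positive e c f x y c>0 p yy with 0ℤ <? c * (x * x) + e * (x * y) + f * (y * y)
    ... | yes q = q
    ... | no q = ⊥-elim (¬nn {k = 0} (nn+ (nn* (nn* (ℤ.+≤+ {0} {4} ℕ.z≤n) (ℤ.<⇒≤ c>0)) (≤⇒nn (ℤ.≮⇒≥ q)))
        (nn+ (square-nn (+ 2 * c * x + e * y)) (nn+ (nn* (<⇒nn p) (ℤ.<⇒≤ yy)) (<⇒nn yy)))) (l e c f x y))
      where
      l : ∀ e c f x y → + 4 * c * (0ℤ - (c * (x * x) + e * (x * y) + f * (y * y)))
        + ((+ 2 * c * x + e * y) * (+ 2 * c * x + e * y) + ((0ℤ - (e * e - + 4 * (c * f)) - + 1) * (y * y) + (y * y - 0ℤ - + 1))) ≡ -[1+ 0 ]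
      l = ℤ-ring

    Result : Mat → Set
    Result Q = crossing Q ≡ 0ℚ ⊎ norm Q ℕ.≤ definite-bound n h

  -- With c > 0 a negative Q∞ means a < 0, and definiteness gives -b > 0. The form takes the value h
  -- at the positive cusp x/y, which is the situation of `definite-norm`.
  elliptic-bound⁺ : ∀ a b m d x y → det (a , b , +[1+ m ] , d) ≡ + n → disc (a , b , +[1+ m ] , d) < 0ℤ →
    ℤ.∣ form (a , b , +[1+ m ] , d) x y ∣ ≡ h → SameSign x y → Result (a , b , +[1+ m ] , d)
  elliptic-bound⁺ +0 b m d x y _ _ _ _ = inj₁ refl
  elliptic-bound⁺ +[1+ _ ] b m d x y _ _ _ _ = inj₁ refl
  elliptic-bound⁺ -[1+ k ] b m d x y dt ds v s = inj₂ (subst (λ t → norm ( -[1+ k ] , t , c , d) ℕ.≤ definite-bound n h) (ℤ.neg-involutive b)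
      (definite-norm n h (+ suc k) c (ℤ.- b) d x y (ℤ.+<+ (ℕ.s≤s ℕ.z≤n)) c>0 f>0 (trans (l₁ (+ suc k) b c d) dt)
        (trans (l₂ (+ suc k) b c d x y) (trans (sym (ℤ.0≤i⇒+∣i∣≡i (ℤ.<⇒≤ φ>0))) (cong +_ v)))
        (proj₁ (sameSign-positive s)) (proj₁ (proj₂ (sameSign-positive s))) (proj₂ (proj₂ (sameSign-positive s)))))
    where
    c = +[1+ m ]
    a = -[1+ k ]
    c>0 : 0ℤ < c
    c>0 = ℤ.+<+ (ℕ.s≤s ℕ.z≤n)
    l₁ : ∀ k b c d → ℤ.- k * d + ℤ.- b * c ≡ ℤ.- k * d - b * c
    l₁ = ℤ-ring
    l₂ : ∀ k b c d x y → c * (x * x) + (d + k) * (x * y) + ℤ.- b * (y * y) ≡ c * (x * x) + (d - ℤ.- k) * (x * y) - b * (y * y)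
    l₂ = ℤ-ring
    ds′ : (d - a) * (d - a) - + 4 * (c * ℤ.- b) < 0ℤ
    ds′ = subst (_< 0ℤ) (disc-form a b c d) ds
    f>0 : 0ℤ < ℤ.- b
    f>0 = factor (sameSign c (ℤ.- b) (coefficient-positive (d - a) c (ℤ.- b) ds′))
      where
      factor : ∀ {u} → SameSign c u → 0ℤ < u
      factor both+ = ℤ.+<+ (ℕ.s≤s ℕ.z≤n)
    l₃ : ∀ u b y → u + ℤ.- b * y ≡ u - b * y
    l₃ = ℤ-ring
    φ>0 : 0ℤ < form (a , b , c , d) x y
    φ>0 = subst (0ℤ <_) (l₃ (c * (x * x) + (d - a) * (x * y)) b (y * y))
      (value-positive (d - a) c (ℤ.- b) x y c>0 ds′ (proj₂ (proj₂ (sameSign-positive s))))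

  elliptic-bound : ∀ Q x y → det Q ≡ + n → disc Q < 0ℤ → ℤ.∣ form Q x y ∣ ≡ h → SameSign x y → Result Q
  elliptic-bound (a , b , +0 , d) x y _ _ _ _ = inj₁ (opp-zeroʳ a)
  elliptic-bound (a , b , +[1+ m ] , d) x y dt ds v s = elliptic-bound⁺ a b m d x y dt ds v s
  elliptic-bound Q@(a , b , -[1+ m ] , d) x y dt ds v s = conclude (elliptic-bound⁺ (ℤ.- a) (ℤ.- b) m (ℤ.- d) x y
      (trans (det-negM Q) dt) (subst (_< 0ℤ) (sym (disc-negM Q)) ds)
      (trans (cong ℤ.∣_∣ (form-negM Q x y)) (trans (ℤ.∣-i∣≡∣i∣ (form Q x y)) v)) s)
    where
    conclude : Result (negM Q) → Result Q
    conclude (inj₁ z) = inj₁ (trans (sym (crossing-even Q)) z)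
    conclude (inj₂ p) = inj₂ (subst (ℕ._≤ definite-bound n h) (norm-negM Q) p)

In01-exists : ∀ a c → ¬ c ≡ + 0 → Σ ℤ λ j → In01 (a + j * c) c
In01-exists a c nz = go c nz refl
  where
  l : ∀ r q c → r + q * c + ℤ.- q * c ≡ r
  l = ℤ-ring
  positive-case : ∀ a m → Σ ℤ λ j → In01 (a + j * +[1+ m ]) +[1+ m ]
  positive-case a m = find (euclid +[1+ m ] a (λ ()))
    where
    find : (Σ ℤ λ q → Σ ℕ λ r → a ≡ + r + q * +[1+ m ] × r ℕ.< suc m) → Σ ℤ λ j → In01 (a + j * +[1+ m ]) +[1+ m ]
    find (q , r , e , h) = ℤ.- q , subst (λ t → In01 t +[1+ m ]) (sym (trans (cong (_+ ℤ.- q * +[1+ m ]) e) (l (+ r) q +[1+ m ])))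
      (inj₁ (ℤ.+≤+ ℕ.z≤n , ℤ.+<+ h))
  go : ∀ c′ → ¬ c′ ≡ + 0 → c ≡ c′ → Σ ℤ λ j → In01 (a + j * c) c
  go +0 nz _ = ⊥-elim (nz refl)
  go +[1+ m ] _ refl = positive-case a m
  go -[1+ m ] _ refl = flip (positive-case (ℤ.- a) m)
    where
    l′ : ∀ a j c → ℤ.- (ℤ.- a + j * c) ≡ a + j * ℤ.- c
    l′ = ℤ-ring
    flip : (Σ ℤ λ j → In01 (ℤ.- a + j * +[1+ m ]) +[1+ m ]) → Σ ℤ λ j → In01 (a + j * -[1+ m ]) -[1+ m ]
    flip (j , p) = j , subst (λ t → In01 t -[1+ m ]) (l′ a j +[1+ m ]) (In01-neg (ℤ.- a + j * +[1+ m ]) +[1+ m ] p)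

In01-unique : ∀ u v c j → In01 u c → In01 v c → v ≡ u + j * c → v ≡ u
In01-unique u v c j (inj₁ (p , q)) (inj₁ (r , s)) e = ℤ.neg-injective (window-unique c (ℤ.- v) (ℤ.- u) (ℤ.- j) (ℤ.neg-mono-≤ r) (gap v s) (ℤ.neg-mono-≤ p) (gap u q)
    (trans (cong (λ t → ℤ.- t) e) (l u j c)))
  where
  l : ∀ u j c → ℤ.- (u + j * c) ≡ ℤ.- u + ℤ.- j * c
  l = ℤ-ring
  l′ : ∀ u c → c - u - + 1 ≡ ℤ.- u + c - 0ℤ - + 1
  l′ = ℤ-ring
  gap : ∀ u → u < c → 0ℤ < ℤ.- u + c
  gap u q = nn⇒< (nn-≡ (<⇒nn q) (l′ u c))
In01-unique u v c j (inj₂ (p , q)) (inj₂ (r , s)) e = window-unique (ℤ.- c) v u (ℤ.- j) s (gap v r) q (gap u p) (trans e (l u j c))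
  where
  l : ∀ u j c → u + j * c ≡ u + ℤ.- j * ℤ.- c
  l = ℤ-ring
  l′ : ∀ u c → u - c - + 1 ≡ u + ℤ.- c - 0ℤ - + 1
  l′ = ℤ-ring
  gap : ∀ u → c < u → 0ℤ < u + ℤ.- c
  gap u q = nn⇒< (nn-≡ (<⇒nn q) (l′ u c))
In01-unique u v c j (inj₁ (p , q)) (inj₂ (r , s)) e = ⊥-elim (ℤ.<-irrefl refl (ℤ.<-≤-trans (ℤ.≤-<-trans p q) (ℤ.≤-trans (ℤ.<⇒≤ r) s)))
In01-unique u v c j (inj₂ (p , q)) (inj₁ (r , s)) e = ⊥-elim (ℤ.<-irrefl refl (ℤ.<-≤-trans (ℤ.≤-<-trans r s) (ℤ.≤-trans (ℤ.<⇒≤ p) q)))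

Γ-upper : ∀ g → InΓ g → lowerLeft g ≡ + 0 → Σ ℤ λ i → g ∼ Tz i
Γ-upper (p , q , .(+ 0) , s) e refl = go (unit-pair p s (trans (l p q s) e))
  where
  l : ∀ p q s → p * s ≡ p * s - q * + 0
  l = ℤ-ring
  go : (p ≡ + 1 × s ≡ + 1) ⊎ (p ≡ -[1+ 0 ] × s ≡ -[1+ 0 ]) → Σ ℤ λ i → (p , q , + 0 , s) ∼ Tz i
  go (inj₁ (f , g)) = q , inj₁ (mat≡ f refl refl g)
  go (inj₂ (f , g)) = ℤ.- q , inj₂ (mat≡ f (sym (ℤ.neg-involutive q)) refl g)

Tz-conj : ∀ i a b c d → (Tz i ⊗ (a , b , c , d)) ⊗ Tz (ℤ.- i) ≡ (a + i * c , b + i * d + ℤ.- i * (a + i * c) , c , d + ℤ.- i * c)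
Tz-conj i a b c d = trans (cong (_⊗ Tz (ℤ.- i)) (Tz-⊗ i a b c d)) (⊗-Tz (ℤ.- i) (a + i * c) (b + i * d) c d)

module Elliptic (n : ℕ) .{{n≢0 : NonZero n}} (M₀ : Mat) (d₀ : det M₀ ≡ + n)
  (X : Pred Mat 0ℓ) (X? : Decidable X) (X⇔ : ∀ M → X M ⇔ InConjClass M₀ M)
  (κ : ℕ) (δ₀ : disc M₀ < 0ℤ) (order : CentralizerOrder M₀ (suc κ)) where
  open ConjugacyClass M₀ X X? X⇔

  private
    L : List Mat
    L = proj₁ order

    L-length : length L ≡ suc κ
    L-length = proj₁ (proj₂ order)

    L-centralizes : All (Centralizes M₀) L
    L-centralizes = proj₁ (proj₂ (proj₂ order))

    L-distinct : AllPairs (λ γ δ → ¬ γ ∼ δ) L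
    L-distinct = proj₁ (proj₂ (proj₂ (proj₂ order)))

    L-complete : ∀ γ → Centralizes M₀ γ → Any (γ ∼_) L
    L-complete = proj₂ (proj₂ (proj₂ (proj₂ order)))

    centralizes : ∀ l → l ∈ L → Centralizes M₀ l
    centralizes l m = All.lookup L-centralizes m

    centralizes-⊗ : ∀ γ δ → Centralizes M₀ γ → Centralizes M₀ δ → Centralizes M₀ (γ ⊗ δ)
    centralizes-⊗ γ δ (g , r) (h , s) = Γ-⊗ γ δ g h ,
      ∼-trans (subst (_∼ ((inv δ ⊗ M₀) ⊗ δ)) (conj-twice γ δ M₀) (conj-∼ δ r)) s

    centralizes-inv : ∀ γ → Centralizes M₀ γ → Centralizes M₀ (inv γ)
    centralizes-inv γ (g , r) = Γ-inv γ g , ∼-sym (subst (_∼ ((inv (inv γ) ⊗ M₀) ⊗ inv γ)) (conj-undo γ g M₀) (conj-∼ (inv γ) r))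

    Γ-cancel-∼ : ∀ λ₀ l l′ → InΓ λ₀ → (λ₀ ⊗ l) ∼ (λ₀ ⊗ l′) → l ∼ l′
    Γ-cancel-∼ λ₀ l l′ g r = subst₂ _∼_ (Γ-inv-cancelˡ λ₀ g l) (Γ-inv-cancelˡ λ₀ g l′) (∼-⊗ˡ (inv λ₀) r)

    -- Left multiplication by a centralizing element permutes the centralizer modulo ±1, hence the
    -- list L up to signs, which an even F does not see.
    translate : ∀ F → Even F → ∀ λ₀ → Centralizes M₀ λ₀ → ∑ L (λ l → F (λ₀ ⊗ l)) ≡ ∑ L F
    translate F eF λ₀ c₀@(g₀ , _) = trans (sym (∑-map (λ₀ ⊗_) L F))
      (∑-reindex _∼?_ ∼-sym ∼-trans (map (λ₀ ⊗_) L) L {F} (even-∼ eF) (distinct L L-distinct) L-distinct to from)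
      where
      distinct : ∀ K → AllPairs (λ γ δ → ¬ γ ∼ δ) K → AllPairs (λ γ δ → ¬ γ ∼ δ) (map (λ₀ ⊗_) K)
      distinct [] [] = []
      distinct (l ∷ K) (h ∷ hs) = All.map⁺ (All.map (λ {l′} ne r → ne (Γ-cancel-∼ λ₀ l l′ g₀ r)) h) ∷ distinct K hs
      to : ∀ x → x ∈ map (λ₀ ⊗_) L → Any (x ∼_) L ⊎ F x ≡ 0ℚ
      to x m = find (∈-map⁻ (λ₀ ⊗_) m)
        where
        find : (∃[ l ] (l ∈ L × x ≡ λ₀ ⊗ l)) → Any (x ∼_) L ⊎ F x ≡ 0ℚ
        find (l , ml , e) = inj₁ (L-complete x (subst (Centralizes M₀) (sym e) (centralizes-⊗ λ₀ l c₀ (centralizes l ml))))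
      from : ∀ x → x ∈ L → Any (x ∼_) (map (λ₀ ⊗_) L) ⊎ F x ≡ 0ℚ
      from x m = inj₁ (lift L (L-complete (inv λ₀ ⊗ x) (centralizes-⊗ (inv λ₀) x (centralizes-inv λ₀ c₀) (centralizes x m))))
        where
        lift : ∀ K → Any ((inv λ₀ ⊗ x) ∼_) K → Any (x ∼_) (map (λ₀ ⊗_) K)
        lift (l ∷ K) (here r) = here (subst (_∼ (λ₀ ⊗ l)) (Γ-cancel-invˡ λ₀ g₀ x) (∼-⊗ˡ λ₀ r))
        lift (l ∷ K) (there a) = there (lift K a)

  -- The sum of f over the elements g of Γ / ±1 with g M₀ g⁻¹ = ±Q.
  orbit-sum-at : (Mat → ℚ) → ∀ Q → Dec (X Q) → ℚ
  orbit-sum-at f Q (yes x) = ∑ L (λ l → f (inv (proj₁ (X-witness Q x)) ⊗ l))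
  orbit-sum-at f Q (no _) = 0ℚ

  orbit-sum : (Mat → ℚ) → Mat → ℚ
  orbit-sum f Q = orbit-sum-at f Q (X? Q)

  -- The sum does not depend on the conjugator: two of them differ by a centralizing element, which
  -- `translate` absorbs.
  orbit-sum-eval : ∀ f → Even f → ∀ Q γ → InΓ γ → Q ∼ ((inv γ ⊗ M₀) ⊗ γ) → orbit-sum f Q ≡ ∑ L (λ l → f (inv γ ⊗ l))
  orbit-sum-eval f ef Q γ g r = go (X? Q)
    where
    go : (x? : Dec (X Q)) → orbit-sum-at f Q x? ≡ ∑ L (λ l → f (inv γ ⊗ l))
    go (no ¬x) = ⊥-elim (¬x (Equivalence.from (X⇔ Q) (γ , g , r)))
    go (yes x) = by (X-witness Q x)
      where
      by : (v : InConjClass M₀ Q) → ∑ L (λ l → f (inv (proj₁ v) ⊗ l)) ≡ ∑ L (λ l → f (inv γ ⊗ l))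
      by (γ₀ , g₀ , r₀) = trans (sym (translate F eF λ₀ (Γ-⊗ γ₀ (inv γ) g₀ (Γ-inv γ g) , fixed)))
          (∑-ext L (λ l → cong f (trans (cong (inv γ₀ ⊗_) (⊗-assoc γ₀ (inv γ) l)) (Γ-inv-cancelˡ γ₀ g₀ (inv γ ⊗ l)))))
        where
        λ₀ = γ₀ ⊗ inv γ
        F : Mat → ℚ
        F l = f (inv γ₀ ⊗ l)
        eF : Even F
        eF l = trans (cong f (negM-⊗ʳ (inv γ₀) l)) (ef (inv γ₀ ⊗ l))
        fixed : ((inv λ₀ ⊗ M₀) ⊗ λ₀) ∼ M₀
        fixed = subst₂ _∼_ (conj-twice γ₀ (inv γ) M₀) (conj-undo γ g M₀) (conj-∼ (inv γ) (∼-trans (∼-sym r₀) r))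

  OrbitSum : (Mat → ℚ) → Mat → Set
  OrbitSum f Q = (X Q × ∃[ γ ] (InΓ γ × Q ∼ ((inv γ ⊗ M₀) ⊗ γ) × orbit-sum f Q ≡ ∑ L (λ l → f (inv γ ⊗ l)))) ⊎ (¬ X Q × orbit-sum f Q ≡ 0ℚ)

  orbit-sum-cases : ∀ f → Even f → ∀ Q → OrbitSum f Q
  orbit-sum-cases f ef Q = go (X? Q) refl
    where
    go : (x? : Dec (X Q)) → X? Q ≡ x? → OrbitSum f Q
    go (no ¬x) e = inj₂ (¬x , cong (orbit-sum-at f Q) e)
    go (yes x) _ = inj₁ (x , by (X-witness Q x))
      where
      by : InConjClass M₀ Q → ∃[ γ ] (InΓ γ × Q ∼ ((inv γ ⊗ M₀) ⊗ γ) × orbit-sum f Q ≡ ∑ L (λ l → f (inv γ ⊗ l)))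
      by (γ , g , r) = γ , g , r , orbit-sum-eval f ef Q γ g r

  orbit-sum-none : ∀ f → Even f → ∀ Q → ¬ X Q → orbit-sum f Q ≡ 0ℚ
  orbit-sum-none f ef Q ¬x = go (orbit-sum-cases f ef Q)
    where
    go : OrbitSum f Q → orbit-sum f Q ≡ 0ℚ
    go (inj₁ (x , _)) = ⊥-elim (¬x x)
    go (inj₂ (_ , z)) = z

  orbit-sum-∼ : ∀ f → Even f → ∀ {Q Q′} → Q ∼ Q′ → orbit-sum f Q ≡ orbit-sum f Q′
  orbit-sum-∼ f ef {Q} {Q′} r = go (orbit-sum-cases f ef Q′)
    where
    go : OrbitSum f Q′ → orbit-sum f Q ≡ orbit-sum f Q′
    go (inj₁ (_ , γ , g , s , e)) = trans (orbit-sum-eval f ef Q γ g (∼-trans r s)) (sym e)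
    go (inj₂ (¬x , z)) = trans (orbit-sum-none f ef Q (λ x → ¬x (X-∼ (∼-sym r) x))) (sym z)

  orbit-sum-conj : ∀ f → Even f → ∀ δ → InΓ δ → ∀ Q → orbit-sum f ((inv δ ⊗ Q) ⊗ δ) ≡ orbit-sum (λ g → f (inv δ ⊗ g)) Q
  orbit-sum-conj f ef δ d Q = go (orbit-sum-cases fδ efδ Q)
    where
    fδ : Mat → ℚ
    fδ g = f (inv δ ⊗ g)
    efδ : Even fδ
    efδ g = trans (cong f (negM-⊗ʳ (inv δ) g)) (ef (inv δ ⊗ g))
    go : OrbitSum fδ Q →
      orbit-sum f ((inv δ ⊗ Q) ⊗ δ) ≡ orbit-sum fδ Q
    go (inj₁ (_ , γ , g , r , e)) = trans (orbit-sum-eval f ef ((inv δ ⊗ Q) ⊗ δ) (γ ⊗ δ) (Γ-⊗ γ δ g d)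
        (subst (((inv δ ⊗ Q) ⊗ δ) ∼_) (conj-twice γ δ M₀) (conj-∼ δ r)))
      (trans (∑-ext L (λ l → cong f (trans (cong (_⊗ l) (inv-⊗ γ δ)) (⊗-assoc (inv δ) (inv γ) l)))) (sym e))
    go (inj₂ (¬x , z)) = trans (orbit-sum-none f ef ((inv δ ⊗ Q) ⊗ δ) (λ x → ¬x (X-conj⁻ δ d Q x))) (sym z)

  orbit-sum-cong : ∀ f f′ Q → (∀ g → InΓ g → f g ≡ f′ g) → orbit-sum f Q ≡ orbit-sum f′ Q
  orbit-sum-cong f f′ Q h = go (X? Q)
    where
    go : (x? : Dec (X Q)) → orbit-sum-at f Q x? ≡ orbit-sum-at f′ Q x?
    go (no _) = refl
    go (yes x) = by (X-witness Q x)
      where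
      by : (v : InConjClass M₀ Q) → ∑ L (λ l → f (inv (proj₁ v) ⊗ l)) ≡ ∑ L (λ l → f′ (inv (proj₁ v) ⊗ l))
      by (γ , g , _) = ∑-∈ L (λ l m → h (inv γ ⊗ l) (Γ-⊗ (inv γ) l (Γ-inv γ g) (proj₁ (centralizes l m))))

  orbit-sum-+ : ∀ f f′ Q → orbit-sum f Q ℚ.+ orbit-sum f′ Q ≡ orbit-sum (λ g → f g ℚ.+ f′ g) Q
  orbit-sum-+ f f′ Q = go (X? Q)
    where
    go : (x? : Dec (X Q)) → orbit-sum-at f Q x? ℚ.+ orbit-sum-at f′ Q x? ≡ orbit-sum-at (λ g → f g ℚ.+ f′ g) Q x?
    go (no _) = refl
    go (yes x) = sym (∑-+ L (λ l → f (inv (proj₁ (X-witness Q x)) ⊗ l)) (λ l → f′ (inv (proj₁ (X-witness Q x)) ⊗ l)))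

  orbit-sum-one : ∀ Q → orbit-sum (λ _ → 1ℚ) Q ≡ natℚ (suc κ) ℚ.* 𝟙 Q
  orbit-sum-one Q = go (X? Q)
    where
    go : (x? : Dec (X Q)) → orbit-sum-at (λ _ → 1ℚ) Q x? ≡ natℚ (suc κ) ℚ.* ind x?
    go (no _) = sym (ℚ.*-zeroʳ (natℚ (suc κ)))
    go (yes _) = trans (∑-ones L) (trans (cong natℚ L-length) (sym (ℚ.*-identityʳ (natℚ (suc κ)))))

  orbit-element : ∀ {Q} γ l → Q ∼ ((inv γ ⊗ M₀) ⊗ γ) → Centralizes M₀ l → Q ∼ (((inv γ ⊗ l) ⊗ M₀) ⊗ inv (inv γ ⊗ l))
  orbit-element {Q} γ l r c = ∼-trans r (subst (((inv γ ⊗ M₀) ⊗ γ) ∼_) e (conj-∼ γ (∼-sym (proj₂ (centralizes-inv l c)))))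
    where
    e : (inv γ ⊗ ((inv (inv l) ⊗ M₀) ⊗ inv l)) ⊗ γ ≡ ((inv γ ⊗ l) ⊗ M₀) ⊗ inv (inv γ ⊗ l)
    e = trans (conj-twice (inv l) γ M₀) (cong₂ (λ s t → (s ⊗ M₀) ⊗ t)
      (trans (inv-⊗ (inv l) γ) (cong (inv γ ⊗_) (inv-involutive l)))
      (sym (trans (inv-⊗ (inv γ) l) (cong (inv l ⊗_) (inv-involutive γ)))))

  upper-not-X : ∀ a b d → ¬ X (a , b , + 0 , d)
  upper-not-X a b d x = absurd (d - a) (subst (_< 0ℤ) (trans (sym (X-disc (a , b , + 0 , d) x)) (disc-upper a b d)) δ₀)
    where
    absurd : ∀ z → ¬ (z * z < 0ℤ)
    absurd +0 (ℤ.+<+ ())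
    absurd +[1+ _ ] (ℤ.+<+ ())
    absurd -[1+ _ ] (ℤ.+<+ ())

  -- Each element of the centralizer contributes one unit of mass, so the order of the centralizer
  -- becomes the denominator of the weight.
  e : Mat → ℚ
  e Q = natℚ (suc κ) ℚ.* 𝟙 Q

  P : Mat → ℚ
  P = orbit-sum arcM

  private
    P-conj : ∀ δ → InΓ δ → ∀ {Q Q′} → Q′ ∼ ((inv δ ⊗ Q) ⊗ δ) → P Q′ ≡ orbit-sum (λ g → arcM (inv δ ⊗ g)) Q
    P-conj δ d {Q} r = trans (orbit-sum-∼ arcM arcM-even r) (orbit-sum-conj arcM arcM-even δ d Q)

    tail : ∀ N → det N ≡ + n → Tail (λ k → P (Tz-pow k ⊗ N))
    tail N@(α , β , γ , δ) _ = suc (ℤ.∣ α + δ ∣ ℕ.+ ℤ.∣ tr M₀ ∣) , λ k h →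
        trans (cong P (Tz-⊗ (+ k) α β γ δ)) (orbit-sum-none arcM arcM-even (α + + k * γ , β + + k * δ , γ , δ) (by k h (γ ≟ + 0)))
      where
      by : ∀ k → suc (ℤ.∣ α + δ ∣ ℕ.+ ℤ.∣ tr M₀ ∣) ℕ.≤ k → Dec (γ ≡ + 0) → ¬ X (α + + k * γ , β + + k * δ , γ , δ)
      by k h (no nz) = X-shift α β γ δ k nz h
      by k h (yes refl) = upper-not-X (α + + k * + 0) (β + + k * δ) δ

  mass : EquivariantMass n
  mass = record
    { P = P
    ; e = e
    ; P-even = λ Q → orbit-sum-∼ arcM arcM-even {negM Q} {Q} ∼-neg
    ; P-S = λ Q → trans (cong (λ t → P Q ℚ.+ t) (P-conj Smat refl (conjS-∼ Q)))
        (trans (orbit-sum-+ arcM (λ g → arcM (inv Smat ⊗ g)) Q)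
        (trans (orbit-sum-cong (λ g → arcM g ℚ.+ arcM (inv Smat ⊗ g)) (λ _ → 1ℚ) Q arcM-S) (orbit-sum-one Q)))
    ; P-U = λ Q → trans (cong₂ (λ s t → P Q ℚ.+ s ℚ.+ t) (P-conj U²mat refl (conjU-∼ Q)) (P-conj Umat refl (conjU²-∼ Q)))
        (trans (cong (λ t → t ℚ.+ orbit-sum (λ g → arcM (inv Umat ⊗ g)) Q) (orbit-sum-+ arcM (λ g → arcM (inv U²mat ⊗ g)) Q))
        (trans (orbit-sum-+ (λ g → arcM g ℚ.+ arcM (inv U²mat ⊗ g)) (λ g → arcM (inv Umat ⊗ g)) Q)
        (trans (orbit-sum-cong (λ g → arcM g ℚ.+ arcM (inv U²mat ⊗ g) ℚ.+ arcM (inv Umat ⊗ g)) (λ _ → 1ℚ) Q arcM-U) (orbit-sum-one Q))))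
    ; P-det = λ Q → det? Q (X? Q)
    ; P-tail = tail }
    where
    det? : ∀ Q → Dec (X Q) → det Q ≡ + n ⊎ P Q ≡ 0ℚ
    det? Q (yes x) = inj₁ (trans (X-det Q x) d₀)
    det? Q (no ¬x) = inj₂ (orbit-sum-none arcM arcM-even Q ¬x)

  fin inf : Mat → ℚ
  fin = orbit-sum finite-arc
  inf = orbit-sum fixes∞

  private
    split-e : ∀ Q → e Q ≡ fin Q ℚ.+ inf Q
    split-e Q = sym (trans (orbit-sum-+ finite-arc fixes∞ Q)
      (trans (orbit-sum-cong (λ g → finite-arc g ℚ.+ fixes∞ g) (λ _ → 1ℚ) Q (λ g _ → l (fixes∞ g))) (orbit-sum-one Q)))
      where
      l : ∀ x → 1ℚ ℚ.- x ℚ.+ x ≡ 1ℚ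
      l = ring-of ringℚ

    finite-arc-T : ∀ g → finite-arc (inv (Tz -[1+ 0 ]) ⊗ g) ≡ finite-arc g
    finite-arc-T (a , b , c , d) = cong finite-arc (Tz-⊗ (+ 1) a b c d)

    fin-τ : ∀ Q → fin (τ Q) ≡ fin Q
    fin-τ Q = trans (orbit-sum-conj finite-arc finite-arc-even (Tz -[1+ 0 ]) refl Q)
      (orbit-sum-cong (λ g → finite-arc (inv (Tz -[1+ 0 ]) ⊗ g)) finite-arc Q (λ g _ → finite-arc-T g))

    e-τ : ∀ Q → e (τ Q) ≡ e Q
    e-τ Q = cong (natℚ (suc κ) ℚ.*_) (𝟙-τ Q)

    h₀ : ℕ
    h₀ = ℤ.∣ lowerLeft M₀ ∣

    R₀ : ℕ
    R₀ = definite-bound n h₀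

    element-bounded : ∀ Q → X Q → ∀ g → InΓ g → Q ∼ ((g ⊗ M₀) ⊗ inv g) → crossing Q ≡ 0ℚ ⊎ finite-arc g ≡ arcM g ⊎ norm Q ℕ.≤ R₀
    element-bounded Q x g@(u , p , v , q) gΓ r = go (arc-or-sameSign u v)
      where
      N : Mat
      N = (g ⊗ M₀) ⊗ inv g
      pull : crossing N ≡ 0ℚ ⊎ norm N ℕ.≤ R₀ → crossing Q ≡ 0ℚ ⊎ finite-arc g ≡ arcM g ⊎ norm Q ℕ.≤ R₀
      pull (inj₁ z) = inj₁ (trans (even-∼ crossing-even r) z)
      pull (inj₂ b) = inj₂ (inj₂ (subst (ℕ._≤ R₀) (sym (norm-∼ r)) b))
      go : finite-arc g ≡ arcM g ⊎ SameSign u v → crossing Q ≡ 0ℚ ⊎ finite-arc g ≡ arcM g ⊎ norm Q ℕ.≤ R₀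
      go (inj₁ z) = inj₂ (inj₁ z)
      go (inj₂ s) = pull (elliptic-bound n h₀ N u v (trans (sym (det-∼ r)) (trans (X-det Q x) d₀))
        (subst (_< 0ℤ) (trans (sym (X-disc Q x)) (disc-∼ r)) δ₀) (cong ℤ.∣_∣ (form-conj M₀ u p v q gΓ)) s)

    bounded : ∀ Q → crossing Q ≡ 0ℚ ⊎ fin Q ≡ P Q ⊎ norm Q ℕ.≤ R₀
    bounded Q = go (orbit-sum-cases arcM arcM-even Q)
      where
      go : OrbitSum arcM Q →
        crossing Q ≡ 0ℚ ⊎ fin Q ≡ P Q ⊎ norm Q ℕ.≤ R₀
      go (inj₂ (¬x , z)) = inj₂ (inj₁ (trans (orbit-sum-none finite-arc finite-arc-even Q ¬x) (sym z)))
      go (inj₁ (x , γ , g , r , eP)) = finish (collect L (λ _ m → m))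
        where
        collect : ∀ K → (∀ l → l ∈ K → l ∈ L) →
          crossing Q ≡ 0ℚ ⊎ ∑ K (λ l → finite-arc (inv γ ⊗ l)) ≡ ∑ K (λ l → arcM (inv γ ⊗ l)) ⊎ norm Q ℕ.≤ R₀
        collect [] _ = inj₂ (inj₁ refl)
        collect (l ∷ K) sub = join (element-bounded Q x (inv γ ⊗ l) (Γ-⊗ (inv γ) l (Γ-inv γ g) (proj₁ c)) (orbit-element γ l r c))
            (collect K (λ k m → sub k (there m)))
          where
          c = centralizes l (sub l (here refl))
          join : crossing Q ≡ 0ℚ ⊎ finite-arc (inv γ ⊗ l) ≡ arcM (inv γ ⊗ l) ⊎ norm Q ℕ.≤ R₀ →
            crossing Q ≡ 0ℚ ⊎ ∑ K (λ l → finite-arc (inv γ ⊗ l)) ≡ ∑ K (λ l → arcM (inv γ ⊗ l)) ⊎ norm Q ℕ.≤ R₀ →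
            crossing Q ≡ 0ℚ ⊎ ∑ (l ∷ K) (λ l → finite-arc (inv γ ⊗ l)) ≡ ∑ (l ∷ K) (λ l → arcM (inv γ ⊗ l)) ⊎ norm Q ℕ.≤ R₀
          join (inj₁ z) _ = inj₁ z
          join (inj₂ (inj₂ b)) _ = inj₂ (inj₂ b)
          join _ (inj₁ z) = inj₁ z
          join _ (inj₂ (inj₂ b)) = inj₂ (inj₂ b)
          join (inj₂ (inj₁ p)) (inj₂ (inj₁ q)) = inj₂ (inj₁ (cong₂ ℚ._+_ p q))
        finish : crossing Q ≡ 0ℚ ⊎ ∑ L (λ l → finite-arc (inv γ ⊗ l)) ≡ ∑ L (λ l → arcM (inv γ ⊗ l)) ⊎ norm Q ℕ.≤ R₀ →
          crossing Q ≡ 0ℚ ⊎ fin Q ≡ P Q ⊎ norm Q ℕ.≤ R₀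
        finish (inj₁ z) = inj₁ z
        finish (inj₂ (inj₂ b)) = inj₂ (inj₂ b)
        finish (inj₂ (inj₁ p)) = inj₂ (inj₁ (trans (orbit-sum-eval finite-arc finite-arc-even Q γ g r) (trans p (sym eP))))

    A₀ B₀ C₀ D₀ : ℤ
    A₀ = proj₁ M₀
    B₀ = proj₁ (proj₂ M₀)
    C₀ = lowerLeft M₀
    D₀ = proj₂ (proj₂ (proj₂ M₀))

    C₀≢0 : ¬ C₀ ≡ + 0
    C₀≢0 z = upper-not-X A₀ B₀ D₀ (subst (λ c → X (A₀ , B₀ , c , D₀)) z X-base)

    translate-of-base : ∀ {Q} g → InΓ g → Q ∼ ((g ⊗ M₀) ⊗ inv g) → lowerLeft g ≡ + 0 →
      Σ ℤ λ i → g ∼ Tz i × Q ∼ ((Tz i ⊗ M₀) ⊗ Tz (ℤ.- i))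
    translate-of-base {Q} g gΓ r z = go (Γ-upper g gΓ z)
      where
      inv-∼ : ∀ {g h} → g ∼ h → inv g ∼ inv h
      inv-∼ (inj₁ refl) = inj₁ refl
      inv-∼ {h = h} (inj₂ refl) = inj₂ (inv-negM h)
      go : (Σ ℤ λ i → g ∼ Tz i) → Σ ℤ λ i → g ∼ Tz i × Q ∼ ((Tz i ⊗ M₀) ⊗ Tz (ℤ.- i))
      go (i , s) = i , s , ∼-trans r (∼-trans (∼-⊗ˡ (g ⊗ M₀) (inv-∼ s)) (∼-⊗ʳ (Tz (ℤ.- i)) (∼-⊗ʳ M₀ s)))

    j : ℤ
    j = proj₁ (In01-exists A₀ C₀ C₀≢0)

    j-in : In01 (A₀ + j * C₀) C₀
    j-in = proj₂ (In01-exists A₀ C₀ C₀≢0)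

    inv-Tz : ∀ i → inv (Tz (ℤ.- i)) ≡ Tz i
    inv-Tz i = mat≡ refl (ℤ.neg-involutive i) refl refl

    -- Only the translates T^i M₀ T^(-i), up to sign, carry mass at ∞, and j singles out the one
    -- that sends ∞ into [0,1).
    X* : Mat
    X* = (Tz j ⊗ M₀) ⊗ Tz (ℤ.- j)

    X*-conj : X* ∼ ((inv (Tz (ℤ.- j)) ⊗ M₀) ⊗ Tz (ℤ.- j))
    X*-conj = inj₁ (cong (λ g → (g ⊗ M₀) ⊗ Tz (ℤ.- j)) (sym (inv-Tz j)))

    X*-member : X X*
    X*-member = Equivalence.from (X⇔ X*) (Tz (ℤ.- j) , Tz-Γ (ℤ.- j) , X*-conj)

    same-translate : ∀ i k → A₀ + i * C₀ ≡ A₀ + k * C₀ → i ≡ k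
    same-translate i k e = go (ℤ.i*j≡0⇒i≡0∨j≡0 (i - k) (trans (l A₀ i k C₀) (ℤ.i≡j⇒i-j≡0 e)))
      where
      l : ∀ a i k c → (i - k) * c ≡ a + i * c - (a + k * c)
      l = ℤ-ring
      go : i - k ≡ + 0 ⊎ C₀ ≡ + 0 → i ≡ k
      go (inj₁ z) = ℤ.i-j≡0⇒i≡j i k z
      go (inj₂ z) = ⊥-elim (C₀≢0 z)

    base-fixed : ∀ i → M₀ ∼ ((Tz i ⊗ M₀) ⊗ Tz (ℤ.- i)) → i ≡ + 0
    base-fixed i r = go (subst (M₀ ∼_) (Tz-conj i A₀ B₀ C₀ D₀) r)
      where
      l : ∀ a c → a + + 0 * c ≡ a
      l = ℤ-ring
      go : M₀ ∼ (A₀ + i * C₀ , B₀ + i * D₀ + ℤ.- i * (A₀ + i * C₀) , C₀ , D₀ + ℤ.- i * C₀) → i ≡ + 0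
      go (inj₁ p) = same-translate i (+ 0) (trans (sym (cong proj₁ p)) (sym (l A₀ C₀)))
      go (inj₂ p) = ⊥-elim (C₀≢0 (self-opposite C₀ (cong lowerLeft p)))

    -- A centralizing element that fixes ∞ is ±T^i, and T^i commutes with M₀ up to sign only for i =
    -- 0 because C₀ ≠ 0. So exactly one unit of mass sits at ∞.
    centralizer-fixes∞ : ∀ l → Centralizes M₀ l → fixes∞ (inv (Tz (ℤ.- j)) ⊗ l) ≡ ind (l ∼? Imat)
    centralizer-fixes∞ l@(a , b , c , d) cl = trans (cong (λ g → fixes∞ (g ⊗ l)) (inv-Tz j)) (trans (cong fixes∞ (Tz-⊗ j a b c d))
        (ind-cong (c ≟ + 0) (l ∼? Imat) to from))
      where
      to : c ≡ + 0 → l ∼ Imat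
      to z = go (translate-of-base {M₀} l (proj₁ cl)
          (∼-sym (subst (λ m → ((m ⊗ M₀) ⊗ inv l) ∼ M₀) (inv-involutive l) (proj₂ (centralizes-inv l cl)))) z)
        where
        go : (Σ ℤ λ i → l ∼ Tz i × M₀ ∼ ((Tz i ⊗ M₀) ⊗ Tz (ℤ.- i))) → l ∼ Imat
        go (i , s , r) = subst (λ k → l ∼ Tz k) (base-fixed i r) s
      from : l ∼ Imat → c ≡ + 0
      from (inj₁ p) = cong lowerLeft p
      from (inj₂ p) = cong lowerLeft p

    inf-X* : inf X* ≡ 1ℚ
    inf-X* = trans (orbit-sum-eval fixes∞ fixes∞-even X* (Tz (ℤ.- j)) (Tz-Γ (ℤ.- j)) X*-conj)
      (trans (∑-∈ L (λ l m → centralizer-fixes∞ l (centralizes l m)))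
      (∑-indicator (_∼? Imat) L (Any.map ∼-sym (L-complete Imat (refl , inj₁ (trans (⊗-identityʳ (Imat ⊗ M₀)) (⊗-identityˡ M₀)))))
        (AllPairs.map (λ ne (p , q) → ne (∼-trans p (∼-sym q))) L-distinct)))

    left01-X* : left01 X* ≡ 1ℚ
    left01-X* = trans (cong left01 (Tz-conj j A₀ B₀ C₀ D₀)) (ind-yes (In01? (A₀ + j * C₀) C₀) j-in)

    term : Mat → ℚ
    term Q = left01 Q ℚ.* inf Q

    term-even : Even term
    term-even Q = cong₂ ℚ._*_ (left01-even Q) (orbit-sum-∼ fixes∞ fixes∞-even {negM Q} {Q} ∼-neg)

    In01-∼ : ∀ {Q N} → N ∼ Q → In01 (proj₁ Q) (lowerLeft Q) → In01 (proj₁ N) (lowerLeft N)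
    In01-∼ (inj₁ refl) p = p
    In01-∼ {Q} (inj₂ refl) p = In01-neg (proj₁ Q) (lowerLeft Q) p

    identify : ∀ Q i → In01 (proj₁ Q) (lowerLeft Q) → Q ∼ ((Tz i ⊗ M₀) ⊗ Tz (ℤ.- i)) → Q ∼ X*
    identify Q i p r = subst (λ k → Q ∼ ((Tz k ⊗ M₀) ⊗ Tz (ℤ.- k))) (same-translate i j
        (In01-unique (A₀ + j * C₀) (A₀ + i * C₀) C₀ (i - j) j-in (In01-∼ (∼-sym (subst (Q ∼_) (Tz-conj i A₀ B₀ C₀ D₀) r)) p) (l A₀ i j C₀))) r
      where
      l : ∀ a i j c → a + i * c ≡ a + j * c + (i - j) * c
      l = ℤ-ring

    support : ∀ Q → Q ∼ X* ⊎ term Q ≡ 0ℚ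
    support Q = go (In01? (proj₁ Q) (lowerLeft Q)) (orbit-sum-cases fixes∞ fixes∞-even Q)
      where
      zeroˡ : ∀ {x y} → x ≡ 0ℚ → x ℚ.* y ≡ 0ℚ
      zeroˡ {y = y} z = trans (cong (ℚ._* y) z) (ℚ.*-zeroˡ y)
      zeroʳ : ∀ {x y} → y ≡ 0ℚ → x ℚ.* y ≡ 0ℚ
      zeroʳ {x} z = trans (cong (x ℚ.*_) z) (ℚ.*-zeroʳ x)
      go : Dec (In01 (proj₁ Q) (lowerLeft Q)) →
        OrbitSum fixes∞ Q →
        Q ∼ X* ⊎ term Q ≡ 0ℚ
      go (no ¬p) _ = inj₂ (zeroˡ {left01 Q} {inf Q} (ind-no (In01? (proj₁ Q) (lowerLeft Q)) ¬p))
      go (yes _) (inj₂ (_ , z)) = inj₂ (zeroʳ {left01 Q} {inf Q} z)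
      go (yes p) (inj₁ (x , γ , g , r , ef)) = finish (collect L (λ _ m → m))
        where
        collect : ∀ K → (∀ l → l ∈ K → l ∈ L) → Q ∼ X* ⊎ ∑ K (λ l → fixes∞ (inv γ ⊗ l)) ≡ 0ℚ
        collect [] _ = inj₂ refl
        collect (l ∷ K) sub = by (lowerLeft (inv γ ⊗ l) ≟ + 0) (collect K (λ k m → sub k (there m)))
          where
          c = centralizes l (sub l (here refl))
          by : Dec (lowerLeft (inv γ ⊗ l) ≡ + 0) → Q ∼ X* ⊎ ∑ K (λ l → fixes∞ (inv γ ⊗ l)) ≡ 0ℚ →
            Q ∼ X* ⊎ ∑ (l ∷ K) (λ l → fixes∞ (inv γ ⊗ l)) ≡ 0ℚ
          by _ (inj₁ s) = inj₁ s
          by (no nz) (inj₂ z) = inj₂ (cong₂ ℚ._+_ (ind-no (lowerLeft (inv γ ⊗ l) ≟ + 0) nz) z)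
          by (yes z) (inj₂ _) = inj₁ (pick (translate-of-base {Q} (inv γ ⊗ l) (Γ-⊗ (inv γ) l (Γ-inv γ g) (proj₁ c)) (orbit-element γ l r c) z))
            where
            pick : (Σ ℤ λ i → (inv γ ⊗ l) ∼ Tz i × Q ∼ ((Tz i ⊗ M₀) ⊗ Tz (ℤ.- i))) → Q ∼ X*
            pick (i , _ , s) = identify Q i p s
        finish : Q ∼ X* ⊎ ∑ L (λ l → fixes∞ (inv γ ⊗ l)) ≡ 0ℚ → Q ∼ X* ⊎ term Q ≡ 0ℚ
        finish (inj₁ s) = inj₁ s
        finish (inj₂ z) = inj₂ (zeroʳ {left01 Q} {inf Q} (trans ef z))

    no-cusp : ∀ Q → fixes∞ Q ℚ.* (P Q ℚ.- P (τ Q)) ≡ 0ℚ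
    no-cusp Q@(a , b , c , d) = go (c ≟ + 0) (X? Q)
      where
      go : (z : Dec (c ≡ + 0)) → Dec (X Q) → ind z ℚ.* (P Q ℚ.- P (τ Q)) ≡ 0ℚ
      go (no _) _ = ℚ.*-zeroˡ (P Q ℚ.- P (τ Q))
      go (yes refl) (yes x) = ⊥-elim (upper-not-X a b d x)
      go (yes _) (no ¬x) = cong (1ℚ ℚ.*_) (cong₂ ℚ._-_ (orbit-sum-none arcM arcM-even Q ¬x)
        (orbit-sum-none arcM arcM-even (τ Q) (λ x → ¬x (X-conj⁻ (Tz -[1+ 0 ]) refl Q x))))

  elliptic-mass : ∀ {Tinf ξ} → IsRepsInfty n Tinf → InR n ξ → CondA n Tinf ξ → CondB n ξ → ⟪ ξ ∣ 𝟙 ⟫ ≡ ℚ.- (+ 1 ℚ./ suc κ)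
  elliptic-mass {Tinf} {ξ} reps ξR A B = trans (divide-by-suc κ ⟪ ξ ∣ 𝟙 ⟫ (ℚ.- 1ℚ) (trans (sym (pair-*ˡ ξ (natℚ (suc κ)) 𝟙)) value))
      (l (+ 1 ℚ./ suc κ))
    where
    l : ∀ x → x ℚ.* ℚ.- 1ℚ ≡ ℚ.- x
    l = ring-of ringℚ
    opposite : ∀ x → (x ℚ.+ x) ℚ.+ (1ℚ ℚ.+ 1ℚ) ≡ 0ℚ → x ℚ.+ x ≡ ℚ.- 1ℚ ℚ.+ ℚ.- 1ℚ
    opposite x p = trans (m x) (trans (cong (λ t → t ℚ.- (1ℚ ℚ.+ 1ℚ)) p) refl)
      where
      m : ∀ x → x ℚ.+ x ≡ (x ℚ.+ x) ℚ.+ (1ℚ ℚ.+ 1ℚ) ℚ.- (1ℚ ℚ.+ 1ℚ)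
      m = ring-of ringℚ
    term-X* : term X* ≡ 1ℚ
    term-X* = cong₂ ℚ._*_ left01-X* inf-X*
    evaluate : ∀ R → norm X* ℕ.≤ R → ∑ (ball R) (λ Q → left01 Q ℚ.* inf Q ℚ.- fixes∞ Q ℚ.* (P Q ℚ.- P (τ Q))) ≡ 1ℚ ℚ.+ 1ℚ
    evaluate R h = trans (∑-ext (ball R) (λ Q → trans (cong (λ t → term Q ℚ.- t) (no-cusp Q)) (ℚ.+-identityʳ (term Q))))
      (trans (∑-ball-2 n R X* (trans (X-det X* X*-member) d₀) h term term-even support) (cong₂ ℚ._+_ term-X* term-X*))
    value : ⟪ ξ ∣ e ⟫ ≡ ℚ.- 1ℚ
    value = eventually-value (eventually-map
      (λ R (p , h) → halve ⟪ ξ ∣ e ⟫ (ℚ.- 1ℚ) (opposite ⟪ ξ ∣ e ⟫ (trans (cong ((⟪ ξ ∣ e ⟫ ℚ.+ ⟪ ξ ∣ e ⟫) ℚ.+_) (sym (evaluate R h))) p)))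
      (eventually-× (mass-formula n mass fin inf split-e fin-τ e-τ R₀ bounded reps ξR A B) (norm X* , λ _ p → p)))

-- Scalar classes

module Scalar (n : ℕ) .{{n≢0 : NonZero n}} (M₀ : Mat) (d₀ : det M₀ ≡ + n)
  (X : Pred Mat 0ℓ) (X? : Decidable X) (X⇔ : ∀ M → X M ⇔ InConjClass M₀ M) (scalar₀ : IsScalar M₀) where
  open ConjugacyClass M₀ X X? X⇔

  private
    members-scalar : ∀ Q → X Q → IsScalar Q
    members-scalar Q x = go (X-witness Q x)
      where
      go : InConjClass M₀ Q → IsScalar Q
      go (γ , g , inj₁ p) = subst IsScalar (sym p) (conj-scalar γ g M₀ scalar₀)
      go (γ , g , inj₂ p) = subst IsScalar (sym p) (negM-scalar ((inv γ ⊗ M₀) ⊗ γ) (conj-scalar γ g M₀ scalar₀))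

    members-base : ∀ Q → X Q → Q ∼ M₀
    members-base Q x = go (X-witness Q x)
      where
      go : InConjClass M₀ Q → Q ∼ M₀
      go (γ , g , r) = subst (Q ∼_) e r
        where
        k = proj₁ M₀
        e : (inv γ ⊗ M₀) ⊗ γ ≡ M₀
        e = trans (cong (λ N → (inv γ ⊗ N) ⊗ γ) (scalar-scale M₀ scalar₀)) (trans (cong (_⊗ γ) (⊗-scale-Iʳ k (inv γ)))
          (trans (scale-⊗ˡ k (inv γ) γ) (trans (cong (scale k) (trans (inv-⊗-self γ) (trans (cong (λ t → scale t Imat) g) (scale-one Imat))))
          (sym (scalar-scale M₀ scalar₀)))))

    swap : ∀ γ → InΓ γ → ∀ N → 𝟙 (γ ⊗ N) ≡ 𝟙 (N ⊗ γ)
    swap γ g N = trans (sym (𝟙-conj γ g (γ ⊗ N))) (cong (λ M → 𝟙 (M ⊗ γ)) (Γ-inv-cancelˡ γ g N))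

    swap-Tz : ∀ γ → InΓ γ → ∀ k N → 𝟙 (γ ⊗ (Tz-pow k ⊗ N)) ≡ 𝟙 (Tz-pow k ⊗ (N ⊗ γ))
    swap-Tz γ g k N = trans (swap γ g (Tz-pow k ⊗ N)) (cong 𝟙 (⊗-assoc (Tz-pow k) N γ))

    at-ST : ∀ k N → 𝟙 (STmat k ⊗ N) ≡ 𝟙 (Tz-pow k ⊗ (N ⊗ Smat))
    at-ST k N = trans (cong 𝟙 (STmat-⊗ k N)) (swap-Tz Smat refl k N)

    at-UT : ∀ k N → 𝟙 (UTmat k ⊗ N) ≡ 𝟙 (Tz-pow (suc k) ⊗ (N ⊗ Umat))
    at-UT k N = trans (cong 𝟙 (UTmat-⊗ k N)) (swap-Tz Umat refl (suc k) N)

    U²ST : ∀ k N → 𝟙 (U²mat ⊗ (STmat k ⊗ N)) ≡ 𝟙 (UTmat k ⊗ N)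
    U²ST k N = trans (cong 𝟙 e) (trans (𝟙-even (Umat ⊗ (Tz-pow (suc k) ⊗ N))) (cong 𝟙 (sym (UTmat-⊗ k N))))
      where
      e : U²mat ⊗ (STmat k ⊗ N) ≡ negM (Umat ⊗ (Tz-pow (suc k) ⊗ N))
      e = trans (cong (U²mat ⊗_) (STmat-⊗ k N)) (trans (⊗-assoc Umat Umat (Smat ⊗ (Tz-pow k ⊗ N)))
        (trans (cong (Umat ⊗_) (trans (U⊗S⊗ (Tz-pow k ⊗ N)) (cong negM (T-Tz k N)))) (negM-⊗ʳ Umat (Tz-pow (suc k) ⊗ N))))

    U²UT : ∀ k N → 𝟙 (U²mat ⊗ (UTmat k ⊗ N)) ≡ 𝟙 (Tz-pow (suc k) ⊗ N)
    U²UT k N = trans (cong (λ M → 𝟙 (U²mat ⊗ M)) (UTmat-⊗ k N)) (trans (cong 𝟙 (U²U⊗ (Tz-pow (suc k) ⊗ N))) (𝟙-even (Tz-pow (suc k) ⊗ N)))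

    U²T : ∀ k N → 𝟙 (Tz-pow (suc k) ⊗ (N ⊗ U²mat)) ≡ 𝟙 (STmat k ⊗ N)
    U²T k N = trans (sym (swap-Tz U²mat refl (suc k) N)) (trans (cong (λ M → 𝟙 (U²mat ⊗ M)) e)
      (trans (cong 𝟙 (trans (negM-⊗ʳ U²mat (Umat ⊗ SX)) (cong negM (U²U⊗ SX))))
      (trans (cong 𝟙 (negM-involutive SX)) (cong 𝟙 (sym (STmat-⊗ k N))))))
      where
      SX = Smat ⊗ (Tz-pow k ⊗ N)
      e : Tz-pow (suc k) ⊗ N ≡ negM (Umat ⊗ SX)
      e = trans (sym (T-Tz k N)) (trans (sym (negM-involutive (Tmat ⊗ (Tz-pow k ⊗ N)))) (cong negM (sym (U⊗S⊗ (Tz-pow k ⊗ N)))))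

    -- Six times the weights 1/3 and 1/2.
    two three : ℚ
    two = 1ℚ ℚ.+ 1ℚ
    three = 1ℚ ℚ.+ 1ℚ ℚ.+ 1ℚ

    -- Chosen so that what remains of three times the first relation and twice the second has the
    -- shape w(S T^k N) - w(U T^(k+1) N); terms common to both relations survive with coefficient 3
    -- - 2 = 1.
    w : Mat → ℚ
    w Q = 𝟙 Q ℚ.- 𝟙 (U²mat ⊗ Q)

    w-even : Even w
    w-even Q = cong₂ ℚ._-_ (𝟙-even Q) (trans (cong 𝟙 (negM-⊗ʳ U²mat Q)) (𝟙-even (U²mat ⊗ Q)))

    w-det : ∀ Q → det Q ≡ + n ⊎ w Q ≡ 0ℚ
    w-det Q = go (X? Q) (X? (U²mat ⊗ Q))
      where
      go : Dec (X Q) → Dec (X (U²mat ⊗ Q)) → det Q ≡ + n ⊎ w Q ≡ 0ℚ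
      go (yes x) _ = inj₁ (trans (X-det Q x) d₀)
      go (no _) (yes x) = inj₁ (trans (sym (trans (det-⊗ U²mat Q) (ℤ.*-identityˡ (det Q)))) (trans (X-det (U²mat ⊗ Q) x) d₀))
      go (no p) (no q) = inj₂ (cong₂ ℚ._-_ (ind-no (X? Q) p) (ind-no (X? (U²mat ⊗ Q)) q))

    w-ST : ∀ k N → w (STmat k ⊗ N) ≡ 𝟙 (STmat k ⊗ N) ℚ.- 𝟙 (UTmat k ⊗ N)
    w-ST k N = cong (λ t → 𝟙 (STmat k ⊗ N) ℚ.- t) (U²ST k N)

    w-UT : ∀ k N → w (UTmat k ⊗ N) ≡ 𝟙 (UTmat k ⊗ N) ℚ.- 𝟙 (Tz-pow (suc k) ⊗ N)
    w-UT k N = cong (λ t → 𝟙 (UTmat k ⊗ N) ℚ.- t) (U²UT k N)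

    upper-vanishes : ∀ β δ k → suc ℤ.∣ β ∣ ℕ.≤ k → β + + k * δ ≡ + 0 → δ ≡ + 0
    upper-vanishes β δ k h e = go (δ ≟ + 0)
      where
      l : ∀ β x → x ≡ β + x - β
      l = ℤ-ring
      l′ : ∀ β → + 0 - β ≡ ℤ.- β
      l′ = ℤ-ring
      kδ : k ℕ.* ℤ.∣ δ ∣ ≡ ℤ.∣ β ∣
      kδ = trans (sym (ℤ.abs-* (+ k) δ)) (trans (cong ℤ.∣_∣ (trans (l β (+ k * δ)) (trans (cong (_- β) e) (l′ β)))) (ℤ.∣-i∣≡∣i∣ β))
      go : Dec (δ ≡ + 0) → δ ≡ + 0
      go (yes z) = z
      go (no nz) = ⊥-elim (ℕ.<-irrefl refl (ℕ.≤-trans h (ℕ.≤-trans (ℕ.m≤m*n k ℤ.∣ δ ∣ {{ℕ.≢-nonZero (λ z → nz (ℤ.∣i∣≡0⇒i≡0 z))}}) (ℕ.≤-reflexive kδ))))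

    -- T^k N is scalar only if γ = 0 and β + kδ = 0; for k > |β| the latter forces δ = 0, against
    -- det N = n.
    tail : ∀ N → det N ≡ + n → Tail (λ k → 𝟙 (Tz-pow k ⊗ N))
    tail N@(α , β , γ , δ) dN = suc ℤ.∣ β ∣ , λ k h → ind-no (X? (Tz-pow k ⊗ N)) (λ x →
        by k h (subst IsScalar (Tz-⊗ (+ k) α β γ δ) (members-scalar (Tz-pow k ⊗ N) x)))
      where
      l : ∀ α β → α * + 0 - β * + 0 ≡ + 0
      l = ℤ-ring
      by : ∀ k → suc ℤ.∣ β ∣ ℕ.≤ k → IsScalar (α + + k * γ , β + + k * δ , γ , δ) → ⊥
      by k h (b , c , _) = ℕ.≢-nonZero⁻¹ n {{n≢0}} (ℤ.+-injective (trans (sym dN)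
        (trans (cong₂ (λ s t → α * s - β * t) (upper-vanishes β δ k h b) c) (l α β))))

    tail-⊗ : ∀ γ → InΓ γ → ∀ N → det N ≡ + n → Tail (λ k → 𝟙 (Tz-pow k ⊗ (N ⊗ γ)))
    tail-⊗ γ g N d = tail (N ⊗ γ) (trans (det-⊗ N γ) (trans (cong (det N *_) g) (trans (ℤ.*-identityʳ (det N)) d)))

    ST-tails : ∀ N → det N ≡ + n → Tail (λ k → w (STmat k ⊗ N))
    ST-tails N d = eventually-map (λ k (p , q) → trans (w-ST k N) (cong₂ ℚ._-_ (trans (at-ST k N) p) (trans (at-UT k N) q)))
      (eventually-× (tail-⊗ Smat refl N d) (tail-suc (tail-⊗ Umat refl N d)))

    UT-tails : ∀ N → det N ≡ + n → Tail (λ k → w (UTmat k ⊗ N))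
    UT-tails N d = eventually-map (λ k (p , q) → trans (w-UT k N) (cong₂ ℚ._-_ (trans (at-UT k N) p) q))
      (eventually-× (tail-suc (tail-⊗ Umat refl N d)) (tail-suc (tail N d)))

    ρ : ℕ → Mat → ℚ
    ρ k N = three ℚ.* 𝟙 (Tz-pow k ⊗ N) ℚ.+ three ℚ.* 𝟙 (STmat k ⊗ (Smat ⊗ N))

    ρ-tails : ∀ N → det N ≡ + n → Tail (λ k → ρ k N)
    ρ-tails N d = eventually-map (λ k (p , q) → cong₂ (λ s t → three ℚ.* s ℚ.+ three ℚ.* t) p (trans (at-ST k (Smat ⊗ N)) q))
      (eventually-× (tail N d) (tail-⊗ Smat refl (Smat ⊗ N) (trans (det-⊗ Smat N) (trans (ℤ.*-identityˡ (det N)) d))))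

    ρ-zero : ∀ N → ρ 0 N ≡ three ℚ.* 𝟙 N ℚ.+ three ℚ.* 𝟙 N
    ρ-zero N = cong₂ (λ s t → three ℚ.* s ℚ.+ three ℚ.* t) (cong 𝟙 (⊗-identityˡ N))
      (trans (at-ST 0 (Smat ⊗ N)) (trans (cong 𝟙 (⊗-identityˡ (conjS N))) (𝟙-S N)))

    -- Again the relations for φ_k and φ_(k+1), now with the multipliers 3 and 2. As `𝟙` is a class
    -- function, right factors can be moved to the left, and equal terms then meet.
    relation : ∀ ξ → CondB n ξ → ∀ k → ⟪ ξ ∣ (λ N → (ρ k N ℚ.- ρ (suc k) N) ℚ.+
            ((w (STmat k ⊗ N) ℚ.- w (UTmat k ⊗ N)) ℚ.- (w (STmat k ⊗ (Smat ⊗ N)) ℚ.- w (UTmat k ⊗ (Smat ⊗ N))))) ⟫ ≡ 0ℚ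
    relation ξ B k = trans (sym (pair-ext ξ pointwise)) (trans (pair-+ ξ (λ N → three ℚ.* b₁ N) (λ N → two ℚ.* b₂ N))
      (cong₂ ℚ._+_ (trans (pair-*ˡ ξ three b₁) (cong (three ℚ.*_) (pair-B₁-difference n ξ B (φ-even k))))
                   (trans (pair-*ˡ ξ two b₂) (cong (two ℚ.*_) (pair-B₂-difference n ξ B (φ-even (suc k)))))))
      where
      φ : ℕ → Mat → ℚ
      φ k M = 𝟙 (Tz-pow k ⊗ M)
      φ-even : ∀ k → Even (φ k)
      φ-even k M = trans (cong 𝟙 (negM-⊗ʳ (Tz-pow k) M)) (𝟙-even (Tz-pow k ⊗ M))
      b₁ b₂ : Mat → ℚ
      b₁ N = φ k N ℚ.- φ k (Umat ⊗ N) ℚ.+ (φ k (N ⊗ Smat) ℚ.- φ k (Umat ⊗ (N ⊗ Smat)))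
      b₂ N = (φ (suc k) (Smat ⊗ N) ℚ.- φ (suc k) N) ℚ.+ (φ (suc k) (Smat ⊗ (N ⊗ Umat)) ℚ.- φ (suc k) (N ⊗ Umat))
                   ℚ.+ (φ (suc k) (Smat ⊗ (N ⊗ U²mat)) ℚ.- φ (suc k) (N ⊗ U²mat))
      l : ∀ a b s d a′ uS u sS →
        three ℚ.* (a ℚ.- b ℚ.+ (s ℚ.- d)) ℚ.+ two ℚ.* ((b ℚ.- a′) ℚ.+ (uS ℚ.- u) ℚ.+ (sS ℚ.- s))
        ≡ ((three ℚ.* a ℚ.+ three ℚ.* sS) ℚ.- (three ℚ.* a′ ℚ.+ three ℚ.* d))
          ℚ.+ (((s ℚ.- u) ℚ.- (u ℚ.- a′)) ℚ.- ((sS ℚ.- uS) ℚ.- (uS ℚ.- b)))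
      l = ring-of ringℚ
      pointwise : ∀ N → three ℚ.* b₁ N ℚ.+ two ℚ.* b₂ N ≡ (ρ k N ℚ.- ρ (suc k) N) ℚ.+
              ((w (STmat k ⊗ N) ℚ.- w (UTmat k ⊗ N)) ℚ.- (w (STmat k ⊗ (Smat ⊗ N)) ℚ.- w (UTmat k ⊗ (Smat ⊗ N))))
      pointwise N = trans
        (cong₂ (λ s t → three ℚ.* s ℚ.+ two ℚ.* t)
          (cong₂ (λ s t → φ k N ℚ.- s ℚ.+ t) (cong 𝟙 (Tk-U k N))
            (cong₂ ℚ._-_ (sym (at-ST k N)) (trans (cong 𝟙 (trans (Tk-U k (N ⊗ Smat)) (cong (Tz-pow (suc k) ⊗_) (sym (⊗-assoc Smat N Smat))))) (sym (at-ST (suc k) SN)))))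
          (cong₂ (λ s t → (φ (suc k) SN ℚ.- φ (suc k) N) ℚ.+ s ℚ.+ t)
            (cong₂ ℚ._-_ (trans (cong (φ (suc k)) (sym (⊗-assoc Smat N Umat))) (sym (at-UT k SN))) (sym (at-UT k N)))
            (cong₂ ℚ._-_ (trans (cong (φ (suc k)) (sym (⊗-assoc Smat N U²mat))) (U²T k SN)) (U²T k N))))
        (trans (l (φ k N) (φ (suc k) SN) (𝟙 (STmat k ⊗ N)) (𝟙 (STmat (suc k) ⊗ SN)) (φ (suc k) N) (𝟙 (UTmat k ⊗ SN)) (𝟙 (UTmat k ⊗ N)) (𝟙 (STmat k ⊗ SN)))
        (cong (λ t → (ρ k N ℚ.- ρ (suc k) N) ℚ.+ t)
          (cong₂ ℚ._-_ (cong₂ ℚ._-_ (sym (w-ST k N)) (sym (w-UT k N))) (cong₂ ℚ._-_ (sym (w-ST k SN)) (sym (w-UT k SN))))))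
        where SN = Smat ⊗ N

    In01-diagonal : ∀ x → in01 x x ≡ 0ℚ
    In01-diagonal x = ind-no (In01? x x) λ { (inj₁ (_ , p)) → ℤ.<-irrefl refl p ; (inj₂ (p , _)) → ℤ.<-irrefl refl p }

    In01-∞ : ∀ x → in01 x (+ 0) ≡ 0ℚ
    In01-∞ x = ind-no (In01? x (+ 0)) λ { (inj₁ (p , q)) → ℤ.<-irrefl refl (ℤ.≤-<-trans p q) ; (inj₂ (p , q)) → ℤ.<-irrefl refl (ℤ.<-≤-trans p q) }

    In01-0 : ∀ x → ¬ x ≡ + 0 → in01 (+ 0) x ≡ 1ℚ
    In01-0 +0 nz = ⊥-elim (nz refl)
    In01-0 +[1+ _ ] _ = refl
    In01-0 -[1+ _ ] _ = refl

    -- If U²Q is scalar, then Q is a multiple of U, which sends ∞ to 1 and 0 to ∞, both outside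
    -- [0,1).
    U²-part : ∀ Q → 𝟙 (U²mat ⊗ Q) ℚ.* (left01 Q ℚ.- right01 Q) ≡ 0ℚ
    U²-part Q@(a , b , c , d) = go (X? (U²mat ⊗ Q))
      where
      go : (x? : Dec (X (U²mat ⊗ Q))) → ind x? ℚ.* (left01 Q ℚ.- right01 Q) ≡ 0ℚ
      go (no _) = ℚ.*-zeroˡ (left01 Q ℚ.- right01 Q)
      go (yes x) = by (subst IsScalar (U²mat-⊗ a b c d) (members-scalar (U²mat ⊗ Q) x))
        where
        by : IsScalar (ℤ.- c , ℤ.- d , a - c , b - d) → 1ℚ ℚ.* (left01 Q ℚ.- right01 Q) ≡ 0ℚ
        by (p , q , _) = cong (1ℚ ℚ.*_) (cong₂ ℚ._-_ (trans (cong (λ t → in01 t c) (ℤ.i-j≡0⇒i≡j a c q)) (In01-diagonal c))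
          (trans (cong (in01 b) (ℤ.neg-injective {d} {+ 0} p)) (In01-∞ b)))

    term : Mat → ℚ
    term Q = 𝟙 Q ℚ.* (left01 Q ℚ.- right01 Q)

    term-even : Even term
    term-even Q@(a , b , c , d) = cong₂ ℚ._*_ (𝟙-even Q) (cong₂ ℚ._-_ (in01-neg a c) (in01-neg b d))

    term-support : ∀ Q → Q ∼ M₀ ⊎ term Q ≡ 0ℚ
    term-support Q = go (X? Q)
      where
      go : (x? : Dec (X Q)) → Q ∼ M₀ ⊎ ind x? ℚ.* (left01 Q ℚ.- right01 Q) ≡ 0ℚ
      go (yes x) = inj₁ (members-base Q x)
      go (no _) = inj₂ (ℚ.*-zeroˡ (left01 Q ℚ.- right01 Q))

    -- A scalar matrix fixes both cusps, and 0 lies in [0,1) while ∞ does not.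
    term-base : term M₀ ≡ ℚ.- 1ℚ
    term-base = trans (cong₂ ℚ._*_ (ind-yes (X? M₀) X-base) (by M₀ d₀ scalar₀)) refl
      where
      l : ∀ a → a * + 0 - + 0 * + 0 ≡ + 0
      l = ℤ-ring
      by : ∀ M → det M ≡ + n → IsScalar M → left01 M ℚ.- right01 M ≡ ℚ.- 1ℚ
      by (a , _ , _ , d) e (refl , refl , _) = cong₂ ℚ._-_ (In01-∞ a) (In01-0 d (λ z → ℕ.≢-nonZero⁻¹ n {{n≢0}}
        (ℤ.+-injective (trans (sym e) (trans (cong (λ t → a * t - + 0 * + 0) z) (l a))))))

    evaluate : ∀ R → norm M₀ ℕ.≤ R → ∑ (ball R) (λ Q → w Q ℚ.* (left01 Q ℚ.- right01 Q)) ≡ ℚ.- 1ℚ ℚ.+ ℚ.- 1ℚ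
    evaluate R h = trans (∑-ext (ball R) pointwise) (trans (∑-ball-2 n R M₀ d₀ h term term-even term-support) (cong₂ ℚ._+_ term-base term-base))
      where
      l : ∀ x y z → (x ℚ.- y) ℚ.* z ≡ x ℚ.* z ℚ.- y ℚ.* z
      l = ring-of ringℚ
      pointwise : ∀ Q → w Q ℚ.* (left01 Q ℚ.- right01 Q) ≡ term Q
      pointwise Q = trans (l (𝟙 Q) (𝟙 (U²mat ⊗ Q)) (left01 Q ℚ.- right01 Q))
        (trans (cong (λ t → term Q ℚ.- t) (U²-part Q)) (ℚ.+-identityʳ (term Q)))

  scalar-mass : ∀ {Tinf ξ} → IsRepsInfty n Tinf → InR n ξ → CondA n Tinf ξ → CondB n ξ → ⟪ ξ ∣ 𝟙 ⟫ ≡ + 1 ℚ./ 6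
  scalar-mass {Tinf} {ξ} reps ξR A B = eventually-value (eventually-map
      (λ R (p , h) → twelfth ⟪ ξ ∣ 𝟙 ⟫ (trans (cong₂ (λ s t → (s ℚ.+ s) ℚ.+ t) (sym total) (sym (evaluate R h))) p))
      (eventually-× (pair-ρ n Tinf reps ξ ξR A w w-even w-det ST-tails UT-tails ρ ρ-tails (relation ξ B)) (norm M₀ , λ _ p → p)))
    where
    total : ⟪ ξ ∣ ρ 0 ⟫ ≡ three ℚ.* ⟪ ξ ∣ 𝟙 ⟫ ℚ.+ three ℚ.* ⟪ ξ ∣ 𝟙 ⟫
    total = trans (pair-ext ξ ρ-zero) (trans (pair-+ ξ (λ N → three ℚ.* 𝟙 N) (λ N → three ℚ.* 𝟙 N))
      (cong₂ ℚ._+_ (pair-*ˡ ξ three 𝟙) (pair-*ˡ ξ three 𝟙)))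
    -- `ρ 0` has 6 = 3 + 3 times the mass and enters twice, and the ball contributes -2: 12x = 2.
    twelfth : ∀ x → ((three ℚ.* x ℚ.+ three ℚ.* x) ℚ.+ (three ℚ.* x ℚ.+ three ℚ.* x)) ℚ.+ (ℚ.- 1ℚ ℚ.+ ℚ.- 1ℚ) ≡ 0ℚ → x ≡ + 1 ℚ./ 6
    twelfth x p = trans (l x) (trans (cong (λ t → (+ 1 ℚ./ 12) ℚ.* t ℚ.+ (+ 1 ℚ./ 6)) p) refl)
      where
      l : ∀ x → x ≡ (+ 1 ℚ./ 12) ℚ.* (((three ℚ.* x ℚ.+ three ℚ.* x) ℚ.+ (three ℚ.* x ℚ.+ three ℚ.* x)) ℚ.+ (ℚ.- 1ℚ ℚ.+ ℚ.- 1ℚ)) ℚ.+ (+ 1 ℚ./ 6)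
      l = ring-of ringℚ

-- The weight of an arbitrary conjugacy class

conjugacy-mass : (n : ℕ) → .{{_ : NonZero n}} → (Tinf : List Mat) → IsRepsInfty n Tinf →
  (ξ : Formal) → InR n ξ → CondA n Tinf ξ → CondB n ξ → (M₀ : Mat) → det M₀ ≡ + n →
  (X : Pred Mat 0ℓ) (X? : Decidable X) → (∀ M → X M ⇔ InConjClass M₀ M) →
  (w : ℚ) → Weight M₀ w → ⟪ ξ ∣ (λ M → ind (X? M)) ⟫ ≡ w
conjugacy-mass n Tinf reps ξ ξR A B M₀ d₀ X X? X⇔ _ (scalar s) = Scalar.scalar-mass n M₀ d₀ X X? X⇔ s reps ξR A B
conjugacy-mass n Tinf reps ξ ξR A B M₀ d₀ X X? X⇔ _ (elliptic k δ order) = Elliptic.elliptic-mass n M₀ d₀ X X? X⇔ k δ order reps ξR A B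
conjugacy-mass n Tinf reps ξ ξR A B M₀ d₀ X X? X⇔ _ (split m δ) = Split.split-mass n M₀ d₀ X X? X⇔ m δ reps ξR A B
conjugacy-mass n Tinf reps ξ ξR A B M₀ d₀ X X? X⇔ _ (nonsplit δ ns) = Vanishing.vanishes n M₀ d₀ X X? X⇔ (ℤ.<⇒≤ δ)
  (λ s → ℤ.<-irrefl (sym (disc-scalar M₀ s)) δ) (λ m e → ⊥-elim (ns m e)) reps ξR A B
conjugacy-mass n Tinf reps ξ ξR A B M₀ d₀ X X? X⇔ _ (parabolic δ ns) = Vanishing.vanishes n M₀ d₀ X X? X⇔
  (ℤ.≤-reflexive (sym δ)) ns (λ m e → square-zero m (trans (sym e) δ)) reps ξR A B

theorem1 : (n : ℕ) → .{{_ : NonZero n}} →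
    (Tinf : List Mat) → IsRepsInfty n Tinf →
    (ξ : Formal) → InR n ξ → CondA n Tinf ξ → CondB n ξ →
    ((M₀ : Mat) → det M₀ ≡ + n →
       (K : Pred Mat 0ℓ) (K? : Decidable K) → (∀ M → K M ⇔ InRightCoset M₀ M) →
       pairing ξ K? ≡ - 1ℚ)
    × ((M₀ : Mat) → det M₀ ≡ + n →
       (X : Pred Mat 0ℓ) (X? : Decidable X) → (∀ M → X M ⇔ InConjClass M₀ M) →
       (w : ℚ) → Weight M₀ w → pairing ξ X? ≡ w)
theorem1 n Tinf reps ξ ξR A B =
  (λ M₀ d₀ K K? K⇔ → coset-theorem n Tinf reps ξ ξR A B M₀ d₀ K K? K⇔) ,
  (λ M₀ d₀ X X? X⇔ w h → trans (pairing≡pair ξ X?) (conjugacy-mass n Tinf reps ξ ξR A B M₀ d₀ X X? X⇔ w h))
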